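{- Let $(W,S)$ be a finite Coxeter group of rank $n=|S|$ which is either of type $B_n$ ($n\ge 2$) or of one of the exceptional types $E_6,E_7,E_8,F_4,H_3,H_4$, $I_2(m)$ ($m\ge 2$). Then the contingency metamatrix $M(W)=(M_{pq})_{0\le p,q\le n}$, where $$M_{pq}=\sum_{I,J\subset S,\ |I|=p,\ |J|=q}\bigl|W_I\backslash W/W_J\bigr|,$$ is totally positive.
   Context: For $I\subset S$, $W_I$ denotes the (standard) parabolic subgroup of $W$ generated by $I$, and $W_I\backslash W/W_J$ is the set of double cosets $W_I w W_J$, $w\in W$. A real matrix is totally positive if every minor (determinant of a square submatrix) is strictly positive. -}

module Defs where

open import Data.Nat using (ℕ; zero; suc; _≤_; _⊓_; _⊔_; _≡ᵇ_) renaming (_*_ to _*ℕ_)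
open import Data.Bool using (Bool; true; false; if_then_else_; _∧_)
open import Data.Fin using (Fin; toℕ; punchIn) renaming (zero to fz; suc to fs; _<_ to _<F_)
open import Data.Fin.Subset using (Subset; _∈_; ∣_∣)
open import Data.List using (List; []; _∷_; _++_; map)
open import Data.Nat.ListAction using (sum)
open import Data.List.Relation.Unary.All using (All)
open import Data.Vec using (Vec; lookup) renaming ([] to []ᵛ; _∷_ to _∷ᵛ_)
open import Data.Integer using (ℤ; +_; -_; _+_; _*_; _<_)
open import Data.Product using (Σ; ∃; _×_; _,_)
open import Relation.Binary.PropositionalEquality using (_≡_)

-- Coxeter matrices of the relevant types.
-- A Coxeter matrix on S = Fin n: m s s = 1, m s t = m t s ≥ 2 for s ≠ t.
-- We build it from a "bond" function on pairs i < j (indices as ℕ).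

coxMatrix : ∀ {n} → (ℕ → ℕ → ℕ) → Fin n → Fin n → ℕ
coxMatrix bond i j =
  if toℕ i ≡ᵇ toℕ j then 1 else bond (toℕ i ⊓ toℕ j) (toℕ i ⊔ toℕ j)

bondB : ℕ → ℕ → ℕ
bondB 0 1 = 4
bondB i j = if j ≡ᵇ suc i then 3 else 2

-- E_6, E_7, E_8 (Bourbaki labelling 1..8 shifted to 0..7):
-- chain 0 - 2 - 3 - 4 - 5 - 6 - 7, and 1 attached to 3.
bondE : ℕ → ℕ → ℕ
bondE 0 2 = 3
bondE 1 3 = 3
bondE 2 3 = 3
bondE 3 4 = 3
bondE 4 5 = 3
bondE 5 6 = 3
bondE 6 7 = 3
bondE _ _ = 2

bondF : ℕ → ℕ → ℕ
bondF 0 1 = 3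
bondF 1 2 = 4
bondF 2 3 = 3
bondF _ _ = 2

bondH : ℕ → ℕ → ℕ
bondH 0 1 = 5
bondH 1 2 = 3
bondH 2 3 = 3
bondH _ _ = 2

bondI : ℕ → ℕ → ℕ → ℕ
bondI m 0 1 = m
bondI m _ _ = 2

data CoxType : ℕ → Set where
  B  : (n : ℕ) → 2 ≤ n → CoxType n
  E6 : CoxType 6
  E7 : CoxType 7
  E8 : CoxType 8
  F4 : CoxType 4
  H3 : CoxType 3
  H4 : CoxType 4
  I2 : (m : ℕ) → 2 ≤ m → CoxType 2

coxMat : ∀ {n} → CoxType n → Fin n → Fin n → ℕ
coxMat (B n _) = coxMatrix bondB
coxMat E6 = coxMatrix bondE
coxMat E7 = coxMatrix bondE
coxMat E8 = coxMatrix bondE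
coxMat F4 = coxMatrix bondF
coxMat H3 = coxMatrix bondH
coxMat H4 = coxMatrix bondH
coxMat (I2 m _) = coxMatrix (bondI m)

-- The Coxeter group W presented by generators S = Fin n and relations
-- (s t)^{m s t} = e, realised as words modulo the generated congruence.

Word : ℕ → Set
Word n = List (Fin n)

alt : ∀ {n} → Fin n → Fin n → ℕ → Word n
alt s t zero    = []
alt s t (suc k) = s ∷ alt t s k

data CoxEq {n} (m : Fin n → Fin n → ℕ) : Word n → Word n → Set where
  ceRefl  : ∀ {u} → CoxEq m u u
  ceSym   : ∀ {u v} → CoxEq m u v → CoxEq m v u
  ceTrans : ∀ {u v w} → CoxEq m u v → CoxEq m v w → CoxEq m u w
  ceRel   : ∀ s t → CoxEq m (alt s t (2 *ℕ m s t)) []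
  ceCong  : ∀ x {u v} y → CoxEq m u v → CoxEq m (x ++ u ++ y) (x ++ v ++ y)

SameDoubleCoset : ∀ {n} → (Fin n → Fin n → ℕ) → Subset n → Subset n →
                  Word n → Word n → Set
SameDoubleCoset m I J w w' =
  Σ (Word _) λ u → Σ (Word _) λ v →
    All (_∈ I) u × All (_∈ J) v × CoxEq m w' (u ++ w ++ v)

HasNumClasses : {A : Set} → (A → A → Set) → ℕ → Set
HasNumClasses {A} R k =
  Σ (Vec A k) λ reps →
    (∀ a b → R (lookup reps a) (lookup reps b) → a ≡ b) ×
    (∀ x → ∃ λ a → R x (lookup reps a))

allSubsets : ∀ n → List (Subset n)
allSubsets zero    = []ᵛ ∷ []
allSubsets (suc n) = map (true ∷ᵛ_) (allSubsets n) ++ map (false ∷ᵛ_) (allSubsets n)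

IsMetamatrix : ∀ {n} → (Fin n → Fin n → ℕ) → (Fin (suc n) → Fin (suc n) → ℕ) → Set
IsMetamatrix {n} m M =
  Σ (Subset n → Subset n → ℕ) λ c →
    (∀ I J → HasNumClasses (SameDoubleCoset m I J) (c I J)) ×
    (∀ p q → M p q ≡
       sum (map (λ I → sum (map (λ J →
              if (∣ I ∣ ≡ᵇ toℕ p) ∧ (∣ J ∣ ≡ᵇ toℕ q) then c I J else 0)
            (allSubsets n))) (allSubsets n)))

sumFin : ∀ k → (Fin k → ℤ) → ℤ
sumFin zero    f = + 0
sumFin (suc k) f = f fz + sumFin k (λ i → f (fs i))

signFin : ∀ {k} → Fin k → ℤ
signFin fz     = + 1
signFin (fs i) = - signFin i

det : ∀ k → (Fin k → Fin k → ℤ) → ℤ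
det zero    A = + 1
det (suc k) A =
  sumFin (suc k) λ j → signFin j * A fz j * det k (λ a b → A (fs a) (punchIn j b))

StrictlyIncreasing : ∀ {k l} → (Fin k → Fin l) → Set
StrictlyIncreasing f = ∀ a b → a <F b → f a <F f b

TotallyPositive : ∀ {N} → (Fin N → Fin N → ℕ) → Set
TotallyPositive {N} M =
  ∀ k (r c : Fin (suc k) → Fin N) → StrictlyIncreasing r → StrictlyIncreasing c →
    + 0 < det (suc k) (λ a b → + M (r a) (c b))

{-
Double cosets are counted by orbits: if W acts on a set with half-spaces as in Tits' lemma and the dominant point x has
stabiliser W_J, then W_I\W/W_J corresponds to the I-dominant points of the orbit of x, since a W_I-orbit contains exactly
one of them.

Exceptional types: let H × A be a product of commuting reflection subgroups of W, with W_J generated by A and a parabolic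
subgroup W_{J'} of H.  A generator of W either moves a coset of H × A or acts on it as a reflection of H or of A, so that
W_I\W/W_J is the disjoint union, over the W_I-orbits on W/(H × A), of double cosets of H modulo W_{J'}.  This reduces the
counts to smaller groups (E8 to E7 × A1, E7, D8 and the trivial group), and the recursion is evaluated.

Type B_n: with r = n - p and s = n - q, M_{pq} is the number of pairs of a subset I with |I| = p and an I-sorted word in
the letters -s, …, s of which every absolute value 1, …, s occurs.  By inclusion-exclusion it is the mixed finite
difference of order (r, s) at (0, 0) of the number of multisets of size n with S + 1 + R (2 S + 1) types.  Times 2^n n! the
latter is the product of (2 R + 1)(2 S + 1) + 2 i - 1 for 1 ≤ i ≤ n, that is Σ_k e_k ((2 R + 1)(2 S + 1))^k with e_k > 0.

Type I_2(m): the cosets of a generator form a path with m nodes.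

In each case a positive multiple of M has the form Y (M' ⊕ d) Yᵀ with d > 0, with Y lower bidiagonal and positive, and
with M' of the same form; this operation preserves total positivity.
-}
module Submission where

-- The group is only given by words modulo a congruence, so deciding whether two words are equal
-- needs an action that separates the elements. A dominant point fixed by no generator has trivial
-- stabiliser, hence words are equal as soon as they agree at that point. For the exceptional groups
-- the point is the sum ρ of the fundamental weights, with coordinates in ℤ[φ] to accommodate the
-- bond 5, and every relation between coset representatives becomes one comparison of integer
-- vectors. E8 has 696729600 elements, too many to list; the factor A lets a J that fits into no
-- convenient H be reached by a subgroup of small index. The enumerations are not proved correct:
-- their output is tested, and the test is proved sound. Total positivity survives Y (M' ⊕ d) Yᵀ
-- although M' ⊕ d has vanishing minors: they are all nonnegative, and in the expansion of each
-- minor of the product some term avoids the zeros. The ratios z p / y (p - 1) are forced: they are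
-- minus the ratios of neighbouring entries in the last row of the inverse matrix.

module Tits where

  open import Defs
  open import Data.Nat using (ℕ; zero; suc; _≤_; _<_; z≤n; s≤s; _≤?_) renaming (_+_ to _+ℕ_; _*_ to _*ℕ_)
  import Data.Nat.Properties as ℕ
  open import Data.Fin using (Fin; _≟_)
  open import Data.List using (List; []; _∷_; _++_; length; reverse; [_])
  import Data.List.Properties as List
  open import Data.List.Relation.Unary.All using (All; []; _∷_)
  import Data.List.Relation.Unary.All as All
  import Data.List.Relation.Unary.All.Properties as All
  open import Data.Product using (∃; _×_; _,_; proj₁; proj₂)
  open import Data.Sum using (_⊎_; inj₁; inj₂)
  open import Data.Empty using (⊥-elim)
  open import Relation.Nullary using (yes; no)
  open import Relation.Binary.PropositionalEquality hiding ([_])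
  open import Function using (_∘_)

  -- Words modulo the Coxeter relations, and Tits' lemma on half-spaces

  module Words {n : ℕ} (m : Fin n → Fin n → ℕ) (m-diag : ∀ s → m s s ≡ 1) where

    infix 4 _≈_
    _≈_ : Word n → Word n → Set
    _≈_ = CoxEq m

    ≡⇒≈ : ∀ {u v} → u ≡ v → u ≈ v
    ≡⇒≈ refl = ceRefl

    ++-congˡ : ∀ x {u v} → u ≈ v → x ++ u ≈ x ++ v
    ++-congˡ x {u} {v} p =
      subst₂ _≈_ (cong (x ++_) (List.++-identityʳ u)) (cong (x ++_) (List.++-identityʳ v)) (ceCong x [] p)

    ++-congʳ : ∀ {u v} y → u ≈ v → u ++ y ≈ v ++ y
    ++-congʳ y p = ceCong [] y p

    ∷-cong : ∀ s {u v} → u ≈ v → s ∷ u ≈ s ∷ v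
    ∷-cong s = ++-congˡ [ s ]

    square : ∀ s → s ∷ s ∷ [] ≈ []
    square s = subst (λ k → alt s s (2 *ℕ k) ≈ []) (m-diag s) (ceRel s s)

    cancel : ∀ s w → s ∷ s ∷ w ≈ w
    cancel s w = ++-congʳ w (square s)

    reverse-inverseʳ : ∀ w → w ++ reverse w ≈ []
    reverse-inverseʳ []      = ceRefl
    reverse-inverseʳ (s ∷ w) =
      ceTrans (≡⇒≈ (trans (cong (λ z → s ∷ w ++ z) (List.unfold-reverse s w))
                          (cong (s ∷_) (sym (List.++-assoc w (reverse w) [ s ])))))
              (ceTrans (∷-cong s (++-congʳ [ s ] (reverse-inverseʳ w))) (square s))

    reverse-inverseˡ : ∀ w → reverse w ++ w ≈ []
    reverse-inverseˡ w =
      subst (λ z → reverse w ++ z ≈ []) (List.reverse-involutive w) (reverse-inverseʳ (reverse w))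

    private
      -- Multiplying by the first letter of the longer word cancels it there and prepends it on the
      -- other side; after `d` such transfers the parity of `d` decides which letter begins which
      -- word, hence the disjunction. With `d` and `j` both equal to `m s t` and `i = 0` it yields
      -- the braid relation.
      shift : ∀ d {x y i j} → alt x y (d +ℕ j) ≈ alt y x i →
              (alt x y j ≈ alt y x (d +ℕ i)) ⊎ (alt y x j ≈ alt x y (d +ℕ i))
      shift zero p = inj₁ p
      shift (suc d) {x} {y} {i} {j} p with shift d {y} {x} {suc i} {j}
             (ceTrans (ceSym (cancel x _)) (∷-cong x p))
      ... | inj₁ q = inj₂ (subst (λ k → alt y x j ≈ alt x y k) (ℕ.+-suc d i) q)
      ... | inj₂ q = inj₁ (subst (λ k → alt x y j ≈ alt y x k) (ℕ.+-suc d i) q)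

    braid : ∀ s t → alt s t (m s t) ≈ alt t s (m s t)
    braid s t with shift (m s t) {s} {t} {0} {m s t}
                     (subst (λ k → alt s t k ≈ []) (cong (m s t +ℕ_) (ℕ.+-identityʳ (m s t))) (ceRel s t))
    ... | inj₁ q = subst (λ k → alt s t (m s t) ≈ alt t s k) (ℕ.+-identityʳ (m s t)) q
    ... | inj₂ q = ceSym (subst (λ k → alt t s (m s t) ≈ alt s t k) (ℕ.+-identityʳ (m s t)) q)

  run : ∀ {n} {X : Set} → (Fin n → X → X) → Word n → X → X
  run act []      x = x
  run act (s ∷ w) x = act s (run act w x)

  -- `Pos s` is a closed half-space bounded by the wall of `s`. The field `dihedral` is Tits'
  -- hypothesis in rank two: the elements of ⟨s, t⟩ that have no reduced word beginning with `s`
  -- keep the chamber on the positive side of `s`. The field `wall` says that a point on both sides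
  -- of a wall is fixed, which makes points with nontrivial stabiliser usable.
  record HalfSpaces {n : ℕ} (m : Fin n → Fin n → ℕ) (X : Set) : Set₁ where
    field
      m-diag   : ∀ s → m s s ≡ 1
      m-pos    : ∀ s t → 0 < m s t
      act      : Fin n → X → X
      Pos      : Fin n → X → Set
      relation : ∀ s t x → run act (alt s t (2 *ℕ m s t)) x ≡ x
      dihedral : ∀ s t → s ≢ t → ∀ k → k < m s t → ∀ x → Pos s x → Pos t x → Pos s (run act (alt t s k) x)
      wall     : ∀ s x → Pos s x → Pos s (act s x) → act s x ≡ x

  -- Bourbaki, Lie V.4.4: if every dihedral subgroup keeps A_s ∩ A_t on one side of the wall of s, so does W.
  module Action {n : ℕ} {m : Fin n → Fin n → ℕ} {X : Set} (H : HalfSpaces m X) where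

    open HalfSpaces H
    open Words m m-diag public

    run-++ : ∀ u v x → run act (u ++ v) x ≡ run act u (run act v x)
    run-++ []      v x = refl
    run-++ (s ∷ u) v x = cong (act s) (run-++ u v x)

    run-≈ : ∀ {u v} → u ≈ v → ∀ x → run act u x ≡ run act v x
    run-≈ ceRefl x = refl
    run-≈ (ceSym p) x = sym (run-≈ p x)
    run-≈ (ceTrans p q) x = trans (run-≈ p x) (run-≈ q x)
    run-≈ (ceRel s t) x = relation s t x
    run-≈ (ceCong a {u} {v} b p) x =
      trans (run-++ a (u ++ b) x)
        (trans (cong (run act a) (trans (run-++ u b x) (trans (run-≈ p (run act b x)) (sym (run-++ v b x)))))
               (sym (run-++ a (v ++ b) x)))

    module _ (I : Fin n → Set) where

      Dominant : X → Set
      Dominant x = ∀ s → I s → Pos s x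

      private
        module Dihedral (s t : Fin n) (s≢t : s ≢ t) where

          Letter : Fin n → Set
          Letter a = (a ≡ s) ⊎ (a ≡ t)

          -- Besides the usual alternating normal form, the bound `k ≤ length u` records that
          -- normalising never lengthens the word, which the later inductions on length rely on.
          data Normal (u : Word n) : Set where
            st : ∀ k → k ≤ m s t → k ≤ length u → u ≈ alt s t k → Normal u
            ts : ∀ k → k ≤ m s t → k ≤ length u → u ≈ alt t s k → Normal u

          normal : ∀ u → All Letter u → Normal u
          normal [] [] = st 0 z≤n z≤n ceRefl
          normal (a ∷ u) (inj₁ refl ∷ ls) with normal u ls
          ... | st zero _ _ p = st 1 (m-pos s t) (s≤s z≤n) (∷-cong s p)
          ... | st (suc k) k≤m k≤u p =
                  ts k (ℕ.≤-trans (ℕ.n≤1+n k) k≤m) (ℕ.≤-trans (ℕ.n≤1+n k) (ℕ.≤-trans k≤u (ℕ.n≤1+n _)))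
                     (ceTrans (∷-cong s p) (cancel s _))
          ... | ts k k≤m k≤u p with suc k ≤? m s t
          ...   | yes k<m = st (suc k) k<m (s≤s k≤u) (∷-cong s p)
          ...   | no k≮m with ℕ.≤-antisym k≤m (ℕ.≮⇒≥ k≮m)
          -- At full length `m s t` the word also has a form beginning with `s`, by `braid`, so the
          -- new letter cancels.
          ...     | refl = after k refl k≤u (ceTrans p (ceSym (braid s t)))
            where
            after : ∀ j → j ≡ m s t → j ≤ length u → u ≈ alt s t (m s t) → Normal (s ∷ u)
            after zero e _ _ = ⊥-elim (ℕ.<⇒≢ (m-pos s t) e)
            after (suc j) e j≤u q =
              ts j (ℕ.≤-trans (ℕ.n≤1+n j) (ℕ.≤-reflexive e)) (ℕ.≤-trans (ℕ.n≤1+n j) (ℕ.≤-trans j≤u (ℕ.n≤1+n _)))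
                 (ceTrans (∷-cong s (ceTrans q (≡⇒≈ (cong (alt s t) (sym e))))) (cancel s _))
          normal (a ∷ u) (inj₂ refl ∷ ls) with normal u ls
          ... | ts zero _ _ p = ts 1 (m-pos s t) (s≤s z≤n) (∷-cong t p)
          ... | ts (suc k) k≤m k≤u p =
                  st k (ℕ.≤-trans (ℕ.n≤1+n k) k≤m) (ℕ.≤-trans (ℕ.n≤1+n k) (ℕ.≤-trans k≤u (ℕ.n≤1+n _)))
                     (ceTrans (∷-cong t p) (cancel t _))
          ... | st k k≤m k≤u p with suc k ≤? m s t
          ...   | yes k<m = ts (suc k) k<m (s≤s k≤u) (∷-cong t p)
          ...   | no k≮m with ℕ.≤-antisym k≤m (ℕ.≮⇒≥ k≮m)
          ...     | refl = after k refl k≤u (ceTrans p (braid s t))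
            where
            after : ∀ j → j ≡ m s t → j ≤ length u → u ≈ alt t s (m s t) → Normal (t ∷ u)
            after zero e _ _ = ⊥-elim (ℕ.<⇒≢ (m-pos s t) e)
            after (suc j) e j≤u q =
              st j (ℕ.≤-trans (ℕ.n≤1+n j) (ℕ.≤-reflexive e)) (ℕ.≤-trans (ℕ.n≤1+n j) (ℕ.≤-trans j≤u (ℕ.n≤1+n _)))
                 (ceTrans (∷-cong t (ceTrans q (≡⇒≈ (cong (alt t s) (sym e))))) (cancel t _))

          alt-letters : ∀ k → All Letter (alt s t k) × All Letter (alt t s k)
          alt-letters zero    = [] , []
          alt-letters (suc k) =
            (inj₁ refl ∷ proj₂ (alt-letters k)) , (inj₂ refl ∷ proj₁ (alt-letters k))

          -- A normal form that is empty, or begins with `t` and is shorter than `m s t`, keeps the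
          -- side. All others, the longest element included, can be written with first letter `s`
          -- and a strictly shorter rest.
          side : ∀ u → All Letter u →
                 (∀ x → Pos s x → Pos t x → Pos s (run act u x)) ⊎
                 (∃ λ u' → All Letter u' × length u' < length u × u ≈ s ∷ u')
          side u ls with normal u ls
          ... | st zero _ _ p = inj₁ (λ x px _ → subst (Pos s) (sym (run-≈ p x)) px)
          ... | st (suc k) _ k<u p = inj₂ (alt t s k , proj₂ (alt-letters k) ,
                  ℕ.≤-trans (s≤s (ℕ.≤-reflexive (length-alt t s k))) k<u , p)
            where
            length-alt : ∀ a b k → length (alt a b k) ≡ k
            length-alt a b zero    = refl
            length-alt a b (suc k) = cong suc (length-alt b a k)
          ... | ts k k≤m k≤u p with suc k ≤? m s t
          ...   | yes k<m = inj₁ (λ x px py → subst (Pos s) (sym (run-≈ p x)) (dihedral s t s≢t k k<m x px py))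
          ...   | no k≮m with ℕ.≤-antisym k≤m (ℕ.≮⇒≥ k≮m)
          ...     | refl = top k refl k≤u (ceTrans p (ceSym (braid s t)))
            where
            length-alt : ∀ a b k → length (alt a b k) ≡ k
            length-alt a b zero    = refl
            length-alt a b (suc k) = cong suc (length-alt b a k)
            top : ∀ j → j ≡ m s t → j ≤ length u → u ≈ alt s t (m s t) →
                  (∀ x → Pos s x → Pos t x → Pos s (run act u x)) ⊎
                  (∃ λ u' → All Letter u' × length u' < length u × u ≈ s ∷ u')
            top zero e _ _ = ⊥-elim (ℕ.<⇒≢ (m-pos s t) e)
            top (suc j) e j≤u q = inj₂ (alt t s j , proj₂ (alt-letters j) ,
              ℕ.≤-trans (s≤s (ℕ.≤-reflexive (length-alt t s j))) j≤u ,
              ceTrans q (≡⇒≈ (cong (alt s t) (sym e))))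

      Side : Word n → Fin n → Set
      Side w s = (∀ x → Dominant x → Pos s (run act w x)) ⊎
                 (∃ λ w' → All I w' × length w' < length w × w ≈ s ∷ w')

      side : ∀ fuel w → length w ≤ fuel → All I w → ∀ s → I s → Side w s
      side _ [] _ _ s is = inj₁ (λ x dx → dx s is)
      side (suc fuel) (t ∷ w) (s≤s w≤f) (it ∷ iw) s is with t ≟ s
      ... | yes refl = inj₂ (w , iw , ℕ.≤-refl , ceRefl)
      -- The word is split as `u ++ v` with `u` in ⟨s, t⟩: whenever `v` can be rewritten to begin
      -- with `s` or `t`, that letter passes to `u`. Once neither happens, `v` sends dominant points
      -- into both half-spaces, and the rank-two alternative for `u` decides. The induction applies
      -- to `v` because it is always shorter than the original word.
      ... | no t≢s = factor fuel [ t ] w (inj₂ refl ∷ []) iw w≤f w≤f ℕ.≤-refl ceRefl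
        where
        open Dihedral s t (t≢s ∘ sym) renaming (side to dihedralSide)
        letters : ∀ {u} → All Letter u → All I u
        letters = All.map λ { (inj₁ refl) → is ; (inj₂ refl) → it }
        snoc : ∀ {u a} → Letter a → All Letter u → All Letter (u ++ [ a ])
        snoc l ls = All.++⁺ ls (l ∷ [])
        move : ∀ u a v v' {w'} → v ≈ a ∷ v' → w' ≈ u ++ v → w' ≈ (u ++ [ a ]) ++ v'
        move u a v v' p q = ceTrans q (ceTrans (++-congˡ u p) (≡⇒≈ (sym (List.++-assoc u [ a ] v'))))
        shorter : ∀ u a v v' {l} → length v' < length v → length u +ℕ length v ≤ l →
                  length (u ++ [ a ]) +ℕ length v' ≤ l
        shorter u a v v' {l} p q = ℕ.≤-trans
          (ℕ.≤-reflexive (trans (cong (_+ℕ length v') (trans (List.length-++ u) (ℕ.+-comm (length u) 1)))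
                                (sym (ℕ.+-suc (length u) (length v')))))
          (ℕ.≤-trans (ℕ.+-monoʳ-≤ (length u) p) q)
        factor : ∀ g u v → All Letter u → All I v → length v ≤ g → length v ≤ fuel →
                 length u +ℕ length v ≤ suc (length w) → t ∷ w ≈ u ++ v → Side (t ∷ w) s
        factor g u v lu iv v≤g v≤f uv≤w p with side fuel v v≤f iv s is
        factor zero u (_ ∷ v) lu iv () v≤f uv≤w p | _
        factor zero u [] lu iv v≤g v≤f uv≤w p | inj₂ (_ , _ , () , _)
        factor (suc g) u v lu iv v≤g v≤f uv≤w p | inj₂ (v' , iv' , v'<v , q) =
          factor g (u ++ [ s ]) v' (snoc (inj₁ refl) lu) iv' (ℕ.≤-pred (ℕ.≤-trans v'<v v≤g))
                 (ℕ.≤-trans (ℕ.<⇒≤ v'<v) v≤f) (shorter u s v v' v'<v uv≤w) (move u s v v' q p)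
        factor g u v lu iv v≤g v≤f uv≤w p | inj₁ vs with side fuel v v≤f iv t it
        factor zero u [] lu iv v≤g v≤f uv≤w p | inj₁ vs | inj₂ (_ , _ , () , _)
        factor zero u (_ ∷ v) lu iv () v≤f uv≤w p | inj₁ vs | _
        factor (suc g) u v lu iv v≤g v≤f uv≤w p | inj₁ vs | inj₂ (v' , iv' , v'<v , q) =
          factor g (u ++ [ t ]) v' (snoc (inj₂ refl) lu) iv' (ℕ.≤-pred (ℕ.≤-trans v'<v v≤g))
                 (ℕ.≤-trans (ℕ.<⇒≤ v'<v) v≤f) (shorter u t v v' v'<v uv≤w) (move u t v v' q p)
        factor g u v lu iv v≤g v≤f uv≤w p | inj₁ vs | inj₁ vt with dihedralSide u lu
        ... | inj₁ pos = inj₁ λ x dx →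
                subst (Pos s) (sym (trans (run-≈ p x) (run-++ u v x))) (pos (run act v x) (vs x dx) (vt x dx))
        ... | inj₂ (u' , lu' , u'<u , q) = inj₂ (u' ++ v , All.++⁺ (letters lu') iv ,
                ℕ.≤-trans (s≤s (ℕ.≤-reflexive (List.length-++ u')))
                          (ℕ.≤-trans (ℕ.+-monoˡ-≤ (length v) u'<u) uv≤w) ,
                ceTrans p (++-congʳ v q))

      Fixes : X → Fin n → Set
      Fixes x s = I s × act s x ≡ x

      -- For `s ∷ w` either `w` can be rewritten to begin with `s`, which cancels and shortens the
      -- word, or the image under `w` and its reflection both lie in the half-space of `s`, hence on
      -- the wall; then `s` fixes the point and is kept as a letter of the stabiliser word.
      dominant-unique : ∀ fuel w → length w ≤ fuel → All I w → ∀ x → Dominant x → Dominant (run act w x) →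
                        run act w x ≡ x × ∃ λ v → All (Fixes x) v × w ≈ v
      dominant-unique _ [] _ _ x dx dy = refl , [] , [] , ceRefl
      dominant-unique (suc fuel) (s ∷ w) (s≤s w≤f) (is ∷ iw) x dx dy with side (length w) w ℕ.≤-refl iw s is
      ... | inj₂ (w' , iw' , w'<w , p) =
            let q = ceTrans (∷-cong s p) (cancel s w')
                e = run-≈ q x
                f , v , fv , r = dominant-unique fuel w' (ℕ.≤-trans (ℕ.<⇒≤ w'<w) w≤f) iw' x dx
                                   (subst Dominant e dy)
            in trans e f , v , fv , ceTrans q r
      ... | inj₁ pos =
            let e = wall s (run act w x) (pos x dx) (dy s is)
                f , v , fv , r = dominant-unique fuel w w≤f iw x dx (subst Dominant e dy)
            in trans e f , s ∷ v , ((is , trans (cong (act s) (sym f)) (trans e f)) ∷ fv) , ∷-cong s r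

    open import Data.Unit using (⊤; tt)

    everything : ∀ (w : Word n) → All (λ _ → ⊤) w
    everything []      = []
    everything (_ ∷ w) = tt ∷ everything w

    -- Taking all generators for `I` turns uniqueness of the dominant point into the fact that
    -- stabilisers of dominant points are standard parabolic subgroups.
    stabiliser : ∀ x → (∀ s → Pos s x) → ∀ w → run act w x ≡ x →
                 ∃ λ v → All (λ s → act s x ≡ x) v × w ≈ v
    stabiliser x dx w e with dominant-unique (λ _ → ⊤) (length w) w ℕ.≤-refl (everything w) x (λ s _ → dx s)
                               (λ s _ → subst (Pos s) (sym e) (dx s))
    ... | _ , v , fv , p = v , All.map proj₂ fv , p

    -- The stabiliser word for the quotient of `u` by `v` would consist of generators fixing `x`;
    -- there are none, so it is empty. Equality of words can thus be established by evaluating both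
    -- at one point.
    faithful : ∀ x → (∀ s → Pos s x) → (∀ s → act s x ≢ x) → ∀ u v → run act u x ≡ run act v x → u ≈ v
    faithful x dx reg u v e with stabiliser x dx (reverse v ++ u)
        (trans (run-++ (reverse v) u x) (trans (cong (run act (reverse v)) e)
          (trans (sym (run-++ (reverse v) v x)) (run-≈ (reverse-inverseˡ v) x))))
    ... | s ∷ _ , fs ∷ _ , _ = ⊥-elim (reg s fs)
    ... | [] , _ , p =
      ceTrans (≡⇒≈ (sym (List.++-identityˡ u)))
        (ceTrans (ceSym (++-congʳ u (reverse-inverseʳ v)))
          (ceTrans (≡⇒≈ (List.++-assoc v (reverse v) u))
            (ceTrans (++-congˡ v p) (≡⇒≈ (List.++-identityʳ v)))))

-- The reflection representation on weights over ℤ[φ]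

module Weights where

  open import Defs
  open Tits
  open import Data.Nat using (ℕ; zero; suc; z≤n; s≤s) renaming (_*_ to _*ℕ_; _<_ to _<ℕ_)
  open import Data.Integer using (ℤ; +_; -_; _+_; _*_; _-_; _≤_; 0ℤ; 1ℤ)
  import Data.Integer.Properties as ℤ
  open import Data.Integer.Solver using (module +-*-Solver)
  open import Data.Fin using (Fin; _≟_)
  open import Data.Vec using (Vec; lookup; zipWith)
  import Data.Vec.Properties as Vec
  open import Data.Product using (_×_; _,_; proj₁; proj₂)
  open import Data.Empty using (⊥-elim)
  open import Relation.Nullary using (yes; no)
  open import Relation.Binary.PropositionalEquality

  -- Entries of a negated Cartan matrix over ℤ[φ], φ² = φ + 1.
  data Coef : Set where
    -two nil one two phi : Coef

  -- The product of the two opposite entries is 4 cos²(π/m), that is 0, 1, 2, φ² for m = 2, 3, 4, 5.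
  -- Splitting 2 as 1 · 2 avoids the square root that a symmetric matrix would need.
  data Bond : Coef → Coef → ℕ → Set where
    bond2  : Bond nil nil 2
    bond3  : Bond one one 3
    bond4  : Bond one two 4
    bond4' : Bond two one 4
    bond5  : Bond phi phi 5

  -- Parametrised by the arithmetic so that one definition runs both on integers and on solver
  -- polynomials; an identity for a concrete number of steps is then an equation that the ring
  -- solver can normalise.
  module Generic {A : Set} (_⊕_ : A → A → A) (⊖_ : A → A) where

    -- step c x y = y + c x, where the pair (a , b) stands for a + b φ
    step : Coef → A × A → A × A → A × A
    step -two (a , b) (c , d) = c ⊕ (⊖ (a ⊕ a)) , d ⊕ (⊖ (b ⊕ b))
    step nil  _       y       = y
    step one  (a , b) (c , d) = a ⊕ c , b ⊕ d
    step two  (a , b) (c , d) = (a ⊕ a) ⊕ c , (b ⊕ b) ⊕ d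
    step phi  (a , b) (c , d) = b ⊕ c , (a ⊕ b) ⊕ d

    -- The coordinates at `s` and `t` evolve among themselves under the two reflections. Exchanging
    -- the roles of `s` and `t` at each recursive call produces the alternating word.
    plane : Coef → Coef → ℕ → A × A → A × A → (A × A) × (A × A)
    plane f g zero    x y = x , y
    plane f g (suc k) x y with plane g f k y x
    ... | y' , x' = step -two x' x' , step f x' y'

    -- accumulated displacements along alpha_s and alpha_t
    total : Coef → Coef → ℕ → A × A → A × A → A × A → (A × A) × (A × A)
    total f g zero    x y o = o , o
    total f g (suc k) x y o =
      let x' = proj₂ (plane g f k y x) ; T , S = total g f k y x o in
      (proj₁ S ⊕ proj₁ x' , proj₂ S ⊕ proj₂ x') , T

  open Generic _+_ -_ public

  R : Set
  R = ℤ × ℤ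

  -- The two rows of the integer matrix of multiplication by a coefficient in the basis 1, φ.
  row₁ row₂ : Coef → R
  row₁ -two = - + 2 , 0ℤ
  row₁ nil  = 0ℤ , 0ℤ
  row₁ one  = 1ℤ , 0ℤ
  row₁ two  = + 2 , 0ℤ
  row₁ phi  = 0ℤ , 1ℤ
  row₂ -two = 0ℤ , - + 2
  row₂ nil  = 0ℤ , 0ℤ
  row₂ one  = 0ℤ , 1ℤ
  row₂ two  = 0ℤ , + 2
  row₂ phi  = 1ℤ , 1ℤ

  private
    open +-*-Solver

    step₁ : ∀ c x y → proj₁ (step c x y) ≡ proj₁ y + (proj₁ (row₁ c) * proj₁ x + proj₂ (row₁ c) * proj₂ x)
    step₁ -two (a , b) (c , d) = solve 3 (λ a b c → c :+ (:- (a :+ a)) := c :+ (con (- + 2) :* a :+ con 0ℤ :* b)) refl a b c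
    step₁ nil (a , b) (c , d) = solve 3 (λ a b c → c := c :+ (con 0ℤ :* a :+ con 0ℤ :* b)) refl a b c
    step₁ one (a , b) (c , d) = solve 3 (λ a b c → a :+ c := c :+ (con 1ℤ :* a :+ con 0ℤ :* b)) refl a b c
    step₁ two (a , b) (c , d) = solve 3 (λ a b c → (a :+ a) :+ c := c :+ (con (+ 2) :* a :+ con 0ℤ :* b)) refl a b c
    step₁ phi (a , b) (c , d) = solve 3 (λ a b c → b :+ c := c :+ (con 0ℤ :* a :+ con 1ℤ :* b)) refl a b c

    step₂ : ∀ c x y → proj₂ (step c x y) ≡ proj₂ y + (proj₁ (row₂ c) * proj₁ x + proj₂ (row₂ c) * proj₂ x)
    step₂ -two (a , b) (c , d) = solve 3 (λ a b d → d :+ (:- (b :+ b)) := d :+ (con 0ℤ :* a :+ con (- + 2) :* b)) refl a b d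
    step₂ nil (a , b) (c , d) = solve 3 (λ a b d → d := d :+ (con 0ℤ :* a :+ con 0ℤ :* b)) refl a b d
    step₂ one (a , b) (c , d) = solve 3 (λ a b d → b :+ d := d :+ (con 0ℤ :* a :+ con 1ℤ :* b)) refl a b d
    step₂ two (a , b) (c , d) = solve 3 (λ a b d → (b :+ b) :+ d := d :+ (con 0ℤ :* a :+ con (+ 2) :* b)) refl a b d
    step₂ phi (a , b) (c , d) = solve 3 (λ a b d → (a :+ b) :+ d := d :+ (con 1ℤ :* a :+ con 1ℤ :* b)) refl a b d

    module Poly = Generic {Polynomial 4} _:+_ :-_

    O : R
    O = 0ℤ , 0ℤ

    dot : R → R → ℤ
    dot (p , p') (x , x') = p * x + p' * x'

    -- A reflection moves a weight along one root only, so `(s t)^m` changes a weight by multiples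
    -- of two roots. If both multiples vanish, the relation holds in all coordinates at once,
    -- whatever the rank.
    cycle : ∀ {f g m} → Bond f g m → ∀ x y → total f g (2 *ℕ m) x y O ≡ (O , O)
    cycle bond2 (x , x') (y , y') = cong₂ _,_
      (cong₂ _,_ (solve 4 (λ x x' y y' → proj₁ (proj₁ (Poly.total nil nil 4 (x , x') (y , y') (con 0ℤ , con 0ℤ))) := con 0ℤ) refl x x' y y')
                (solve 4 (λ x x' y y' → proj₂ (proj₁ (Poly.total nil nil 4 (x , x') (y , y') (con 0ℤ , con 0ℤ))) := con 0ℤ) refl x x' y y'))
      (cong₂ _,_ (solve 4 (λ x x' y y' → proj₁ (proj₂ (Poly.total nil nil 4 (x , x') (y , y') (con 0ℤ , con 0ℤ))) := con 0ℤ) refl x x' y y')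
                (solve 4 (λ x x' y y' → proj₂ (proj₂ (Poly.total nil nil 4 (x , x') (y , y') (con 0ℤ , con 0ℤ))) := con 0ℤ) refl x x' y y'))
    cycle bond3 (x , x') (y , y') = cong₂ _,_
      (cong₂ _,_ (solve 4 (λ x x' y y' → proj₁ (proj₁ (Poly.total one one 6 (x , x') (y , y') (con 0ℤ , con 0ℤ))) := con 0ℤ) refl x x' y y')
                (solve 4 (λ x x' y y' → proj₂ (proj₁ (Poly.total one one 6 (x , x') (y , y') (con 0ℤ , con 0ℤ))) := con 0ℤ) refl x x' y y'))
      (cong₂ _,_ (solve 4 (λ x x' y y' → proj₁ (proj₂ (Poly.total one one 6 (x , x') (y , y') (con 0ℤ , con 0ℤ))) := con 0ℤ) refl x x' y y')
                (solve 4 (λ x x' y y' → proj₂ (proj₂ (Poly.total one one 6 (x , x') (y , y') (con 0ℤ , con 0ℤ))) := con 0ℤ) refl x x' y y'))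
    cycle bond4 (x , x') (y , y') = cong₂ _,_
      (cong₂ _,_ (solve 4 (λ x x' y y' → proj₁ (proj₁ (Poly.total one two 8 (x , x') (y , y') (con 0ℤ , con 0ℤ))) := con 0ℤ) refl x x' y y')
                (solve 4 (λ x x' y y' → proj₂ (proj₁ (Poly.total one two 8 (x , x') (y , y') (con 0ℤ , con 0ℤ))) := con 0ℤ) refl x x' y y'))
      (cong₂ _,_ (solve 4 (λ x x' y y' → proj₁ (proj₂ (Poly.total one two 8 (x , x') (y , y') (con 0ℤ , con 0ℤ))) := con 0ℤ) refl x x' y y')
                (solve 4 (λ x x' y y' → proj₂ (proj₂ (Poly.total one two 8 (x , x') (y , y') (con 0ℤ , con 0ℤ))) := con 0ℤ) refl x x' y y'))
    cycle bond4' (x , x') (y , y') = cong₂ _,_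
      (cong₂ _,_ (solve 4 (λ x x' y y' → proj₁ (proj₁ (Poly.total two one 8 (x , x') (y , y') (con 0ℤ , con 0ℤ))) := con 0ℤ) refl x x' y y')
                (solve 4 (λ x x' y y' → proj₂ (proj₁ (Poly.total two one 8 (x , x') (y , y') (con 0ℤ , con 0ℤ))) := con 0ℤ) refl x x' y y'))
      (cong₂ _,_ (solve 4 (λ x x' y y' → proj₁ (proj₂ (Poly.total two one 8 (x , x') (y , y') (con 0ℤ , con 0ℤ))) := con 0ℤ) refl x x' y y')
                (solve 4 (λ x x' y y' → proj₂ (proj₂ (Poly.total two one 8 (x , x') (y , y') (con 0ℤ , con 0ℤ))) := con 0ℤ) refl x x' y y'))
    cycle bond5 (x , x') (y , y') = cong₂ _,_
      (cong₂ _,_ (solve 4 (λ x x' y y' → proj₁ (proj₁ (Poly.total phi phi 10 (x , x') (y , y') (con 0ℤ , con 0ℤ))) := con 0ℤ) refl x x' y y')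
                (solve 4 (λ x x' y y' → proj₂ (proj₁ (Poly.total phi phi 10 (x , x') (y , y') (con 0ℤ , con 0ℤ))) := con 0ℤ) refl x x' y y'))
      (cong₂ _,_ (solve 4 (λ x x' y y' → proj₁ (proj₂ (Poly.total phi phi 10 (x , x') (y , y') (con 0ℤ , con 0ℤ))) := con 0ℤ) refl x x' y y')
                (solve 4 (λ x x' y y' → proj₂ (proj₂ (Poly.total phi phi 10 (x , x') (y , y') (con 0ℤ , con 0ℤ))) := con 0ℤ) refl x x' y y'))

  Nonneg : R → Set
  Nonneg (a , b) = 0ℤ ≤ a × 0ℤ ≤ b

  private
    nonneg-step : ∀ c {x y} → c ≢ -two → Nonneg x → Nonneg y → Nonneg (step c x y)
    nonneg-step -two c≢ _ _ = ⊥-elim (c≢ refl)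
    nonneg-step nil  _ _ q = q
    nonneg-step one  _ (a , b) (c , d) = ℤ.+-mono-≤ a c , ℤ.+-mono-≤ b d
    nonneg-step two  _ (a , b) (c , d) = ℤ.+-mono-≤ (ℤ.+-mono-≤ a a) c , ℤ.+-mono-≤ (ℤ.+-mono-≤ b b) d
    nonneg-step phi  _ (a , b) (c , d) = ℤ.+-mono-≤ b c , ℤ.+-mono-≤ (ℤ.+-mono-≤ a b) d

    via : ∀ {x y : R} → proj₁ x ≡ proj₁ y → proj₂ x ≡ proj₂ y → Nonneg y → Nonneg x
    via p q (a , b) = subst (0ℤ ≤_) (sym p) a , subst (0ℤ ≤_) (sym q) b

    -- These coordinates are the values of the positive roots of the rank-two system, and positive
    -- roots are nonnegative combinations of the simple ones. Each case rewrites the alternating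
    -- expression as such a combination.
    dihedral-nonneg : ∀ {f g m} → Bond f g m → ∀ k → k <ℕ m → ∀ {x y} → Nonneg x → Nonneg y →
                      Nonneg (proj₂ (plane g f k y x))
    dihedral-nonneg b zero _ p q = p
    dihedral-nonneg bond2 1 _ p q = p
    dihedral-nonneg bond3 1 _ p q = nonneg-step one (λ ()) q p
    dihedral-nonneg bond3 2 _ {x , x'} {y , y'} p q = via
      (solve 4 (λ x x' y y' → proj₁ (proj₂ (Poly.plane one one 2 (y , y') (x , x'))) := y) refl x x' y y')
      (solve 4 (λ x x' y y' → proj₂ (proj₂ (Poly.plane one one 2 (y , y') (x , x'))) := y') refl x x' y y') q
    dihedral-nonneg bond4 1 _ p q = nonneg-step two (λ ()) q p
    dihedral-nonneg bond4 2 _ {x , x'} {y , y'} p q = via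
      (solve 4 (λ x x' y y' → proj₁ (proj₂ (Poly.plane two one 2 (y , y') (x , x'))) := proj₁ (Poly.step two (y , y') (x , x'))) refl x x' y y')
      (solve 4 (λ x x' y y' → proj₂ (proj₂ (Poly.plane two one 2 (y , y') (x , x'))) := proj₂ (Poly.step two (y , y') (x , x'))) refl x x' y y')
      (nonneg-step two (λ ()) q p)
    dihedral-nonneg bond4 3 _ {x , x'} {y , y'} p q = via
      (solve 4 (λ x x' y y' → proj₁ (proj₂ (Poly.plane two one 3 (y , y') (x , x'))) := x) refl x x' y y')
      (solve 4 (λ x x' y y' → proj₂ (proj₂ (Poly.plane two one 3 (y , y') (x , x'))) := x') refl x x' y y') p
    dihedral-nonneg bond4' 1 _ p q = nonneg-step one (λ ()) q p
    dihedral-nonneg bond4' 2 _ {x , x'} {y , y'} p q = via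
      (solve 4 (λ x x' y y' → proj₁ (proj₂ (Poly.plane one two 2 (y , y') (x , x'))) := proj₁ (Poly.step one (y , y') (x , x'))) refl x x' y y')
      (solve 4 (λ x x' y y' → proj₂ (proj₂ (Poly.plane one two 2 (y , y') (x , x'))) := proj₂ (Poly.step one (y , y') (x , x'))) refl x x' y y')
      (nonneg-step one (λ ()) q p)
    dihedral-nonneg bond4' 3 _ {x , x'} {y , y'} p q = via
      (solve 4 (λ x x' y y' → proj₁ (proj₂ (Poly.plane one two 3 (y , y') (x , x'))) := x) refl x x' y y')
      (solve 4 (λ x x' y y' → proj₂ (proj₂ (Poly.plane one two 3 (y , y') (x , x'))) := x') refl x x' y y') p
    dihedral-nonneg bond5 1 _ p q = nonneg-step phi (λ ()) q p
    dihedral-nonneg bond5 2 _ {x , x'} {y , y'} p q = via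
      (solve 4 (λ x x' y y' → proj₁ (proj₂ (Poly.plane phi phi 2 (y , y') (x , x'))) := proj₁ (Poly.step phi (y , y') (x' , x :+ x'))) refl x x' y y')
      (solve 4 (λ x x' y y' → proj₂ (proj₂ (Poly.plane phi phi 2 (y , y') (x , x'))) := proj₂ (Poly.step phi (y , y') (x' , x :+ x'))) refl x x' y y')
      (nonneg-step phi (λ ()) q (proj₂ p , ℤ.+-mono-≤ (proj₁ p) (proj₂ p)))
    dihedral-nonneg bond5 3 _ {x , x'} {y , y'} p q = via
      (solve 4 (λ x x' y y' → proj₁ (proj₂ (Poly.plane phi phi 3 (y , y') (x , x'))) := proj₁ (Poly.step phi (x , x') (y , y'))) refl x x' y y')
      (solve 4 (λ x x' y y' → proj₂ (proj₂ (Poly.plane phi phi 3 (y , y') (x , x'))) := proj₂ (Poly.step phi (x , x') (y , y'))) refl x x' y y')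
      (nonneg-step phi (λ ()) p q)
    dihedral-nonneg bond5 4 _ {x , x'} {y , y'} p q = via
      (solve 4 (λ x x' y y' → proj₁ (proj₂ (Poly.plane phi phi 4 (y , y') (x , x'))) := y) refl x x' y y')
      (solve 4 (λ x x' y y' → proj₂ (proj₂ (Poly.plane phi phi 4 (y , y') (x , x'))) := y') refl x x' y y') q
    dihedral-nonneg bond2 (suc (suc k)) (s≤s (s≤s ()))
    dihedral-nonneg bond3 (suc (suc (suc k))) (s≤s (s≤s (s≤s ())))
    dihedral-nonneg bond4 (suc (suc (suc (suc k)))) (s≤s (s≤s (s≤s (s≤s ()))))
    dihedral-nonneg bond4' (suc (suc (suc (suc k)))) (s≤s (s≤s (s≤s (s≤s ()))))
    dihedral-nonneg bond5 (suc (suc (suc (suc (suc k))))) (s≤s (s≤s (s≤s (s≤s (s≤s ())))))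

  Cartan : ℕ → Set
  Cartan n = Vec (Vec Coef n) n

  entry : ∀ {n} → Cartan n → Fin n → Fin n → Coef
  entry C s t = lookup (lookup C s) t

  Weight : ℕ → Set
  Weight = Vec R

  reflect : ∀ {n} → Cartan n → Fin n → Weight n → Weight n
  reflect C s v = move (lookup v s) (lookup C s) v
    where
    move : ∀ {n} → R → Vec Coef n → Weight n → Weight n
    move x = zipWith (λ c → step c x)

  lookup-reflect : ∀ {n} (C : Cartan n) s v r →
                   lookup (reflect C s v) r ≡ step (entry C s r) (lookup v s) (lookup v r)
  lookup-reflect C s v r = Vec.lookup-zipWith (λ c → step c (lookup v s)) r (lookup C s) v

  record Presents {n} (C : Cartan n) (m : Fin n → Fin n → ℕ) : Set where
    field
      diagonal : ∀ s → entry C s s ≡ -two × m s s ≡ 1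
      bonds    : ∀ s t → s ≢ t → Bond (entry C s t) (entry C t s) (m s t)

  module _ {n} {C : Cartan n} {m : Fin n → Fin n → ℕ} (pres : Presents C m) where

    open Presents pres

    private
      coord = lookup-reflect C

      plane-coord : ∀ s t k v → let x , y = plane (entry C s t) (entry C t s) k (lookup v s) (lookup v t) in
        lookup (run (reflect C) (alt s t k) v) s ≡ x × lookup (run (reflect C) (alt s t k) v) t ≡ y
      plane-coord s t zero v = refl , refl
      plane-coord s t (suc k) v with plane-coord t s k v
      ... | p , q =
        trans (coord s _ s) (trans
          (cong (λ c → step c (lookup (run (reflect C) (alt t s k) v) s) (lookup (run (reflect C) (alt t s k) v) s)) (proj₁ (diagonal s)))
          (cong (λ z → step -two z z) q)) ,
        trans (coord s (run (reflect C) (alt t s k) v) t) (cong₂ (step (entry C s t)) q p)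

      none : ∀ r p q → r ≡ r + (dot p O + dot q O)
      none r (p , p') (q , q') = solve 5 (λ r p p' q q' →
        r := r :+ ((p :* con 0ℤ :+ p' :* con 0ℤ) :+ (q :* con 0ℤ :+ q' :* con 0ℤ))) refl r p p' q q'

      collect : ∀ r p q T S x → (r + (dot q T + dot p S)) + dot p x ≡
                r + (dot p (proj₁ S + proj₁ x , proj₂ S + proj₂ x) + dot q T)
      collect r (p , p') (q , q') (T , T') (S , S') (x , x') = solve 11 (λ r p p' q q' T T' S S' x x' →
        (r :+ ((q :* T :+ q' :* T') :+ (p :* S :+ p' :* S'))) :+ (p :* x :+ p' :* x') :=
        r :+ ((p :* (S :+ x) :+ p' :* (S' :+ x')) :+ (q :* T :+ q' :* T'))) refl r p p' q q' T T' S S' x x'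

      -- Coordinate `r` depends on the walk only through the accumulated multiples of the roots of
      -- `s` and `t`, weighted by the Cartan entries `entry C s r` and `entry C t r`.
      total-coord₁ : ∀ s t r k v → proj₁ (lookup (run (reflect C) (alt s t k) v) r) ≡
        proj₁ (lookup v r) + (dot (row₁ (entry C s r)) (proj₁ (total (entry C s t) (entry C t s) k (lookup v s) (lookup v t) O))
                                + dot (row₁ (entry C t r)) (proj₂ (total (entry C s t) (entry C t s) k (lookup v s) (lookup v t) O)))
      total-coord₁ s t r zero v = none (proj₁ (lookup v r)) (row₁ (entry C s r)) (row₁ (entry C t r))
      total-coord₁ s t r (suc k) v =
        let U = λ v → total (entry C t s) (entry C s t) k (lookup v t) (lookup v s) O in
        trans (cong proj₁ (coord s _ r))
          (trans (step₁ (entry C s r) _ _)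
            (trans (cong₂ (λ a x → a + dot (row₁ (entry C s r)) x) (total-coord₁ t s r k v) (proj₂ (plane-coord t s k v)))
                   (collect (proj₁ (lookup v r)) (row₁ (entry C s r)) (row₁ (entry C t r)) (proj₁ (U v)) (proj₂ (U v)) (proj₂ (plane (entry C t s) (entry C s t) k (lookup v t) (lookup v s))))))

      total-coord₂ : ∀ s t r k v → proj₂ (lookup (run (reflect C) (alt s t k) v) r) ≡
        proj₂ (lookup v r) + (dot (row₂ (entry C s r)) (proj₁ (total (entry C s t) (entry C t s) k (lookup v s) (lookup v t) O))
                                + dot (row₂ (entry C t r)) (proj₂ (total (entry C s t) (entry C t s) k (lookup v s) (lookup v t) O)))
      total-coord₂ s t r zero v = none (proj₂ (lookup v r)) (row₂ (entry C s r)) (row₂ (entry C t r))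
      total-coord₂ s t r (suc k) v =
        let U = λ v → total (entry C t s) (entry C s t) k (lookup v t) (lookup v s) O in
        trans (cong proj₂ (coord s _ r))
          (trans (step₂ (entry C s r) _ _)
            (trans (cong₂ (λ a x → a + dot (row₂ (entry C s r)) x) (total-coord₂ t s r k v) (proj₂ (plane-coord t s k v)))
                   (collect (proj₂ (lookup v r)) (row₂ (entry C s r)) (row₂ (entry C t r)) (proj₁ (U v)) (proj₂ (U v)) (proj₂ (plane (entry C t s) (entry C s t) k (lookup v t) (lookup v s))))))

      ext : ∀ {A : Set} {k} (u v : Vec A k) → (∀ i → lookup u i ≡ lookup v i) → u ≡ v
      ext u v h = trans (sym (Vec.tabulate∘lookup u)) (trans (Vec.tabulate-cong h) (Vec.tabulate∘lookup v))

      involutive : ∀ s v → reflect C s (reflect C s v) ≡ v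
      involutive s v = ext _ _ λ r →
        trans (coord s (reflect C s v) r)
          (trans (cong₂ (step (entry C s r))
                    (trans (coord s v s) (cong (λ c → step c (lookup v s) (lookup v s)) (proj₁ (diagonal s))))
                    (coord s v r))
                 (twice (entry C s r) (lookup v s) (lookup v r)))
        where
        twice : ∀ c x y → step c (step -two x x) (step c x y) ≡ y
        twice -two (a , b) (c , d) = cong₂ _,_
          (solve 2 (λ a c → (c :+ (:- (a :+ a))) :+ (:- ((a :+ (:- (a :+ a))) :+ (a :+ (:- (a :+ a))))) := c) refl a c)
          (solve 2 (λ a c → (c :+ (:- (a :+ a))) :+ (:- ((a :+ (:- (a :+ a))) :+ (a :+ (:- (a :+ a))))) := c) refl b d)
        twice nil x y = refl
        twice one (a , b) (c , d) = cong₂ _,_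
          (solve 2 (λ a c → (a :+ (:- (a :+ a))) :+ (a :+ c) := c) refl a c)
          (solve 2 (λ a c → (a :+ (:- (a :+ a))) :+ (a :+ c) := c) refl b d)
        twice two (a , b) (c , d) = cong₂ _,_
          (solve 2 (λ a c → ((a :+ (:- (a :+ a))) :+ (a :+ (:- (a :+ a)))) :+ ((a :+ a) :+ c) := c) refl a c)
          (solve 2 (λ a c → ((a :+ (:- (a :+ a))) :+ (a :+ (:- (a :+ a)))) :+ ((a :+ a) :+ c) := c) refl b d)
        twice phi (a , b) (c , d) = cong₂ _,_
          (solve 2 (λ b c → (b :+ (:- (b :+ b))) :+ (b :+ c) := c) refl b c)
          (solve 3 (λ a b d → ((a :+ (:- (a :+ a))) :+ (b :+ (:- (b :+ b)))) :+ ((a :+ b) :+ d) := d) refl a b d)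

      nonneg-neg : ∀ {a} → 0ℤ ≤ a → 0ℤ ≤ a - (a + a) → a ≡ 0ℤ
      nonneg-neg {a} p q = ℤ.≤-antisym
        (subst₂ _≤_ (ℤ.+-identityˡ a) (solve 1 (λ a → (a :+ (:- (a :+ a))) :+ a := con 0ℤ) refl a) (ℤ.+-monoˡ-≤ a q)) p

      step-zero : ∀ c y → step c (0ℤ , 0ℤ) y ≡ y
      step-zero -two (a , b) = cong₂ _,_ (ℤ.+-identityʳ a) (ℤ.+-identityʳ b)
      step-zero nil  y = refl
      step-zero one  (a , b) = cong₂ _,_ (ℤ.+-identityˡ a) (ℤ.+-identityˡ b)
      step-zero two  (a , b) = cong₂ _,_ (ℤ.+-identityˡ a) (ℤ.+-identityˡ b)
      step-zero phi  (a , b) = cong₂ _,_ (ℤ.+-identityˡ a) (ℤ.+-identityˡ b)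

    weights : HalfSpaces m (Weight n)
    weights = record
      { m-diag   = λ s → proj₂ (diagonal s)
      ; m-pos    = pos
      ; act      = reflect C
      ; Pos      = λ s v → Nonneg (lookup v s)
      ; relation = relation
      ; dihedral = λ s t s≢t k k<m v p q →
          subst Nonneg (sym (proj₂ (plane-coord t s k v))) (dihedral-nonneg (bonds s t s≢t) k k<m p q)
      ; wall     = wall
      }
      where
      bond-pos : ∀ {f g k} → Bond f g k → 0 <ℕ k
      bond-pos bond2  = s≤s z≤n
      bond-pos bond3  = s≤s z≤n
      bond-pos bond4  = s≤s z≤n
      bond-pos bond4' = s≤s z≤n
      bond-pos bond5  = s≤s z≤n
      pos : ∀ s t → 0 <ℕ m s t
      pos s t with s ≟ t
      ... | yes refl = subst (0 <ℕ_) (sym (proj₂ (diagonal s))) (s≤s z≤n)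
      ... | no s≢t = bond-pos (bonds s t s≢t)
      relation : ∀ s t v → run (reflect C) (alt s t (2 *ℕ m s t)) v ≡ v
      relation s t v with s ≟ t
      ... | yes refl = subst (λ k → run (reflect C) (alt s s (2 *ℕ k)) v ≡ v) (sym (proj₂ (diagonal s))) (involutive s v)
      ... | no s≢t = ext _ _ λ r → cong₂ _,_
              (back proj₁ row₁ r (total-coord₁ s t r (2 *ℕ m s t) v))
              (back proj₂ row₂ r (total-coord₂ s t r (2 *ℕ m s t) v))
        where
        back : ∀ (π : R → ℤ) (row : Coef → R) r {z} →
               z ≡ π (lookup v r) + (dot (row (entry C s r)) (proj₁ (total (entry C s t) (entry C t s) (2 *ℕ m s t) (lookup v s) (lookup v t) O))
                                   + dot (row (entry C t r)) (proj₂ (total (entry C s t) (entry C t s) (2 *ℕ m s t) (lookup v s) (lookup v t) O))) →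
               z ≡ π (lookup v r)
        back π row r e = trans e (trans
          (cong (λ T → π (lookup v r) + (dot (row (entry C s r)) (proj₁ T) + dot (row (entry C t r)) (proj₂ T)))
                (cycle (bonds s t s≢t) (lookup v s) (lookup v t)))
          (sym (none (π (lookup v r)) (row (entry C s r)) (row (entry C t r)))))
      wall : ∀ s v → Nonneg (lookup v s) → Nonneg (lookup (reflect C s v) s) → reflect C s v ≡ v
      wall s v (p , p') q' with subst Nonneg (trans (coord s v s) (cong (λ c → step c (lookup v s) (lookup v s)) (proj₁ (diagonal s)))) q'
      ... | q , q″ = ext _ _ λ r → trans (coord s v r)
        (trans (cong (λ z → step (entry C s r) z (lookup v r)) (cong₂ _,_ (nonneg-neg p q) (nonneg-neg p' q″)))
               (step-zero (entry C s r) (lookup v r)))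

-- Counting double cosets through the cosets of a reflection subgroup

module Cosets where

  open import Defs
  open Tits
  open import Data.Nat using (ℕ) renaming (_+_ to _+ℕ_; _*_ to _*ℕ_)
  open import Data.Fin using (Fin)
  open import Data.Fin.Subset using (Subset; _∈_)
  open import Data.List using (List; []; _∷_; _++_; length; reverse; [_]; map; concatMap)
  import Data.List.Properties as List
  open import Data.Nat.ListAction using (sum)
  open import Data.List.Membership.Propositional using () renaming (_∈_ to _∈ˡ_)
  open import Data.List.Relation.Unary.All using (All; []; _∷_)
  import Data.List.Relation.Unary.All as All
  import Data.List.Relation.Unary.All.Properties as All
  open import Data.List.Relation.Unary.Any using (Any; here; there)
  import Data.List.Relation.Unary.Any as Any
  import Data.List.Relation.Unary.Any.Properties as Any
  open import Data.List.Relation.Unary.AllPairs using (AllPairs; []; _∷_)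
  import Data.List.Relation.Unary.AllPairs as AllPairs
  import Data.List.Relation.Unary.AllPairs.Properties as AllPairs
  open import Data.Product using (Σ; ∃; _×_; _,_; proj₁; proj₂)
  open import Data.Sum using (_⊎_; inj₁; inj₂)
  open import Relation.Nullary using (¬_)
  open import Relation.Binary.PropositionalEquality hiding ([_])

  -- A list form of the count, with separation only between earlier and later representatives: it
  -- concatenates and maps well, and symmetry of the relation restores the indexed form at the end.
  Classes : {A : Set} → (A → A → Set) → ℕ → Set
  Classes {A} _~_ k = Σ (List A) λ reps → length reps ≡ k × AllPairs (λ x y → ¬ (x ~ y)) reps × (∀ x → Any (x ~_) reps)

  DoubleCosets : ∀ {n} → (Fin n → Fin n → ℕ) → Subset n → Subset n → ℕ → Set
  DoubleCosets m I J = Classes (SameDoubleCoset m I J)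

  -- Representatives taken from different fibres of an invariant cannot be equivalent, so the fibres
  -- may be counted separately.
  classes-partition : {A K : Set} (_~_ : A → A → Set) (key : A → K) →
    (∀ {x y} → x ~ y → key x ≡ key y) →
    (ks : List K) → AllPairs _≢_ ks → (∀ x → key x ∈ˡ ks) → (size : K → ℕ) →
    (∀ {κ} → κ ∈ˡ ks → Σ (List A) λ reps → length reps ≡ size κ × AllPairs (λ x y → ¬ (x ~ y)) reps ×
       All (λ x → key x ≡ κ) reps × (∀ x → key x ≡ κ → Any (x ~_) reps)) →
    Classes _~_ (sum (map size ks))
  classes-partition {A} {K} _~_ key ~⇒key ks distinct total size fibre
    with go ks distinct (All.tabulate fibre)
    where
    Fibre : K → Set
    Fibre κ = Σ (List A) λ reps → length reps ≡ size κ × AllPairs (λ x y → ¬ (x ~ y)) reps ×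
       All (λ x → key x ≡ κ) reps × (∀ x → key x ≡ κ → Any (x ~_) reps)
    go : ∀ ks → AllPairs _≢_ ks → All Fibre ks →
         Σ (List A) λ reps → length reps ≡ sum (map size ks) × AllPairs (λ x y → ¬ (x ~ y)) reps ×
           All (λ x → key x ∈ˡ ks) reps × (∀ x → key x ∈ˡ ks → Any (x ~_) reps)
    go [] _ _ = [] , refl , [] , [] , λ _ ()
    go (κ ∷ ks) (κ∉ ∷ ds) ((r , l , p , f , c) ∷ fs) with go ks ds fs
    ... | r' , l' , p' , f' , c' = r ++ r' ,
          trans (List.length-++ r) (cong₂ _+ℕ_ l l') ,
          AllPairs.++⁺ p p' (All.map (λ kx → All.map (λ ky x~y →
            All.lookup κ∉ ky (trans (sym kx) (~⇒key x~y))) f') f) ,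
          All.++⁺ (All.map here f) (All.map there f') ,
          λ { x (here e) → Any.++⁺ˡ (c x e) ; x (there e) → Any.++⁺ʳ r (c' x e) }
  ... | r , l , p , _ , c = r , l , p , λ x → c x (total x)

  All-reverse : ∀ {n} {P : Fin n → Set} {w : Word n} → All P w → All P (reverse w)
  All-reverse [] = []
  All-reverse {P = P} {s ∷ w} (p ∷ ps) = subst (All P) (sym (List.unfold-reverse s w)) (All.++⁺ (All-reverse ps) (p ∷ []))

  module _ {n} {m : Fin n → Fin n → ℕ} (m-diag : ∀ s → m s s ≡ 1) where

    open Words m m-diag

    doubleCoset-sym : ∀ {I J w w'} → SameDoubleCoset m I J w w' → SameDoubleCoset m I J w' w
    doubleCoset-sym {w = w} {w'} (u , v , iu , jv , p) = reverse u , reverse v , All-reverse iu , All-reverse jv ,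
      ceSym (ceTrans (++-congˡ (reverse u) (++-congʳ (reverse v) p)) (ceTrans (≡⇒≈ shuffle)
        (ceTrans (++-congʳ _ (reverse-inverseˡ u))
          (ceTrans (++-congˡ w (reverse-inverseʳ v)) (≡⇒≈ (List.++-identityʳ w))))))
      where
      shuffle : reverse u ++ (u ++ w ++ v) ++ reverse v ≡ (reverse u ++ u) ++ w ++ (v ++ reverse v)
      shuffle = trans (cong (reverse u ++_) (trans (List.++-assoc u (w ++ v) (reverse v)) (cong (u ++_) (List.++-assoc w v (reverse v)))))
                      (sym (List.++-assoc (reverse u) u (w ++ v ++ reverse v)))

    doubleCoset-trans : ∀ {I J w w' w″} → SameDoubleCoset m I J w w' → SameDoubleCoset m I J w' w″ → SameDoubleCoset m I J w w″
    doubleCoset-trans {w = w} (u , v , iu , jv , p) (u' , v' , iu' , jv' , p') = u' ++ u , v ++ v' , All.++⁺ iu' iu , All.++⁺ jv jv' ,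
      ceTrans p' (ceTrans (++-congˡ u' (++-congʳ v' p)) (≡⇒≈ (trans (cong (u' ++_) (trans (List.++-assoc u (w ++ v) v') (cong (u ++_) (List.++-assoc w v v'))))
        (sym (List.++-assoc u' u (w ++ v ++ v'))))))

    private
      reverse-≈ : ∀ {u v} → u ≈ v → reverse u ≈ reverse v
      reverse-≈ {u} {v} p =
        ceTrans (≡⇒≈ (sym (List.++-identityʳ (reverse u))))
          (ceTrans (++-congˡ (reverse u) (ceSym (reverse-inverseʳ v)))
            (ceTrans (++-congˡ (reverse u) (++-congʳ (reverse v) (ceSym p)))
              (ceTrans (≡⇒≈ (sym (List.++-assoc (reverse u) u (reverse v)))) (++-congʳ (reverse v) (reverse-inverseˡ u)))))

      reverse-coset : ∀ {I J w w'} → SameDoubleCoset m I J w w' → SameDoubleCoset m J I (reverse w) (reverse w')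
      reverse-coset {w = w} (u , v , uI , vJ , p) = reverse v , reverse u , All-reverse vJ , All-reverse uI ,
        ceTrans (reverse-≈ p) (≡⇒≈ (trans (List.reverse-++ u (w ++ v))
          (trans (cong (_++ reverse u) (List.reverse-++ w v)) (List.++-assoc (reverse v) (reverse w) (reverse u)))))

    -- Inversion, realised by `reverse`, exchanges the two sides.
    doubleCosets-sym : ∀ {I J c} → DoubleCosets m I J c → DoubleCosets m J I c
    doubleCosets-sym {I} {J} (ws , len , sep , cover) =
      map reverse ws , trans (List.length-map reverse ws) len ,
      AllPairs.map⁺ (AllPairs.map (λ {w} {w'} ¬p p → ¬p (subst₂ (SameDoubleCoset m I J) (List.reverse-involutive w) (List.reverse-involutive w') (reverse-coset p))) sep) ,
      λ w → Any.map⁺ (Any.map (λ {w'} p → subst (λ x → SameDoubleCoset m J I x (reverse w')) (List.reverse-involutive w) (reverse-coset p)) (cover (reverse w)))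

  data Entry (D : Set) (k l : ℕ) : Set where
    move : D → Entry D k l
    loop : Fin k → Entry D k l
    triv : Fin l → Entry D k l

  follow : ∀ {D : Set} {k l} → Entry D k l → D × Word k → D × Word k
  follow (move b) (_ , h) = b , h
  follow (loop t) (a , h) = a , t ∷ h
  follow (triv _) (a , h) = a , h

  extend : ∀ {D : Set} {n k l} → (Fin n → D → Entry D k l) → Fin n → D × Word k → D × Word k
  extend ent s x = follow (ent s (proj₁ x)) x

  trace : ∀ {D : Set} {n k l} → (Fin n → D → Entry D k l) → Word n → D → D × Word k
  trace ent []      a = a , []
  trace ent (s ∷ w) a = extend ent s (trace ent w a)

  Correct : ∀ {n k l} (m : Fin n → Fin n → ℕ) {D : Set} → (D → Word n) → (Fin k → Word n) → (Fin l → Word n) →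
            Fin n → D → Entry D k l → Set
  Correct m d φ α s a (move b) = CoxEq m (s ∷ d a) (d b)
  Correct m d φ α s a (loop t) = CoxEq m (s ∷ d a) (d a ++ φ t)
  Correct m d φ α s a (triv z) = CoxEq m (s ∷ d a) (d a ++ α z)

  -- D indexes W/(H × A), for commuting reflection subgroups H = ⟨φ t⟩ and A = ⟨α z⟩: a generator s either moves a coset
  -- d H A to another one, or satisfies s d = d φ t or s d = d α z.
  record CosetGraph {n k : ℕ} (m : Fin n → Fin n → ℕ) (m' : Fin k → Fin k → ℕ) (l : ℕ) (D : Set) : Set where
    field
      m-diag  : ∀ s → m s s ≡ 1
      m-diag' : ∀ t → m' t t ≡ 1
      base    : D
      ent     : Fin n → D → Entry D k l
      d       : D → Word n
      φ       : Fin k → Word n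
      α       : Fin l → Word n
      correct : ∀ s a → Correct m d φ α s a (ent s a)
      φ-rel   : ∀ t t' → CoxEq m (concatMap φ (alt t t' (2 *ℕ m' t t'))) []
      commute : ∀ t z → CoxEq m (φ t ++ α z) (α z ++ φ t)
      -- This makes `trace` respect the relations, so that it describes an action of the group. By
      -- `label` and `pure`, the image of H acts at `base` through its own elements, and a
      -- representative carries `base` to its coset without a contribution in H.
      returns : ∀ s t a → proj₁ (trace ent (alt s t (2 *ℕ m s t)) a) ≡ a ×
                          CoxEq m' (proj₂ (trace ent (alt s t (2 *ℕ m s t)) a)) []
      label   : ∀ t → proj₁ (trace ent (φ t) base) ≡ base × CoxEq m' (proj₂ (trace ent (φ t) base)) [ t ]
      pure    : ∀ a → trace ent (d a) base ≡ (a , [])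

  module CosetCount {n k l} {m : Fin n → Fin n → ℕ} {m' : Fin k → Fin k → ℕ} {D : Set} (G : CosetGraph m m' l D) where

    open CosetGraph G
    open Words m m-diag
    open Words m' m-diag' using () renaming (_≈_ to _≈'_)
    private module W' = Words m' m-diag'

    image : Word k → Word n
    image = concatMap φ

    image-α : Word l → Word n
    image-α = concatMap α

    infix 4 _∼_
    _∼_ : D × Word k → D × Word k → Set
    (a , g) ∼ (b , h) = a ≡ b × g ≈' h

    ∼-refl : ∀ {x} → x ∼ x
    ∼-refl = refl , ceRefl
    ∼-sym : ∀ {x y} → x ∼ y → y ∼ x
    ∼-sym (p , q) = sym p , ceSym q
    ∼-trans : ∀ {x y z} → x ∼ y → y ∼ z → x ∼ z
    ∼-trans (p , q) (p' , q') = trans p p' , ceTrans q q'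

    T : Word n → D → D × Word k
    T = trace ent

    -- (a , h) stands for the coset d a · image h · A
    act* : Word n → D × Word k → D × Word k
    act* w (a , h) = proj₁ (T w a) , proj₂ (T w a) ++ h

    act*-resp : ∀ w {x y} → x ∼ y → act* w x ∼ act* w y
    act*-resp w {a , _} (refl , q) = refl , W'.++-congˡ (proj₂ (T w a)) q

    follow-++ : ∀ e (x : D × Word k) h → proj₁ (follow e x) ≡ proj₁ (follow e (proj₁ x , proj₂ x ++ h)) ×
                proj₂ (follow e x) ++ h ≡ proj₂ (follow {l = l} e (proj₁ x , proj₂ x ++ h))
    follow-++ (move b) x h = refl , refl
    follow-++ (loop t) x h = refl , refl
    follow-++ (triv z) x h = refl , refl

    T-++ : ∀ u v a → T (u ++ v) a ≡ act* u (T v a)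
    T-++ []      v a = refl
    T-++ (s ∷ u) v a rewrite T-++ u v a with follow-++ (ent s (proj₁ (T u (proj₁ (T v a))))) (T u (proj₁ (T v a))) (proj₂ (T v a))
    ... | p , q = cong₂ _,_ (sym p) (sym q)

    act*-++ : ∀ u v x → act* (u ++ v) x ≡ act* u (act* v x)
    act*-++ u v (a , h) = trans (cong (λ x → proj₁ x , proj₂ x ++ h) (T-++ u v a)) (cong (proj₁ (T u (proj₁ (T v a))) ,_) (List.++-assoc (proj₂ (T u (proj₁ (T v a)))) (proj₂ (T v a)) h))

    act*-≈ : ∀ {u v} → u ≈ v → ∀ x → act* u x ∼ act* v x
    act*-≈ ceRefl x = ∼-refl
    act*-≈ (ceSym p) x = ∼-sym (act*-≈ p x)
    act*-≈ (ceTrans p q) x = ∼-trans (act*-≈ p x) (act*-≈ q x)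
    act*-≈ (ceRel s t) (a , h) = proj₁ (returns s t a) , W'.++-congʳ h (proj₂ (returns s t a))
    act*-≈ (ceCong x {u} {v} y p) z = subst₂ _∼_ (sym (split u)) (sym (split v)) (act*-resp x (act*-≈ p (act* y z)))
      where
      split : ∀ u → act* (x ++ u ++ y) z ≡ act* x (act* u (act* y z))
      split u = trans (act*-++ x (u ++ y) z) (cong (act* x) (act*-++ u y z))

    act*-reverse : ∀ u {x y} → act* u x ∼ y → act* (reverse u) y ∼ x
    act*-reverse u {x} p = ∼-trans (act*-resp (reverse u) (∼-sym p))
      (subst (_∼ x) (act*-++ (reverse u) u x) (act*-≈ (reverse-inverseˡ u) x))

    image-++ : ∀ g h → image (g ++ h) ≡ image g ++ image h
    image-++ g h = List.concatMap-++ φ g h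

    image-≈ : ∀ {g h} → g ≈' h → image g ≈ image h
    image-≈ ceRefl = ceRefl
    image-≈ (ceSym p) = ceSym (image-≈ p)
    image-≈ (ceTrans p q) = ceTrans (image-≈ p) (image-≈ q)
    image-≈ (ceRel s t) = φ-rel s t
    image-≈ (ceCong x {u} {v} y p) =
      subst₂ _≈_ (sym (trans (image-++ x (u ++ y)) (cong (image x ++_) (image-++ u y))))
                 (sym (trans (image-++ x (v ++ y)) (cong (image x ++_) (image-++ v y))))
                 (ceCong (image x) (image y) (image-≈ p))

    commute* : ∀ z h → α z ++ image h ≈ image h ++ α z
    commute* z [] = ≡⇒≈ (List.++-identityʳ (α z))
    commute* z (t ∷ h) =
      ceTrans (≡⇒≈ (sym (List.++-assoc (α z) (φ t) (image h))))
        (ceTrans (++-congʳ (image h) (ceSym (commute t z)))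
          (ceTrans (≡⇒≈ (List.++-assoc (φ t) (α z) (image h)))
            (ceTrans (++-congˡ (φ t) (commute* z h)) (≡⇒≈ (sym (List.++-assoc (φ t) (image h) (α z)))))))

    -- Each step of the trace is an equation in the group. The letters of A that `trace` drops are
    -- pushed to the right past the image of H, with which they commute.
    decompose : ∀ w a → ∃ λ z → w ++ d a ≈ (d (proj₁ (T w a)) ++ image (proj₂ (T w a))) ++ image-α z
    decompose [] a = [] , ≡⇒≈ (sym (trans (List.++-identityʳ _) (List.++-identityʳ (d a))))
    decompose (s ∷ w) a with decompose w a
    ... | z , p with T w a
    ... | b , h with ent s b | correct s b
    ... | move c | q = z , ceTrans (∷-cong s p) (++-congʳ (image-α z) (++-congʳ (image h) q))
    ... | loop t | q = z , ceTrans (∷-cong s p) (++-congʳ (image-α z)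
            (ceTrans (++-congʳ (image h) q) (≡⇒≈ (List.++-assoc (d b) (φ t) (image h)))))
    ... | triv y | q = y ∷ z , ceTrans (∷-cong s p) (ceTrans (++-congʳ (image-α z)
            (ceTrans (++-congʳ (image h) q) (ceTrans (≡⇒≈ (List.++-assoc (d b) (α y) (image h)))
              (ceTrans (++-congˡ (d b) (commute* y h)) (≡⇒≈ (sym (List.++-assoc (d b) (image h) (α y))))))))
            (≡⇒≈ (List.++-assoc (d b ++ image h) (α y) (image-α z))))

    -- The image of `h` takes the base state to `(base , h)`. So the embedding of H is injective,
    -- and every state is reached by some word.
    image-trace : ∀ h → T (image h) base ∼ (base , h)
    image-trace [] = ∼-refl
    image-trace (t ∷ h) = subst (_∼ (base , t ∷ h)) (sym (T-++ (φ t) (image h) base))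
      (∼-trans (act*-resp (φ t) (image-trace h)) (proj₁ (label t) , W'.++-congʳ h (proj₂ (label t))))

    -- Says that conjugating W_J by the representative `d a₀` gives exactly the product of A and the
    -- image of W_J': every generator in `J` acts at `a₀` as a generator from `J'` or from A, and
    -- all of these occur.
    record Start (J : Subset n) (J' : Subset k) : Set where
      field
        a₀      : D
        J-fixes : ∀ j → j ∈ J → (∃ λ t → t ∈ J' × ent j a₀ ≡ loop t) ⊎ (∃ λ z → ent j a₀ ≡ triv z)
        J'-from : ∀ t → t ∈ J' → ∃ λ j → j ∈ J × ent j a₀ ≡ loop t
        A-from  : ∀ z → ∃ λ j → j ∈ J × ent j a₀ ≡ triv z

    -- Moves change the representative without any contribution in H, and the paths to the chosen
    -- `rep` carry the empty word. Hence a reflection of H met as a loop anywhere in the orbit can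
    -- be transported to the representative unchanged, and `labels` collects them all.
    record Orbits (I : Subset n) : Set where
      field
        rep      : D → D
        labels   : D → Subset k
        reps     : List D
        distinct : AllPairs _≢_ reps
        complete : ∀ a → rep a ≡ a → a ∈ˡ reps
        fixed    : All (λ r → rep r ≡ r) reps
        path     : ∀ a → ∃ λ u → All (_∈ I) u × T u a ≡ (rep a , [])
        stays    : ∀ s → s ∈ I → ∀ a b → ent s a ≡ move b → rep b ≡ rep a
        labelled : ∀ s → s ∈ I → ∀ a t → ent s a ≡ loop t → t ∈ labels (rep a)
        occurs   : ∀ r t → t ∈ labels r → ∃ λ a → rep a ≡ r × ∃ λ s → s ∈ I × ent s a ≡ loop t

    module _ {I : Subset n} {J : Subset n} {J' : Subset k} (S : Start J J') (O : Orbits I) where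

      open Start S
      open Orbits O

      private
        point : Word n → D × Word k
        point w = T w a₀

        T-act* : ∀ u a → act* u (a , []) ≡ T u a
        T-act* u a = cong (proj₁ (T u a) ,_) (List.++-identityʳ (proj₂ (T u a)))

        J-trace : ∀ v → All (_∈ J) v → proj₁ (T v a₀) ≡ a₀ × All (_∈ J') (proj₂ (T v a₀))
        J-trace [] _ = refl , []
        J-trace (j ∷ v) (jJ ∷ vJ) with T v a₀ | J-trace v vJ
        ... | .(a₀) , h | refl , hJ with ent j a₀ | J-fixes j jJ
        ... | .(loop t) | inj₁ (t , tJ , refl) = refl , tJ ∷ hJ
        ... | .(triv z) | inj₂ (z , refl) = refl , hJ

        J-lift : ∀ y → All (_∈ J') y → ∃ λ v → All (_∈ J) v × T v a₀ ≡ (a₀ , y)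
        J-lift [] _ = [] , [] , refl
        J-lift (t ∷ y) (tJ ∷ yJ) with J-lift y yJ | J'-from t tJ
        ... | v , vJ , e | j , jJ , q =
          j ∷ v , jJ ∷ vJ , trans (cong (λ x → follow (ent j (proj₁ x)) x) e) (cong (λ x → follow x (a₀ , y)) q)

        A-lift : ∀ z → ∃ λ v → All (_∈ J) v × v ++ d a₀ ≈ d a₀ ++ image-α z
        A-lift [] = [] , [] , ≡⇒≈ (sym (List.++-identityʳ (d a₀)))
        A-lift (y ∷ z) with A-lift z | A-from y
        ... | v , vJ , p | j , jJ , q = j ∷ v , jJ ∷ vJ ,
          ceTrans (∷-cong j p) (ceTrans (++-congʳ (image-α z) (subst (Correct m d φ α j a₀) q (correct j a₀)))
            (≡⇒≈ (List.++-assoc (d a₀) (α y) (image-α z))))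

        cancelʳ : ∀ {x y} u → x ++ u ≈ y ++ u → x ≈ y
        cancelʳ {x} {y} u p = ceTrans (tail x) (ceTrans (++-congʳ (reverse u) p) (ceSym (tail y)))
          where
          tail : ∀ x → x ≈ (x ++ u) ++ reverse u
          tail x = ceSym (ceTrans (≡⇒≈ (List.++-assoc x u (reverse u)))
                     (ceTrans (++-congˡ x (reverse-inverseʳ u)) (≡⇒≈ (List.++-identityʳ x))))

        -- Equal points give `w` and `w'`, multiplied by `d a₀`, the same coset representative and
        -- the same element of H, so they differ by an element of A on the right. `A-lift` realises
        -- that element by a word in `J` on the other side of `d a₀`.
        same-point : ∀ w w' → point w ∼ point w' → ∃ λ v → All (_∈ J) v × w' ≈ w ++ v
        same-point w w' (p , q) with decompose w a₀ | decompose w' a₀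
        ... | z , e | z' , e' with A-lift z | A-lift z'
        ... | v , vJ , f | v' , vJ' , f' =
          reverse v ++ v' , All.++⁺ (All-reverse vJ) vJ' ,
          ceTrans (standard w' v' z' e' f')
            (ceTrans (++-congʳ v' (ceTrans (≡⇒≈ (cong (λ b → (d b ++ image (proj₂ (point w'))) ++ reverse (d a₀)) (sym p)))
                                   (++-congʳ (reverse (d a₀)) (++-congˡ (d (proj₁ (point w))) (image-≈ (ceSym q))))))
              (ceTrans (++-congʳ v' (moveʳ w (ceTrans (standard w v z e f) ceRefl)))
                       (≡⇒≈ (List.++-assoc w (reverse v) v'))))
          where
          X : Word n → Word n
          X w = d (proj₁ (point w)) ++ image (proj₂ (point w))
          standard : ∀ w v z → w ++ d a₀ ≈ X w ++ image-α z → v ++ d a₀ ≈ d a₀ ++ image-α z →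
                     w ≈ (X w ++ reverse (d a₀)) ++ v
          standard w v z e f = cancelʳ (d a₀) (ceTrans e (ceSym
            (ceTrans (≡⇒≈ (List.++-assoc (X w ++ reverse (d a₀)) v (d a₀)))
              (ceTrans (++-congˡ (X w ++ reverse (d a₀)) f)
                (ceTrans (≡⇒≈ (List.++-assoc (X w) (reverse (d a₀)) (d a₀ ++ image-α z)))
                  (++-congˡ (X w) (ceTrans (≡⇒≈ (sym (List.++-assoc (reverse (d a₀)) (d a₀) (image-α z))))
                     (++-congʳ (image-α z) (reverse-inverseˡ (d a₀))))))))))
          moveʳ : ∀ w {x v} → w ≈ x ++ v → x ≈ w ++ reverse v
          moveʳ w {x} {v} p = ceSym (ceTrans (++-congʳ (reverse v) p) (ceTrans (≡⇒≈ (List.++-assoc x v (reverse v)))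
            (ceTrans (++-congˡ x (reverse-inverseʳ v)) (≡⇒≈ (List.++-identityʳ x)))))

        rep-trace : ∀ u → All (_∈ I) u → ∀ a → rep (proj₁ (T u a)) ≡ rep a × All (_∈ labels (rep a)) (proj₂ (T u a))
        rep-trace [] _ a = refl , []
        rep-trace (s ∷ u) (sI ∷ uI) a with T u a | rep-trace u uI a
        ... | b , h | e , hT with ent s b in eq
        ... | move c = trans (stays s sI b c eq) e , hT
        ... | loop t = e , subst (λ r → t ∈ labels r) e (labelled s sI b t eq) ∷ hT
        ... | triv z = e , hT

        rep-idem : ∀ a → rep (rep a) ≡ rep a
        rep-idem a with path a
        ... | u , uI , e = trans (cong (λ x → rep (proj₁ x)) (sym e)) (proj₁ (rep-trace u uI a))

        connect : ∀ a b → rep a ≡ rep b → ∃ λ u → All (_∈ I) u × act* u (a , []) ∼ (b , [])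
        connect a b e with path a | path b
        ... | u , uI , p | v , vI , q = reverse v ++ u , All.++⁺ (All-reverse vI) uI ,
          subst (_∼ (b , [])) (sym (act*-++ (reverse v) u (a , [])))
            (∼-trans (act*-resp (reverse v) (subst (_∼ act* v (b , [])) (sym (T-act* u a))
                       (subst₂ _∼_ (sym p) (sym (trans (T-act* v b) q)) (e , ceRefl))))
                     (act*-reverse v ∼-refl))

        act*-shift : ∀ u a b g → act* u (a , []) ∼ (b , g) → ∀ h → act* u (a , h) ∼ (b , g ++ h)
        act*-shift u a b g (p , q) h = p , W'.++-congʳ h (ceTrans (ceSym (W'.≡⇒≈ (List.++-identityʳ (proj₂ (T u a))))) q)

        -- Walk to the node where the loop `t` occurs, traverse it, and return: both walks carry the
        -- trivial element of H, so the whole contributes exactly `t`.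
        circuit : ∀ a t → t ∈ labels (rep a) → ∃ λ u → All (_∈ I) u × act* u (a , []) ∼ (a , [ t ])
        circuit a t tT with occurs (rep a) t tT
        ... | b , e , s , sI , q with connect a b (sym e) | connect b a e
        ... | u , uI , p | v , vI , p' = v ++ s ∷ u , All.++⁺ vI (sI ∷ uI) ,
          subst (_∼ (a , [ t ])) (sym (act*-++ v (s ∷ u) (a , [])))
            (∼-trans (act*-resp v (subst (_∼ (b , [ t ])) (sym (act*-++ [ s ] u (a , [])))
                       (∼-trans (act*-resp [ s ] p) (subst (λ x → act* [ s ] (b , []) ∼ x) (cong (λ x → follow x (b , [])) q) (step (ent s b))))))
                     (act*-shift v b a [] p' [ t ]))
          where
          step : ∀ e → (proj₁ (follow e (b , [])) , proj₂ (follow e (b , [])) ++ []) ∼ follow {l = l} e (b , [])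
          step e = refl , W'.≡⇒≈ (List.++-identityʳ _)

        circuits : ∀ a x → All (_∈ labels (rep a)) x → ∃ λ u → All (_∈ I) u × act* u (a , []) ∼ (a , x)
        circuits a [] _ = [] , [] , ∼-refl
        circuits a (t ∷ x) (tT ∷ xT) with circuit a t tT | circuits a x xT
        ... | u , uI , p | v , vI , q = u ++ v , All.++⁺ uI vI ,
          subst (_∼ (a , t ∷ x)) (sym (act*-++ u v (a , []))) (∼-trans (act*-resp u q) (act*-shift u a a [ t ] p x))

        -- Left multiplication by W_I stays in the orbit and multiplies the H-part by labels; right
        -- multiplication by W_J fixes the coset `a₀` and multiplies the H-part by an element of
        -- W_J'.
        forward : ∀ w w' → SameDoubleCoset m I J w w' →
          rep (proj₁ (point w)) ≡ rep (proj₁ (point w')) ×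
          SameDoubleCoset m' (labels (rep (proj₁ (point w)))) J' (proj₂ (point w)) (proj₂ (point w'))
        forward w w' (u , v , uI , vJ , p) with J-trace v vJ | T-++ u (w ++ v) a₀ | T-++ w v a₀ | act*-≈ p (a₀ , [])
        ... | e , hJ | r₁ | r₂ | f with rep-trace u uI (proj₁ (point w))
        ... | g , hT = trans (sym g) (sym (cong rep (trans (proj₁ f') (cong (λ x → proj₁ (T u (proj₁ x))) w≡)))) ,
              proj₂ (T u (proj₁ (point w))) , proj₂ (T v a₀) , hT , hJ ,
              ceTrans (proj₂ f') (W'.≡⇒≈ (cong₂ (λ x y → proj₂ (T u x) ++ y) (cong proj₁ w≡) (cong proj₂ w≡)))
          where
          w≡ : act* w (T v a₀) ≡ (proj₁ (point w) , proj₂ (point w) ++ proj₂ (T v a₀))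
          w≡ = cong (λ a → proj₁ (T w a) , proj₂ (T w a) ++ proj₂ (T v a₀)) e
          f' : point w' ∼ act* u (act* w (T v a₀))
          f' = subst₂ _∼_ (T-act* w' a₀) (trans (T-act* (u ++ w ++ v) a₀) (trans r₁ (cong (act* u) r₂))) f

        -- Circuits realise the left factor, a word in `J` fixing `a₀` realises the right one, and
        -- `same-point` absorbs the remaining ambiguity in A.
        backward : ∀ w w' → rep (proj₁ (point w)) ≡ rep (proj₁ (point w')) →
          SameDoubleCoset m' (labels (rep (proj₁ (point w)))) J' (proj₂ (point w)) (proj₂ (point w')) →
          SameDoubleCoset m I J w w'
        backward w w' e (x , y , xT , yJ , p) with circuits (proj₁ (point w)) x xT | connect (proj₁ (point w)) (proj₁ (point w')) e | J-lift y yJ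
        ... | u , uI , q | u' , uI' , q' | v , vJ , r with same-point ((u' ++ u) ++ w ++ v) w' same
          where
          a = proj₁ (point w)
          g = proj₂ (point w)
          same : point ((u' ++ u) ++ w ++ v) ∼ point w'
          same = subst (_∼ point w')
            (sym (trans (T-++ (u' ++ u) (w ++ v) a₀) (trans (cong (act* (u' ++ u)) (trans (T-++ w v a₀) (cong (act* w) r)))
                   (act*-++ u' u (a , g ++ y)))))
            (∼-trans (act*-resp u' (act*-shift u a a x q (g ++ y)))
              (∼-trans (act*-shift u' a (proj₁ (point w')) [] q' (x ++ g ++ y)) (refl , ceSym p)))
        ... | v' , vJ' , s = u' ++ u , v ++ v' , All.++⁺ uI' uI , All.++⁺ vJ vJ' ,
              ceTrans s (≡⇒≈ (trans (List.++-assoc (u' ++ u) (w ++ v) v') (cong ((u' ++ u) ++_) (List.++-assoc w v v'))))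

        -- The trailing inverse of `d a₀` is there because points are read off from `a₀`, not from
        -- `base`.
        lift : D → Word k → Word n
        lift r h = d r ++ image h ++ reverse (d a₀)

        lift-point : ∀ r h → point (lift r h) ∼ (r , h)
        lift-point r h = subst (_∼ (r , h))
          (sym (trans (T-++ (d r) (image h ++ reverse (d a₀)) a₀) (cong (act* (d r)) (T-++ (image h) (reverse (d a₀)) a₀))))
          (∼-trans (act*-resp (d r) (∼-trans (act*-resp (image h) back) (image-base h)))
                   (act*-shift (d r) base r [] (subst (act* (d r) (base , []) ∼_) (trans (T-act* (d r) base) (pure r)) ∼-refl) h))
          where
          back : T (reverse (d a₀)) a₀ ∼ (base , [])
          back = subst (_∼ (base , [])) (T-act* (reverse (d a₀)) a₀)
                   (act*-reverse (d a₀) (subst (act* (d a₀) (base , []) ∼_) (trans (T-act* (d a₀) base) (pure a₀)) ∼-refl))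
          image-base : ∀ h → act* (image h) (base , []) ∼ (base , h)
          image-base h = subst (_∼ (base , h)) (sym (T-act* (image h) base)) (image-trace h)

      count : (size : D → ℕ) → All (λ r → DoubleCosets m' (labels r) J' (size r)) reps →
              DoubleCosets m I J (sum (map size reps))
      count size sizes = classes-partition (SameDoubleCoset m I J) (λ w → rep (proj₁ (point w)))
        (λ {w} {w'} p → proj₁ (forward w w' p)) reps distinct (λ w → complete _ (rep-idem (proj₁ (point w)))) size fibre
        where
        fibre : ∀ {r} → r ∈ˡ reps → Σ (List (Word n)) λ ws → length ws ≡ size r ×
          AllPairs (λ w w' → ¬ SameDoubleCoset m I J w w') ws ×
          All (λ w → rep (proj₁ (point w)) ≡ r) ws ×
          (∀ w → rep (proj₁ (point w)) ≡ r → Any (SameDoubleCoset m I J w) ws)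
        fibre {r} r∈ with All.lookup sizes r∈ | All.lookup fixed r∈
        ... | hs , len , sep , cover | rr =
          map (lift r) hs , trans (List.length-map (lift r) hs) len ,
          AllPairs.map⁺ (AllPairs.map (λ {h} {h'} ¬p p → ¬p (transport h h' (forward (lift r h) (lift r h') p))) sep) ,
          All.map⁺ (All.tabulate λ {h} _ → trans (cong rep (proj₁ (lift-point r h))) rr) ,
          λ w e → Any.map⁺ (Any.map (λ {h} p → backward w (lift r h)
                    (trans e (sym (trans (cong rep (proj₁ (lift-point r h))) rr)))
                    (respect {w} e (proj₂ (lift-point r h)) p)) (cover (proj₂ (point w))))
          where
          transport : ∀ h h' → rep (proj₁ (point (lift r h))) ≡ rep (proj₁ (point (lift r h'))) ×
            SameDoubleCoset m' (labels (rep (proj₁ (point (lift r h))))) J' (proj₂ (point (lift r h))) (proj₂ (point (lift r h'))) →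
            SameDoubleCoset m' (labels r) J' h h'
          transport h h' (_ , x , y , xT , yJ , p) =
            x , y , subst (λ r → All (_∈ labels r) x) (trans (cong rep (proj₁ (lift-point r h))) rr) xT , yJ ,
            ceTrans (ceSym (proj₂ (lift-point r h'))) (ceTrans p (W'.++-congˡ x (W'.++-congʳ y (proj₂ (lift-point r h)))))
          respect : ∀ {w h g} → rep (proj₁ (point w)) ≡ r → g ≈' h → SameDoubleCoset m' (labels r) J' (proj₂ (point w)) h →
            SameDoubleCoset m' (labels (rep (proj₁ (point w)))) J' (proj₂ (point w)) g
          respect e q (x , y , xT , yJ , p) = x , y , subst (λ r → All (_∈ labels r) x) (sym e) xT , yJ , ceTrans q p

-- Trees used as arrays, and boolean tests with their soundness

module Tries where

  open import Defs
  open import Data.Nat using (ℕ; zero; suc; _≡ᵇ_)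
  import Data.Nat.Properties as ℕ
  open import Data.Integer using (ℤ; +_; -[1+_])
  open import Data.Bool using (Bool; true; false; _∧_)
  open import Data.Fin using (zero; suc)
  open import Data.Fin.Subset using (Subset)
  open import Data.List using (List; []; _∷_; _++_; map)
  open import Data.List.Membership.Propositional using (_∈_)
  import Data.List.Membership.Propositional.Properties as List
  open import Data.List.Relation.Unary.Any using (here; there)
  open import Data.List.Relation.Unary.All using (All; []; _∷_)
  import Data.List.Relation.Unary.All as All
  import Data.List.Relation.Unary.All.Properties as All
  open import Data.List.Relation.Unary.AllPairs using (AllPairs; []; _∷_)
  import Data.List.Relation.Unary.AllPairs as AllPairs
  import Data.List.Relation.Unary.AllPairs.Properties as AllPairs
  open import Data.Vec using () renaming ([] to []ᵛ; _∷_ to _∷ᵛ_)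
  open import Data.Product using (Σ; _×_; _,_; proj₁; proj₂)
  open import Data.Maybe using (Maybe; just; nothing)
  open import Data.Unit using (tt)
  open import Data.Empty using (⊥-elim)
  open import Relation.Nullary using (Dec; yes; no)
  open import Relation.Nullary.Decidable using (map′)
  open import Relation.Binary.PropositionalEquality hiding ([_])
  open import Function using (_∘_)

  -- A coset graph can have hundreds of nodes; addressing them by paths in a balanced tree makes
  -- access logarithmic, and the shape alone fixes the index type.
  data Shape : Set where
    leaf : Shape
    fork : Shape → Shape → Shape

  data Index : Shape → Set where
    here  : Index leaf
    left  : ∀ {a b} → Index a → Index (fork a b)
    right : ∀ {a b} → Index b → Index (fork a b)

  data Array (A : Set) : Shape → Set where
    cell : A → Array A leaf
    _∙_  : ∀ {a b} → Array A a → Array A b → Array A (fork a b)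

  _at_ : ∀ {A sh} → Array A sh → Index sh → A
  cell x  at here    = x
  (l ∙ r) at left i  = l at i
  (l ∙ r) at right i = r at i

  generate : ∀ {A} sh → (Index sh → A) → Array A sh
  generate leaf       f = cell (f here)
  generate (fork a b) f = generate a (f ∘ left) ∙ generate b (f ∘ right)

  modify : ∀ {A sh} → Index sh → (A → A) → Array A sh → Array A sh
  modify here      f (cell x) = cell (f x)
  modify (left i)  f (l ∙ r)  = modify i f l ∙ r
  modify (right i) f (l ∙ r)  = l ∙ modify i f r

  indices : ∀ sh → List (Index sh)
  indices leaf       = here ∷ []
  indices (fork a b) = map left (indices a) ++ map right (indices b)

  first : ∀ sh → Index sh
  first leaf       = here
  first (fork a b) = left (first a)

  _==_ : ∀ {sh} → Index sh → Index sh → Bool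
  here    == here    = true
  left i  == left j  = i == j
  right i == right j = i == j
  _       == _       = false

  _before_ : ∀ {sh} → Index sh → Index sh → Bool
  left i  before left j  = i before j
  right i before right j = i before j
  left _  before right _ = true
  _       before _       = false

  balance : ∀ {A : Set} → ℕ → List (Σ Shape (Array A)) → Maybe (Σ Shape (Array A))
  balance _          []             = nothing
  balance _          (x ∷ [])       = just x
  balance zero       _              = nothing
  balance (suc fuel) xs@(_ ∷ _ ∷ _) = balance fuel (pairs xs)
    where
    pairs : ∀ {A : Set} → List (Σ Shape (Array A)) → List (Σ Shape (Array A))
    pairs ((a , x) ∷ (b , y) ∷ zs) = (fork a b , x ∙ y) ∷ pairs zs
    pairs zs                       = zs

  at-generate : ∀ {A} sh (f : Index sh → A) i → generate sh f at i ≡ f i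
  at-generate leaf       f here      = refl
  at-generate (fork a b) f (left i)  = at-generate a (f ∘ left) i
  at-generate (fork a b) f (right i) = at-generate b (f ∘ right) i

  modify-same : ∀ {A sh} (i : Index sh) (f : A → A) xs → modify i f xs at i ≡ f (xs at i)
  modify-same here      f (cell x) = refl
  modify-same (left i)  f (l ∙ r)  = modify-same i f l
  modify-same (right i) f (l ∙ r)  = modify-same i f r

  _≟ᵢ_ : ∀ {sh} (i j : Index sh) → Dec (i ≡ j)
  here    ≟ᵢ here    = yes refl
  left i  ≟ᵢ left j  = map′ (cong left) (λ { refl → refl }) (i ≟ᵢ j)
  left i  ≟ᵢ right j = no λ ()
  right i ≟ᵢ left j  = no λ ()
  right i ≟ᵢ right j = map′ (cong right) (λ { refl → refl }) (i ≟ᵢ j)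

  modify-other : ∀ {A sh} (i j : Index sh) → i ≢ j → ∀ (f : A → A) xs → modify i f xs at j ≡ xs at j
  modify-other here      here      i≢j f xs      = ⊥-elim (i≢j refl)
  modify-other (left i)  (left j)  i≢j f (l ∙ r) = modify-other i j (i≢j ∘ cong left) f l
  modify-other (left i)  (right j) i≢j f (l ∙ r) = refl
  modify-other (right i) (left j)  i≢j f (l ∙ r) = refl
  modify-other (right i) (right j) i≢j f (l ∙ r) = modify-other i j (i≢j ∘ cong right) f r

  ==⇒≡ : ∀ {sh} (i j : Index sh) → (i == j) ≡ true → i ≡ j
  ==⇒≡ here      here      _ = refl
  ==⇒≡ (left i)  (left j)  e = cong left (==⇒≡ i j e)
  ==⇒≡ (right i) (right j) e = cong right (==⇒≡ i j e)

  ==-refl : ∀ {sh} (i : Index sh) → (i == i) ≡ true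
  ==-refl here      = refl
  ==-refl (left i)  = ==-refl i
  ==-refl (right i) = ==-refl i

  ∈-indices : ∀ {sh} (i : Index sh) → i ∈ indices sh
  ∈-indices here      = here refl
  ∈-indices (left i)  = List.∈-++⁺ˡ (List.∈-map⁺ left (∈-indices i))
  ∈-indices {fork a b} (right i) = List.∈-++⁺ʳ (map left (indices a)) (List.∈-map⁺ right (∈-indices i))

  indices-distinct : ∀ sh → AllPairs _≢_ (indices sh)
  indices-distinct leaf = [] ∷ []
  indices-distinct (fork a b) = AllPairs.++⁺
    (AllPairs.map⁺ (AllPairs.map (λ { i≢j refl → i≢j refl }) (indices-distinct a)))
    (AllPairs.map⁺ (AllPairs.map (λ { i≢j refl → i≢j refl }) (indices-distinct b)))
    (All.map⁺ (All.universal (λ i → All.map⁺ (All.universal (λ j ()) (indices b))) (indices a)))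

  data Trie (A : Set) : ℕ → Set where
    tip  : A → Trie A 0
    node : ∀ {n} → Trie A n → Trie A n → Trie A (suc n)

  -- All values become leaves of one tree, so that repeated queries refer to the same component
  -- instead of repeating the count.
  memo : ∀ {A} n → (Subset n → A) → Trie A n
  memo zero    f = tip (f []ᵛ)
  memo (suc n) f = node (memo n (f ∘ (true ∷ᵛ_))) (memo n (f ∘ (false ∷ᵛ_)))

  find : ∀ {A n} → Trie A n → Subset n → A
  find (tip x)    []ᵛ          = x
  find (node a b) (true ∷ᵛ s)  = find a s
  find (node a b) (false ∷ᵛ s) = find b s

  find-memo : ∀ {A} n (f : Subset n → A) s → find (memo n f) s ≡ f s
  find-memo zero    f []ᵛ          = refl
  find-memo (suc n) f (true ∷ᵛ s)  = find-memo n _ s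
  find-memo (suc n) f (false ∷ᵛ s) = find-memo n _ s

  every : {A : Set} → (A → Bool) → List A → Bool
  every p []       = true
  every p (x ∷ xs) = p x ∧ every p xs

  ∧-true : ∀ {a b} → a ∧ b ≡ true → a ≡ true × b ≡ true
  ∧-true {true} {true} _ = refl , refl

  every-sound : {A : Set} (p : A → Bool) (xs : List A) → every p xs ≡ true → ∀ {x} → x ∈ xs → p x ≡ true
  every-sound p (x ∷ xs) e (here refl) = proj₁ (∧-true e)
  every-sound p (x ∷ xs) e (there i)   = every-sound p xs (proj₂ (∧-true {p x} e)) i

  ≡ᵇ-sound : ∀ m n → (m ≡ᵇ n) ≡ true → m ≡ n
  ≡ᵇ-sound m n e = ℕ.≡ᵇ⇒≡ m n (subst Data.Bool.T (sym e) tt)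
    where import Data.Bool

  sameℤ : ℤ → ℤ → Bool
  sameℤ (+ a)    (+ b)    = a ≡ᵇ b
  sameℤ -[1+ a ] -[1+ b ] = a ≡ᵇ b
  sameℤ _        _        = false

  sameℤ-sound : ∀ x y → sameℤ x y ≡ true → x ≡ y
  sameℤ-sound (+ a)    (+ b)    e = cong +_ (≡ᵇ-sound a b e)
  sameℤ-sound -[1+ a ] -[1+ b ] e = cong -[1+_] (≡ᵇ-sound a b e)

  sameSubset : ∀ {n} → Subset n → Subset n → Bool
  sameSubset []ᵛ []ᵛ = true
  sameSubset (true  ∷ᵛ s) (true  ∷ᵛ t) = sameSubset s t
  sameSubset (false ∷ᵛ s) (false ∷ᵛ t) = sameSubset s t
  sameSubset (_ ∷ᵛ _) (_ ∷ᵛ _) = false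

  sameSubset-sound : ∀ {n} (s t : Subset n) → sameSubset s t ≡ true → s ≡ t
  sameSubset-sound []ᵛ []ᵛ _ = refl
  sameSubset-sound (true  ∷ᵛ s) (true  ∷ᵛ t) e = cong (true ∷ᵛ_) (sameSubset-sound s t e)
  sameSubset-sound (false ∷ᵛ s) (false ∷ᵛ t) e = cong (false ∷ᵛ_) (sameSubset-sound s t e)

-- Coset graphs found by search and accepted by a test

module CosetTables where

  open import Defs
  open Tits
  open Weights
  open Cosets
  open Tries
  open import Data.Nat using (ℕ; zero; suc; z≤n) renaming (_+_ to _+ℕ_; _*_ to _*ℕ_)
  import Data.Nat.Properties as ℕ
  open import Data.Integer using (0ℤ; 1ℤ; +≤+)
  open import Data.Bool using (Bool; true; false; _∧_; _∨_; if_then_else_)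
  open import Data.Fin using (Fin; zero; suc)
  import Data.Fin as Fin
  open import Data.Fin.Subset using (Subset; _∈_)
  open import Data.List using (List; []; _∷_; _++_; map; foldr; foldl; allFin; concatMap)
  import Data.List.Properties as List
  open import Data.List.Membership.Propositional using () renaming (_∈_ to _∈ˡ_)
  import Data.List.Membership.Propositional.Properties as List
  open import Data.List.Relation.Unary.Any using (here; there)
  open import Data.List.Relation.Unary.All using (All; []; _∷_)
  import Data.List.Relation.Unary.All as All
  import Data.List.Relation.Unary.All.Properties as All
  open import Data.List.Relation.Unary.AllPairs using (AllPairs; []; _∷_)
  open import Data.Nat.ListAction using (sum)
  open import Data.Vec using (Vec; lookup; _[_]≔_; here; there) renaming ([] to []ᵛ; _∷_ to _∷ᵛ_)
  import Data.Vec as Vec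
  import Data.Vec.Properties as Vec
  open import Data.Maybe using (Maybe; just; nothing; _<∣>_; fromMaybe)
  import Data.Maybe as Maybe
  open import Data.Product using (Σ; ∃; _×_; _,_; proj₁; proj₂)
  open import Data.Sum using (_⊎_; inj₁; inj₂)
  open import Data.Empty using (⊥-elim)
  open import Relation.Nullary using (Dec; yes; no)
  open import Relation.Binary.PropositionalEquality hiding ([_])
  open import Function using (_∘_; id)

  sameWeight : ∀ {n} → Weight n → Weight n → Bool
  sameWeight []ᵛ            []ᵛ            = true
  sameWeight ((a , b) ∷ᵛ u) ((c , d) ∷ᵛ v) = sameℤ a c ∧ sameℤ b d ∧ sameWeight u v

  sameWeight-sound : ∀ {n} (u v : Weight n) → sameWeight u v ≡ true → u ≡ v
  sameWeight-sound []ᵛ []ᵛ _ = refl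
  sameWeight-sound ((a , b) ∷ᵛ u) ((c , d) ∷ᵛ v) e with ∧-true {sameℤ a c} e
  ... | p , e' with ∧-true {sameℤ b d} e'
  ... | q , r = cong₂ _∷ᵛ_ (cong₂ _,_ (sameℤ-sound a c p) (sameℤ-sound b d q)) (sameWeight-sound u v r)

  ρ : ∀ {n} → Weight n
  ρ = Vec.replicate _ (1ℤ , 0ℤ)

  -- All coordinates of `ρ` are 1, and a simple reflection turns its own coordinate into -1; so `ρ`
  -- is dominant and fixed by no generator.
  ≈-from-ρ : ∀ {n} {C : Cartan n} {m} → Presents C m → ∀ u v → run (reflect C) u ρ ≡ run (reflect C) v ρ → CoxEq m u v
  ≈-from-ρ {C = C} pres = faithful ρ (λ s → subst Nonneg (sym (Vec.lookup-replicate s (1ℤ , 0ℤ))) (+≤+ z≤n , +≤+ z≤n))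
    λ s e → irregular (trans (cong₂ (λ c x → step c x x) (sym (proj₁ (Presents.diagonal pres s))) (sym (Vec.lookup-replicate s (1ℤ , 0ℤ))))
      (trans (sym (lookup-reflect C s ρ s)) (trans (cong (λ v → lookup v s) e) (Vec.lookup-replicate s (1ℤ , 0ℤ)))))
    where
    open Action (weights pres)

    irregular : step -two (1ℤ , 0ℤ) (1ℤ , 0ℤ) ≢ (1ℤ , 0ℤ)
    irregular ()

  -- An entry `nothing` makes no claim, so a table may stay incomplete. Whether enough of it is
  -- filled is decided only when a larger group consults it or a metamatrix is read off.
  record System (n : ℕ) (m : Fin n → Fin n → ℕ) : Set where
    constructor system
    field
      cartan   : Cartan n
      presents : Presents cartan m
      counts   : Trie (Trie (Maybe ℕ) n) n
      sound    : ∀ I J c → find (find counts I) J ≡ just c → DoubleCosets m I J c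

  -- The contribution of one reflection subgroup. The count depends on `J` only through the `J'`
  -- found for it, so totals are stored per `I` and `J'`, and `starts` translates `J`.
  record Column {n : ℕ} (m : Fin n → Fin n → ℕ) : Set where
    constructor column
    field
      {width} : ℕ
      starts  : Trie (Maybe (Subset width)) n
      totals  : Trie (Trie (Maybe ℕ) width) n

    value : Subset n → Subset n → Maybe ℕ
    value I J = Maybe.maybe′ (find (find totals I)) nothing (find starts J)

    field
      sound : ∀ I J c → value I J ≡ just c → DoubleCosets m I J c

  module Labels {D : Set} {k l : ℕ} where

    private E = Entry D k l

    loops : ∀ {j} → Subset j → Vec E j → Subset k → Subset k
    loops []ᵛ         []ᵛ            T = T
    loops (true ∷ᵛ I) (loop t ∷ᵛ es) T = loops I es (T [ t ]≔ true)
    loops (_ ∷ᵛ I)    (_ ∷ᵛ es)      T = loops I es T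

    trivs : ∀ {j} → Subset j → Vec E j → Subset l → Subset l
    trivs []ᵛ         []ᵛ            T = T
    trivs (true ∷ᵛ I) (triv t ∷ᵛ es) T = trivs I es (T [ t ]≔ true)
    trivs (_ ∷ᵛ I)    (_ ∷ᵛ es)      T = trivs I es T

    fixed : ∀ {j} → Subset j → Vec E j → Bool
    fixed []ᵛ         []ᵛ            = true
    fixed (true ∷ᵛ I) (move b ∷ᵛ es) = false
    fixed (_ ∷ᵛ I)    (_ ∷ᵛ es)      = fixed I es

    ∈-insert : ∀ {j} (T : Subset j) t {x} → x ∈ T → x ∈ (T [ t ]≔ true)
    ∈-insert T t {x} p with x Fin.≟ t
    ... | yes refl = Vec.[]≔-updates T t
    ... | no x≢t = Vec.[]≔-minimal T x t x≢t p

    ∈-insert⁻ : ∀ {j} (T : Subset j) t {x} → x ∈ (T [ t ]≔ true) → x ≡ t ⊎ x ∈ T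
    ∈-insert⁻ T t {x} p with x Fin.≟ t
    ... | yes refl = inj₁ refl
    ... | no x≢t = inj₂ (Vec.lookup⇒[]= x T (trans (sym (Vec.lookup∘updateAt′ x t x≢t T)) (Vec.[]=⇒lookup p)))

    loops-⊇ : ∀ {j} I (es : Vec E j) T {x} → x ∈ T → x ∈ loops I es T
    loops-⊇ []ᵛ          []ᵛ            T p = p
    loops-⊇ (true ∷ᵛ I)  (loop t ∷ᵛ es) T p = loops-⊇ I es _ (∈-insert T t p)
    loops-⊇ (true ∷ᵛ I)  (move _ ∷ᵛ es) T p = loops-⊇ I es T p
    loops-⊇ (true ∷ᵛ I)  (triv _ ∷ᵛ es) T p = loops-⊇ I es T p
    loops-⊇ (false ∷ᵛ I) (loop _ ∷ᵛ es) T p = loops-⊇ I es T p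
    loops-⊇ (false ∷ᵛ I) (move _ ∷ᵛ es) T p = loops-⊇ I es T p
    loops-⊇ (false ∷ᵛ I) (triv _ ∷ᵛ es) T p = loops-⊇ I es T p

    loops-∈ : ∀ {j} I (es : Vec E j) T {s t} → s ∈ I → lookup es s ≡ loop t → t ∈ loops I es T
    loops-∈ (true ∷ᵛ I)  (loop t ∷ᵛ es) T here refl   = loops-⊇ I es _ (Vec.[]≔-updates T t)
    loops-∈ (true ∷ᵛ I)  (loop t ∷ᵛ es) T (there p) e = loops-∈ I es _ p e
    loops-∈ (true ∷ᵛ I)  (move _ ∷ᵛ es) T (there p) e = loops-∈ I es T p e
    loops-∈ (true ∷ᵛ I)  (triv _ ∷ᵛ es) T (there p) e = loops-∈ I es T p e
    loops-∈ (false ∷ᵛ I) (loop _ ∷ᵛ es) T (there p) e = loops-∈ I es T p e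
    loops-∈ (false ∷ᵛ I) (move _ ∷ᵛ es) T (there p) e = loops-∈ I es T p e
    loops-∈ (false ∷ᵛ I) (triv _ ∷ᵛ es) T (there p) e = loops-∈ I es T p e

    private
      shift : ∀ {j b} {I : Subset j} {es : Vec E j} {e : E} {x : E} {A : Set} →
              A ⊎ (∃ λ s → s ∈ I × lookup es s ≡ x) → A ⊎ (∃ λ s → s ∈ (b ∷ᵛ I) × lookup (e ∷ᵛ es) s ≡ x)
      shift (inj₁ p) = inj₁ p
      shift (inj₂ (s , p , q)) = inj₂ (suc s , there p , q)

    loops-∈⁻ : ∀ {j} I (es : Vec E j) T {t} → t ∈ loops I es T → t ∈ T ⊎ (∃ λ s → s ∈ I × lookup es s ≡ loop t)
    loops-∈⁻ []ᵛ          []ᵛ            T p = inj₁ p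
    loops-∈⁻ (true ∷ᵛ I)  (loop t ∷ᵛ es) T p with loops-∈⁻ I es (T [ t ]≔ true) p
    ... | inj₂ q = shift {A = _ ∈ T} (inj₂ q)
    ... | inj₁ q with ∈-insert⁻ T t q
    ... | inj₁ refl = inj₂ (zero , here , refl)
    ... | inj₂ r    = inj₁ r
    loops-∈⁻ (true ∷ᵛ I)  (move _ ∷ᵛ es) T p = shift (loops-∈⁻ I es T p)
    loops-∈⁻ (true ∷ᵛ I)  (triv _ ∷ᵛ es) T p = shift (loops-∈⁻ I es T p)
    loops-∈⁻ (false ∷ᵛ I) (loop _ ∷ᵛ es) T p = shift (loops-∈⁻ I es T p)
    loops-∈⁻ (false ∷ᵛ I) (move _ ∷ᵛ es) T p = shift (loops-∈⁻ I es T p)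
    loops-∈⁻ (false ∷ᵛ I) (triv _ ∷ᵛ es) T p = shift (loops-∈⁻ I es T p)

    trivs-∈⁻ : ∀ {j} I (es : Vec E j) T {t} → t ∈ trivs I es T → t ∈ T ⊎ (∃ λ s → s ∈ I × lookup es s ≡ triv t)
    trivs-∈⁻ []ᵛ          []ᵛ            T p = inj₁ p
    trivs-∈⁻ (true ∷ᵛ I)  (triv t ∷ᵛ es) T p with trivs-∈⁻ I es (T [ t ]≔ true) p
    ... | inj₂ q = shift {A = _ ∈ T} (inj₂ q)
    ... | inj₁ q with ∈-insert⁻ T t q
    ... | inj₁ refl = inj₂ (zero , here , refl)
    ... | inj₂ r    = inj₁ r
    trivs-∈⁻ (true ∷ᵛ I)  (move _ ∷ᵛ es) T p = shift (trivs-∈⁻ I es T p)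
    trivs-∈⁻ (true ∷ᵛ I)  (loop _ ∷ᵛ es) T p = shift (trivs-∈⁻ I es T p)
    trivs-∈⁻ (false ∷ᵛ I) (loop _ ∷ᵛ es) T p = shift (trivs-∈⁻ I es T p)
    trivs-∈⁻ (false ∷ᵛ I) (move _ ∷ᵛ es) T p = shift (trivs-∈⁻ I es T p)
    trivs-∈⁻ (false ∷ᵛ I) (triv _ ∷ᵛ es) T p = shift (trivs-∈⁻ I es T p)

    fixed-sound : ∀ {j} I (es : Vec E j) → fixed I es ≡ true → ∀ s → s ∈ I →
                  (∃ λ t → lookup es s ≡ loop t) ⊎ (∃ λ z → lookup es s ≡ triv z)
    fixed-sound (true ∷ᵛ I)  (loop t ∷ᵛ es) e zero here = inj₁ (t , refl)
    fixed-sound (true ∷ᵛ I)  (triv z ∷ᵛ es) e zero here = inj₂ (z , refl)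
    fixed-sound (true ∷ᵛ I)  (loop _ ∷ᵛ es) e (suc s) (there p) = fixed-sound I es e s p
    fixed-sound (true ∷ᵛ I)  (triv _ ∷ᵛ es) e (suc s) (there p) = fixed-sound I es e s p
    fixed-sound (false ∷ᵛ I) (loop _ ∷ᵛ es) e (suc s) (there p) = fixed-sound I es e s p
    fixed-sound (false ∷ᵛ I) (triv _ ∷ᵛ es) e (suc s) (there p) = fixed-sound I es e s p
    fixed-sound (false ∷ᵛ I) (move _ ∷ᵛ es) e (suc s) (there p) = fixed-sound I es e s p

  none : ∀ {j} → Subset j
  none = Vec.replicate _ false

  ∉-none : ∀ {j} {x : Fin j} {A : Set} → x ∈ none → A
  ∉-none {x = suc x} (there p) = ∉-none p

  full : ∀ {j} → Subset j → Bool
  full []ᵛ      = true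
  full (b ∷ᵛ s) = b ∧ full s

  full-sound : ∀ {j} (s : Subset j) → full s ≡ true → ∀ x → x ∈ s
  full-sound (true ∷ᵛ s) e zero    = here
  full-sound (true ∷ᵛ s) e (suc x) = there (full-sound s e x)

  insert : ∀ {k} → Subset k → List (Subset k × ℕ) → List (Subset k × ℕ)
  insert T [] = (T , 1) ∷ []
  insert T ((T' , c) ∷ g) = if sameSubset T T' then (T' , suc c) ∷ g else (T' , c) ∷ insert T g

  -- Many orbits carry the same label set; with multiplicities, each count for H is looked up once
  -- per distinct set.
  group : ∀ {k} → List (Subset k) → List (Subset k × ℕ)
  group = foldr insert []

  module Grouping {k : ℕ} (f : Subset k → Maybe ℕ) where

    addTimes : ℕ → Maybe ℕ → Maybe ℕ → Maybe ℕ
    addTimes c (just x) (just y) = just (c *ℕ x +ℕ y)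
    addTimes c _        _        = nothing

    weighted : List (Subset k × ℕ) → Maybe ℕ
    weighted []            = just 0
    weighted ((T , c) ∷ g) = addTimes c (f T) (weighted g)

    val : Subset k → ℕ
    val T = fromMaybe 0 (f T)

    Defined : Subset k → Set
    Defined T = f T ≡ just (val T)

    private
      value : List (Subset k × ℕ) → ℕ
      value g = sum (map (λ (T , c) → c *ℕ val T) g)

      weighted-sound : ∀ g {x} → weighted g ≡ just x → All (λ (T , _) → Defined T) g × x ≡ value g
      weighted-sound [] refl = [] , refl
      weighted-sound ((T , c) ∷ g) e with f T in p | weighted g in q
      weighted-sound ((T , c) ∷ g) refl | just y | just z with weighted-sound g q
      ... | ds , refl = trans p (cong (just ∘ fromMaybe 0) (sym p)) ∷ ds , refl

      insert-sound : ∀ T g → All (λ (T , _) → Defined T) (insert T g) →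
                     Defined T × All (λ (T , _) → Defined T) g × value (insert T g) ≡ val T +ℕ value g
      insert-sound T [] (d ∷ []) = d , [] , cong (_+ℕ 0) (ℕ.+-identityʳ (val T))
      insert-sound T ((T' , c) ∷ g) ds with sameSubset T T' in e
      insert-sound T ((T' , c) ∷ g) (d ∷ ds) | true with sameSubset-sound T T' e
      ... | refl = d , d ∷ ds , ℕ.+-assoc (val T) (c *ℕ val T) (value g)
      insert-sound T ((T' , c) ∷ g) (d ∷ ds) | false with insert-sound T g ds
      ... | d' , ds' , p = d' , d ∷ ds' , trans (cong (c *ℕ val T' +ℕ_) p)
        (trans (sym (ℕ.+-assoc (c *ℕ val T') (val T) (value g)))
          (trans (cong (_+ℕ value g) (ℕ.+-comm (c *ℕ val T') (val T))) (ℕ.+-assoc (val T) (c *ℕ val T') (value g))))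

      group-sound : ∀ Ts → All (λ (T , _) → Defined T) (group Ts) → All Defined Ts × value (group Ts) ≡ sum (map val Ts)
      group-sound [] _ = [] , refl
      group-sound (T ∷ Ts) ds with insert-sound T (group Ts) ds
      ... | d , ds' , p with group-sound Ts ds'
      ... | es , q = d ∷ es , trans p (cong (val T +ℕ_) q)

    weighted-group : ∀ Ts {x} → weighted (group Ts) ≡ just x → All Defined Ts × x ≡ sum (map val Ts)
    weighted-group Ts e with weighted-sound (group Ts) e
    ... | ds , p with group-sound Ts ds
    ... | es , q = es , trans p q

  module Table {n} {m : Fin n → Fin n → ℕ} (C : Cartan n) (pres : Presents C m)
               {k} {m' : Fin k → Fin k → ℕ} (H : System k m')
               {l} (φs : Vec (Word n) k) (αs : Vec (Word n) l) where

    open System H renaming (cartan to C'; presents to pres'; sound to counts-sound)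

    go : Word n → Weight n → Weight n
    go = run (reflect C)

    -- Keeps, next to a coset representative, the images of `ρ` under the words that occur in the
    -- three kinds of entry. The frame of a neighbour arises by reflecting these weights, since a
    -- generator acts on the left.
    record Frame : Set where
      constructor frame
      field
        word    : Word n
        centre  : Weight n
        images  : Vec (Weight n) n
        looped  : Vec (Weight n) k
        trivial : Vec (Weight n) l
        centre≡  : centre ≡ go word ρ
        images≡  : ∀ s → lookup images s ≡ go (s ∷ word) ρ
        looped≡  : ∀ t → lookup looped t ≡ go (word ++ lookup φs t) ρ
        trivial≡ : ∀ z → lookup trivial z ≡ go (word ++ lookup αs z) ρ
    open Frame

    origin : Frame
    origin = frame [] ρ (Vec.tabulate λ s → reflect C s ρ) (Vec.map (λ w → go w ρ) φs) (Vec.map (λ w → go w ρ) αs)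
      refl (Vec.lookup∘tabulate _) (λ t → Vec.lookup-map t _ φs) (λ z → Vec.lookup-map z _ αs)

    next : Fin n → Frame → Frame
    next s (frame w c is ls ts c≡ is≡ ls≡ ts≡) = frame (s ∷ w) (lookup is s)
      (Vec.tabulate λ s' → reflect C s' (lookup is s)) (Vec.map (reflect C s) ls) (Vec.map (reflect C s) ts)
      (is≡ s)
      (λ s' → trans (Vec.lookup∘tabulate _ s') (cong (reflect C s') (is≡ s)))
      (λ t → trans (Vec.lookup-map t _ ls) (cong (reflect C s) (ls≡ t)))
      (λ z → trans (Vec.lookup-map z _ ts) (cong (reflect C s) (ts≡ z)))

    search : ∀ {j} → Weight n → Vec (Weight n) j → Maybe (Fin j)
    search x []ᵛ       = nothing
    search x (y ∷ᵛ ys) = if sameWeight x y then just zero else Maybe.map suc (search x ys)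

    member : Weight n → List Frame → Bool
    member x []       = false
    member x (f ∷ fs) = if sameWeight x (centre f) then true else member x fs

    -- A generator that acts on the coset as a reflection of H or of A leads nowhere new. This is
    -- the search pattern for minimal representatives of a reflection subgroup; nothing about it is
    -- proved, because `good` tests its outcome.
    grow : List Frame → List Frame → Frame → List Frame
    grow prev new f = foldl (λ new s → add new (next s f) (search (lookup (images f) s) (looped f)) (search (lookup (images f) s) (trivial f)))
                            new (allFin n)
      where
      add : List Frame → Frame → Maybe (Fin k) → Maybe (Fin l) → List Frame
      add new g nothing nothing = if member (centre g) prev ∨ member (centre g) new then new else g ∷ new
      add new g _       _       = new

    levels : ℕ → List Frame → List Frame → List Frame
    levels zero       prev cur         = cur
    levels (suc fuel) prev []          = []
    levels (suc fuel) prev cur@(_ ∷ _) = cur ++ levels fuel cur (foldl (grow prev) [] cur)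

    frames : Maybe (Σ Shape (Array Frame))
    -- The fuels 20 and 100 bound the number of pairing rounds and the length of a representative.
    -- If they were too small, the column would be lost, never wrong.
    frames = balance 20 (map (λ f → leaf , cell f) (levels 100 [] (origin ∷ [])))

    locate : ∀ {sh} → Weight n → Array Frame sh → Maybe (Index sh)
    locate x (cell f) = if sameWeight x (centre f) then just here else nothing
    locate x (l ∙ r)  = Maybe.map left (locate x l) <∣> Maybe.map right (locate x r)

    module _ {sh} (pts : Array Frame sh) where

      private D = Index sh

      entryAt : Frame → D → Weight n → Entry D k l
      entryAt f a x = choose (search x (looped f)) (search x (trivial f))
        where
        choose : Maybe (Fin k) → Maybe (Fin l) → Entry D k l
        choose (just t) _        = loop t
        choose nothing  (just z) = triv z
        -- A failed search falls back to `a`. Such an entry is false, since no reflection fixes a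
        -- regular weight, and `goodEntries` rejects it.
        choose nothing  nothing  = move (fromMaybe a (locate x pts))

      rows : Array (Vec (Entry D k l) n) sh
      rows = generate sh λ a → Vec.tabulate λ s → entryAt (pts at a) a (lookup (images (pts at a)) s)

      module _ (tbl : Array (Vec (Entry D k l) n) sh) where

        ent : Fin n → D → Entry D k l
        ent s a = lookup (tbl at a) s

        goodEntry : Frame → Entry D k l → Weight n → Bool
        goodEntry f (move b) x = sameWeight x (centre (pts at b))
        goodEntry f (loop t) x = sameWeight x (lookup (looped f) t)
        goodEntry f (triv z) x = sameWeight x (lookup (trivial f) z)

        goodEntries : Bool
        goodEntries = every (λ a → every (λ s → goodEntry (pts at a) (ent s a) (lookup (images (pts at a)) s)) (allFin n)) (indices sh)

        same' : Word k → Word k → Bool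
        same' []        []        = true
        same' g         h         = sameWeight (run (reflect C') g ρ) (run (reflect C') h ρ)

        endsAt : D → Word k → D × Word k → Bool
        endsAt a g (b , h) = (b == a) ∧ same' h g

        goodRelations : Bool
        goodRelations = every (λ a → every (λ s → every (λ t → endsAt a [] (trace ent (alt s t (2 *ℕ m s t)) a)) (allFin n)) (allFin n)) (indices sh)

        isPure : D → D × Word k → Bool
        isPure a (b , [])    = b == a
        isPure a (b , _ ∷ _) = false

        goodWords : Bool
        goodWords = every (λ t → endsAt (first sh) (t ∷ []) (trace ent (lookup φs t) (first sh))) (allFin k)
                  ∧ every (λ a → isPure a (trace ent (word (pts at a)) (first sh))) (indices sh)

        goodImage : Bool
        goodImage = every (λ t → every (λ t' → sameWeight (go (concatMap (lookup φs) (alt t t' (2 *ℕ m' t t'))) ρ) ρ) (allFin k)) (allFin k)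
                  ∧ every (λ t → every (λ z → sameWeight (go (lookup φs t ++ lookup αs z) ρ) (go (lookup αs z ++ lookup φs t) ρ)) (allFin l)) (allFin k)

        good : Bool
        good = goodImage ∧ goodWords ∧ goodEntries ∧ goodRelations

        module Sound (valid : good ≡ true) where

          private
            same'-sound : ∀ g h → same' g h ≡ true → CoxEq m' g h
            same'-sound []      []      _ = ceRefl
            same'-sound []      (_ ∷ _) e = ≈-from-ρ pres' _ _ (sameWeight-sound _ _ e)
            same'-sound (_ ∷ _) []      e = ≈-from-ρ pres' _ _ (sameWeight-sound _ _ e)
            same'-sound (_ ∷ _) (_ ∷ _) e = ≈-from-ρ pres' _ _ (sameWeight-sound _ _ e)

            endsAt-sound : ∀ a g x → endsAt a g x ≡ true → proj₁ x ≡ a × CoxEq m' (proj₂ x) g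
            endsAt-sound a g (b , h) e with ∧-true {b == a} e
            ... | p , q = ==⇒≡ b a p , same'-sound h g q

            isPure-sound : ∀ a x → isPure a x ≡ true → x ≡ (a , [])
            isPure-sound a (b , []) e = cong (_, []) (==⇒≡ b a e)

            over : ∀ {A : Set} {p : A → Bool} {xs : List A} → every p xs ≡ true → ∀ {x} → x ∈ˡ xs → p x ≡ true
            over {p = p} {xs} = every-sound p xs

            parts : goodImage ≡ true × goodWords ≡ true × goodEntries ≡ true × goodRelations ≡ true
            parts with ∧-true {goodImage} valid
            ... | p , q with ∧-true {goodWords} q
            ... | r , s with ∧-true {goodEntries} s
            ... | t , u = p , r , t , u

            correct-entry : ∀ s a e → goodEntry (pts at a) e (lookup (images (pts at a)) s) ≡ true →
                            Correct m (λ a → word (pts at a)) (lookup φs) (lookup αs) s a e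
            correct-entry s a (move b) e = ≈-from-ρ pres _ _
              (trans (sym (images≡ (pts at a) s)) (trans (sameWeight-sound _ _ e) (centre≡ (pts at b))))
            correct-entry s a (loop t) e = ≈-from-ρ pres _ _
              (trans (sym (images≡ (pts at a) s)) (trans (sameWeight-sound _ _ e) (looped≡ (pts at a) t)))
            correct-entry s a (triv z) e = ≈-from-ρ pres _ _
              (trans (sym (images≡ (pts at a) s)) (trans (sameWeight-sound _ _ e) (trivial≡ (pts at a) z)))

          graph : CosetGraph m m' l D
          graph = record
            { m-diag  = λ s → proj₂ (Presents.diagonal pres s)
            ; m-diag' = λ s → proj₂ (Presents.diagonal pres' s)
            ; base    = first sh
            ; ent     = ent
            ; d       = λ a → word (pts at a)
            ; φ       = lookup φs
            ; α       = lookup αs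
            ; correct = λ s a → correct-entry s a (ent s a)
                (over (over (proj₁ (proj₂ (proj₂ parts))) (∈-indices a)) (List.∈-allFin s))
            ; φ-rel   = λ t t' → ≈-from-ρ pres _ _ (sameWeight-sound _ _
                (over (over (proj₁ (∧-true (proj₁ parts))) (List.∈-allFin t)) (List.∈-allFin t')))
            ; commute = λ t z → ≈-from-ρ pres _ _ (sameWeight-sound _ _
                (over (over (proj₂ (∧-true {every _ (allFin k)} (proj₁ parts))) (List.∈-allFin t)) (List.∈-allFin z)))
            ; returns = λ s t a → endsAt-sound a [] _
                (over (over (over (proj₂ (proj₂ (proj₂ parts))) (∈-indices a)) (List.∈-allFin s)) (List.∈-allFin t))
            ; label   = λ t → endsAt-sound (first sh) (t ∷ []) _
                (over (proj₁ (∧-true (proj₁ (proj₂ parts)))) (List.∈-allFin t))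
            ; pure    = λ a → isPure-sound a _
                (over (proj₂ (∧-true {every _ (allFin k)} (proj₁ (proj₂ parts)))) (∈-indices a))
            }

        open Labels {D} {k} {l}

        parent : ∀ {j} → D → Subset j → Vec (Entry D k l) j → Maybe D
        parent a []ᵛ         []ᵛ            = nothing
        parent a (true ∷ᵛ I) (move b ∷ᵛ es) = if b before a then just b else parent a I es
        parent a (_ ∷ᵛ I)    (_ ∷ᵛ es)      = parent a I es

        descend : D → Maybe D → Array D sh → Array D sh
        descend a nothing  reps = reps
        descend a (just b) reps = modify a (λ _ → reps at b) reps

        -- Indices are processed in increasing order, so the earlier neighbour chosen as parent
        -- already has its final representative. Whether all members of an orbit end with the same
        -- one is left to the test `stable`.
        descents : Subset n → List D → Array D sh → Array D sh
        descents I []       reps = reps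
        descents I (a ∷ as) reps = descents I as (descend a (parent a I (tbl at a)) reps)

        representatives : Subset n → Array D sh
        representatives I = descents I (indices sh) (generate sh id)

        stays : ∀ {j} → Array D sh → D → Subset j → Vec (Entry D k l) j → Bool
        stays reps r []ᵛ         []ᵛ            = true
        stays reps r (true ∷ᵛ I) (move b ∷ᵛ es) = ((reps at b) == r) ∧ stays reps r I es
        stays reps r (_ ∷ᵛ I)    (_ ∷ᵛ es)      = stays reps r I es

        stable : Subset n → Array D sh → Bool
        stable I reps = every (λ a → stays reps (reps at a) I (tbl at a)) (indices sh)

        labelling : Subset n → Array D sh → List D → Array (Subset k) sh
        labelling I reps []       = generate sh (λ _ → none)
        labelling I reps (a ∷ as) = modify (reps at a) (loops I (tbl at a)) (labelling I reps as)

        pick : Array D sh → List D → List D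
        pick reps []       = []
        pick reps (a ∷ as) = if (reps at a) == a then a ∷ pick reps as else pick reps as

        -- a column of counts for one subset I, as a function of J'
        tally : List (Subset k) → Trie (Maybe ℕ) k
        tally Ts = grouped (group Ts)
          where
          grouped : List (Subset k × ℕ) → Trie (Maybe ℕ) k
          grouped g = memo k (λ J' → Grouping.weighted (λ T → find (find counts T) J') g)

        orbitLabels : Array D sh → Array (Subset k) sh → List (Subset k)
        orbitLabels reps Ts = map (Ts at_) (pick reps (indices sh))

        totalFrom : Subset n → Array D sh → Trie (Maybe ℕ) k
        totalFrom I reps = if stable I reps then tally (orbitLabels reps (labelling I reps (indices sh))) else memo k (λ _ → nothing)

        -- At a suitable coset no generator in `J` moves, and every generator of A occurs among the
        -- loops; the loops in H then form `J'`.
        startAt : Subset n → List D → Maybe (Subset k)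
        startAt J []       = nothing
        startAt J (a ∷ as) = if fixed J (tbl at a) ∧ full (trivs J (tbl at a) none)
                             then just (loops J (tbl at a) none) else startAt J as

        module _ (valid : good ≡ true) where

          open Sound valid
          open CosetCount graph

          private
            bool : ∀ b → (b ≡ true) ⊎ (b ≡ false)
            bool true  = inj₁ refl
            bool false = inj₂ refl

            parent-sound : ∀ {j} a (I : Subset j) es {b} → parent a I es ≡ just b → ∃ λ s → s ∈ I × lookup es s ≡ move b
            parent-sound a []ᵛ []ᵛ ()
            parent-sound a (true ∷ᵛ I) (move b ∷ᵛ es) e with b before a
            parent-sound a (true ∷ᵛ I) (move b ∷ᵛ es) refl | true = zero , here , refl
            ... | false with parent-sound a I es e
            ... | s , p , q = suc s , there p , q
            parent-sound a (true ∷ᵛ I) (loop _ ∷ᵛ es) e with parent-sound a I es e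
            ... | s , p , q = suc s , there p , q
            parent-sound a (true ∷ᵛ I) (triv _ ∷ᵛ es) e with parent-sound a I es e
            ... | s , p , q = suc s , there p , q
            parent-sound a (false ∷ᵛ I) (move _ ∷ᵛ es) e with parent-sound a I es e
            ... | s , p , q = suc s , there p , q
            parent-sound a (false ∷ᵛ I) (loop _ ∷ᵛ es) e with parent-sound a I es e
            ... | s , p , q = suc s , there p , q
            parent-sound a (false ∷ᵛ I) (triv _ ∷ᵛ es) e with parent-sound a I es e
            ... | s , p , q = suc s , there p , q

            Path : Subset n → D → D → Set
            Path I a b = ∃ λ u → All (_∈ I) u × T u a ≡ (b , [])

            Paths : Subset n → Array D sh → Set
            Paths I reps = ∀ a → Path I a (reps at a)

            path-step : ∀ {I s a b c} → s ∈ I → ent s a ≡ move b → Path I b c → Path I a c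
            path-step {s = s} {a} sI e (u , uI , p) = u ++ s ∷ [] , All.++⁺ uI (sI ∷ []) ,
              trans (T-++ u (s ∷ []) a) (trans (cong (λ x → act* u (follow x (a , []))) e)
                (cong (λ x → proj₁ x , proj₂ x ++ []) p))

            descend-sound : ∀ I a b reps → parent a I (tbl at a) ≡ b → Paths I reps → Paths I (descend a b reps)
            descend-sound I a nothing reps e ps = ps
            descend-sound I a (just b) reps e ps c with a ≟ᵢ c
            ... | no a≢c = subst (Path I c) (sym (modify-other a c a≢c _ reps)) (ps c)
            ... | yes refl with parent-sound a I (tbl at a) e
            ... | s , sI , q = subst (Path I a) (sym (modify-same a _ reps)) (path-step sI q (ps b))

            descents-sound : ∀ I as reps → Paths I reps → Paths I (descents I as reps)
            descents-sound I []       reps ps = ps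
            descents-sound I (a ∷ as) reps ps = descents-sound I as _ (descend-sound I a _ reps refl ps)

            stays-sound : ∀ {j} reps r (I : Subset j) es → stays reps r I es ≡ true →
                          ∀ s b → s ∈ I → lookup es s ≡ move b → reps at b ≡ r
            stays-sound reps r (true ∷ᵛ I) (move b ∷ᵛ es) e zero .b here refl = ==⇒≡ _ _ (proj₁ (∧-true e))
            stays-sound reps r (true ∷ᵛ I) (move b ∷ᵛ es) e (suc s) c (there p) q =
              stays-sound reps r I es (proj₂ (∧-true {(reps at b) == r} e)) s c p q
            stays-sound reps r (true ∷ᵛ I) (loop _ ∷ᵛ es) e (suc s) c (there p) q = stays-sound reps r I es e s c p q
            stays-sound reps r (true ∷ᵛ I) (triv _ ∷ᵛ es) e (suc s) c (there p) q = stays-sound reps r I es e s c p q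
            stays-sound reps r (false ∷ᵛ I) (move _ ∷ᵛ es) e (suc s) c (there p) q = stays-sound reps r I es e s c p q
            stays-sound reps r (false ∷ᵛ I) (loop _ ∷ᵛ es) e (suc s) c (there p) q = stays-sound reps r I es e s c p q
            stays-sound reps r (false ∷ᵛ I) (triv _ ∷ᵛ es) e (suc s) c (there p) q = stays-sound reps r I es e s c p q

            labelling-∈ : ∀ I reps as {a t} → a ∈ˡ as → t ∈ loops I (tbl at a) none → t ∈ (labelling I reps as at (reps at a))
            labelling-∈ I reps (a ∷ as) (here refl) p = subst (_ ∈_) (sym (modify-same (reps at a) _ _)) (grow-loops p)
              where
              grow-loops : ∀ {t T} → t ∈ loops I (tbl at a) none → t ∈ loops I (tbl at a) T
              grow-loops p with loops-∈⁻ I (tbl at a) none p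
              ... | inj₁ q = ∉-none q
              ... | inj₂ (s , sI , q) = loops-∈ I (tbl at a) _ sI q
            labelling-∈ I reps (b ∷ as) {a} (there i) p with (reps at b) ≟ᵢ (reps at a)
            ... | no ne = subst (_ ∈_) (sym (modify-other (reps at b) (reps at a) ne _ _)) (labelling-∈ I reps as i p)
            ... | yes e = subst (λ r → _ ∈ (modify (reps at b) (loops I (tbl at b)) (labelling I reps as) at r)) e
                (subst (_ ∈_) (sym (modify-same (reps at b) _ _))
                  (loops-⊇ I (tbl at b) _ (subst (λ r → _ ∈ (labelling I reps as at r)) (sym e) (labelling-∈ I reps as i p))))

            labelling-∈⁻ : ∀ I reps as r {t} → t ∈ (labelling I reps as at r) →
                           ∃ λ a → reps at a ≡ r × ∃ λ s → s ∈ I × ent s a ≡ loop t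
            labelling-∈⁻ I reps [] r p = ∉-none (subst (_ ∈_) (at-generate sh (λ _ → none) r) p)
            labelling-∈⁻ I reps (a ∷ as) r p with (reps at a) ≟ᵢ r
            ... | no ne = labelling-∈⁻ I reps as r (subst (_ ∈_) (modify-other (reps at a) r ne _ _) p)
            ... | yes refl with loops-∈⁻ I (tbl at a) _ (subst (_ ∈_) (modify-same (reps at a) _ _) p)
            ... | inj₁ q = labelling-∈⁻ I reps as (reps at a) q
            ... | inj₂ (s , sI , q) = a , refl , s , sI , q

            pick-fixed : ∀ reps as → All (λ r → reps at r ≡ r) (pick reps as)
            pick-fixed reps [] = []
            pick-fixed reps (a ∷ as) with (reps at a) == a in e
            ... | true  = ==⇒≡ _ _ e ∷ pick-fixed reps as
            ... | false = pick-fixed reps as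

            pick-All : ∀ {P : D → Set} reps as → All P as → All P (pick reps as)
            pick-All reps [] [] = []
            pick-All reps (a ∷ as) (p ∷ ps) with (reps at a) == a
            ... | true  = p ∷ pick-All reps as ps
            ... | false = pick-All reps as ps

            pick-distinct : ∀ reps as → AllPairs _≢_ as → AllPairs _≢_ (pick reps as)
            pick-distinct reps [] [] = []
            pick-distinct reps (a ∷ as) (p ∷ ps) with (reps at a) == a
            ... | true  = pick-All reps as p ∷ pick-distinct reps as ps
            ... | false = pick-distinct reps as ps

            pick-∈ : ∀ reps as {a} → a ∈ˡ as → reps at a ≡ a → a ∈ˡ pick reps as
            pick-∈ reps (a ∷ as) (here refl) e with (reps at a) == a in q
            ... | true  = here refl
            ... | false with trans (sym q) (trans (cong (_== a) e) (==-refl a))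
            ... | ()
            pick-∈ reps (b ∷ as) (there i) e with (reps at b) == b
            ... | true  = there (pick-∈ reps as i e)
            ... | false = pick-∈ reps as i e

            orbits : ∀ I → stable I (representatives I) ≡ true → Orbits I
            orbits I st = record
              { rep      = λ a → reps at a
              ; labels   = λ r → labelling I reps (indices sh) at r
              ; reps     = pick reps (indices sh)
              ; distinct = pick-distinct reps _ (indices-distinct sh)
              ; complete = λ a e → pick-∈ reps _ (∈-indices a) e
              ; fixed    = pick-fixed reps (indices sh)
              ; path     = descents-sound I (indices sh) (generate sh id) (λ a → [] , [] , cong (_, []) (sym (at-generate sh id a)))
              ; stays    = λ s sI a b e → stays-sound reps (reps at a) I (tbl at a)
                  (every-sound (λ a → stays reps (reps at a) I (tbl at a)) (indices sh) st (∈-indices a)) s b sI e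
              ; labelled = λ s sI a t e → labelling-∈ I reps (indices sh) (∈-indices a) (loops-∈ I (tbl at a) none sI e)
              ; occurs   = λ r t p → labelling-∈⁻ I reps (indices sh) r p
              }
              where reps = representatives I

            start-sound : ∀ J as J' → startAt J as ≡ just J' → Start J J'
            start-sound J (a ∷ as) J' e with fixed J (tbl at a) ∧ full (trivs J (tbl at a) none) in q
            ... | false = start-sound J as J' e
            start-sound J (a ∷ as) .(loops J (tbl at a) none) refl | true with ∧-true {fixed J (tbl at a)} q
            ... | f , g = record
              { a₀      = a
              ; J-fixes = fixes
              ; J'-from = λ t p → from (loops-∈⁻ J (tbl at a) none p)
              ; A-from  = λ z → from' (trivs-∈⁻ J (tbl at a) none (full-sound _ g z))
              }
              where
              fixes : ∀ j → j ∈ J → (∃ λ t → t ∈ loops J (tbl at a) none × ent j a ≡ loop t) ⊎ (∃ λ z → ent j a ≡ triv z)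
              fixes j jJ with fixed-sound J (tbl at a) f j jJ
              ... | inj₁ (t , p) = inj₁ (t , loops-∈ J (tbl at a) none jJ p , p)
              ... | inj₂ z = inj₂ z
              from : ∀ {t} → t ∈ none ⊎ (∃ λ s → s ∈ J × ent s a ≡ loop t) → ∃ λ s → s ∈ J × ent s a ≡ loop t
              from (inj₁ p) = ∉-none p
              from (inj₂ p) = p
              from' : ∀ {z} → z ∈ none ⊎ (∃ λ s → s ∈ J × ent s a ≡ triv z) → ∃ λ s → s ∈ J × ent s a ≡ triv z
              from' (inj₁ p) = ∉-none p
              from' (inj₂ p) = p

            total-sound : ∀ I J J' c → startAt J (indices sh) ≡ just J' →
                          find (totalFrom I (representatives I)) J' ≡ just c → DoubleCosets m I J c
            total-sound I J J' c st e with bool (stable I (representatives I))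
            ... | inj₂ q rewrite q with trans (sym (find-memo k (λ _ → nothing) J')) e
            ... | ()
            total-sound I J J' c st e | inj₁ q rewrite q
              with Grouping.weighted-group (λ T → find (find counts T) J') (orbitLabels (representatives I) (labelling I (representatives I) (indices sh)))
                     (trans (sym (find-memo k _ J')) e)
            ... | ds , r = subst (DoubleCosets m I J) (sym (trans r (cong sum (sym (List.map-∘ (Orbits.reps (orbits I q)))))))
              (count (start-sound J (indices sh) J' st) (orbits I q)
                (λ a → fromMaybe 0 (find (find counts (Orbits.labels (orbits I q) a)) J'))
                (All.map (λ {a} p → counts-sound _ J' _ p) (All.map⁻ ds)))

          tabulated : Column m
          tabulated = column (memo n λ J → startAt J (indices sh)) (memo n λ I → totalFrom I (representatives I)) sound
            where
            sound : ∀ I J c → Maybe.maybe′ (find (find (memo n λ I → totalFrom I (representatives I)) I)) nothing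
                                (find (memo n λ J → startAt J (indices sh)) J) ≡ just c → DoubleCosets m I J c
            sound I J c e rewrite find-memo n (λ J → startAt J (indices sh)) J | find-memo n (λ I → totalFrom I (representatives I)) I
              with startAt J (indices sh) in q
            ... | just J' = total-sound I J J' c q e

  module _ {n} {m : Fin n → Fin n → ℕ} (C : Cartan n) (pres : Presents C m) where

    module _ {k} {m' : Fin k → Fin k → ℕ} (H : System k m') {l} (φs : Vec (Word n) k) (αs : Vec (Word n) l) where

      open Table C pres H φs αs

      private
        checked : ∀ {sh} (pts : Array Frame sh) (tbl : Array (Vec (Entry (Index sh) k l) n) sh) → Maybe (Column m)
        checked pts tbl = decide (good pts tbl) refl
          where
          decide : ∀ b → good pts tbl ≡ b → Maybe (Column m)
          decide true  e = just (tabulated pts tbl e)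
          decide false _ = nothing

        from : Maybe (Σ Shape (Array Frame)) → Maybe (Column m)
        from nothing           = nothing
        from (just (sh , pts)) = checked pts (rows pts)

      cosetColumn : Maybe (Column m)
      cosetColumn = from frames

    private
      -- A pair is settled by the first subgroup that covers `J` or, after exchanging the two sides,
      -- `I`. So no single subgroup has to cover all subsets.
      lookupValue : List (Maybe (Column m)) → Subset n → Subset n → Maybe ℕ
      lookupValue []             I J = nothing
      lookupValue (nothing ∷ cs) I J = lookupValue cs I J
      lookupValue (just c ∷ cs)  I J = Column.value c I J <∣> (Column.value c J I <∣> lookupValue cs I J)

      lookupValue-sound : ∀ cs I J c → lookupValue cs I J ≡ just c → DoubleCosets m I J c
      lookupValue-sound (nothing ∷ cs) I J c e = lookupValue-sound cs I J c e
      lookupValue-sound (just x ∷ cs) I J c e with Column.value x I J in p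
      lookupValue-sound (just x ∷ cs) I J c refl | just .c = Column.sound x I J c p
      ... | nothing with Column.value x J I in q
      lookupValue-sound (just x ∷ cs) I J c refl | nothing | just .c = doubleCosets-sym (λ s → proj₂ (Presents.diagonal pres s)) (Column.sound x J I c q)
      ... | nothing = lookupValue-sound cs I J c e

    assemble : List (Maybe (Column m)) → System n m
    assemble cs = system C pres (memo n λ I → memo n λ J → lookupValue cs I J) sound
      where
      sound : ∀ I J c → find (find (memo n λ I → memo n λ J → lookupValue cs I J) I) J ≡ just c → DoubleCosets m I J c
      sound I J c e = lookupValue-sound cs I J c
        (trans (sym (trans (cong (λ t → find t J) (find-memo n (λ I → memo n λ J → lookupValue cs I J) I)) (find-memo n _ J))) e)

  -- The bottom of the recursion: in a column over this system, W_J is conjugate to A alone.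
  trivialSystem : System 0 (λ ())
  trivialSystem = system []ᵛ (record { diagonal = λ () ; bonds = λ () }) (tip (tip (just 1)))
    λ { []ᵛ []ᵛ .1 refl → ([] ∷ []) , refl , ([] ∷ []) , λ { [] → here ([] , [] , [] , [] , ceRefl) } }

  bond? : ∀ f g j → Maybe (Bond f g j)
  bond? nil nil 2 = just bond2
  bond? one one 3 = just bond3
  bond? one two 4 = just bond4
  bond? two one 4 = just bond4'
  bond? phi phi 5 = just bond5
  bond? _   _   _ = nothing

  diagonal? : ∀ c j → Maybe (c ≡ -two × j ≡ 1)
  diagonal? -two 1 = just (refl , refl)
  diagonal? _    _ = nothing

  allJust : ∀ {n} {P : Fin n → Set} → (∀ s → Maybe (P s)) → Maybe (∀ s → P s)
  allJust {zero}  f = just λ ()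
  allJust {suc n} f with f zero | allJust (f ∘ suc)
  ... | just p | just ps = just λ { zero → p ; (suc s) → ps s }
  ... | _      | _       = nothing

  presents? : ∀ {n} (C : Cartan n) (m : Fin n → Fin n → ℕ) → Maybe (Presents C m)
  presents? C m with allJust (λ s → diagonal? (entry C s s) (m s s)) | allJust (λ s → allJust (λ t → bonds s t (s Fin.≟ t)))
    where
    bonds : ∀ s t → Dec (s ≡ t) → Maybe (s ≢ t → Bond (entry C s t) (entry C t s) (m s t))
    bonds s t (yes p) = just λ ne → ⊥-elim (ne p)
    bonds s t (no _)  = Maybe.map (λ b _ → b) (bond? (entry C s t) (entry C t s) (m s t))
  ... | just d | just b = just (record { diagonal = d ; bonds = b })
  ... | _      | _      = nothing

-- From tables of counts to metamatrices

module Metamatrices where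

  open import Defs
  open Tits
  open Weights using (module Presents)
  open Cosets
  open Tries
  open CosetTables
  open import Data.Nat using (ℕ; zero; suc; _≡ᵇ_; s≤s) renaming (_+_ to _+ℕ_)
  import Data.Nat.Properties as ℕ
  open import Data.Bool using (Bool; true; false; _∧_; if_then_else_)
  open import Data.Fin using (Fin; zero; suc; toℕ; fromℕ<)
  import Data.Fin.Properties as Fin
  open import Data.Fin.Subset using (Subset; ∣_∣)
  open import Data.Fin.Subset.Properties using (∣p∣≤n)
  open import Data.List using (List; []; _∷_; map; allFin; filterᵇ)
  open import Data.Nat.ListAction using (sum)
  open import Data.List.Membership.Propositional using (_∈_)
  import Data.List.Membership.Propositional.Properties as List
  open import Data.List.Relation.Unary.Any using (Any; here; there)
  open import Data.List.Relation.Unary.All using (All; []; _∷_)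
  open import Data.List.Relation.Unary.AllPairs using (AllPairs; []; _∷_)
  open import Data.Vec using (Vec; lookup; fromList) renaming ([] to []ᵛ; _∷_ to _∷ᵛ_)
  import Data.Vec as Vec
  import Data.Vec.Properties as Vec
  open import Data.Maybe using (Maybe; just; nothing; fromMaybe)
  open import Data.Product using (∃; _×_; _,_; proj₁; proj₂)
  open import Data.Empty using (⊥-elim)
  open import Relation.Nullary using (¬_)
  open import Relation.Binary.PropositionalEquality hiding ([_])
  open import Function using (_∘_)

  module _ {A : Set} {_~_ : A → A → Set} (~-sym : ∀ {x y} → x ~ y → y ~ x) where

    hasNumClasses : ∀ {k} → Classes _~_ k → HasNumClasses _~_ k
    hasNumClasses (xs , refl , sep , cover) = fromList xs , separated xs sep , λ x → position xs (cover x)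
      where
      at-all : ∀ {P : A → Set} xs → All P xs → ∀ a → P (lookup (fromList xs) a)
      at-all (x ∷ xs) (p ∷ ps) zero    = p
      at-all (x ∷ xs) (p ∷ ps) (suc a) = at-all xs ps a
      separated : ∀ xs → AllPairs (λ x y → ¬ (x ~ y)) xs → ∀ a b → lookup (fromList xs) a ~ lookup (fromList xs) b → a ≡ b
      separated (x ∷ xs) (p ∷ ps) zero    zero    r = refl
      separated (x ∷ xs) (p ∷ ps) zero    (suc b) r = ⊥-elim (at-all xs p b r)
      separated (x ∷ xs) (p ∷ ps) (suc a) zero    r = ⊥-elim (at-all xs p a (~-sym r))
      separated (x ∷ xs) (p ∷ ps) (suc a) (suc b) r = cong suc (separated xs ps a b r)
      position : ∀ {x} xs → Any (x ~_) xs → ∃ λ a → x ~ lookup (fromList xs) a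
      position (y ∷ xs) (here r)  = zero , r
      position (y ∷ xs) (there i) with position xs i
      ... | a , r = suc a , r

    -- Sending each representative of one system to an equivalent one of the other is injective, in
    -- both directions.
    hasNumClasses-unique : (∀ {x y z} → x ~ y → y ~ z → x ~ z) → ∀ {j k} → HasNumClasses _~_ j → HasNumClasses _~_ k → j ≡ k
    hasNumClasses-unique ~-trans a b = ℕ.≤-antisym (smaller a b) (smaller b a)
      where
      smaller : ∀ {j k} → HasNumClasses _~_ j → HasNumClasses _~_ k → j Data.Nat.≤ k
      smaller (xs , inj , _) (ys , _ , cover) = Fin.injective⇒≤ {f = λ a → proj₁ (cover (lookup xs a))} λ {a} {b} e →
        inj a b (~-trans (proj₂ (cover (lookup xs a))) (subst (λ c → lookup ys c ~ lookup xs b) (sym e) (~-sym (proj₂ (cover (lookup xs b))))))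

  ∈-allSubsets : ∀ {n} (I : Subset n) → I ∈ allSubsets n
  ∈-allSubsets []ᵛ = here refl
  ∈-allSubsets (true ∷ᵛ I) = List.∈-++⁺ˡ (List.∈-map⁺ (true ∷ᵛ_) (∈-allSubsets I))
  ∈-allSubsets {suc n} (false ∷ᵛ I) = List.∈-++⁺ʳ (map (true ∷ᵛ_) (allSubsets n)) (List.∈-map⁺ (false ∷ᵛ_) (∈-allSubsets I))

  sum-filter : {A : Set} (p : A → Bool) (f : A → ℕ) (xs : List A) →
               sum (map (λ x → if p x then f x else 0) xs) ≡ sum (map f (filterᵇ p xs))
  sum-filter p f [] = refl
  sum-filter p f (x ∷ xs) with p x
  ... | true  = cong (f x +ℕ_) (sum-filter p f xs)
  ... | false = sum-filter p f xs

  sum-cong : {A : Set} {f g : A → ℕ} → (∀ x → f x ≡ g x) → ∀ xs → sum (map f xs) ≡ sum (map g xs)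
  sum-cong e []       = refl
  sum-cong e (x ∷ xs) = cong₂ _+ℕ_ (e x) (sum-cong e xs)

  sum-zero : {A : Set} (xs : List A) → sum (map (λ _ → 0) xs) ≡ 0
  sum-zero []       = refl
  sum-zero (x ∷ xs) = sum-zero xs

  ofSize : ∀ n → ℕ → List (Subset n)
  ofSize n p = filterᵇ (λ I → ∣ I ∣ ≡ᵇ p) (allSubsets n)

  ∈-filterᵇ : {A : Set} (p : A → Bool) {x : A} {xs : List A} → x ∈ xs → p x ≡ true → x ∈ filterᵇ p xs
  ∈-filterᵇ p {xs = y ∷ xs} (here refl) e rewrite e = here refl
  ∈-filterᵇ p {xs = y ∷ xs} (there i) e with p y
  ... | true  = there (∈-filterᵇ p i e)
  ... | false = ∈-filterᵇ p i e

  metamatrixEntry : ∀ n → (Subset n → Subset n → ℕ) → ℕ → ℕ → ℕ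
  metamatrixEntry n c p q = sum (map (λ I → sum (map (λ J →
    if (∣ I ∣ ≡ᵇ p) ∧ (∣ J ∣ ≡ᵇ q) then c I J else 0) (allSubsets n))) (allSubsets n))

  metamatrixEntry-ofSize : ∀ n c p q →
    metamatrixEntry n c p q ≡ sum (map (λ I → sum (map (c I) (ofSize n q))) (ofSize n p))
  metamatrixEntry-ofSize n c p q = trans (sum-cong inner (allSubsets n)) (sum-filter (λ I → ∣ I ∣ ≡ᵇ p) _ (allSubsets n))
    where
    inner : ∀ I → sum (map (λ J → if (∣ I ∣ ≡ᵇ p) ∧ (∣ J ∣ ≡ᵇ q) then c I J else 0) (allSubsets n)) ≡
                  (if ∣ I ∣ ≡ᵇ p then sum (map (c I) (ofSize n q)) else 0)
    inner I with ∣ I ∣ ≡ᵇ p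
    ... | true  = sum-filter (λ J → ∣ J ∣ ≡ᵇ q) (c I) (allSubsets n)
    ... | false = sum-zero (allSubsets n)

  addJust : Maybe ℕ → Maybe ℕ → Maybe ℕ
  addJust (just x) (just y) = just (x +ℕ y)
  addJust _        _        = nothing

  sumJust : List (Maybe ℕ) → Maybe ℕ
  sumJust []       = just 0
  sumJust (x ∷ xs) = addJust x (sumJust xs)

  sumJust-defined : {A : Set} (f : A → Maybe ℕ) (g : A → ℕ) → (∀ x → f x ≡ just (g x)) →
                    ∀ xs → sumJust (map f xs) ≡ just (sum (map g xs))
  sumJust-defined f g d []       = refl
  sumJust-defined f g d (x ∷ xs) = cong₂ addJust (d x) (sumJust-defined f g d xs)

  sumJust-sound : {A : Set} (f : A → Maybe ℕ) (xs : List A) {y : ℕ} → sumJust (map f xs) ≡ just y →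
    (∀ {x} → x ∈ xs → f x ≡ just (fromMaybe 0 (f x))) × y ≡ sum (map (fromMaybe 0 ∘ f) xs)
  sumJust-sound f [] refl = (λ ()) , refl
  sumJust-sound f (x ∷ xs) e with f x in p | sumJust (map f xs) in q
  sumJust-sound f (x ∷ xs) refl | just a | just b with sumJust-sound f xs q
  ... | d , refl = (λ { (here refl) → trans p (cong (just ∘ fromMaybe 0) (sym p)) ; (there i) → d i }) , refl

  Table² : ℕ → Set
  Table² n = Vec (Vec ℕ (suc n)) (suc n)

  module _ {n} {m : Fin n → Fin n → ℕ} where

    private
      is : Maybe ℕ → ℕ → Bool
      is (just x) y = x ≡ᵇ y
      is nothing  y = false

      is-sound : ∀ x y → is x y ≡ true → x ≡ just y
      is-sound (just x) y e = cong just (≡ᵇ-sound x y e)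

      entryOK : Trie (Trie (Maybe ℕ) n) n → List (Subset n) → List (Subset n) → ℕ → Bool
      entryOK c Is Js x = is (sumJust (map (λ I → sumJust (map (find (find c I)) Js)) Is)) x

      tableOK : Trie (Trie (Maybe ℕ) n) n → Vec (List (Subset n)) (suc n) → Table² n → Bool
      tableOK c sizes M = every (λ p → every (λ q → entryOK c (lookup sizes p) (lookup sizes q) (lookup (lookup M p) q)) (allFin (suc n))) (allFin (suc n))

    hasMetamatrix : Maybe (System n m) → Table² n → Bool
    hasMetamatrix nothing  M = false
    hasMetamatrix (just s) M = tableOK (System.counts s) (Vec.tabulate (λ p → ofSize n (toℕ p))) M

    private
      module _ (s : System n m) (M : Table² n) (ok : hasMetamatrix (just s) M ≡ true) where

        open System s

        c : Subset n → Subset n → ℕ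
        c I J = fromMaybe 0 (find (find counts I) J)

        entry-sound : ∀ p q → sumJust (map (λ I → sumJust (map (find (find counts I)) (ofSize n (toℕ q)))) (ofSize n (toℕ p))) ≡ just (lookup (lookup M p) q)
        entry-sound p q = is-sound _ _ (subst₂ (λ Is Js → entryOK counts Is Js (lookup (lookup M p) q) ≡ true)
          (Vec.lookup∘tabulate (λ p → ofSize n (toℕ p)) p) (Vec.lookup∘tabulate (λ p → ofSize n (toℕ p)) q)
          (every-sound _ (allFin (suc n)) (every-sound _ (allFin (suc n)) ok (List.∈-allFin p)) (List.∈-allFin q)))

        size : (I : Subset n) → Fin (suc n)
        size I = fromℕ< (s≤s (∣p∣≤n I))

        ∈-size : ∀ I → I ∈ ofSize n (toℕ (size I))
        ∈-size I = ∈-filterᵇ (λ J → ∣ J ∣ ≡ᵇ toℕ (size I)) (∈-allSubsets I)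
          (subst (λ k → (∣ I ∣ ≡ᵇ k) ≡ true) (sym (Fin.toℕ-fromℕ< (s≤s (∣p∣≤n I)))) (≡ᵇ-refl ∣ I ∣))
          where
          ≡ᵇ-refl : ∀ k → (k ≡ᵇ k) ≡ true
          ≡ᵇ-refl zero    = refl
          ≡ᵇ-refl (suc k) = ≡ᵇ-refl k

        row-sound : ∀ q {I} p → I ∈ ofSize n (toℕ p) → sumJust (map (find (find counts I)) (ofSize n (toℕ q))) ≡
                    just (fromMaybe 0 (sumJust (map (find (find counts I)) (ofSize n (toℕ q)))))
        row-sound q p I∈ = proj₁ (sumJust-sound _ (ofSize n (toℕ p)) (entry-sound p q)) I∈

        -- A sum in `Maybe` is defined only if all its terms are, and `I`, `J` occur among the terms
        -- of the entry indexed by their own sizes. A successful comparison of totals therefore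
        -- shows that the table has no gaps.
        counted : ∀ I J → find (find counts I) J ≡ just (c I J)
        counted I J = proj₁ (sumJust-sound (find (find counts I)) (ofSize n (toℕ (size J))) (row-sound (size J) (size I) (∈-size I))) (∈-size J)

        isMetamatrix : IsMetamatrix m (λ p q → lookup (lookup M p) q)
        isMetamatrix = c ,
          (λ I J → hasNumClasses (doubleCoset-sym (λ s → proj₂ (Presents.diagonal presents s))) (sound I J (c I J) (counted I J))) ,
          λ p q → trans (proj₂ (sumJust-sound _ (ofSize n (toℕ p)) (entry-sound p q)))
            (trans (sum-cong (λ I → cong (fromMaybe 0) (sumJust-defined (find (find counts I)) (c I) (counted I) (ofSize n (toℕ q)))) (ofSize n (toℕ p)))
              (sym (metamatrixEntry-ofSize n c (toℕ p) (toℕ q))))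

    metamatrix-sound : ∀ s M → hasMetamatrix s M ≡ true → IsMetamatrix m (λ p q → lookup (lookup M p) q)
    metamatrix-sound (just s) M ok = isMetamatrix s M ok

-- Coxeter diagrams and numerals for words

module Diagrams where

  open import Defs
  open Weights
  open CosetTables
  open Metamatrices
  open import Data.Nat using (ℕ; zero; suc; pred; _≡ᵇ_; _<ᵇ_)
  open import Data.Nat.DivMod using (_/_; _%_)
  open import Data.Bool using (if_then_else_)
  open import Data.Fin using (Fin; zero; suc; toℕ)
  open import Data.List using (List; []; _∷_; map; length)
  open import Data.Vec using (Vec; tabulate) renaming ([] to []ᵛ; _∷_ to _∷ᵛ_)
  open import Data.Maybe using (Maybe; just; nothing)
  open import Data.Product using (Σ; _×_; _,_)

  bondA bondD : ℕ → ℕ → ℕ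
  bondA i j = if j ≡ᵇ suc i then 3 else 2
  bondD 0 1 = 2
  bondD 0 2 = 3
  bondD i j = if j ≡ᵇ suc i then 3 else 2

  -- The bond 4 is oriented by the order of the nodes, which places the entries 1 and 2 as `Bond`
  -- expects. A Coxeter matrix with other bonds gets wrong entries and is rejected by `presents?`.
  cartanOf : ∀ {n} → (Fin n → Fin n → ℕ) → Cartan n
  cartanOf m = tabulate λ i → tabulate λ j → coef (toℕ i) (toℕ j) (m i j)
    where
    coef : ℕ → ℕ → ℕ → Coef
    coef i j 1 = -two
    coef i j 3 = one
    coef i j 4 = if i <ᵇ j then one else two
    coef i j 5 = phi
    coef i j _ = nil

  -- the decimal digits of a numeral are the generators of a word, the first generator being 1
  word : ∀ n → ℕ → Word n
  word n k = digits n 100 k []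
    where
    letter : ∀ n → ℕ → Fin (suc n)
    letter zero    _       = zero
    letter (suc n) zero    = zero
    letter (suc n) (suc k) = suc (letter n k)
    digits : ∀ n → ℕ → ℕ → Word n → Word n
    digits n       zero    k         w = w
    digits zero    (suc f) k         w = w
    digits (suc n) (suc f) zero      w = w
    digits (suc n) (suc f) k@(suc _) w = digits (suc n) f (k / 10) (letter n (pred (k % 10)) ∷ w)

  words : ∀ {n} k → List ℕ → Vec (Word n) k
  words     zero    _        = []ᵛ
  words     (suc k) []       = [] ∷ᵛ words k []
  words {n} (suc k) (x ∷ xs) = word n x ∷ᵛ words k xs

  Subsystem : Set
  Subsystem = (Σ ℕ λ k → Σ (Fin k → Fin k → ℕ) λ m → Maybe (System k m)) × List ℕ × List ℕ

  via : ∀ {k} {m : Fin k → Fin k → ℕ} → Maybe (System k m) → List ℕ → List ℕ → Subsystem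
  via s φ α = (_ , _ , s) , φ , α

  point : Maybe (System 0 λ ())
  point = just trivialSystem

  group′ : ∀ {n} {m : Fin n → Fin n → ℕ} (C : Cartan n) → Maybe (Presents C m) → List Subsystem → Maybe (System n m)
  group′ C nothing     subs = nothing
  group′ {m = m} C (just pres) subs = just (assemble C pres (map col subs))
    where
    col : Subsystem → Maybe (Column m)
    col ((k , m' , nothing) , φ , α) = nothing
    col ((k , m' , just H) , φ , α)  = cosetColumn C pres H (words k φ) (words (length α) α)

  -- via H φ α: the reflection subgroup with Coxeter generators φ (a copy of H) and α
  groupOf : ∀ {n} (m : Fin n → Fin n → ℕ) → List Subsystem → Maybe (System n m)
  groupOf m = group′ (cartanOf m) (presents? (cartanOf m) m)

  infixl 1 _>>>_
  _>>>_ : {A B : Set} → A → (A → B) → B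
  x >>> f = f x

-- Determinants defined by expansion along the first row

module Determinants where

  open import Defs hiding (B)
  open import Data.Nat using (ℕ; zero; suc)
  open import Data.Integer using (ℤ; +_; -_; _+_; _*_; 0ℤ; 1ℤ)
  import Data.Integer.Properties as ℤ
  open import Data.Integer.Solver using (module +-*-Solver)
  open import Data.Nat.Properties using (suc-injective)
  open import Data.Fin.Properties using (toℕ-injective; toℕ-inject₁)
  open import Data.Fin using (Fin; toℕ; punchIn; inject₁; fromℕ) renaming (zero to fz; suc to fs)
  open import Relation.Binary.PropositionalEquality
  open import Function using (_∘_; flip)

  open +-*-Solver

  Matrix : ℕ → Set
  Matrix k = Fin k → Fin k → ℤ

  sumFin-cong : ∀ k {f g : Fin k → ℤ} → (∀ i → f i ≡ g i) → sumFin k f ≡ sumFin k g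
  sumFin-cong zero    e = refl
  sumFin-cong (suc k) e = cong₂ _+_ (e fz) (sumFin-cong k (e ∘ fs))

  sumFin-zero : ∀ k {f : Fin k → ℤ} → (∀ i → f i ≡ 0ℤ) → sumFin k f ≡ 0ℤ
  sumFin-zero zero    e = refl
  sumFin-zero (suc k) e = cong₂ _+_ (e fz) (sumFin-zero k (e ∘ fs))

  sumFin-linear : ∀ k x y (f g : Fin k → ℤ) → sumFin k (λ i → x * f i + y * g i) ≡ x * sumFin k f + y * sumFin k g
  sumFin-linear zero    x y f g = solve 2 (λ x y → con 0ℤ := x :* con 0ℤ :+ y :* con 0ℤ) refl x y
  sumFin-linear (suc k) x y f g = trans (cong (λ z → x * f fz + y * g fz + z) (sumFin-linear k x y (f ∘ fs) (g ∘ fs)))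
    (solve 6 (λ x y a b s t → x :* a :+ y :* b :+ (x :* s :+ y :* t) := x :* (a :+ s) :+ y :* (b :+ t)) refl
      x y (f fz) (g fz) (sumFin k (f ∘ fs)) (sumFin k (g ∘ fs)))

  sumFin-scale : ∀ k x (f : Fin k → ℤ) → sumFin k (λ i → x * f i) ≡ x * sumFin k f
  sumFin-scale zero    x f = sym (ℤ.*-zeroʳ x)
  sumFin-scale (suc k) x f = trans (cong (λ z → x * f fz + z) (sumFin-scale k x (f ∘ fs))) (sym (ℤ.*-distribˡ-+ x _ _))

  sumFin-+ : ∀ k (f g : Fin k → ℤ) → sumFin k (λ i → f i + g i) ≡ sumFin k f + sumFin k g
  sumFin-+ zero    f g = refl
  sumFin-+ (suc k) f g = trans (cong (λ z → f fz + g fz + z) (sumFin-+ k (f ∘ fs) (g ∘ fs)))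
    (solve 4 (λ a b s t → a :+ b :+ (s :+ t) := a :+ s :+ (b :+ t)) refl (f fz) (g fz) (sumFin k (f ∘ fs)) (sumFin k (g ∘ fs)))

  sumFin-swap : ∀ j k (f : Fin j → Fin k → ℤ) →
                sumFin j (λ a → sumFin k (f a)) ≡ sumFin k (λ b → sumFin j (λ a → f a b))
  sumFin-swap zero    k f = sym (sumFin-zero k (λ _ → refl))
  sumFin-swap (suc j) k f = trans (cong (λ z → sumFin k (f fz) + z) (sumFin-swap j k (f ∘ fs)))
    (sym (sumFin-+ k (f fz) (λ b → sumFin j (λ a → f (fs a) b))))

  sumFin-last : ∀ k (f : Fin (suc k) → ℤ) → sumFin (suc k) f ≡ sumFin k (f ∘ inject₁) + f (fromℕ k)
  sumFin-last zero    f = trans (ℤ.+-identityʳ (f fz)) (sym (ℤ.+-identityˡ (f fz)))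
  sumFin-last (suc k) f = trans (cong (λ z → f fz + z) (sumFin-last k (f ∘ fs))) (sym (ℤ.+-assoc (f fz) _ _))

  expand : ∀ k → Matrix (suc k) → Fin (suc k) → ℤ
  expand k A j = signFin j * A fz j * det k (λ a b → A (fs a) (punchIn j b))

  det-cong : ∀ k {A B : Matrix k} → (∀ i j → A i j ≡ B i j) → det k A ≡ det k B
  det-cong zero    e = refl
  det-cong (suc k) e = sumFin-cong (suc k) λ j → cong₂ _*_ (cong (signFin j *_) (e fz j))
    (det-cong k (λ a b → e (fs a) (punchIn j b)))

  -- Expand along the first row, then each minor along its first column. The resulting double sum
  -- over rows and columns can be regrouped with the row index outside, and the inner sums are again
  -- row expansions.
  det-column : ∀ k (A : Matrix (suc k)) →
    det (suc k) A ≡ sumFin (suc k) (λ i → signFin i * A i fz * det k (λ a b → A (punchIn i a) (fs b)))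
  det-column zero    A = refl
  det-column (suc k) A = cong (λ z → 1ℤ * A fz fz * det (suc k) (λ a b → A (fs a) (fs b)) + z)
    (trans (sumFin-cong (suc k) (λ j →
        trans (cong (signFin (fs j) * A fz (fs j) *_) (det-column k (λ a b → A (fs a) (punchIn (fs j) b))))
              (sym (sumFin-scale (suc k) (signFin (fs j) * A fz (fs j)) (λ i → signFin i * A (fs i) fz * det k (λ a b → A (fs (punchIn i a)) (fs (punchIn j b))))))))
      (trans (sumFin-swap (suc k) (suc k) (λ j i → signFin (fs j) * A fz (fs j) * (signFin i * A (fs i) fz * det k (λ a b → A (fs (punchIn i a)) (fs (punchIn j b))))))
        (sumFin-cong (suc k) (λ i → trans (sumFin-cong (suc k) (λ j →
            solve 5 (λ s a t b d → :- s :* a :* (t :* b :* d) := :- t :* b :* (s :* a :* d)) refl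
              (signFin j) (A fz (fs j)) (signFin i) (A (fs i) fz) (det k (λ a b → A (fs (punchIn i a)) (fs (punchIn j b))))))
          (sumFin-scale (suc k) (signFin (fs i) * A (fs i) fz) (λ j → signFin j * A fz (fs j) * det k (λ a b → A (fs (punchIn i a)) (fs (punchIn j b)))))))))

  det-transpose : ∀ k (A : Matrix k) → det k (flip A) ≡ det k A
  det-transpose zero    A = refl
  det-transpose (suc k) A = trans (sumFin-cong (suc k) (λ j → cong (signFin j * A j fz *_)
    (det-transpose k (λ a b → A (punchIn j a) (fs b))))) (sym (det-column k A))

  det-row-linear : ∀ k (i : Fin k) x y (A B C : Matrix k) →
    (∀ a → a ≢ i → ∀ b → A a b ≡ C a b) → (∀ a → a ≢ i → ∀ b → B a b ≡ C a b) →
    (∀ b → C i b ≡ x * A i b + y * B i b) → det k C ≡ x * det k A + y * det k B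
  det-row-linear (suc k) fz x y A B C eA eB eC =
    trans (sumFin-cong (suc k) (λ j →
      trans (cong (λ z → signFin j * z * det k (λ a b → C (fs a) (punchIn j b))) (eC j))
        (trans (solve 6 (λ s x a y b d → s :* (x :* a :+ y :* b) :* d := x :* (s :* a :* d) :+ y :* (s :* b :* d)) refl
                  (signFin j) x (A fz j) y (B fz j) (det k (λ a b → C (fs a) (punchIn j b))))
          (cong₂ (λ d e → x * (signFin j * A fz j * d) + y * (signFin j * B fz j * e))
            (det-cong k (λ a b → sym (eA (fs a) (λ ()) (punchIn j b))))
            (det-cong k (λ a b → sym (eB (fs a) (λ ()) (punchIn j b))))))))
      (sumFin-linear (suc k) x y (expand k A) (expand k B))
  det-row-linear (suc k) (fs i) x y A B C eA eB eC =
    trans (sumFin-cong (suc k) (λ j →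
      trans (cong (signFin j * C fz j *_)
          (det-row-linear k i x y (λ a b → A (fs a) (punchIn j b)) (λ a b → B (fs a) (punchIn j b)) (λ a b → C (fs a) (punchIn j b))
            (λ a a≢i b → eA (fs a) (λ { refl → a≢i refl }) (punchIn j b))
            (λ a a≢i b → eB (fs a) (λ { refl → a≢i refl }) (punchIn j b))
            (λ b → eC (punchIn j b))))
        (trans (solve 6 (λ s c x d y e → s :* c :* (x :* d :+ y :* e) := x :* (s :* c :* d) :+ y :* (s :* c :* e)) refl
                  (signFin j) (C fz j) x (det k (λ a b → A (fs a) (punchIn j b))) y (det k (λ a b → B (fs a) (punchIn j b))))
          (cong₂ (λ c c' → x * (signFin j * c * det k (λ a b → A (fs a) (punchIn j b))) + y * (signFin j * c' * det k (λ a b → B (fs a) (punchIn j b))))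
            (sym (eA fz (λ ()) j)) (sym (eB fz (λ ()) j))))))
      (sumFin-linear (suc k) x y (expand k A) (expand k B))

  det-zero-row : ∀ k (i : Fin k) (A : Matrix k) → (∀ b → A i b ≡ 0ℤ) → det k A ≡ 0ℤ
  det-zero-row k i A e = trans (det-row-linear k i 0ℤ 0ℤ A A A (λ _ _ _ → refl) (λ _ _ _ → refl)
    (λ b → trans (e b) (sym (cong₂ _+_ (ℤ.*-zeroˡ (A i b)) (ℤ.*-zeroˡ (A i b)))))) (cong₂ _+_ (ℤ.*-zeroˡ (det k A)) (ℤ.*-zeroˡ (det k A)))

  -- If the first two rows agree, expansion along the first column leaves two cancelling terms and
  -- minors whose first two rows agree again. Equal rows further down survive in all minors of the
  -- first row expansion.
  det-equal-rows : ∀ k (i : Fin (suc k)) (A : Matrix (suc (suc k))) →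
    (∀ b → A (inject₁ i) b ≡ A (fs i) b) → det (suc (suc k)) A ≡ 0ℤ
  det-equal-rows k fz A e = trans (det-column (suc k) A)
    (trans (cong₂ (λ x y → 1ℤ * A fz fz * x + (- 1ℤ * A (fs fz) fz * det (suc k) (λ a b → A (punchIn (fs fz) a) (fs b)) + y)) same (rest k A e))
      (trans (cong (λ x → 1ℤ * x * det (suc k) (λ a b → A (punchIn (fs fz) a) (fs b)) + (- 1ℤ * A (fs fz) fz * det (suc k) (λ a b → A (punchIn (fs fz) a) (fs b)) + 0ℤ)) (e fz))
        (solve 2 (λ a d → con 1ℤ :* a :* d :+ (con (- 1ℤ) :* a :* d :+ con 0ℤ) := con 0ℤ) refl (A (fs fz) fz) _)))
    where
    same : det (suc k) (λ a b → A (fs a) (fs b)) ≡ det (suc k) (λ a b → A (punchIn (fs fz) a) (fs b))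
    same = det-cong (suc k) {λ a b → A (fs a) (fs b)} {λ a b → A (punchIn (fs fz) a) (fs b)} λ { fz b → sym (e (fs b)) ; (fs a) b → refl }
    rest : ∀ k (A : Matrix (suc (suc k))) → (∀ b → A fz b ≡ A (fs fz) b) →
      sumFin k (λ i → signFin (fs (fs i)) * A (fs (fs i)) fz * det (suc k) (λ a b → A (punchIn (fs (fs i)) a) (fs b))) ≡ 0ℤ
    rest zero    A e = refl
    rest (suc k) A e = sumFin-zero (suc k) λ i → trans
      (cong (signFin (fs (fs i)) * A (fs (fs i)) fz *_) (det-equal-rows k fz (λ a b → A (punchIn (fs (fs i)) a) (fs b)) (e ∘ fs)))
      (ℤ.*-zeroʳ (signFin (fs (fs i)) * A (fs (fs i)) fz))
  det-equal-rows (suc k) (fs i) A e = sumFin-zero (suc (suc (suc k))) λ j → trans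
    (cong (signFin j * A fz j *_) (det-equal-rows k i (λ a b → A (fs a) (punchIn j b)) (λ b → e (punchIn j b))))
    (ℤ.*-zeroʳ (signFin j * A fz j))

  det-scale : ∀ k c (A : Matrix k) → det k (λ a b → c * A a b) ≡ c Data.Integer.^ k * det k A
  det-scale zero    c A = refl
  det-scale (suc k) c A = trans (sumFin-cong (suc k) (λ j →
      trans (cong (signFin j * (c * A fz j) *_) (det-scale k c (λ a b → A (fs a) (punchIn j b))))
        (solve 5 (λ s c a p d → s :* (c :* a) :* (p :* d) := c :* p :* (s :* a :* d)) refl
          (signFin j) c (A fz j) (c Data.Integer.^ k) (det k (λ a b → A (fs a) (punchIn j b))))))
    (sumFin-scale (suc k) (c * c Data.Integer.^ k) (expand k A))

  private
    punchIn-inject : ∀ {k} (j : Fin (suc k)) (b : Fin k) → punchIn (inject₁ j) (inject₁ b) ≡ inject₁ (punchIn j b)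
    punchIn-inject fz     b      = refl
    punchIn-inject (fs j) fz     = refl
    punchIn-inject (fs j) (fs b) = cong fs (punchIn-inject j b)

    punchIn-inject-last : ∀ {k} (j : Fin (suc k)) → punchIn (inject₁ j) (fromℕ k) ≡ fromℕ (suc k)
    punchIn-inject-last fz = refl
    punchIn-inject-last {suc k} (fs j) = cong fs (punchIn-inject-last j)

    punchIn-last : ∀ {k} (b : Fin k) → punchIn (fromℕ k) b ≡ inject₁ b
    punchIn-last fz     = refl
    punchIn-last (fs b) = cong fs (punchIn-last b)

    sign-inject : ∀ {k} (j : Fin k) → signFin (inject₁ j) ≡ signFin j
    sign-inject fz     = refl
    sign-inject (fs j) = cong -_ (sign-inject j)

  -- Expand along the first row: the minor that omits the last column has a zero last row, and the
  -- others keep the shape.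
  det-corner : ∀ k d (A : Matrix (suc k)) → (∀ b → A (fromℕ k) (inject₁ b) ≡ 0ℤ) → A (fromℕ k) (fromℕ k) ≡ d →
               det (suc k) A ≡ d * det k (λ a b → A (inject₁ a) (inject₁ b))
  det-corner zero d A z e = trans (cong (λ x → 1ℤ * x * 1ℤ + 0ℤ) e) (solve 1 (λ d → con 1ℤ :* d :* con 1ℤ :+ con 0ℤ := d :* con 1ℤ) refl d)
  det-corner (suc k) d A z e = trans (sumFin-last (suc k) (λ j → signFin j * A fz j * det (suc k) (λ a b → A (fs a) (punchIn j b))))
    (trans (cong₂ _+_
      (trans (sumFin-cong (suc k) (λ j →
          trans (cong₂ (λ s x → s * A fz (inject₁ j) * x) (sign-inject j)
            (trans (det-corner k d (λ a b → A (fs a) (punchIn (inject₁ j) b))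
                      (λ b → trans (cong (A (fromℕ (suc k))) (punchIn-inject j b)) (z (punchIn j b)))
                      (trans (cong (A (fromℕ (suc k))) (punchIn-inject-last j)) e))
                   (cong (d *_) (det-cong k (λ a b → cong (A (fs (inject₁ a))) (punchIn-inject j b))))))
            (solve 4 (λ s a d x → s :* a :* (d :* x) := d :* (s :* a :* x)) refl
              (signFin j) (A fz (inject₁ j)) d (det k (λ a b → A (fs (inject₁ a)) (inject₁ (punchIn j b)))))))
        (sumFin-scale (suc k) d (λ j → signFin j * A fz (inject₁ j) * det k (λ a b → A (fs (inject₁ a)) (inject₁ (punchIn j b))))))
      (trans (cong (signFin (fromℕ (suc k)) * A fz (fromℕ (suc k)) *_)
          (det-zero-row (suc k) (fromℕ k) (λ a b → A (fs a) (punchIn (fromℕ (suc k)) b)) (λ b → trans (cong (A (fromℕ (suc k))) (punchIn-last b)) (z b))))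
        (ℤ.*-zeroʳ (signFin (fromℕ (suc k)) * A fz (fromℕ (suc k))))))
      (ℤ.+-identityʳ _))

  det-adjacent : ∀ k (A : Matrix k) (i j : Fin k) → toℕ j ≡ suc (toℕ i) → (∀ b → A i b ≡ A j b) → det k A ≡ 0ℤ
  det-adjacent (suc zero)    A fz (fs ()) e rows
  det-adjacent (suc (suc k)) A i (fs j) e rows = det-equal-rows k j A λ b →
    trans (cong (λ i → A i b) (toℕ-injective (trans (toℕ-inject₁ j) (suc-injective e)))) (rows b)

-- Total positivity and bidiagonal bordering

module TotalPositivity where

  open import Defs hiding (B)
  open Determinants
  open import Data.Nat using (ℕ; zero; suc; pred; z≤n; s≤s; _<?_; _≤?_; _∸_) renaming (_<_ to _<ℕ_; _≤_ to _≤ℕ_; _+_ to _+ℕ_)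
  import Data.Nat.Properties as ℕ
  open import Data.Integer using (ℤ; +_; -_; _+_; _*_; _≤_; _<_; 0ℤ; +≤+; +<+; positive; nonNegative)
  import Data.Integer.Properties as ℤ
  open import Data.Bool using (Bool; true; false; if_then_else_)
  open import Data.Fin using (Fin; inject₁; fromℕ; fromℕ<; toℕ; _≟_) renaming (zero to fz; suc to fs)
  import Data.Fin.Properties as Fin
  open import Data.Product using (Σ; ∃; _×_; _,_)
  open import Data.Sum using (_⊎_; inj₁; inj₂)
  open import Data.Empty using (⊥-elim)
  open import Relation.Nullary using (yes; no; does)
  open import Relation.Nullary.Decidable using (dec-true; dec-false)
  open import Relation.Binary.PropositionalEquality
  open import Function using (_∘_)

  Increasing : ∀ {k} → (Fin k → ℕ) → Set
  Increasing r = ∀ a b → toℕ a <ℕ toℕ b → r a <ℕ r b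

  *-nonneg : ∀ x y → 0ℤ ≤ x → 0ℤ ≤ y → 0ℤ ≤ x * y
  *-nonneg x y p q = subst (_≤ x * y) (ℤ.*-zeroʳ x) (ℤ.*-monoˡ-≤-nonNeg x {{nonNegative p}} q)

  *-pos : ∀ x y → 0ℤ < x → 0ℤ < y → 0ℤ < x * y
  *-pos x y p q = subst (_< x * y) (ℤ.*-zeroʳ x) (ℤ.*-monoˡ-<-pos x {{positive p}} q)

  +-nonneg : ∀ x y → 0ℤ ≤ x → 0ℤ ≤ y → 0ℤ ≤ x + y
  +-nonneg x y p q = ℤ.+-mono-≤ {0ℤ} {x} {0ℤ} {y} p q

  +-posˡ : ∀ x y → 0ℤ < x → 0ℤ ≤ y → 0ℤ < x + y
  +-posˡ x y p q = ℤ.+-mono-<-≤ {0ℤ} {x} {0ℤ} {y} p q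

  +-posʳ : ∀ x y → 0ℤ ≤ x → 0ℤ < y → 0ℤ < x + y
  +-posʳ x y p q = ℤ.+-mono-≤-< {0ℤ} {x} {0ℤ} {y} p q

  strict? : ∀ k (ρ : Fin k → ℕ) → (∀ a b → toℕ a <ℕ toℕ b → ρ a ≤ℕ ρ b) →
            Increasing ρ ⊎ ∃ λ (i : Fin k) → ∃ λ j → toℕ j ≡ suc (toℕ i) × ρ i ≡ ρ j
  strict? zero ρ weak = inj₁ λ ()
  strict? (suc zero) ρ weak = inj₁ λ { fz fz () }
  strict? (suc (suc k)) ρ weak with ρ fz ℕ.≟ ρ (fs fz) | strict? (suc k) (ρ ∘ fs) (λ a b p → weak (fs a) (fs b) (s≤s p))
  ... | yes e | _ = inj₂ (fz , fs fz , refl , e)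
  ... | no ne | inj₂ (i , j , p , e) = inj₂ (fs i , fs j , cong suc p , e)
  ... | no ne | inj₁ inc = inj₁ increasing
    where
    first : ρ fz <ℕ ρ (fs fz)
    first = ℕ.≤∧≢⇒< (weak fz (fs fz) (s≤s z≤n)) ne
    increasing : Increasing ρ
    increasing fz     (fs fz)     _       = first
    increasing fz     (fs (fs b)) _       = ℕ.<-trans first (inc fz (fs b) (s≤s z≤n))
    increasing (fs a) (fs b)      (s≤s p) = inc a b p

  lower : Bool → ℕ → ℕ
  lower true  p = p
  lower false p = pred p

  -- Replacing each row p of N by y p (row p) + z p (row p - 1): multilinearity expands the minors of the result into
  -- minors of N whose row indices are weakly increasing, and those with a repetition vanish.
  module RowOperation {k : ℕ} (N : ℕ → Fin k → ℤ) (bound : ℕ)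
    (minors : ∀ r → Increasing r → (∀ a → r a <ℕ bound) → 0ℤ ≤ det k (λ a → N (r a)))
    (y z : ℕ → ℤ) (y≥0 : ∀ p → 0ℤ ≤ y p) (z≥0 : ∀ p → 0ℤ ≤ z p)
    (r : Fin k → ℕ) (increasing : Increasing r) (bounded : ∀ a → r a <ℕ bound) where

    mix : ℕ → Fin k → ℤ
    mix p b = y p * N p b + z p * N (pred p) b

    coef : Bool → ℕ → ℤ
    coef true  = y
    coef false = z

    private
      update : (Fin k → Bool) → Fin k → Bool → Fin k → Bool
      update h i v a = if does (a ≟ i) then v else h a

      -- An intermediate matrix of the multilinear expansion: rows before `j` have been resolved to
      -- the choice recorded in `h`, the rest are still mixed.
      state : ℕ → (Fin k → Bool) → Matrix k
      state j h a with toℕ a <? j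
      ... | yes _ = N (lower (h a) (r a))
      ... | no _  = mix (r a)

      update-at : ∀ h i v → update h i v i ≡ v
      update-at h i v with i ≟ i
      ... | yes _ = refl
      ... | no q = ⊥-elim (q refl)

      update-off : ∀ h i v a → a ≢ i → update h i v a ≡ h a
      update-off h i v a a≢i with a ≟ i
      ... | yes q = ⊥-elim (a≢i q)
      ... | no _ = refl

      off : ∀ i v h a → a ≢ i → ∀ b → state (suc (toℕ i)) (update h i v) a b ≡ state (toℕ i) h a b
      off i v h a a≢i b with toℕ a <? suc (toℕ i) | toℕ a <? toℕ i
      ... | yes _ | yes _ = cong (λ c → N (lower c (r a)) b) (update-off h i v a a≢i)
      ... | no _ | no _ = refl
      ... | yes p | no q = ⊥-elim (a≢i (Fin.toℕ-injective (ℕ.≤-antisym (ℕ.≤-pred p) (ℕ.≮⇒≥ q))))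
      ... | no p | yes q = ⊥-elim (p (ℕ.≤-trans q (ℕ.n≤1+n (toℕ i))))

      on : ∀ i v h b → state (suc (toℕ i)) (update h i v) i b ≡ N (lower v (r i)) b
      on i v h b with toℕ i <? suc (toℕ i)
      ... | no p = ⊥-elim (p ℕ.≤-refl)
      ... | yes _ = cong (λ c → N (lower c (r i)) b) (update-at h i v)

      before : ∀ i h b → state (toℕ i) h i b ≡ mix (r i) b
      before i h b with toℕ i <? toℕ i
      ... | yes p = ⊥-elim (ℕ.<-irrefl refl p)
      ... | no _ = refl

      split : ∀ i h → det k (state (toℕ i) h) ≡
              y (r i) * det k (state (suc (toℕ i)) (update h i true)) + z (r i) * det k (state (suc (toℕ i)) (update h i false))
      split i h = det-row-linear k i (y (r i)) (z (r i)) (state (suc (toℕ i)) (update h i true))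
        (state (suc (toℕ i)) (update h i false)) (state (toℕ i) h) (off i true h) (off i false h)
        (λ b → trans (before i h b) (sym (cong₂ (λ s t → y (r i) * s + z (r i) * t) (on i true h b) (on i false h b))))

      finished : ∀ h a b → state k h a b ≡ N (lower (h a) (r a)) b
      finished h a b with toℕ a <? k
      ... | yes _ = refl
      ... | no p = ⊥-elim (p (Fin.toℕ<n a))

      lower-≤ : ∀ v p → lower v p ≤ℕ p
      lower-≤ true  p = ℕ.≤-refl
      lower-≤ false p = ℕ.pred[n]≤n

      pred-≤ : ∀ v p → pred p ≤ℕ lower v p
      pred-≤ true  p = ℕ.pred[n]≤n
      pred-≤ false p = ℕ.≤-refl

      chosen≥0 : ∀ (h : Fin k → Bool) → 0ℤ ≤ det k (λ a → N (lower (h a) (r a)))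
      chosen≥0 h with strict? k (λ a → lower (h a) (r a))
          (λ a b p → ℕ.≤-trans (lower-≤ (h a) (r a)) (ℕ.≤-trans (ℕ.pred-mono-≤ (increasing a b p)) (pred-≤ (h b) (r b))))
      ... | inj₁ inc = minors (λ a → lower (h a) (r a)) inc (λ a → ℕ.≤-<-trans (lower-≤ (h a) (r a)) (bounded a))
      ... | inj₂ (i , j , p , e) = ℤ.≤-reflexive (sym (det-adjacent k (λ a → N (lower (h a) (r a))) i j p (λ b → cong (λ p → N p b) e)))

      state≥0 : ∀ d j → j +ℕ d ≡ k → ∀ h → 0ℤ ≤ det k (state j h)
      state≥0 zero j e h with trans (sym (ℕ.+-identityʳ j)) e
      ... | refl = subst (0ℤ ≤_) (sym (det-cong k (finished h))) (chosen≥0 h)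
      state≥0 (suc d) j e h = subst (λ j → 0ℤ ≤ det k (state j h)) i≡j
        (subst (0ℤ ≤_) (sym (split i h)) (+-nonneg (y (r i) * det k (state (suc (toℕ i)) (update h i true))) (z (r i) * det k (state (suc (toℕ i)) (update h i false)))
          (*-nonneg (y (r i)) (det k (state (suc (toℕ i)) (update h i true))) (y≥0 (r i)) (state≥0 d (suc (toℕ i)) e' (update h i true)))
          (*-nonneg (z (r i)) (det k (state (suc (toℕ i)) (update h i false))) (z≥0 (r i)) (state≥0 d (suc (toℕ i)) e' (update h i false)))))
        where
        j<k : j <ℕ k
        j<k = subst (suc j ≤ℕ_) (trans (sym (ℕ.+-suc j d)) e) (ℕ.m≤m+n (suc j) d)
        i = fromℕ< j<k
        i≡j : toℕ i ≡ j
        i≡j = Fin.toℕ-fromℕ< j<k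
        e' : suc (toℕ i) +ℕ d ≡ k
        e' = trans (cong (λ j → suc j +ℕ d) i≡j) (trans (sym (ℕ.+-suc j d)) e)

      module _ (h : Fin k → Bool) (h>0 : ∀ a → 0ℤ < coef (h a) (r a)) (goal : 0ℤ < det k (λ a → N (lower (h a) (r a)))) where

        update-same : ∀ i v → h i ≡ v → ∀ a → update h i v a ≡ h a
        update-same i v e a with a ≟ i
        ... | yes refl = sym e
        ... | no _ = refl

        state-cong : ∀ j {h h'} → (∀ a → h a ≡ h' a) → ∀ a b → state j h a b ≡ state j h' a b
        state-cong j e a b with toℕ a <? j
        ... | yes _ = cong (λ v → N (lower v (r a)) b) (e a)
        ... | no _ = refl

        state>0 : ∀ d j → j +ℕ d ≡ k → 0ℤ < det k (state j h)
        state>0 zero j e with trans (sym (ℕ.+-identityʳ j)) e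
        ... | refl = subst (0ℤ <_) (sym (det-cong k (finished h))) goal
        state>0 (suc d) j e = subst (λ j → 0ℤ < det k (state j h)) i≡j (subst (0ℤ <_) (sym (split i h)) (pick (h i) refl))
          where
          j<k : j <ℕ k
          j<k = subst (suc j ≤ℕ_) (trans (sym (ℕ.+-suc j d)) e) (ℕ.m≤m+n (suc j) d)
          i = fromℕ< j<k
          i≡j : toℕ i ≡ j
          i≡j = Fin.toℕ-fromℕ< j<k
          e' : suc (toℕ i) +ℕ d ≡ k
          e' = trans (cong (λ j → suc j +ℕ d) i≡j) (trans (sym (ℕ.+-suc j d)) e)
          next : ∀ v → h i ≡ v → 0ℤ < coef v (r i) * det k (state (suc (toℕ i)) (update h i v))
          next v q = *-pos (coef v (r i)) (det k (state (suc (toℕ i)) (update h i v))) (subst (λ v → 0ℤ < coef v (r i)) q (h>0 i))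
            (subst (0ℤ <_) (sym (det-cong k (state-cong (suc (toℕ i)) (update-same i v q)))) (state>0 d (suc (toℕ i)) e'))
          pick : ∀ v → h i ≡ v → 0ℤ < y (r i) * det k (state (suc (toℕ i)) (update h i true)) + z (r i) * det k (state (suc (toℕ i)) (update h i false))
          pick true  q = +-posˡ (y (r i) * det k (state (suc (toℕ i)) (update h i true))) (z (r i) * det k (state (suc (toℕ i)) (update h i false))) (next true q) (*-nonneg (z (r i)) (det k (state (suc (toℕ i)) (update h i false))) (z≥0 (r i)) (state≥0 d (suc (toℕ i)) e' (update h i false)))
          pick false q = +-posʳ (y (r i) * det k (state (suc (toℕ i)) (update h i true))) (z (r i) * det k (state (suc (toℕ i)) (update h i false))) (*-nonneg (y (r i)) (det k (state (suc (toℕ i)) (update h i true))) (y≥0 (r i)) (state≥0 d (suc (toℕ i)) e' (update h i true))) (next false q)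

    mix≥0 : 0ℤ ≤ det k (λ a → mix (r a))
    mix≥0 = state≥0 k 0 refl (λ _ → true)

    -- All terms of the expansion are nonnegative, so a single choice `h` with positive coefficients
    -- and a positive minor suffices.
    mix>0 : ∀ h → (∀ a → 0ℤ < coef (h a) (r a)) → 0ℤ < det k (λ a → N (lower (h a) (r a))) → 0ℤ < det k (λ a → mix (r a))
    mix>0 h h>0 goal = state>0 h h>0 goal k 0 refl

  -- Natural number indices make `pred` and the additional index `n` available without casts. The
  -- empty minor is included and equals 1, which serves a minor consisting of the corner alone.
  TP : ℕ → (ℕ → ℕ → ℤ) → Set
  TP n M = ∀ K (r c : Fin K → ℕ) → Increasing r → Increasing c → (∀ a → r a <ℕ n) → (∀ b → c b <ℕ n) →
           0ℤ < det K (λ a b → M (r a) (c b))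

  block : ℕ → ℤ → (ℕ → ℕ → ℤ) → ℕ → ℕ → ℤ
  block n d M i j with i ℕ.≟ n | j ℕ.≟ n
  ... | yes _ | yes _ = d
  ... | yes _ | no _  = 0ℤ
  ... | no _  | yes _ = 0ℤ
  ... | no _  | no _  = M i j

  -- Y (M ⊕ d) Yᵀ for the lower bidiagonal matrix Y with diagonal y and subdiagonal z
  bordered : ℕ → ℕ → (ℕ → ℕ) → (ℕ → ℕ) → (ℕ → ℕ → ℤ) → ℕ → ℕ → ℤ
  bordered n d y z M p q =
    + y q * (+ y p * block n (+ d) M p q + + z p * block n (+ d) M (pred p) q) +
    + z q * (+ y p * block n (+ d) M p (pred q) + + z p * block n (+ d) M (pred p) (pred q))

  increasing-bound : ∀ {K N} (r : Fin K → ℕ) → Increasing r → (∀ a → r a <ℕ N) →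
                     ∀ d a → toℕ a +ℕ suc d ≡ K → r a +ℕ suc d ≤ℕ N
  increasing-bound {N = N} r inc bd zero a e = subst (_≤ℕ N) (ℕ.+-comm 1 (r a)) (bd a)
  increasing-bound {K} {N} r inc bd (suc d) a e =
    ℕ.≤-trans (ℕ.≤-reflexive (ℕ.+-suc (r a) (suc d)))
      (ℕ.≤-trans (ℕ.+-monoˡ-≤ (suc d) (inc a b (subst (toℕ a <ℕ_) (sym b≡) ℕ.≤-refl)))
        (increasing-bound r inc bd d b (trans (cong (_+ℕ suc d) b≡) (trans (sym (ℕ.+-suc (toℕ a) (suc d))) e))))
    where
    a<K : suc (toℕ a) <ℕ K
    a<K = subst (suc (suc (toℕ a)) ≤ℕ_) (trans (sym (trans (ℕ.+-suc (toℕ a) (suc d)) (cong suc (ℕ.+-suc (toℕ a) d)))) e)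
            (s≤s (s≤s (ℕ.m≤m+n (toℕ a) d)))
    b = fromℕ< a<K
    b≡ : toℕ b ≡ suc (toℕ a)
    b≡ = Fin.toℕ-fromℕ< a<K

  size-bound : ∀ {K N} (r : Fin K → ℕ) → Increasing r → (∀ a → r a <ℕ N) → K ≤ℕ N
  size-bound {zero}  r inc bd = z≤n
  size-bound {suc k} r inc bd = ℕ.≤-trans (ℕ.m≤n+m (suc k) (r fz)) (increasing-bound r inc bd k fz refl)

  -- row indices in [0, n] can be lowered by at most one, staying increasing, so as to avoid n
  avoid : ∀ {K n} → K ≤ℕ n → (r : Fin K → ℕ) → Increasing r → (∀ a → r a <ℕ suc n) →
          Σ (Fin K → Bool) λ h → Increasing (λ a → lower (h a) (r a)) × (∀ a → lower (h a) (r a) <ℕ n) × (∀ a → h a ≡ false → 0 <ℕ r a)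
  avoid {K} {n} K≤n r inc bd = h , increasing , (λ a → ℕ.≤-<-trans (lower≤cap a) (cap<n a)) , positive-if
    where
    -- The largest value that position `a` of an increasing sequence of length `K` below `n` can
    -- take. When the value `n` is also allowed, `r a` exceeds it by at most one, so lowering
    -- exactly those positions is enough.
    cap : Fin K → ℕ
    cap a = (n ∸ K) +ℕ toℕ a
    h : Fin K → Bool
    h a = does (r a ≤? cap a)
    facts : ∀ a → (h a ≡ true × r a ≤ℕ cap a) ⊎ (h a ≡ false × cap a <ℕ r a)
    facts a with r a ≤? cap a
    ... | yes p = inj₁ (dec-true (r a ≤? cap a) p , p)
    ... | no p  = inj₂ (dec-false (r a ≤? cap a) p , ℕ.≰⇒> p)
    cap<n : ∀ a → cap a <ℕ n
    cap<n a = subst (cap a <ℕ_) (ℕ.m∸n+n≡m K≤n) (ℕ.+-monoʳ-< (n ∸ K) (Fin.toℕ<n a))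
    r≤ : ∀ a → r a ≤ℕ suc (cap a)
    r≤ a = ℕ.+-cancelʳ-≤ (suc d) (r a) (suc (cap a)) (ℕ.≤-trans (increasing-bound r inc bd d a e)
      (ℕ.≤-reflexive (cong suc (trans (sym (ℕ.m∸n+n≡m K≤n)) (trans (cong ((n ∸ K) +ℕ_) (sym e)) (sym (ℕ.+-assoc (n ∸ K) (toℕ a) (suc d))))))))
      where
      d = K ∸ suc (toℕ a)
      e : toℕ a +ℕ suc d ≡ K
      e = trans (ℕ.+-suc (toℕ a) d) (ℕ.m+[n∸m]≡n (Fin.toℕ<n a))
    lower≤cap : ∀ a → lower (h a) (r a) ≤ℕ cap a
    lower≤cap a with facts a
    ... | inj₁ (e , p) = subst (λ v → lower v (r a) ≤ℕ cap a) (sym e) p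
    ... | inj₂ (e , p) = subst (λ v → lower v (r a) ≤ℕ cap a) (sym e) (ℕ.pred-mono-≤ (r≤ a))
    positive-if : ∀ a → h a ≡ false → 0 <ℕ r a
    positive-if a e with facts a
    ... | inj₁ (e' , _) with trans (sym e) e'
    ... | ()
    positive-if a e | inj₂ (_ , p) = ℕ.≤-trans (s≤s z≤n) p
    lower≤ : ∀ v p → lower v p ≤ℕ p
    lower≤ true  p = ℕ.≤-refl
    lower≤ false p = ℕ.pred[n]≤n
    increasing : Increasing (λ a → lower (h a) (r a))
    increasing a b a<b with facts b
    ... | inj₁ (e , _) = subst (λ v → lower (h a) (r a) <ℕ lower v (r b)) (sym e) (ℕ.≤-<-trans (lower≤ (h a) (r a)) (inc a b a<b))
    ... | inj₂ (e , p) = subst (λ v → lower (h a) (r a) <ℕ lower v (r b)) (sym e)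
            (ℕ.≤-<-trans (lower≤cap a) (ℕ.<-≤-trans (ℕ.+-monoʳ-< (n ∸ K) a<b) (ℕ.pred-mono-≤ p)))

  module Bordered (n d : ℕ) (d>0 : 0 <ℕ d) (y z : ℕ → ℕ) (y>0 : ∀ p → p ≤ℕ n → 0 <ℕ y p) (z>0 : ∀ p → 0 <ℕ p → p ≤ℕ n → 0 <ℕ z p)
                  (M : ℕ → ℕ → ℤ) (tp : TP n M) where

    private
      N : ℕ → ℕ → ℤ
      N = block n (+ d) M

      Hits : ∀ {K} → (Fin K → ℕ) → Set
      Hits r = ∃ λ a → r a ≡ n

      hits? : ∀ {K} (r : Fin K → ℕ) → (∀ a → r a <ℕ suc n) → Hits r ⊎ (∀ a → r a <ℕ n)
      hits? r bd with Fin.any? (λ a → r a ℕ.≟ n)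
      ... | yes p = inj₁ p
      ... | no p = inj₂ λ a → ℕ.≤∧≢⇒< (ℕ.≤-pred (bd a)) (λ e → p (a , e))

      N-inner : ∀ {i j} → i <ℕ n → j <ℕ n → N i j ≡ M i j
      N-inner {i} {j} p q with i ℕ.≟ n | j ℕ.≟ n
      ... | yes refl | _ = ⊥-elim (ℕ.<-irrefl refl p)
      ... | no _ | yes refl = ⊥-elim (ℕ.<-irrefl refl q)
      ... | no _ | no _ = refl

      N-row : ∀ {i j} → i ≡ n → j <ℕ n → N i j ≡ 0ℤ
      N-row {i} {j} p q with i ℕ.≟ n | j ℕ.≟ n
      ... | no ne | _ = ⊥-elim (ne p)
      ... | yes _ | yes refl = ⊥-elim (ℕ.<-irrefl refl q)
      ... | yes _ | no _ = refl

      N-column : ∀ {i j} → i <ℕ n → j ≡ n → N i j ≡ 0ℤ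
      N-column {i} {j} p q with i ℕ.≟ n | j ℕ.≟ n
      ... | yes refl | _ = ⊥-elim (ℕ.<-irrefl refl p)
      ... | no _ | no ne = ⊥-elim (ne q)
      ... | no _ | yes _ = refl

      N-corner : ∀ {i j} → i ≡ n → j ≡ n → N i j ≡ + d
      N-corner {i} {j} p q with i ℕ.≟ n | j ℕ.≟ n
      ... | yes _ | yes _ = refl
      ... | no ne | _ = ⊥-elim (ne p)
      ... | yes _ | no ne = ⊥-elim (ne q)

      last-hit : ∀ {k} (r : Fin (suc k) → ℕ) → Increasing r → (∀ a → r a <ℕ suc n) → Hits r → r (fromℕ k) ≡ n
      last-hit {k} r inc bd (a , e) with toℕ a ℕ.<? k
      ... | no p = subst (λ b → r b ≡ n) (Fin.toℕ-injective (trans (ℕ.≤-antisym (ℕ.≤-pred (Fin.toℕ<n a)) (ℕ.≮⇒≥ p)) (sym (Fin.toℕ-fromℕ k)))) e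
      ... | yes p = ⊥-elim (ℕ.<-irrefl refl (ℕ.≤-trans (bd (fromℕ k)) (subst (_<ℕ r (fromℕ k)) e (inc a (fromℕ k) (subst (toℕ a <ℕ_) (sym (Fin.toℕ-fromℕ k)) p)))))

      rest : ∀ {k} (r : Fin (suc k) → ℕ) → Increasing r → r (fromℕ k) ≡ n → ∀ a → r (inject₁ a) <ℕ n
      rest {k} r inc e a = subst (r (inject₁ a) <ℕ_) e (inc (inject₁ a) (fromℕ k)
        (subst₂ _<ℕ_ (sym (Fin.toℕ-inject₁ a)) (sym (Fin.toℕ-fromℕ k)) (Fin.toℕ<n a)))

      inner>0 : ∀ K (r c : Fin K → ℕ) → Increasing r → Increasing c → (∀ a → r a <ℕ n) → (∀ b → c b <ℕ n) → 0ℤ < det K (λ a b → N (r a) (c b))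
      inner>0 K r c ir ic br bc = subst (0ℤ <_) (det-cong K (λ a b → sym (N-inner (br a) (bc b)))) (tp K r c ir ic br bc)

      corner>0 : ∀ K (r c : Fin K → ℕ) → Increasing r → Increasing c → (∀ a → r a <ℕ suc n) → (∀ b → c b <ℕ suc n) →
                 Hits r → Hits c → 0ℤ < det K (λ a b → N (r a) (c b))
      corner>0 (suc k) r c ir ic br bc hr hc = subst (0ℤ <_)
        (sym (det-corner k (+ d) (λ a b → N (r a) (c b)) (λ b → N-row er (rest c ic ec b)) (N-corner er ec)))
        (*-pos (+ d) (det k (λ a b → N (r (inject₁ a)) (c (inject₁ b)))) (+<+ d>0)
          (inner>0 k (r ∘ inject₁) (c ∘ inject₁)
            (λ a b p → ir (inject₁ a) (inject₁ b) (subst₂ _<ℕ_ (sym (Fin.toℕ-inject₁ a)) (sym (Fin.toℕ-inject₁ b)) p))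
            (λ a b p → ic (inject₁ a) (inject₁ b) (subst₂ _<ℕ_ (sym (Fin.toℕ-inject₁ a)) (sym (Fin.toℕ-inject₁ b)) p))
            (rest r ir er) (rest c ic ec)))
        where
        er = last-hit r ir br hr
        ec = last-hit c ic bc hc

      -- A minor of M ⊕ d containing the new row but not the new column, or conversely, has a zero
      -- line; the others are minors of M, possibly times d.
      N≥0 : ∀ K (r c : Fin K → ℕ) → Increasing r → Increasing c → (∀ a → r a <ℕ suc n) → (∀ b → c b <ℕ suc n) → 0ℤ ≤ det K (λ a b → N (r a) (c b))
      N≥0 K r c ir ic br bc with hits? r br | hits? c bc
      ... | inj₁ hr | inj₁ hc = ℤ.<⇒≤ (corner>0 K r c ir ic br bc hr hc)
      ... | inj₂ br' | inj₂ bc' = ℤ.<⇒≤ (inner>0 K r c ir ic br' bc')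
      ... | inj₁ (a , e) | inj₂ bc' = ℤ.≤-reflexive (sym (det-zero-row K a (λ a b → N (r a) (c b)) (λ b → N-row e (bc' b))))
      ... | inj₂ br' | inj₁ (b , e) = ℤ.≤-reflexive (sym (trans (sym (det-transpose K (λ a b → N (r a) (c b))))
              (det-zero-row K b (λ b a → N (r a) (c b)) (λ a → N-column (br' a) e))))

      y≥0 : ∀ p → 0ℤ ≤ + y p
      y≥0 p = +≤+ z≤n
      z≥0 : ∀ p → 0ℤ ≤ + z p
      z≥0 p = +≤+ z≤n

      B : ℕ → ℕ → ℤ
      B p q = + y p * N p q + + z p * N (pred p) q

      module Rows {K} (r c : Fin K → ℕ) (ir : Increasing r) (ic : Increasing c) (br : ∀ a → r a <ℕ suc n) (bc : ∀ b → c b <ℕ suc n) =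
        RowOperation (λ p b → N p (c b)) (suc n) (λ r' ir' br' → N≥0 K r' c ir' ic br' bc) (λ p → + y p) (λ p → + z p) y≥0 z≥0 r ir br

      chosen>0 : ∀ p v → p <ℕ suc n → (v ≡ false → 0 <ℕ p) → 0ℤ < (if v then + y p else + z p)
      chosen>0 p true  b f = +<+ (y>0 p (ℕ.≤-pred b))
      chosen>0 p false b f = +<+ (z>0 p (f refl) (ℕ.≤-pred b))

      -- The product Y (M ⊕ d) is not totally positive: its last column vanishes outside the last
      -- row. Minors with that column and without that row are zero, which is why the alternative
      -- `Hits r ⊎ …` is assumed. When column `n` is absent, the rows are lowered so as to avoid `n`
      -- too.
      B>0 : ∀ K (r c : Fin K → ℕ) → Increasing r → Increasing c → (∀ a → r a <ℕ suc n) → (∀ b → c b <ℕ suc n) →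
            Hits r ⊎ (∀ b → c b <ℕ n) → 0ℤ < det K (λ a b → B (r a) (c b))
      B>0 K r c ir ic br bc side with hits? c bc | side
      ... | inj₁ hc | inj₁ hr = Rows.mix>0 r c ir ic br bc (λ _ → true) (λ a → +<+ (y>0 (r a) (ℕ.≤-pred (br a)))) (corner>0 K r c ir ic br bc hr hc)
      ... | inj₁ (b , e) | inj₂ bc' = ⊥-elim (ℕ.<-irrefl e (bc' b))
      ... | inj₂ bc' | _ with avoid (size-bound c ic bc') r ir br
      ... | h , inc , bd , pos = Rows.mix>0 r c ir ic br bc h
              (λ a → coefs (h a) (r a) (chosen>0 (r a) (h a) (br a) (pos a)))
              (inner>0 K (λ a → lower (h a) (r a)) c inc ic bd bc')
        where
        coefs : ∀ v p → 0ℤ < (if v then + y p else + z p) → 0ℤ < Rows.coef r c ir ic br bc v p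
        coefs true  p q = q
        coefs false p q = q

      B≥0 : ∀ K (r c : Fin K → ℕ) → Increasing r → Increasing c → (∀ a → r a <ℕ suc n) → (∀ b → c b <ℕ suc n) → 0ℤ ≤ det K (λ a b → B (r a) (c b))
      B≥0 K r c ir ic br bc = Rows.mix≥0 r c ir ic br bc

      module Columns {K} (r c : Fin K → ℕ) (ir : Increasing r) (ic : Increasing c) (br : ∀ a → r a <ℕ suc n) (bc : ∀ b → c b <ℕ suc n) =
        RowOperation (λ q a → B (r a) q) (suc n)
          (λ c' ic' bc' → subst (0ℤ ≤_) (sym (det-transpose K (λ a b → B (r a) (c' b)))) (B≥0 K r c' ir ic' br bc'))
          (λ p → + y p) (λ p → + z p) y≥0 z≥0 c ic bc

    bordered-tp : TP (suc n) (bordered n d y z M)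
    bordered-tp K r c ir ic br bc = subst (0ℤ <_) (det-transpose K (λ a b → bordered n d y z M (r a) (c b))) goal
      where
      flipped : ∀ c' → Increasing c' → (∀ b → c' b <ℕ suc n) → Hits r ⊎ (∀ b → c' b <ℕ n) → 0ℤ < det K (λ b a → B (r a) (c' b))
      flipped c' ic' bc' side = subst (0ℤ <_) (sym (det-transpose K (λ a b → B (r a) (c' b)))) (B>0 K r c' ir ic' br bc' side)
      coefs : ∀ v p → 0ℤ < (if v then + y p else + z p) → 0ℤ < Columns.coef r c ir ic br bc v p
      coefs true  p q = q
      coefs false p q = q
      goal : 0ℤ < det K (λ b a → bordered n d y z M (r a) (c b))
      -- If row `n` is used, `B>0` holds for all columns and the diagonal choice suffices; otherwise
      -- the columns are lowered to avoid `n`.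
      goal with hits? r br
      ... | inj₁ hr = Columns.mix>0 r c ir ic br bc (λ _ → true) (λ b → +<+ (y>0 (c b) (ℕ.≤-pred (bc b)))) (flipped c ic bc (inj₁ hr))
      ... | inj₂ br' with avoid (size-bound r ir br') c ic bc
      ... | h , inc , bd , pos = Columns.mix>0 r c ir ic br bc h
              (λ b → coefs (h b) (c b) (chosen>0 (c b) (h b) (bc b) (pos b)))
              (flipped (λ b → lower (h b) (c b)) inc (λ b → ℕ.≤-trans (bd b) (ℕ.n≤1+n n)) (inj₂ bd))

-- Certificates of total positivity

module Factorisations where

  open import Defs hiding (B)
  open Determinants
  open TotalPositivity
  open Tries using (every; every-sound; ∧-true; sameℤ; sameℤ-sound)
  open import Data.Nat using (ℕ; zero; suc; z≤n; s≤s; _<ᵇ_) renaming (_<_ to _<ℕ_)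
  import Data.Nat.Properties as ℕ
  open import Data.Integer using (ℤ; +_; _*_; _<_; _^_; 0ℤ; +<+; nonNegative)
  import Data.Integer.Properties as ℤ
  open import Data.Bool using (Bool; true; _∧_)
  open import Data.Bool.Properties using (T-≡)
  open import Data.Fin using (Fin; toℕ) renaming (zero to fz)
  import Data.Fin.Properties as Fin
  open import Data.List using (List; []; _∷_; length; applyUpTo; upTo; allFin)
  import Data.List.Membership.Propositional.Properties as List
  open import Data.Product using (_×_; _,_)
  open import Function.Bundles using (Equivalence)
  open import Relation.Binary.PropositionalEquality
  open import Function using (_∘_)

  -- Scaling by C multiplies a minor of size k by C^k, so denominators in a factorisation can be
  -- cleared.
  tp⇒totallyPositive : ∀ {N} (M : Fin N → Fin N → ℕ) C → 0 <ℕ C → ∀ T → TP N T →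
                       (∀ i j → + C * + M i j ≡ T (toℕ i) (toℕ j)) → TotallyPositive M
  tp⇒totallyPositive M C C>0 T tp e k r c ir ic = unscale (suc k) (λ a b → + M (r a) (c b))
    (subst (0ℤ <_) (det-cong (suc k) (λ a b → sym (e (r a) (c b))))
      (tp (suc k) (toℕ ∘ r) (toℕ ∘ c) ir ic (Fin.toℕ<n ∘ r) (Fin.toℕ<n ∘ c)))
    where
    power>0 : ∀ k → 0ℤ < (+ C) ^ k
    power>0 zero    = +<+ (s≤s z≤n)
    power>0 (suc k) = *-pos (+ C) ((+ C) ^ k) (+<+ C>0) (power>0 k)
    unscale : ∀ k (A : Matrix k) → 0ℤ < det k (λ a b → + C * A a b) → 0ℤ < det k A
    unscale k A p = ℤ.*-cancelˡ-<-nonNeg ((+ C) ^ k) {{nonNegative (ℤ.<⇒≤ (power>0 k))}}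
      (subst₂ _<_ (sym (ℤ.*-zeroʳ ((+ C) ^ k))) (det-scale k (+ C) A) p)

  tp-cong : ∀ {n S T} → (∀ i j → i <ℕ n → j <ℕ n → S i j ≡ T i j) → TP n S → TP n T
  tp-cong e tp K r c ir ic br bc = subst (0ℤ <_) (det-cong K (λ a b → e (r a) (c b) (br a) (bc b))) (tp K r c ir ic br bc)

  tp-empty : ∀ T → TP 0 T
  tp-empty T zero    r c ir ic br bc = +<+ (s≤s z≤n)
  tp-empty T (suc K) r c ir ic br bc with br fz
  ... | ()

  nth : {A : Set} → A → List A → ℕ → A
  nth d []       _       = d
  nth d (x ∷ xs) zero    = x
  nth d (x ∷ xs) (suc i) = nth d xs i

  nth-applyUpTo : ∀ {A : Set} (d : A) f n i → i <ℕ n → nth d (applyUpTo f n) i ≡ f i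
  nth-applyUpTo d f (suc n) zero    _       = refl
  nth-applyUpTo d f (suc n) (suc i) (s≤s p) = nth-applyUpTo d (f ∘ suc) n i p

  entries : List (List ℤ) → ℕ → ℕ → ℤ
  entries xss i j = nth 0ℤ (nth [] xss i) j

  tabulate² : ℕ → (ℕ → ℕ → ℤ) → List (List ℤ)
  tabulate² n f = applyUpTo (λ i → applyUpTo (f i) n) n

  entries-tabulate² : ∀ n f i j → i <ℕ n → j <ℕ n → entries (tabulate² n f) i j ≡ f i j
  entries-tabulate² n f i j p q =
    trans (cong (λ xs → nth 0ℤ xs j) (nth-applyUpTo [] (λ i → applyUpTo (f i) n) n i p)) (nth-applyUpTo 0ℤ (f i) n j q)

  -- the data d, y, z of a factorisation Y (M ⊕ d) Yᵀ
  Level : Set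
  Level = ℕ × List ℕ × List ℕ

  -- Built from the end of the list outwards: the last level gives a 1 × 1 matrix, and each earlier
  -- one adds a row and a column.
  table : List Level → List (List ℤ)
  table [] = []
  table ((d , y , z) ∷ ls) = next (table ls)
    where
    next : List (List ℤ) → List (List ℤ)
    next T = tabulate² (suc (length ls)) (bordered (length ls) d (nth 0 y) (nth 0 z) (entries T))

  <ᵇ-sound : ∀ m n → (m <ᵇ n) ≡ true → m <ℕ n
  <ᵇ-sound m n e = ℕ.<ᵇ⇒< m n (Equivalence.from T-≡ e)

  positiveUpTo : ℕ → (ℕ → ℕ) → Bool
  positiveUpTo n y = every (λ p → 0 <ᵇ y p) (upTo n)

  positiveUpTo-sound : ∀ n y → positiveUpTo n y ≡ true → ∀ p → p <ℕ n → 0 <ℕ y p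
  positiveUpTo-sound n y e p p<n = <ᵇ-sound 0 (y p) (every-sound _ (upTo n) e (List.∈-upTo⁺ p<n))

  valid : List Level → Bool
  valid [] = true
  valid ((d , y , z) ∷ ls) = (0 <ᵇ d) ∧ positiveUpTo (suc (length ls)) (nth 0 y) ∧ positiveUpTo (length ls) (nth 0 z ∘ suc) ∧ valid ls

  table-tp : ∀ ls → valid ls ≡ true → TP (length ls) (entries (table ls))
  table-tp [] _ = tp-empty _
  table-tp ((d , y , z) ∷ ls) e with ∧-true {0 <ᵇ d} e
  ... | p , e' with ∧-true {positiveUpTo (suc (length ls)) (nth 0 y)} e'
  ... | q , e″ with ∧-true {positiveUpTo (length ls) (nth 0 z ∘ suc)} e″
  ... | r , s = tp-cong (λ i j i< j< → sym (entries-tabulate² (suc (length ls)) (bordered (length ls) d (nth 0 y) (nth 0 z) (entries (table ls))) i j i< j<))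
    (Bordered.bordered-tp (length ls) d (<ᵇ-sound 0 d p) (nth 0 y) (nth 0 z)
      (λ p p≤ → positiveUpTo-sound _ (nth 0 y) q p (s≤s p≤)) (λ { (suc p) _ p≤ → positiveUpTo-sound _ (nth 0 z ∘ suc) r p p≤ })
      (entries (table ls)) (table-tp ls s))

  factorises : ∀ {N} → (Fin N → Fin N → ℕ) → ℕ → List Level → Bool
  factorises {N} M C ls = (0 <ᵇ C) ∧ valid ls ∧ agrees (table ls)
    where
    agrees : List (List ℤ) → Bool
    agrees T = every (λ i → every (λ j → sameℤ (+ C * + M i j) (entries T (toℕ i) (toℕ j))) (allFin N)) (allFin N)

  factorises-sound : ∀ {N} (M : Fin N → Fin N → ℕ) C ls → length ls ≡ N → factorises M C ls ≡ true → TotallyPositive M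
  factorises-sound {N} M C ls refl e with ∧-true {0 <ᵇ C} e
  ... | p , e' with ∧-true {valid ls} e'
  ... | q , r = tp⇒totallyPositive M C (<ᵇ-sound 0 C p) (entries (table ls)) (table-tp ls q)
    (λ i j → sameℤ-sound _ _ (every-sound _ (allFin N) (every-sound _ (allFin N) r (List.∈-allFin i)) (List.∈-allFin j)))

-- The exceptional groups

module Exceptional where

  open import Defs hiding (B; E6; E7; E8; F4; H3; H4)
  open Weights
  open CosetTables
  open Metamatrices
  open Diagrams
  open Factorisations
  open Tries using (∧-true)
  open import Data.Nat using (ℕ)
  open import Data.Bool using (Bool; true; _∧_)
  open import Data.Fin using (Fin)
  open import Data.List using ([]; _∷_)
  open import Data.Vec using (lookup) renaming ([] to []ᵛ; _∷_ to _∷ᵛ_)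
  open import Data.Maybe using (Maybe)
  open import Data.Product using (_×_; _,_; proj₁; proj₂)
  open import Relation.Binary.PropositionalEquality using (_≡_; refl)

  share : {A B : Set} → A → (A → B) → B
  share x f = f x

  -- The long numerals are palindromes of odd length, hence reflections. The one with 45 letters,
  -- the conjugate of the other by 4321234, commutes with H3; the one with 31 letters completes
  -- three simple reflections to a subsystem of type A4.
  systemsH : Maybe (System 3 (coxMatrix {3} bondH)) × Maybe (System 4 (coxMatrix {4} bondH))
  systemsH =
    share (groupOf (coxMatrix {1} bondA)
        (via point [] [] ∷
         via point [] (1 ∷ []) ∷ [])) λ a1 →
    share (groupOf (coxMatrix {2} bondA)
        (via a1 (1 ∷ []) [] ∷
         via point [] (1 ∷ 2 ∷ []) ∷ [])) λ a2 →
    share (groupOf (coxMatrix {3} bondA)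
        (via a2 (1 ∷ 2 ∷ []) [] ∷
         via a1 (3 ∷ []) (1 ∷ []) ∷
         via point [] (1 ∷ 2 ∷ 3 ∷ []) ∷ [])) λ a3 →
    share (groupOf (coxMatrix {4} bondA)
        (via a3 (1 ∷ 2 ∷ 3 ∷ []) [] ∷
         via a2 (3 ∷ 4 ∷ []) (1 ∷ []) ∷
         via point [] (1 ∷ 2 ∷ 3 ∷ 4 ∷ []) ∷ [])) λ a4 →
    share (groupOf (coxMatrix {2} bondH)
        (via a1 (1 ∷ []) [] ∷
         via point [] (1 ∷ 2 ∷ []) ∷ [])) λ i5 →
    share (groupOf (coxMatrix {3} bondH)
        (via i5 (1 ∷ 2 ∷ []) [] ∷
         via a2 (2 ∷ 3 ∷ []) [] ∷
         via a1 (1 ∷ []) (3 ∷ []) ∷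
         via point [] (1 ∷ 2 ∷ 3 ∷ []) ∷ [])) λ h3 →
    share (groupOf (coxMatrix {4} bondH)
        (via h3 (1 ∷ 2 ∷ 3 ∷ []) [] ∷
         via h3 (1 ∷ 2 ∷ 3 ∷ []) (432123412312123421231212132124321213214321234 ∷ []) ∷
         via a4 (2 ∷ 3 ∷ 4 ∷ 1231212342123121213212432121321 ∷ []) [] ∷
         via point [] (1 ∷ 2 ∷ 3 ∷ 4 ∷ []) ∷ [])) λ h4 →
    h3 , h4

  tableH3 : Table² 3
  tableH3 =
    ((120 ∷ᵛ 180 ∷ᵛ 62 ∷ᵛ 1 ∷ᵛ []ᵛ) ∷ᵛ
     (180 ∷ᵛ 288 ∷ᵛ 111 ∷ᵛ 3 ∷ᵛ []ᵛ) ∷ᵛ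
     (62 ∷ᵛ 111 ∷ᵛ 52 ∷ᵛ 3 ∷ᵛ []ᵛ) ∷ᵛ
     (1 ∷ᵛ 3 ∷ᵛ 3 ∷ᵛ 1 ∷ᵛ []ᵛ) ∷ᵛ []ᵛ)

  tableH4 : Table² 4
  tableH4 =
    ((14400 ∷ᵛ 28800 ∷ᵛ 17040 ∷ᵛ 2640 ∷ᵛ 1 ∷ᵛ []ᵛ) ∷ᵛ
     (28800 ∷ᵛ 58560 ∷ᵛ 35520 ∷ᵛ 5764 ∷ᵛ 4 ∷ᵛ []ᵛ) ∷ᵛ
     (17040 ∷ᵛ 35520 ∷ᵛ 22366 ∷ᵛ 3892 ∷ᵛ 6 ∷ᵛ []ᵛ) ∷ᵛ
     (2640 ∷ᵛ 5764 ∷ᵛ 3892 ∷ᵛ 772 ∷ᵛ 4 ∷ᵛ []ᵛ) ∷ᵛ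
     (1 ∷ᵛ 4 ∷ᵛ 6 ∷ᵛ 4 ∷ᵛ 1 ∷ᵛ []ᵛ) ∷ᵛ []ᵛ)

  -- Both parabolic subgroups of type B3 enter, each numbered from the double bond outwards; the two
  -- root lengths keep them from being conjugate.
  systemsF : Maybe (System 4 (coxMatrix {4} bondF))
  systemsF =
    share (groupOf (coxMatrix {1} bondA)
        (via point [] [] ∷
         via point [] (1 ∷ []) ∷ [])) λ a1 →
    share (groupOf (coxMatrix {2} bondA)
        (via a1 (1 ∷ []) [] ∷
         via point [] (1 ∷ 2 ∷ []) ∷ [])) λ a2 →
    share (groupOf (coxMatrix {2} bondB)
        (via a1 (1 ∷ []) [] ∷
         via a1 (2 ∷ []) [] ∷
         via point [] (1 ∷ 2 ∷ []) ∷ [])) λ b2 →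
    share (groupOf (coxMatrix {3} bondB)
        (via b2 (1 ∷ 2 ∷ []) [] ∷
         via a2 (2 ∷ 3 ∷ []) [] ∷
         via a1 (1 ∷ []) (3 ∷ []) ∷
         via point [] (1 ∷ 2 ∷ 3 ∷ []) ∷ [])) λ b3 →
    share (groupOf (coxMatrix {4} bondF)
        (via b3 (3 ∷ 2 ∷ 1 ∷ []) [] ∷
         via b3 (2 ∷ 3 ∷ 4 ∷ []) [] ∷
         via a2 (1 ∷ 2 ∷ []) (4 ∷ []) ∷
         via a2 (3 ∷ 4 ∷ []) (1 ∷ []) ∷
         via point [] (1 ∷ 2 ∷ 3 ∷ 4 ∷ []) ∷ [])) λ f4 →
    f4

  tableF4 : Table² 4
  tableF4 =
    ((1152 ∷ᵛ 2304 ∷ᵛ 1392 ∷ᵛ 240 ∷ᵛ 1 ∷ᵛ []ᵛ) ∷ᵛ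
     (2304 ∷ᵛ 4800 ∷ᵛ 3072 ∷ᵛ 580 ∷ᵛ 4 ∷ᵛ []ᵛ) ∷ᵛ
     (1392 ∷ᵛ 3072 ∷ᵛ 2134 ∷ᵛ 460 ∷ᵛ 6 ∷ᵛ []ᵛ) ∷ᵛ
     (240 ∷ᵛ 580 ∷ᵛ 460 ∷ᵛ 124 ∷ᵛ 4 ∷ᵛ []ᵛ) ∷ᵛ
     (1 ∷ᵛ 4 ∷ᵛ 6 ∷ᵛ 4 ∷ᵛ 1 ∷ᵛ []ᵛ) ∷ᵛ []ᵛ)

  -- The long numerals are reflections in the highest roots of D4, D5, D6, E6, E7 and E8, of length
  -- 2 h - 3 for the Coxeter number h. Adjoining such a root, as in the extended diagrams, yields
  -- the subsystems A1 × A5 of E6, A1 × D6 and A7 of E7, and A1 × E7 and D8 of E8. They reach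
  -- subsets `J` that the parabolic subgroups in the lists leave open.
  systemsE : Maybe (System 6 (coxMatrix {6} bondE)) × Maybe (System 7 (coxMatrix {7} bondE)) × Maybe (System 8 (coxMatrix {8} bondE))
  systemsE =
    share (groupOf (coxMatrix {1} bondA)
        (via point [] [] ∷
         via point [] (1 ∷ []) ∷ [])) λ a1 →
    share (groupOf (coxMatrix {2} bondA)
        (via a1 (1 ∷ []) [] ∷
         via point [] (1 ∷ 2 ∷ []) ∷ [])) λ a2 →
    share (groupOf (coxMatrix {3} bondA)
        (via a2 (1 ∷ 2 ∷ []) [] ∷
         via a1 (3 ∷ []) (1 ∷ []) ∷
         via point [] (1 ∷ 2 ∷ 3 ∷ []) ∷ [])) λ a3 →
    share (groupOf (coxMatrix {4} bondA)
        (via a3 (1 ∷ 2 ∷ 3 ∷ []) [] ∷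
         via a2 (3 ∷ 4 ∷ []) (1 ∷ []) ∷
         via point [] (1 ∷ 2 ∷ 3 ∷ 4 ∷ []) ∷ [])) λ a4 →
    share (groupOf (coxMatrix {5} bondA)
        (via a4 (1 ∷ 2 ∷ 3 ∷ 4 ∷ []) [] ∷
         via a3 (3 ∷ 4 ∷ 5 ∷ []) (1 ∷ []) ∷
         via a2 (4 ∷ 5 ∷ []) (1 ∷ 2 ∷ []) ∷
         via point [] (1 ∷ 2 ∷ 3 ∷ 4 ∷ 5 ∷ []) ∷ [])) λ a5 →
    share (groupOf (coxMatrix {6} bondA)
        (via a5 (1 ∷ 2 ∷ 3 ∷ 4 ∷ 5 ∷ []) [] ∷
         via a4 (3 ∷ 4 ∷ 5 ∷ 6 ∷ []) (1 ∷ []) ∷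
         via a3 (4 ∷ 5 ∷ 6 ∷ []) (1 ∷ 2 ∷ []) ∷
         via point [] (1 ∷ 2 ∷ 3 ∷ 4 ∷ 5 ∷ 6 ∷ []) ∷ [])) λ a6 →
    share (groupOf (coxMatrix {7} bondA)
        (via a6 (1 ∷ 2 ∷ 3 ∷ 4 ∷ 5 ∷ 6 ∷ []) [] ∷
         via a5 (1 ∷ 2 ∷ 3 ∷ 4 ∷ 5 ∷ []) (7 ∷ []) ∷
         via a4 (4 ∷ 5 ∷ 6 ∷ 7 ∷ []) (1 ∷ 2 ∷ []) ∷
         via a3 (5 ∷ 6 ∷ 7 ∷ []) (1 ∷ 2 ∷ 3 ∷ []) ∷
         via point [] (1 ∷ 2 ∷ 3 ∷ 4 ∷ 5 ∷ 6 ∷ 7 ∷ []) ∷ [])) λ a7 →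
    share (groupOf (coxMatrix {4} bondD)
        (via a3 (1 ∷ 3 ∷ 2 ∷ []) [] ∷
         via a3 (2 ∷ 3 ∷ 4 ∷ []) [] ∷
         via a3 (1 ∷ 3 ∷ 4 ∷ []) [] ∷
         via a1 (342313243 ∷ []) (1 ∷ 2 ∷ 4 ∷ []) ∷
         via point [] (1 ∷ 2 ∷ 3 ∷ 4 ∷ []) ∷ [])) λ d4 →
    share (groupOf (coxMatrix {5} bondD)
        (via d4 (1 ∷ 2 ∷ 3 ∷ 4 ∷ []) [] ∷
         via a4 (2 ∷ 3 ∷ 4 ∷ 5 ∷ []) [] ∷
         via a3 (4 ∷ 5 ∷ 342313243 ∷ []) (1 ∷ 2 ∷ []) ∷
         via a1 (2 ∷ []) (1 ∷ 4 ∷ 5 ∷ 342313243 ∷ []) ∷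
         via point [] (1 ∷ 2 ∷ 3 ∷ 4 ∷ 5 ∷ []) ∷ [])) λ d5 →
    share (groupOf (coxMatrix {6} bondD)
        (via d5 (1 ∷ 2 ∷ 3 ∷ 4 ∷ 5 ∷ []) [] ∷
         via a5 (1 ∷ 3 ∷ 4 ∷ 5 ∷ 6 ∷ []) [] ∷
         via a3 (5 ∷ 6 ∷ 4534231324354 ∷ []) (1 ∷ 2 ∷ 3 ∷ []) ∷
         via point [] (1 ∷ 2 ∷ 3 ∷ 4 ∷ 5 ∷ 6 ∷ []) ∷ [])) λ d6 →
    -- The table of D8 serves E8 only and stays partial: it has, for instance, no entry for a pair
    -- of empty subsets.
    share (groupOf (coxMatrix {8} bondD)
        (via point [] (1 ∷ 2 ∷ 3 ∷ 4 ∷ 5 ∷ 6 ∷ 7 ∷ []) ∷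
         via point [] (1 ∷ 3 ∷ 4 ∷ 5 ∷ 6 ∷ 7 ∷ 8 ∷ []) ∷
         via d5 (5 ∷ 4534231324354 ∷ 6 ∷ 7 ∷ 8 ∷ []) (1 ∷ 2 ∷ 3 ∷ []) ∷
         via a3 (1 ∷ 3 ∷ 2 ∷ []) (5 ∷ 6 ∷ 7 ∷ 8 ∷ 4534231324354 ∷ []) ∷
         via d4 (6 ∷ 8 ∷ 7 ∷ 56453423132435465 ∷ []) (1 ∷ 2 ∷ 3 ∷ 4 ∷ []) ∷ [])) λ d8 →
    share (groupOf (coxMatrix {6} bondE)
        (via d5 (2 ∷ 3 ∷ 4 ∷ 5 ∷ 6 ∷ []) [] ∷
         via a5 (1 ∷ 3 ∷ 4 ∷ 5 ∷ 6 ∷ []) (245634524313425436542 ∷ []) ∷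
         via a5 (1 ∷ 3 ∷ 4 ∷ 5 ∷ 6 ∷ []) [] ∷
         via point [] (1 ∷ 2 ∷ 3 ∷ 4 ∷ 5 ∷ 6 ∷ []) ∷ [])) λ e6 →
    share (groupOf (coxMatrix {7} bondE)
        (via e6 (1 ∷ 2 ∷ 3 ∷ 4 ∷ 5 ∷ 6 ∷ []) [] ∷
         via d6 (2 ∷ 3 ∷ 4 ∷ 5 ∷ 6 ∷ 7 ∷ []) (134567245634524313425436542765431 ∷ []) ∷
         via a7 (1 ∷ 3 ∷ 4 ∷ 5 ∷ 6 ∷ 7 ∷ 245634524313425436542 ∷ []) [] ∷
         via d6 (2 ∷ 3 ∷ 4 ∷ 5 ∷ 6 ∷ 7 ∷ []) [] ∷
         via point [] (1 ∷ 2 ∷ 3 ∷ 4 ∷ 5 ∷ 6 ∷ 7 ∷ []) ∷ [])) λ e7 →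
    share (groupOf (coxMatrix {8} bondE)
        (via e7 (1 ∷ 2 ∷ 3 ∷ 4 ∷ 5 ∷ 6 ∷ 7 ∷ []) (876543245678134567245634524313425436542765431876542345678 ∷ []) ∷
         via e7 (1 ∷ 2 ∷ 3 ∷ 4 ∷ 5 ∷ 6 ∷ 7 ∷ []) [] ∷
         via d8 (2 ∷ 3 ∷ 4 ∷ 5 ∷ 6 ∷ 7 ∷ 8 ∷ 134567245634524313425436542765431 ∷ []) [] ∷
         via point [] (1 ∷ 2 ∷ 3 ∷ 4 ∷ 5 ∷ 6 ∷ 7 ∷ 8 ∷ []) ∷ [])) λ e8 →
    e6 , e7 , e8

  tableE6 : Table² 6
  tableE6 =
    ((51840 ∷ᵛ 155520 ∷ᵛ 172800 ∷ᵛ 86400 ∷ᵛ 18558 ∷ᵛ 1278 ∷ᵛ 1 ∷ᵛ []ᵛ) ∷ᵛ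
     (155520 ∷ᵛ 479520 ∷ᵛ 550800 ∷ᵛ 287100 ∷ᵛ 65124 ∷ᵛ 4830 ∷ᵛ 6 ∷ᵛ []ᵛ) ∷ᵛ
     (172800 ∷ᵛ 550800 ∷ᵛ 658800 ∷ᵛ 361350 ∷ᵛ 87680 ∷ᵛ 7145 ∷ᵛ 15 ∷ᵛ []ᵛ) ∷ᵛ
     (86400 ∷ᵛ 287100 ∷ᵛ 361350 ∷ᵛ 211450 ∷ᵛ 55945 ∷ᵛ 5165 ∷ᵛ 20 ∷ᵛ []ᵛ) ∷ᵛ
     (18558 ∷ᵛ 65124 ∷ᵛ 87680 ∷ᵛ 55945 ∷ᵛ 16650 ∷ᵛ 1834 ∷ᵛ 15 ∷ᵛ []ᵛ) ∷ᵛ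
     (1278 ∷ᵛ 4830 ∷ᵛ 7145 ∷ᵛ 5165 ∷ᵛ 1834 ∷ᵛ 268 ∷ᵛ 6 ∷ᵛ []ᵛ) ∷ᵛ
     (1 ∷ᵛ 6 ∷ᵛ 15 ∷ᵛ 20 ∷ᵛ 15 ∷ᵛ 6 ∷ᵛ 1 ∷ᵛ []ᵛ) ∷ᵛ []ᵛ)

  tableE7 : Table² 7
  tableE7 =
    ((2903040 ∷ᵛ 10160640 ∷ᵛ 13789440 ∷ᵛ 9072000 ∷ᵛ 2938320 ∷ᵛ 415800 ∷ᵛ 17642 ∷ᵛ 1 ∷ᵛ []ᵛ) ∷ᵛ
     (10160640 ∷ᵛ 36126720 ∷ᵛ 49956480 ∷ᵛ 33626880 ∷ᵛ 11211480 ∷ᵛ 1648920 ∷ᵛ 73927 ∷ᵛ 7 ∷ᵛ []ᵛ) ∷ᵛ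
     (13789440 ∷ᵛ 49956480 ∷ᵛ 70640640 ∷ᵛ 48867840 ∷ᵛ 16868580 ∷ᵛ 2598930 ∷ᵛ 124611 ∷ᵛ 21 ∷ᵛ []ᵛ) ∷ᵛ
     (9072000 ∷ᵛ 33626880 ∷ᵛ 48867840 ∷ᵛ 34960080 ∷ᵛ 12595710 ∷ᵛ 2055820 ∷ᵛ 107265 ∷ᵛ 35 ∷ᵛ []ᵛ) ∷ᵛ
     (2938320 ∷ᵛ 11211480 ∷ᵛ 16868580 ∷ᵛ 12595710 ∷ᵛ 4794276 ∷ᵛ 843134 ∷ᵛ 49183 ∷ᵛ 35 ∷ᵛ []ᵛ) ∷ᵛ
     (415800 ∷ᵛ 1648920 ∷ᵛ 2598930 ∷ᵛ 2055820 ∷ᵛ 843134 ∷ᵛ 164334 ∷ᵛ 11231 ∷ᵛ 21 ∷ᵛ []ᵛ) ∷ᵛ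
     (17642 ∷ᵛ 73927 ∷ᵛ 124611 ∷ᵛ 107265 ∷ᵛ 49183 ∷ᵛ 11231 ∷ᵛ 994 ∷ᵛ 7 ∷ᵛ []ᵛ) ∷ᵛ
     (1 ∷ᵛ 7 ∷ᵛ 21 ∷ᵛ 35 ∷ᵛ 35 ∷ᵛ 21 ∷ᵛ 7 ∷ᵛ 1 ∷ᵛ []ᵛ) ∷ᵛ []ᵛ)

  tableE8 : Table² 8
  tableE8 =
    ((696729600 ∷ᵛ 2786918400 ∷ᵛ 4470681600 ∷ᵛ 3657830400 ∷ᵛ 1601268480 ∷ᵛ 357557760 ∷ᵛ 34508640 ∷ᵛ 881760 ∷ᵛ 1 ∷ᵛ []ᵛ) ∷ᵛ
     (2786918400 ∷ᵛ 11240570880 ∷ᵛ 18207866880 ∷ᵛ 15071616000 ∷ᵛ 6692958720 ∷ᵛ 1522152576 ∷ᵛ 150602304 ∷ᵛ 4006856 ∷ᵛ 8 ∷ᵛ []ᵛ) ∷ᵛ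
     (4470681600 ∷ᵛ 18207866880 ∷ᵛ 29831639040 ∷ᵛ 25032430080 ∷ᵛ 11304830880 ∷ᵛ 2627041536 ∷ᵛ 267654842 ∷ᵛ 7467894 ∷ᵛ 28 ∷ᵛ []ᵛ) ∷ᵛ
     (3657830400 ∷ᵛ 15071616000 ∷ᵛ 25032430080 ∷ᵛ 21351747648 ∷ᵛ 9839303040 ∷ᵛ 2346581468 ∷ᵛ 247700376 ∷ᵛ 7318836 ∷ᵛ 56 ∷ᵛ []ᵛ) ∷ᵛ
     (1601268480 ∷ᵛ 6692958720 ∷ᵛ 11304830880 ∷ᵛ 9839303040 ∷ᵛ 4648819998 ∷ᵛ 1144964066 ∷ᵛ 126314765 ∷ᵛ 4008367 ∷ᵛ 70 ∷ᵛ []ᵛ) ∷ᵛ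
     (357557760 ∷ᵛ 1522152576 ∷ᵛ 2627041536 ∷ᵛ 2346581468 ∷ᵛ 1144964066 ∷ᵛ 293984848 ∷ᵛ 34351972 ∷ᵛ 1196498 ∷ᵛ 56 ∷ᵛ []ᵛ) ∷ᵛ
     (34508640 ∷ᵛ 150602304 ∷ᵛ 267654842 ∷ᵛ 247700376 ∷ᵛ 126314765 ∷ᵛ 34351972 ∷ᵛ 4349062 ∷ᵛ 172685 ∷ᵛ 28 ∷ᵛ []ᵛ) ∷ᵛ
     (881760 ∷ᵛ 4006856 ∷ᵛ 7467894 ∷ᵛ 7318836 ∷ᵛ 4008367 ∷ᵛ 1196498 ∷ᵛ 172685 ∷ᵛ 8524 ∷ᵛ 8 ∷ᵛ []ᵛ) ∷ᵛ
     (1 ∷ᵛ 8 ∷ᵛ 28 ∷ᵛ 56 ∷ᵛ 70 ∷ᵛ 56 ∷ᵛ 28 ∷ᵛ 8 ∷ᵛ 1 ∷ᵛ []ᵛ) ∷ᵛ []ᵛ)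

  -- Stated for a variable pair of systems so that both tests refer to one evaluation of the
  -- recursion.
  verifyH : Maybe (System 3 (coxMatrix {3} bondH)) × Maybe (System 4 (coxMatrix {4} bondH)) → Bool
  verifyH s = hasMetamatrix (proj₁ s) tableH3 ∧ hasMetamatrix (proj₂ s) tableH4

  checkH : verifyH systemsH ≡ true
  checkH = refl

  checkF : hasMetamatrix systemsF tableF4 ≡ true
  checkF = refl

  verifyE : Maybe (System 6 (coxMatrix {6} bondE)) × Maybe (System 7 (coxMatrix {7} bondE)) × Maybe (System 8 (coxMatrix {8} bondE)) → Bool
  verifyE s = hasMetamatrix (proj₁ s) tableE6 ∧ hasMetamatrix (proj₁ (proj₂ s)) tableE7 ∧ hasMetamatrix (proj₂ (proj₂ s)) tableE8

  checkE : verifyE systemsE ≡ true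
  checkE = refl

  matrix : ∀ {n} → Table² n → Fin _ → Fin _ → ℕ
  matrix T p q = lookup (lookup T p) q

  verifiedH : ∀ s → verifyH s ≡ true → IsMetamatrix (coxMatrix bondH) (matrix tableH3) × IsMetamatrix (coxMatrix bondH) (matrix tableH4)
  verifiedH (h3 , h4) e =
    let p0 , q0 = ∧-true {hasMetamatrix h3 tableH3} e
    in metamatrix-sound h3 tableH3 p0 , metamatrix-sound h4 tableH4 q0

  metamatrixH3 : IsMetamatrix (coxMatrix bondH) (matrix tableH3)
  metamatrixH3 = proj₁ (verifiedH systemsH checkH)

  metamatrixH4 : IsMetamatrix (coxMatrix bondH) (matrix tableH4)
  metamatrixH4 = proj₂ (verifiedH systemsH checkH)

  metamatrixF4 : IsMetamatrix (coxMatrix bondF) (matrix tableF4)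
  metamatrixF4 = metamatrix-sound systemsF tableF4 checkF

  verifiedE : ∀ s → verifyE s ≡ true → IsMetamatrix (coxMatrix bondE) (matrix tableE6) × IsMetamatrix (coxMatrix bondE) (matrix tableE7) × IsMetamatrix (coxMatrix bondE) (matrix tableE8)
  verifiedE (e6 , e7 , e8) e =
    let p0 , q0 = ∧-true {hasMetamatrix e6 tableE6} e
        p1 , q1 = ∧-true {hasMetamatrix e7 tableE7} q0
    in metamatrix-sound e6 tableE6 p0 , metamatrix-sound e7 tableE7 p1 , metamatrix-sound e8 tableE8 q1

  metamatrixE6 : IsMetamatrix (coxMatrix bondE) (matrix tableE6)
  metamatrixE6 = proj₁ (verifiedE systemsE checkE)

  metamatrixE7 : IsMetamatrix (coxMatrix bondE) (matrix tableE7)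
  metamatrixE7 = proj₁ (proj₂ (verifiedE systemsE checkE))

  metamatrixE8 : IsMetamatrix (coxMatrix bondE) (matrix tableE8)
  metamatrixE8 = proj₂ (proj₂ (verifiedE systemsE checkE))

  -- If Y (M' ⊕ d) Yᵀ is the scaled matrix, the last row u of the inverse of Y multiplies it to d
  -- y_n e_n. So u is proportional to the last row of the inverse matrix, and z p / y (p - 1) = - u
  -- (p - 1) / u p. Here u = (-3/8, 5/12, -1/2, 1), whence the ratios 9/10, 5/6, 1/2; the diagonal
  -- clears denominators, and 45 = 120 · 3/8. The inner levels repeat this with M', and the larger
  -- certificates have the same form.
  totallyPositiveH3 : TotallyPositive (matrix tableH3)
  totallyPositiveH3 = factorises-sound (matrix tableH3) 120
    ((45 , 10 ∷ 6 ∷ 2 ∷ 1 ∷ [] , 0 ∷ 9 ∷ 5 ∷ 1 ∷ []) ∷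
     (59 , 6 ∷ 2 ∷ 1 ∷ [] , 0 ∷ 5 ∷ 1 ∷ []) ∷
     (15 , 2 ∷ 1 ∷ [] , 0 ∷ 1 ∷ []) ∷
     (1 , 1 ∷ [] , 0 ∷ []) ∷ []) refl refl

  totallyPositiveH4 : TotallyPositive (matrix tableH4)
  totallyPositiveH4 = factorises-sound (matrix tableH4) 361933065361807977339131054400
    ((152501406710335605319510785577 , 131580 ∷ 2302 ∷ 1260 ∷ 2 ∷ 1 ∷ [] , 0 ∷ 127417 ∷ 2193 ∷ 1151 ∷ 1 ∷ []) ∷
     (179458478241896455430652481140 , 23858 ∷ 13080 ∷ 2 ∷ 1 ∷ [] , 0 ∷ 863377 ∷ 11929 ∷ 109 ∷ []) ∷
     (2393737204773862283988962 , 23020 ∷ 2 ∷ 1 ∷ [] , 0 ∷ 876469 ∷ 1151 ∷ []) ∷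
     (95810559477949260 , 218 ∷ 1 ∷ [] , 0 ∷ 8720099 ∷ []) ∷
     (21 , 1 ∷ [] , 0 ∷ []) ∷ []) refl refl

  totallyPositiveF4 : TotallyPositive (matrix tableF4)
  totallyPositiveF4 = factorises-sound (matrix tableF4) 315592379828204094720
    ((106868565426200015061 , 4212 ∷ 394 ∷ 240 ∷ 2 ∷ 1 ∷ [] , 0 ∷ 3901 ∷ 351 ∷ 197 ∷ 1 ∷ []) ∷
     (151221348667681128720 , 334 ∷ 1032 ∷ 2 ∷ 1 ∷ [] , 0 ∷ 2081 ∷ 835 ∷ 43 ∷ []) ∷
     (27395171860087161 , 1576 ∷ 2 ∷ 1 ∷ [] , 0 ∷ 2223 ∷ 197 ∷ []) ∷
     (91625405040 , 86 ∷ 1 ∷ [] , 0 ∷ 19539 ∷ []) ∷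
     (10 , 1 ∷ [] , 0 ∷ []) ∷ []) refl refl

  totallyPositiveE6 : TotallyPositive (matrix tableE6)
  totallyPositiveE6 = factorises-sound (matrix tableE6) 1166913189041489271462256615016545602695199494382813182594828923773191652790382452703441435956081425665091974477043531140400000
    ((285883072903493413707135554133157874240070786012527138467956015871958933582350814717140632372985412731547478175489142490900000 , 8462655 ∷ 5128846 ∷ 2884950 ∷ 113972 ∷ 74793 ∷ 2 ∷ 1 ∷ [] , 0 ∷ 7915796 ∷ 4701475 ∷ 2564423 ∷ 96165 ∷ 56986 ∷ 1 ∷ []) ∷
     (504581906742940268308216517789561848572831633219234959510912136483407872086211671678247361658787060912590696371091971335710000 , 74050702 ∷ 807696369 ∷ 6075626 ∷ 4006575 ∷ 2 ∷ 1 ∷ [] , 0 ∷ 83570887 ∷ 925633775 ∷ 89744041 ∷ 3037813 ∷ 17807 ∷ []) ∷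
     (902887949940515817067340903344268454619316825536329948586206667882670718088082407369835681632603381679958270070025625 , 1479507947928 ∷ 60242030 ∷ 1937524 ∷ 1 ∷ 1 ∷ [] , 0 ∷ 125820685891 ∷ 6849573833 ∷ 30121015 ∷ 484381 ∷ []) ∷
     (1049293368385671648661560043489807380543220006094990304294815162212746691237491794617541279915419409782500 , 1137273282608810 ∷ 51933843485400 ∷ 17807 ∷ 1 ∷ [] , 0 ∷ 1701905246079604907 ∷ 136474017932032399 ∷ 162295159525 ∷ []) ∷
     (5743501110487469038196574106572499694823774352946936018733698808977504049413749500 , 976010031902284 ∷ 302719 ∷ 1 ∷ [] , 0 ∷ 26390619812879182641 ∷ 648769403963573917 ∷ []) ∷
     (982490783781101195188356959177734588956053676 , 1513595 ∷ 1 ∷ [] , 0 ∷ 33085914479994408681 ∷ []) ∷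
     (24931 , 1 ∷ [] , 0 ∷ []) ∷ []) refl refl

  totallyPositiveE7 : TotallyPositive (matrix tableE7)
  totallyPositiveE7 = factorises-sound (matrix tableE7) 30087685422573244049733998871084202525996952542320562754346333987559162061773470500195355398659901665043311332418794258777870615396411767800034694194226531713487154009644096374078562966450225571833947875975107612586781709624145091626901684605281042053900483337165536381959680000
    ((8160219698996383945437115023564739861439287604486344888924850471601821893409414395944540528002819898635466930433644474773548511347521700267787684475177996701207895533892656527478567560421087414765273912935179681901205864589742473411192206782082297014070450971845723256520798775 , 1912670734 ∷ 1007163570 ∷ 25648994 ∷ 14056800 ∷ 6702 ∷ 4196 ∷ 2 ∷ 1 ∷ [] , 0 ∷ 1835392979 ∷ 956335367 ∷ 23980085 ∷ 12824497 ∷ 5857 ∷ 3351 ∷ 1 ∷ []) ∷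
     (13421455882190463670034617714926038163857392567751319506748938121558963357946427968686934550819577864537659459435844226512227666663150075653597003021034522821878750075901715046794154745624728148362497264372439637921495152942787382168328965928373364319235003019963217825368806500 , 562956110539550574 ∷ 482115902797226 ∷ 199748954351880 ∷ 148058710 ∷ 18569044 ∷ 2 ∷ 1 ∷ [] , 0 ∷ 793919995303079665 ∷ 13403716917608347 ∷ 241057951398613 ∷ 184952735511 ∷ 14805871 ∷ 845 ∷ []) ∷
     (9336671527004030391585115434554549262565585944426413906829152140046312107070433678216405070385703914766081577078242379516289886510345842704868567222449744955974673923591694587007021495686065589448392031341576430860114081126415376880170376985174695783527864874150212622500 , 591417480310498497970 ∷ 5674289385618853608 ∷ 199511946022 ∷ 15052692 ∷ 2 ∷ 1 ∷ [] , 0 ∷ 791888822269303473027157 ∷ 295708740155249248985 ∷ 236428724400785567 ∷ 99755973011 ∷ 3763173 ∷ []) ∷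
     (158819715641705169473821662372896768979457420186759228220842221377848682462989488175867623259442045768926633113482331771913323534638565389565066019373943904255425031974115128168240943971910655656152694803116097944303386220423314647440989358074083509680567500 , 2629959653036076622480893582216 ∷ 670588495661846105934 ∷ 3109173686516 ∷ 338 ∷ 1 ∷ [] , 0 ∷ 290147290259738309560589900555713553 ∷ 751310835784449480000021452815 ∷ 34960040288990212769467 ∷ 4075745363009 ∷ []) ∷
     (1288034251325363925643888245805612304049967916454421271937110990429581121116373117954165310767928658291312395267903946125758555383919114648823080376766156165621533639907291714124482031976846463234050982003714590202098877539139635081 , 419080985846628593313475188446 ∷ 1363907902479768148 ∷ 1897870 ∷ 1 ∷ [] , 0 ∷ 141933360469873544243358983578980367047424787 ∷ 247172327528969391599289203285421611 ∷ 44245929770246665614911783 ∷ []) ∷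
     (50018442342828929008009897420370816098249958227561233354029153773840865251485777966874018556228116408364550758447154403729554904984028545942363408831480300386515366476088657360460 , 165192314823954906627564 ∷ 89199890 ∷ 1 ∷ [] , 0 ∷ 13225079430294945499926562470400243294247878250717 ∷ 2430505638691556852851402404616290703 ∷ []) ∷
     (336124771297479428722912717880042156642942903444107647540645544590002643080352662798364360622057497816060 , 3357770 ∷ 1 ∷ [] , 0 ∷ 96217887712558283260311510385850440500867900499 ∷ []) ∷
     (576299620 , 1 ∷ [] , 0 ∷ []) ∷ []) refl refl

  totallyPositiveE8 : TotallyPositive (matrix tableE8)
  totallyPositiveE8 = factorises-sound (matrix tableE8) 2098961747482822694088963850869324670020387105740910654259433423186554350643439611413269818266543469125538074497489646390701549526070722524572428430912352036262213433272459375180970861441634100230771980755831458290469163537888089954892812417367996975977991848730809646243299902857605198502677392946275206653923675167868555013383659260319216186652745471481397387147789521156329053695387083670291087685530650779260331184801466587375283007577655978206315031720215999282081206279704828923233748825289531815137321642151790831786850240678557507015802570152520500064985559040230156781195773446675879830322278489634857504641869421951691629801190499918730812541299808999168000000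
    ((670722170233995501189372953531981588104616845855572323006454031771246594901116842904576625860430051264715522805662148271146587148749924012966249303273805604047134030995747825851767667932934508372910107863552949304203070838219265740639075526600883062121556996368786511167441564962677584293934322315766631552181578844520297551096477120853289501156765145546993148032863858624041983862074540498827409100575820537464238960733158302876222278059432497913214076566163890848179417437483354458194946652675308523101430938686802043147896828006019196961083213618063519634368195010069642412121532787021636269428938153788735211969041638361259895868610650202929012746331110853622924375 , 221187186757343880 ∷ 13260605911896758 ∷ 6861979551518140 ∷ 256307125117066 ∷ 136334220539040 ∷ 34638835100 ∷ 20399405303 ∷ 2 ∷ 1 ∷ [] , 0 ∷ 216272156952762199 ∷ 12902585894178393 ∷ 6630302955948379 ∷ 245070698268505 ∷ 128153562558533 ∷ 31558847347 ∷ 17319417550 ∷ 1 ∷ []) ∷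
     (979046224842341572837966113663343067548505528486488931879314104692495881218189843389228244421838937974936462407831288074278902025409345731384457686711242850405708521937083350634645222284257194528665573261677900284556460411205753797784797647123007446108685936537723477807297677596184312611128833846746329148159280393492185405663587679128593571006860505154601424112078903028179362452024289465252460337726659110304005593393670466425311166418511726769352579859994872802502315260509033634914320616938282850673962826809316275150651508730996016122534838829766657711214546477830087852619191716181407571843624853820331621152649355227766777389179585488884746590969529167838375000 , 116268663995935344563180186 ∷ 277012142064112219996079376 ∷ 99378542882196635695514 ∷ 39260786637648333088716 ∷ 2557198276322636 ∷ 758379224445684 ∷ 2 ∷ 1 ∷ [] , 0 ∷ 1531266460981036024992539999 ∷ 406940323985773705971130651 ∷ 1923695431000779305528329 ∷ 49689271441098317847757 ∷ 6070004118374819587 ∷ 639299569080659 ∷ 3079987753 ∷ []) ∷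
     (39142228020794644656743579087706427758527386699186918349495321649043207539519917758695016406141845957979329581770895888103813288918494047575922655681839622143923126421846360649062277005908135335859630271393828080414309073733239715471471945473701543150728843453984246185015058252381736455473791056125507728717553082126521706330385878794082041476253441458090878700780230970800274650257208608633993219196819224692519961528470273253715897640776177250974652414362392111442060556667941753526871947262154031369936938379534110169044147561698305663505189510127110995504753317852895581436074958552373488878262650700862624427527512391178310042264274455337300000 , 80689093562528143891920920093908990180 ∷ 3015050908300859325350141332717846 ∷ 40383245156759652532218323019696 ∷ 2233406566875627780378 ∷ 215653255866060275 ∷ 2 ∷ 1 ∷ [] , 0 ∷ 361408039395820073739149078931781645227 ∷ 9797961361164131758304683154260377379 ∷ 1507525454150429662675070666358923 ∷ 31159911386388620781032656651 ∷ 1116703283437813890189 ∷ 119079655365025 ∷ []) ∷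
     (520091862069486717929070481761013778964423353948944908105079269722113726627420674705783741310082964512169459099731468114356530321583976647986327466494932208282852139475915509428182662747805426881278013405926988083889092610534364216125476990734195975299678192810706432427495987171812520183735470823677655373035658505228343788843548512392152293685910699640569012401264889962437416983250662035083533526074392350562288719627928474002870946753060243814977668979506922700196353230142958952374469608731342036606178222952739641047561297028683237642734683825078379289931971951763507708107918154886422812485308816812187332078490360 , 3343832361385178856332418075028775895831646959700237406 ∷ 15267026759543768452445603117463269936420549259539100 ∷ 190323933837812346026828266728944408274 ∷ 1291384047650900308420496764400 ∷ 3079987753 ∷ 1 ∷ [] , 0 ∷ 340514911532004794471616698033980135462980802720273398678093 ∷ 2940152399949154136135167542546638569312615849225053641981 ∷ 97318166158053422571162650182386910411946319341545 ∷ 128810630572606403718228892971756496437781 ∷ 294139452932741210894226030667 ∷ []) ∷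
     (637994449746051708411308882638100577224097738663977428725383229364673661979348489548604988536763810360801161356805868288789298010865440254468948422452769538367114474902032857243745468942099279822360584697684992530169857763679090683982793708034362441313979638323384535906959320638455075906440878796326881003817402955482707962418719950677944582384144449695238742407581291025226442452012077435171740589636089915253959684853457141899208479744365315025318031305690229933732085526123418056491351756255543690386226919190556718235425554426164421624283165146094945929453 , 7016416444885256408639715791506046683131379881691802160675628061688 ∷ 273941787825084661383091407230599374987512477932958 ∷ 32388048493983797025503272189209516400 ∷ 42352911591503 ∷ 1 ∷ [] , 0 ∷ 119525584915913645798764535769278438297529913542465866390008497936440890313 ∷ 3318242766843949654954833365955434460874762548222700627790819917265973 ∷ 1741414613311779909670852695162922823299059302542719365927 ∷ 284430895715679390290877146710624838561829029 ∷ []) ∷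
     (503164802857571572341688529980730305899748863877841162802056022795150920762571735360622173264606013136195857243262759894313812540854817183842709135943211379764888773053471920410152469559167872566610021663938344640384072025987005187038977841646092857812865826281963011989682729078337696515845360555046924816037436672047666054543984408988398450036851937937172978740099488801417664308328121530916013521917808666114918677356579832176725414769762212990980795647997128374699400 , 2485690226686324580876808216239873895508713704416422093359200670 ∷ 28337988601818283520763189783602688462238915920 ∷ 617463098092522237 ∷ 1 ∷ [] , 0 ∷ 924178687866006944804987806641898914607661388543425065318039437707262854137844474075599 ∷ 2093554699526580584693387624244373195867162775961010484219378308371246614989057 ∷ 3824249221819518449326358244439639082016967392282112722435891 ∷ []) ∷
     (1294104720307392423352250562903904998830970606594414633527927819615485192641923594086615084205280439544265968260042197814217994729872010245864165068965903697455295280683042248067783956416232090614003537259646204568018816463479658072073433184715825457756507372451583945135612183568666471044176281944348114558301906806846743114722535156893069265763345 , 7267913088716104132844416720574534519087387855560 ∷ 832232871342095189 ∷ 1 ∷ [] , 0 ∷ 165622945770920362615412471458227736781244697552174311108127121979660410113778614427871827 ∷ 400846098720987328492793903969539390879584303324419550374517804293384178231871 ∷ []) ∷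
     (163395689799747894036313725549716092258082189420178516244818141768387187252911827921829626686598210112441747353580619294257844469821786511285653950524346934768803670155790280627802457756070760 , 26846221656196619 ∷ 1 ∷ [] , 0 ∷ 720497572853782420526061612886750287151119001127836457564424663180477636465588259428631 ∷ []) ∷
     (2622975933265043 , 1 ∷ [] , 0 ∷ []) ∷ []) refl refl

-- Double cosets as dominant points of an orbit

module DominantPoints where

  open import Defs hiding (B)
  open Tits
  open Cosets
  open import Data.Nat using (ℕ) renaming (_*_ to _*ℕ_)
  import Data.Nat.Properties as ℕ
  open import Data.Fin using (Fin)
  open import Data.Fin.Subset using (Subset; _∈_)
  open import Data.List using (List; []; _∷_; _++_; length; reverse)
  import Data.List.Properties as List
  open import Data.List.Membership.Propositional using () renaming (_∈_ to _∈ˡ_)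
  open import Data.List.Relation.Unary.All using (All; []; _∷_)
  import Data.List.Relation.Unary.All as All
  import Data.List.Relation.Unary.All.Properties as All
  open import Data.List.Relation.Unary.Any using (Any; here; there)
  open import Data.List.Relation.Unary.AllPairs using (AllPairs; []; _∷_)
  open import Data.List.Relation.Unary.Unique.Propositional using (Unique)
  open import Data.Product using (∃; _×_; _,_; proj₁)
  open import Relation.Nullary using (¬_)
  open import Relation.Binary.PropositionalEquality

  module DominantCount {n} {m : Fin n → Fin n → ℕ} {X : Set} (H : HalfSpaces m X) where

    open HalfSpaces H
    open Action H

    run-reverse : ∀ w {x y} → run act w x ≡ y → run act (reverse w) y ≡ x
    run-reverse w {x} refl = trans (sym (run-++ (reverse w) w x)) (run-≈ (reverse-inverseˡ w) x)

    module _ (I J : Subset n) (λ₀ : X) (dominant : ∀ s → Pos s λ₀)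
             (fixed : ∀ s → s ∈ J → act s λ₀ ≡ λ₀) (fixing : ∀ s → act s λ₀ ≡ λ₀ → s ∈ J) where

      private
        run-fixed : ∀ {v} → All (_∈ J) v → run act v λ₀ ≡ λ₀
        run-fixed []             = refl
        run-fixed {s ∷ v} (j ∷ js) = trans (cong (act s) (run-fixed js)) (fixed s j)

        Orbit : X → Set
        Orbit x = Dominant (_∈ I) x × ∃ λ w → run act w λ₀ ≡ x

        words : ∀ xs → All Orbit xs → List (Word n)
        words []       []               = []
        words (x ∷ xs) ((_ , w , _) ∷ os) = w ∷ words xs os

        words-length : ∀ xs os → length (words xs os) ≡ length xs
        words-length []       []       = refl
        words-length (x ∷ xs) (o ∷ os) = cong ℕ.suc (words-length xs os)

        related : ∀ {w w'} → SameDoubleCoset m I J w w' → Dominant (_∈ I) (run act w λ₀) → Dominant (_∈ I) (run act w' λ₀) →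
                  run act w λ₀ ≡ run act w' λ₀
        related {w} {w'} (u , v , iu , jv , p) d d' = trans (sym (proj₁ (dominant-unique (_∈ I) (length u) u ℕ.≤-refl iu _ d (subst (Dominant (_∈ I)) e d')))) (sym e)
          where
          e : run act w' λ₀ ≡ run act u (run act w λ₀)
          e = trans (run-≈ p λ₀) (trans (run-++ u (w ++ v) λ₀) (cong (run act u) (trans (run-++ w v λ₀) (cong (run act w) (run-fixed jv)))))

        separated : ∀ xs os → AllPairs _≢_ xs → AllPairs (λ w w' → ¬ SameDoubleCoset m I J w w') (words xs os)
        separated []       []                   []       = []
        separated (x ∷ xs) ((d , w , e) ∷ os) (p ∷ ps) = head xs os p ∷ separated xs os ps
          where
          head : ∀ ys os → All (x ≢_) ys → All (λ w' → ¬ SameDoubleCoset m I J w w') (words ys os)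
          head []       []                   []       = []
          head (y ∷ ys) ((d' , w' , e') ∷ os) (q ∷ qs) =
            (λ r → q (trans (sym e) (trans (related r (subst (Dominant (_∈ I)) (sym e) d) (subst (Dominant (_∈ I)) (sym e') d')) e'))) ∷ head ys os qs

        covered : ∀ xs os w u → All (_∈ I) u → run act u (run act w λ₀) ∈ˡ xs → Any (SameDoubleCoset m I J w) (words xs os)
        covered (x ∷ xs) ((_ , w' , e) ∷ os) w u iu (here f) = here (class (stabiliser λ₀ dominant (reverse w' ++ (u ++ w))
          (trans (run-++ (reverse w') (u ++ w) λ₀) (trans (cong (run act (reverse w')) (trans (run-++ u w λ₀) f)) (run-reverse w' e)))))
          where
          class : (∃ λ v → All (λ s → act s λ₀ ≡ λ₀) v × reverse w' ++ (u ++ w) ≈ v) → SameDoubleCoset m I J w w'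
          class (v , fv , p) = u , reverse v , iu , All-reverse (All.map (λ {s} → fixing s) fv) ,
            ceTrans (≡⇒≈ (sym (List.++-identityʳ w')))
              (ceTrans (++-congˡ w' (ceSym (reverse-inverseʳ v)))
                (ceTrans (≡⇒≈ (sym (List.++-assoc w' v (reverse v))))
                  (ceTrans (++-congʳ (reverse v) w'v) (≡⇒≈ (List.++-assoc u w (reverse v))))))
            where
            w'v : w' ++ v ≈ u ++ w
            w'v = ceTrans (++-congˡ w' (ceSym p)) (ceTrans (≡⇒≈ (sym (List.++-assoc w' (reverse w') (u ++ w)))) (++-congʳ (u ++ w) (reverse-inverseʳ w')))
        covered (x ∷ xs) (o ∷ os) w u iu (there i) = there (covered xs os w u iu i)

      -- Separation rests on `dominant-unique`, coverage on the stabiliser of `λ₀` being W_J: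
      -- `fixed` and `fixing` together say that `J` consists of exactly the generators fixing `λ₀`.
      dominant-count : ∀ xs → Unique xs → All (λ x → Dominant (_∈ I) x × ∃ λ w → run act w λ₀ ≡ x) xs →
        (∀ w → ∃ λ u → All (_∈ I) u × run act u (run act w λ₀) ∈ˡ xs) → DoubleCosets m I J (length xs)
      dominant-count xs unique os complete = words xs os , words-length xs os , separated xs os unique ,
        λ w → let u , iu , i = complete w in covered xs os w u iu i

  -- Lets a concrete set of coordinate vectors inherit the geometry of the weights; injectivity of
  -- `δ` carries the equations back.
  pullback : ∀ {n} {m : Fin n → Fin n → ℕ} {X Y : Set} (H : HalfSpaces m Y) (δ : X → Y) → (∀ {x x'} → δ x ≡ δ x' → x ≡ x') →
             (act' : Fin n → X → X) → (∀ s x → δ (act' s x) ≡ HalfSpaces.act H s (δ x)) → HalfSpaces m X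
  pullback {m = m} H δ injective act' equivariant = record
    { m-diag   = m-diag
    ; m-pos    = m-pos
    ; act      = act'
    ; Pos      = λ s x → Pos s (δ x)
    ; relation = λ s t x → injective (trans (run-δ (alt s t (2 *ℕ m s t)) x) (relation s t (δ x)))
    ; dihedral = λ s t s≢t k k<m x p q → subst (Pos s) (sym (run-δ (alt t s k) x)) (dihedral s t s≢t k k<m (δ x) p q)
    ; wall     = λ s x p q → injective (trans (equivariant s x) (wall s (δ x) p (subst (Pos s) (equivariant s x) q)))
    }
    where
    open HalfSpaces H
    run-δ : ∀ w x → δ (run act' w x) ≡ run act w (δ x)
    run-δ []      x = refl
    run-δ (s ∷ w) x = trans (equivariant s (run act' w x)) (cong (act s) (run-δ w x))

-- Finite differences and the Gram matrix of type B

module FiniteDifferences where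

  open TotalPositivity
  open Factorisations using (tp-cong; tp-empty)
  open import Data.Nat using (ℕ; zero; suc; pred; z≤n; s≤s; _∸_) renaming (_*_ to _*ℕ_; _<_ to _<ℕ_; _≤_ to _≤ℕ_)
  import Data.Nat.Properties as ℕ
  open import Data.Integer using (ℤ; +_; -_; _+_; _-_; _*_; _^_; 0ℤ; 1ℤ)
  import Data.Integer.Properties as ℤ
  open import Data.Integer.Solver using (module +-*-Solver)
  open import Data.Sum using (inj₁; inj₂)
  open import Data.Empty using (⊥-elim)
  open import Relation.Nullary using (yes; no)
  open import Relation.Binary.PropositionalEquality
  open import Function using (_∘_)

  open +-*-Solver

  Δ : ℕ → (ℕ → ℤ) → ℕ → ℤ
  Δ zero    f R = f R
  Δ (suc r) f R = Δ r f (suc R) - Δ r f R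

  Δ-cong : ∀ r {f g} → (∀ R → f R ≡ g R) → ∀ R → Δ r f R ≡ Δ r g R
  Δ-cong zero    e R = e R
  Δ-cong (suc r) e R = cong₂ _-_ (Δ-cong r e (suc R)) (Δ-cong r e R)

  Δ-zero : ∀ r R → Δ r (λ _ → 0ℤ) R ≡ 0ℤ
  Δ-zero zero    R = refl
  Δ-zero (suc r) R = cong₂ _-_ (Δ-zero r (suc R)) (Δ-zero r R)

  Δ-+ : ∀ r f g R → Δ r (λ R → f R + g R) R ≡ Δ r f R + Δ r g R
  Δ-+ zero    f g R = refl
  Δ-+ (suc r) f g R = trans (cong₂ _-_ (Δ-+ r f g (suc R)) (Δ-+ r f g R))
    (solve 4 (λ a b c d → (a :+ b) :- (c :+ d) := (a :- c) :+ (b :- d)) refl (Δ r f (suc R)) (Δ r g (suc R)) (Δ r f R) (Δ r g R))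

  Δ-scale : ∀ r c f R → Δ r (λ R → c * f R) R ≡ c * Δ r f R
  Δ-scale zero    c f R = refl
  Δ-scale (suc r) c f R = trans (cong₂ _-_ (Δ-scale r c f (suc R)) (Δ-scale r c f R))
    (solve 3 (λ c a b → c :* a :- c :* b := c :* (a :- b)) refl c (Δ r f (suc R)) (Δ r f R))

  Δ-const : ∀ r c R → Δ (suc r) (λ _ → c) R ≡ 0ℤ
  Δ-const zero    c R = ℤ.+-inverseʳ c
  Δ-const (suc r) c R = cong₂ _-_ (Δ-const r c (suc R)) (Δ-const r c R)

  prefix : (ℕ → ℤ) → ℕ → ℤ
  prefix f zero    = 0ℤ
  prefix f (suc R) = prefix f R + f R

  Δ-prefix : ∀ r f R → Δ (suc r) (prefix f) R ≡ Δ r f R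
  Δ-prefix zero    f R = solve 2 (λ a b → (a :+ b) :- a := b) refl (prefix f R) (f R)
  Δ-prefix (suc r) f R = cong₂ _-_ (Δ-prefix r f (suc R)) (Δ-prefix r f R)

  odd : ℕ → ℤ
  odd R = + 2 * + R + 1ℤ

  odd-suc : ∀ R → odd (suc R) ≡ odd R + + 2
  odd-suc R = solve 1 (λ R → con (+ 2) :* (con 1ℤ :+ R) :+ con 1ℤ := con (+ 2) :* R :+ con 1ℤ :+ con (+ 2)) refl (+ R)

  -- The discrete Leibniz rule for a linear factor of slope 2: the factor is evaluated at
  -- `R + r + 1`, and the correction carries r + 1 times the slope.
  Δ-odd : ∀ r f R → Δ (suc r) (λ R → odd R * f R) R ≡ (odd R + + 2 * + suc r) * Δ (suc r) f R + + 2 * + suc r * Δ r f R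
  Δ-odd zero f R = trans (cong (λ x → x * f (suc R) - odd R * f R) (odd-suc R))
    (solve 3 (λ o a b → (o :+ con (+ 2)) :* a :- o :* b := (o :+ con (+ 2)) :* (a :- b) :+ con (+ 2) :* b) refl (odd R) (f (suc R)) (f R))
  Δ-odd (suc r) f R = trans (cong₂ _-_ (trans (Δ-odd r f (suc R)) (cong (λ x → (x + + 2 * + suc r) * Δ (suc r) f (suc R) + + 2 * + suc r * Δ r f (suc R)) (odd-suc R))) (Δ-odd r f R))
    (solve 5 (λ o n a b c →
      ((o :+ con (+ 2) :+ con (+ 2) :* n) :* a :+ con (+ 2) :* n :* b) :- ((o :+ con (+ 2) :* n) :* (b :- c) :+ con (+ 2) :* n :* c) :=
      (o :+ con (+ 2) :* (con 1ℤ :+ n)) :* (a :- (b :- c)) :+ con (+ 2) :* (con 1ℤ :+ n) :* (b :- c)) refl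
      (odd R) (+ suc r) (Δ (suc r) f (suc R)) (Δ r f (suc R)) (Δ r f R))

  -- Equal to 2^r r! times the Stirling number of the second kind of type B, whose recurrence
  -- becomes `U-suc`.
  U : ℕ → ℕ → ℤ
  U r k = Δ r (λ R → odd R ^ k) 0

  U-0 : ∀ r → U (suc r) 0 ≡ 0ℤ
  U-0 r = Δ-const r 1ℤ 0

  U-suc : ∀ r k → U (suc r) (suc k) ≡ (+ 2 * + suc r + 1ℤ) * U (suc r) k + + 2 * + suc r * U r k
  U-suc r k = trans (Δ-odd r (λ R → odd R ^ k) 0)
    (cong (λ x → x * U (suc r) k + + 2 * + suc r * U r k) (ℤ.+-comm 1ℤ (+ 2 * + suc r)))

  -- A polynomial of degree k in R is annihilated by more than k differences.
  U-triangular : ∀ k r → k <ℕ r → U r k ≡ 0ℤ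
  U-triangular zero    (suc r) _       = U-0 r
  U-triangular (suc k) (suc r) (s≤s p) = trans (U-suc r k)
    (trans (cong₂ (λ x y → (+ 2 * + suc r + 1ℤ) * x + + 2 * + suc r * y) (U-triangular k (suc r) (ℕ.≤-trans p (ℕ.n≤1+n r))) (U-triangular k r p))
      (cong₂ _+_ (ℤ.*-zeroʳ (+ 2 * + suc r + 1ℤ)) (ℤ.*-zeroʳ (+ 2 * + suc r))))

  sumBelow : ℕ → (ℕ → ℤ) → ℤ
  sumBelow zero    f = 0ℤ
  sumBelow (suc n) f = f 0 + sumBelow n (f ∘ suc)

  sumBelow-cong : ∀ n {f g} → (∀ k → k <ℕ n → f k ≡ g k) → sumBelow n f ≡ sumBelow n g
  sumBelow-cong zero    e = refl
  sumBelow-cong (suc n) e = cong₂ _+_ (e 0 (s≤s z≤n)) (sumBelow-cong n (λ k p → e (suc k) (s≤s p)))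

  sumBelow-zero : ∀ n f → (∀ k → f k ≡ 0ℤ) → sumBelow n f ≡ 0ℤ
  sumBelow-zero zero    f e = refl
  sumBelow-zero (suc n) f e = cong₂ _+_ (e 0) (sumBelow-zero n (f ∘ suc) (e ∘ suc))

  sumBelow-linear : ∀ n x y f g → sumBelow n (λ k → x * f k + y * g k) ≡ x * sumBelow n f + y * sumBelow n g
  sumBelow-linear zero    x y f g = solve 2 (λ x y → con 0ℤ := x :* con 0ℤ :+ y :* con 0ℤ) refl x y
  sumBelow-linear (suc n) x y f g = trans (cong (λ s → x * f 0 + y * g 0 + s) (sumBelow-linear n x y (f ∘ suc) (g ∘ suc)))
    (solve 6 (λ x y a b s t → x :* a :+ y :* b :+ (x :* s :+ y :* t) := x :* (a :+ s) :+ y :* (b :+ t)) refl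
      x y (f 0) (g 0) (sumBelow n (f ∘ suc)) (sumBelow n (g ∘ suc)))

  Gram : ℕ → (ℕ → ℤ) → (ℕ → ℕ → ℤ) → ℕ → ℕ → ℤ
  Gram n d L p q = sumBelow n (λ k → d k * (L k p * L k q))

  -- Rows and columns are numbered by the size of a subset, so the order of the difference is the
  -- complementary number `N ∸ p`.
  Z : ℕ → (ℕ → ℕ) → ℕ → ℕ → ℤ
  Z zero    d = λ _ _ → 0ℤ
  Z (suc N) d = Gram (suc N) (λ k → + d k) (λ k p → U (N ∸ p) k)

  private
    module Step (N : ℕ) (d : ℕ → ℕ) where

      -- With r = N - p these are the coefficients 2 r and 2 r + 1 of the recurrence `U-suc`. In the
      -- last row, where r = 0, the diagonal entry is 1 instead, to pick up U 0 0 = 1; row 0 has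
      -- nothing above it, hence `z 0 = 0`.
      y z : ℕ → ℕ
      y p with p ℕ.≟ N
      ... | yes _ = 1
      ... | no _  = 2 *ℕ (N ∸ p)
      z zero    = 0
      z (suc p) = suc (2 *ℕ (N ∸ suc p))

      y-N : y N ≡ 1
      y-N with N ℕ.≟ N
      ... | yes _ = refl
      ... | no ne = ⊥-elim (ne refl)

      y-<N : ∀ p → p <ℕ N → y p ≡ 2 *ℕ (N ∸ p)
      y-<N p p<N with p ℕ.≟ N
      ... | yes e = ⊥-elim (ℕ.<⇒≢ p<N e)
      ... | no _  = refl

      y>0 : ∀ p → p ≤ℕ N → 0 <ℕ y p
      y>0 p p≤N with p ℕ.≟ N
      ... | yes _ = s≤s z≤n
      ... | no ne = ℕ.≤-trans (ℕ.m<n⇒0<n∸m (ℕ.≤∧≢⇒< p≤N ne)) (ℕ.m≤m+n (N ∸ p) _)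

      z>0 : ∀ p → 0 <ℕ p → p ≤ℕ N → 0 <ℕ z p
      z>0 (suc p) _ _ = s≤s z≤n

      δ : ℕ → ℤ
      δ p with p ℕ.≟ N
      ... | yes _ = 1ℤ
      ... | no _  = 0ℤ

      tilde : ℕ → ℕ → ℤ
      tilde k p with p ℕ.≟ N
      ... | yes _ = 0ℤ
      ... | no _  = U (pred (N ∸ p)) k

      -- The triangle of the smaller size bordered by a unit vector: the data for k + 1 are those of
      -- the smaller size for k, and k = 0 contributes only the corner.
      L : ℕ → ℕ → ℤ
      L zero    = δ
      L (suc k) = tilde k

      δ-N : δ N ≡ 1ℤ
      δ-N with N ℕ.≟ N
      ... | yes _ = refl
      ... | no ne = ⊥-elim (ne refl)

      δ-<N : ∀ p → p <ℕ N → δ p ≡ 0ℤ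
      δ-<N p p<N with p ℕ.≟ N
      ... | yes e = ⊥-elim (ℕ.<⇒≢ p<N e)
      ... | no _  = refl

      tilde-N : ∀ k → tilde k N ≡ 0ℤ
      tilde-N k with N ℕ.≟ N
      ... | yes _ = refl
      ... | no ne = ⊥-elim (ne refl)

      tilde-<N : ∀ k p → p <ℕ N → tilde k p ≡ U (pred (N ∸ p)) k
      tilde-<N k p p<N with p ℕ.≟ N
      ... | yes e = ⊥-elim (ℕ.<⇒≢ p<N e)
      ... | no _  = refl

      block-Gram : ∀ p q → p ≤ℕ N → q ≤ℕ N → block N (+ d 0) (Z N (d ∘ suc)) p q ≡ Gram (suc N) (λ k → + d k) L p q
      block-Gram p q p≤N q≤N with p ℕ.≟ N | q ℕ.≟ N
      ... | yes _ | yes _ = trans (solve 1 (λ d → d := d :* (con 1ℤ :* con 1ℤ) :+ con 0ℤ) refl (+ d 0))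
            (cong (λ s → + d 0 * (1ℤ * 1ℤ) + s) (sym (sumBelow-zero N (λ k → + d (suc k) * (0ℤ * 0ℤ)) (λ k → ℤ.*-zeroʳ (+ d (suc k))))))
      ... | yes _ | no _ = sym (cong₂ _+_ (ℤ.*-zeroʳ (+ d 0))
              (sumBelow-zero N (λ k → + d (suc k) * (0ℤ * U (pred (N ∸ q)) k)) (λ k → ℤ.*-zeroʳ (+ d (suc k)))))
      ... | no _ | yes _ = sym (cong₂ _+_ (ℤ.*-zeroʳ (+ d 0))
              (sumBelow-zero N (λ k → + d (suc k) * (U (pred (N ∸ p)) k * 0ℤ))
                (λ k → trans (cong (+ d (suc k) *_) (ℤ.*-zeroʳ (U (pred (N ∸ p)) k))) (ℤ.*-zeroʳ (+ d (suc k))))))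
      ... | no np | no nq = inner N refl
        where
        inner : ∀ N' → N ≡ N' → Z N' (d ∘ suc) p q ≡ + d 0 * (0ℤ * 0ℤ) + sumBelow N (λ k → + d (suc k) * (U (pred (N ∸ p)) k * U (pred (N ∸ q)) k))
        inner zero    e = trans (sym (ℤ.+-identityˡ 0ℤ)) (cong₂ _+_ (sym (ℤ.*-zeroʳ (+ d 0))) (cong (λ n → sumBelow n (λ k → + d (suc k) * (U (pred (N ∸ p)) k * U (pred (N ∸ q)) k))) (sym e)))
        inner (suc N') refl = trans (sym (ℤ.+-identityˡ _)) (cong₂ _+_ (sym (ℤ.*-zeroʳ (+ d 0)))
          (sumBelow-cong (suc N') (λ k _ → cong₂ (λ a b → + d (suc k) * (U a k * U b k)) (shift p (ℕ.≤∧≢⇒< p≤N np)) (shift q (ℕ.≤∧≢⇒< q≤N nq)))))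
          where
          shift : ∀ p → p <ℕ suc N' → N' ∸ p ≡ pred (suc N' ∸ p)
          shift p (s≤s p≤) = cong pred (sym (ℕ.+-∸-assoc 1 p≤))

      -- This is `U-suc` read as multiplication by the bidiagonal matrix: it raises k by one and
      -- expresses order r through the orders r - 1 and r.
      row : ∀ k p → k ≤ℕ N → p ≤ℕ N → + y p * L k p + + z p * L k (pred p) ≡ U (N ∸ p) k
      row k p k≤N p≤N with ℕ.m≤n⇒m<n∨m≡n p≤N
      row zero zero k≤N p≤N | inj₂ refl = refl
      row zero (suc p) k≤N p≤N | inj₂ refl =
        trans (cong₂ _+_ (cong₂ (λ a b → + a * b) y-N δ-N) (trans (cong (+ z (suc p) *_) (δ-<N p ℕ.≤-refl)) (ℤ.*-zeroʳ (+ z (suc p)))))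
              (sym (cong (λ r → U r 0) (ℕ.n∸n≡0 p)))
      row (suc k) (suc p) k≤N p≤N | inj₂ refl =
        trans (cong₂ _+_ (trans (cong (+ y (suc p) *_) (tilde-N k)) (ℤ.*-zeroʳ (+ y (suc p))))
                (cong₂ (λ a b → + suc (2 *ℕ a) * b) (ℕ.n∸n≡0 p) (trans (tilde-<N k p ℕ.≤-refl) (cong (λ r → U (pred r) k) (ℕ.m+n∸n≡m 1 p)))))
              (trans (ℤ.+-identityˡ _) (sym (cong (λ r → U r (suc k)) (ℕ.n∸n≡0 p))))
      row k p k≤N p≤N | inj₁ p<N = trans (cong (λ a → + a * L k p + + z p * L k (pred p)) (y-<N p p<N)) (below k k≤N p p<N (N ∸ p) refl)
        where
        below : ∀ k → k ≤ℕ N → ∀ p → p <ℕ N → ∀ r → N ∸ p ≡ r → + (2 *ℕ (N ∸ p)) * L k p + + z p * L k (pred p) ≡ U (N ∸ p) k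
        below k k≤N p p<N zero e = ⊥-elim (ℕ.<⇒≢ (ℕ.m<n⇒0<n∸m p<N) (sym e))
        below zero k≤N p p<N (suc r) e =
          trans (cong₂ (λ a b → + (2 *ℕ (N ∸ p)) * a + + z p * b) (δ-<N p p<N) (δ-<N (pred p) (ℕ.≤-<-trans ℕ.pred[n]≤n p<N)))
            (trans (cong₂ _+_ (ℤ.*-zeroʳ (+ (2 *ℕ (N ∸ p)))) (ℤ.*-zeroʳ (+ z p))) (sym (trans (cong (λ r → U r 0) e) (U-0 r))))
        -- In row 0 the recurrence has a term U N k that no preceding row could supply; it vanishes
        -- because k < N.
        below (suc k) k<N zero p<N (suc r) refl =
          trans (cong (λ a → + (2 *ℕ N) * a + 0ℤ) (tilde-<N k 0 p<N))
            (trans (ℤ.+-identityʳ _) (sym (trans (U-suc r k)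
              (trans (cong (λ x → (+ 2 * + suc r + 1ℤ) * x + + 2 * + suc r * U r k) (U-triangular k (suc r) k<N))
                (trans (cong (_+ + 2 * + suc r * U r k) (ℤ.*-zeroʳ (+ 2 * + suc r + 1ℤ)))
                  (trans (ℤ.+-identityˡ _) (cong (_* U r k) (sym (ℤ.pos-* 2 (suc r))))))))))
        below (suc k) k<N (suc p) p<N (suc r) e =
          trans (cong₂ (λ a b → + (2 *ℕ (N ∸ suc p)) * a + + suc (2 *ℕ (N ∸ suc p)) * b)
                  (trans (tilde-<N k (suc p) p<N) (cong (λ r → U (pred r) k) e))
                  (trans (tilde-<N k p (ℕ.<-trans ℕ.≤-refl p<N)) (cong (λ r → U r k) (trans (ℕ.pred[m∸n]≡m∸[1+n] N p) e))))
            (trans (cong (λ r' → + (2 *ℕ r') * U r k + + suc (2 *ℕ r') * U (suc r) k) e)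
              (trans (cong₂ (λ a b → a * U r k + b * U (suc r) k) (ℤ.pos-* 2 (suc r)) (trans (cong (_+_ 1ℤ) (ℤ.pos-* 2 (suc r))) (ℤ.+-comm 1ℤ (+ 2 * + suc r))))
                (trans (ℤ.+-comm (+ 2 * + suc r * U r k) _) (sym (trans (cong (λ r → U r (suc k)) e) (U-suc r k))))))

      bordered-Z : ∀ p q → p <ℕ suc N → q <ℕ suc N → bordered N (d 0) y z (Z N (d ∘ suc)) p q ≡ Z (suc N) d p q
      bordered-Z p q (s≤s p≤N) (s≤s q≤N) = trans
        (cong₂ (λ s t → + y q * s + + z q * t)
          (trans (cong₂ (λ s t → + y p * s + + z p * t) (block-Gram p q p≤N q≤N) (block-Gram (pred p) q p'≤N q≤N)) (sym (sumBelow-linear (suc N) (+ y p) (+ z p) (term p q) (term (pred p) q))))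
          (trans (cong₂ (λ s t → + y p * s + + z p * t) (block-Gram p (pred q) p≤N q'≤N) (block-Gram (pred p) (pred q) p'≤N q'≤N)) (sym (sumBelow-linear (suc N) (+ y p) (+ z p) (term p (pred q)) (term (pred p) (pred q))))))
        (trans (sym (sumBelow-linear (suc N) (+ y q) (+ z q) (λ k → + y p * term p q k + + z p * term (pred p) q k) (λ k → + y p * term p (pred q) k + + z p * term (pred p) (pred q) k)))
          (sumBelow-cong (suc N) λ k k<N → trans
            (solve 9 (λ yq yp d a a' b b' zp zq →
              yq :* (yp :* (d :* (a :* b)) :+ zp :* (d :* (a' :* b))) :+ zq :* (yp :* (d :* (a :* b')) :+ zp :* (d :* (a' :* b'))) :=
              d :* ((yp :* a :+ zp :* a') :* (yq :* b :+ zq :* b'))) refl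
              (+ y q) (+ y p) (+ d k) (L k p) (L k (pred p)) (L k q) (L k (pred q)) (+ z p) (+ z q))
            (cong₂ (λ a b → + d k * (a * b)) (row k p (ℕ.≤-pred k<N) p≤N) (row k q (ℕ.≤-pred k<N) q≤N))))
        where
        term : ℕ → ℕ → ℕ → ℤ
        term p q k = + d k * (L k p * L k q)
        p'≤N : pred p ≤ℕ N
        p'≤N = ℕ.≤-trans ℕ.pred[n]≤n p≤N
        q'≤N : pred q ≤ℕ N
        q'≤N = ℕ.≤-trans ℕ.pred[n]≤n q≤N

  Z-tp : ∀ N d → (∀ k → k <ℕ N → 0 <ℕ d k) → TP N (Z N d)
  Z-tp zero    d d>0 = tp-empty _
  Z-tp (suc N) d d>0 = tp-cong bordered-Z
    (Bordered.bordered-tp N (d 0) (d>0 0 (s≤s z≤n)) y z y>0 z>0 (Z N (d ∘ suc)) (Z-tp N (d ∘ suc) (λ k p → d>0 (suc k) (s≤s p))))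
    where open Step N d

-- Multisets and the expansion of their number

module Multichoose where

  open import Defs hiding (B)
  open FiniteDifferences
  open import Data.Nat using (ℕ; zero; suc; z≤n; s≤s; _∸_) renaming (_+_ to _+ℕ_; _*_ to _*ℕ_; _<_ to _<ℕ_; _≤_ to _≤ℕ_)
  import Data.Nat.Properties as ℕ
  open import Data.Integer using (ℤ; +_; -_; _+_; _-_; _*_; _^_; 1ℤ)
  import Data.Integer.Properties as ℤ
  open import Data.Integer.Solver using (module +-*-Solver)
  open import Relation.Binary.PropositionalEquality
  open import Function using (_∘_)

  open +-*-Solver

  multichoose : ℕ → ℕ → ℕ
  multichoose N       zero    = 1
  multichoose zero    (suc n) = 0
  multichoose (suc N) (suc n) = multichoose N (suc n) +ℕ multichoose (suc N) n

  private
    mutual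
      -- The two ways of reaching a neighbouring binomial coefficient by a rational factor; each is
      -- proved from the other at smaller arguments.
      raise-top : ∀ n N → + (N +ℕ n) * + multichoose N n ≡ + N * + multichoose (suc N) n
      raise-top zero    N = cong (λ k → + k * 1ℤ) (ℕ.+-identityʳ N)
      raise-top (suc n) N = trans (cong (λ k → + k * + multichoose N (suc n)) (ℕ.+-suc N n))
        (trans (solve 3 (λ N n x → (con 1ℤ :+ (N :+ n)) :* x := N :* x :+ (con 1ℤ :+ n) :* x) refl (+ N) (+ n) (+ multichoose N (suc n)))
          (trans (cong (λ z → + N * + multichoose N (suc n) + z) (trans (raise-size n N) (raise-top n N)))
            (solve 3 (λ N x y → N :* x :+ N :* y := N :* (x :+ y)) refl (+ N) (+ multichoose N (suc n)) (+ multichoose (suc N) n))))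

      raise-size : ∀ n N → + suc n * + multichoose N (suc n) ≡ + (N +ℕ n) * + multichoose N n
      raise-size zero    zero    = refl
      raise-size (suc n) zero    = trans (ℤ.*-zeroʳ (+ suc (suc n))) (sym (ℤ.*-zeroʳ (+ suc n)))
      raise-size n       (suc N) = trans
        (solve 3 (λ n x y → (con 1ℤ :+ n) :* (x :+ y) := (con 1ℤ :+ n) :* x :+ (con 1ℤ :+ n) :* y) refl (+ n) (+ multichoose N (suc n)) (+ multichoose (suc N) n))
        (trans (cong (λ z → z + + suc n * + multichoose (suc N) n) (trans (raise-size n N) (raise-top n N)))
          (solve 3 (λ N n x → N :* x :+ (con 1ℤ :+ n) :* x := (con 1ℤ :+ (N :+ n)) :* x) refl (+ N) (+ n) (+ multichoose (suc N) n)))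

  -- The order 2^n n! of the group of type B_n.
  scale : ℕ → ℕ
  scale zero    = 1
  scale (suc n) = 2 *ℕ suc n *ℕ scale n

  scale>0 : ∀ n → 0 <ℕ scale n
  scale>0 zero    = s≤s z≤n
  scale>0 (suc n) = ℕ.*-mono-≤ {1} {2 *ℕ suc n} (s≤s z≤n) (scale>0 n)

  -- coefficients of (z + 1) (z + 3) ⋯ (z + 2 n - 1)
  coeff : ℕ → ℕ → ℕ
  coeff zero    zero    = 1
  coeff zero    (suc k) = 0
  coeff (suc n) zero    = suc (2 *ℕ n) *ℕ coeff n 0
  coeff (suc n) (suc k) = coeff n k +ℕ suc (2 *ℕ n) *ℕ coeff n (suc k)

  coeff>0 : ∀ n k → k ≤ℕ n → 0 <ℕ coeff n k
  coeff>0 zero    zero    _       = s≤s z≤n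
  coeff>0 (suc n) zero    _       = ℕ.≤-trans (coeff>0 n 0 z≤n) (ℕ.m≤m+n (coeff n 0) _)
  coeff>0 (suc n) (suc k) (s≤s p) = ℕ.≤-trans (coeff>0 n k p) (ℕ.m≤m+n (coeff n k) _)

  coeff-zero : ∀ n k → n <ℕ k → coeff n k ≡ 0
  coeff-zero zero    (suc k) _       = refl
  coeff-zero (suc n) (suc k) (s≤s p) = cong₂ _+ℕ_ (coeff-zero n k p)
    (trans (cong (suc (2 *ℕ n) *ℕ_) (coeff-zero n (suc k) (ℕ.≤-trans p (ℕ.n≤1+n k)))) (ℕ.*-zeroʳ (suc (2 *ℕ n))))

  sumBelow-last : ∀ n f → sumBelow (suc n) f ≡ sumBelow n f + f n
  sumBelow-last zero    f = trans (ℤ.+-identityʳ (f 0)) (sym (ℤ.+-identityˡ (f 0)))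
  sumBelow-last (suc n) f = trans (cong (λ z → f 0 + z) (sumBelow-last n (f ∘ suc))) (sym (ℤ.+-assoc (f 0) _ _))

  coeffSum : ℕ → ℤ → ℤ
  coeffSum n z = sumBelow (suc n) (λ k → + coeff n k * z ^ k)

  coeffSum-suc : ∀ n z → coeffSum (suc n) z ≡ (z + + suc (2 *ℕ n)) * coeffSum n z
  coeffSum-suc n z = trans
    (cong₂ _+_ (trans (cong (_* 1ℤ) (ℤ.pos-* (suc (2 *ℕ n)) (coeff n 0))) refl)
      (trans (sumBelow-cong (suc n) (λ k _ → trans (cong (_* z ^ suc k) (trans (ℤ.pos-+ (coeff n k) _) (cong (λ x → + coeff n k + x) (ℤ.pos-* (suc (2 *ℕ n)) (coeff n (suc k))))))
          (solve 5 (λ a o b z p → (a :+ o :* b) :* (z :* p) := z :* (a :* p) :+ o :* (b :* (z :* p))) refl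
            (+ coeff n k) (+ suc (2 *ℕ n)) (+ coeff n (suc k)) z (z ^ k))))
        (sumBelow-linear (suc n) z (+ suc (2 *ℕ n)) (λ k → + coeff n k * z ^ k) (λ k → + coeff n (suc k) * z ^ suc k))))
    (trans (solve 5 (λ o c z s t → o :* c :* con 1ℤ :+ (z :* s :+ o :* t) := z :* s :+ o :* (c :* con 1ℤ :+ t)) refl
        (+ suc (2 *ℕ n)) (+ coeff n 0) z (coeffSum n z) (sumBelow (suc n) (λ k → + coeff n (suc k) * z ^ suc k)))
      (trans (cong (λ x → z * coeffSum n z + + suc (2 *ℕ n) * x)
          (trans (sumBelow-last (suc n) (λ k → + coeff n k * z ^ k))
            (trans (cong (λ c → coeffSum n z + + c * z ^ suc n) (coeff-zero n (suc n) ℕ.≤-refl)) (ℤ.+-identityʳ (coeffSum n z)))))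
        (solve 3 (λ z o s → z :* s :+ o :* s := (z :+ o) :* s) refl z (+ suc (2 *ℕ n)) (coeffSum n z))))

  -- Doubling the factor N + i of the rising factorial gives z + 2 i + 1, since 2 N = z + 1.
  scale-multichoose : ∀ n N z → + 2 * + N ≡ z + 1ℤ → + scale n * + multichoose N n ≡ coeffSum n z
  scale-multichoose zero    N z e = refl
  scale-multichoose (suc n) N z e = trans (cong (_* + multichoose N (suc n)) (trans (ℤ.pos-* (2 *ℕ suc n) (scale n)) (cong (_* + scale n) (ℤ.pos-* 2 (suc n)))))
    (trans (solve 3 (λ s c x → con (+ 2) :* s :* c :* x := con (+ 2) :* (c :* (s :* x))) refl (+ suc n) (+ scale n) (+ multichoose N (suc n)))
      (trans (cong (λ x → + 2 * (+ scale n * x)) (raise-size n N))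
        (trans (solve 4 (λ c N n x → con (+ 2) :* (c :* ((N :+ n) :* x)) := (con (+ 2) :* N :+ con (+ 2) :* n) :* (c :* x)) refl (+ scale n) (+ N) (+ n) (+ multichoose N n))
          (trans (cong₂ (λ x y → (x + + 2 * + n) * y) e (scale-multichoose n N z e))
            (trans (cong (_* coeffSum n z) (trans (ℤ.+-assoc z 1ℤ (+ 2 * + n)) (cong (λ x → z + (1ℤ + x)) (sym (ℤ.pos-* 2 n)))))
              (sym (coeffSum-suc n z)))))))

  Δ-sumBelow : ∀ r N (f : ℕ → ℕ → ℤ) R → Δ r (λ R → sumBelow N (λ k → f k R)) R ≡ sumBelow N (λ k → Δ r (f k) R)
  Δ-sumBelow r zero    f R = Δ-zero r R
  Δ-sumBelow r (suc N) f R = trans (Δ-+ r (f 0) (λ R → sumBelow N (λ k → f (suc k) R)) R) (cong (λ z → Δ r (f 0) R + z) (Δ-sumBelow r N (f ∘ suc) R))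

  total : ℕ → ℕ → ℕ → ℤ
  total n S R = + multichoose (suc S +ℕ R *ℕ suc (2 *ℕ S)) n

  ^-distrib : ∀ x y k → (x * y) ^ k ≡ x ^ k * y ^ k
  ^-distrib x y zero    = refl
  ^-distrib x y (suc k) = trans (cong (x * y *_) (^-distrib x y k))
    (solve 4 (λ x y a b → x :* y :* (a :* b) := x :* a :* (y :* b)) refl x y (x ^ k) (y ^ k))

  scaled-total : ∀ n S R → + scale n * total n S R ≡ coeffSum n (odd R * odd S)
  scaled-total n S R = scale-multichoose n (suc S +ℕ R *ℕ suc (2 *ℕ S)) (odd R * odd S)
    (trans (cong (+ 2 *_) (trans (ℤ.pos-+ (suc S) (R *ℕ suc (2 *ℕ S))) (cong (λ x → + suc S + x) (trans (ℤ.pos-* R (suc (2 *ℕ S))) (cong (λ x → + R * (1ℤ + x)) (ℤ.pos-* 2 S))))))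
      (solve 2 (λ S R → con (+ 2) :* ((con 1ℤ :+ S) :+ R :* (con 1ℤ :+ con (+ 2) :* S)) :=
        (con (+ 2) :* R :+ con 1ℤ) :* (con (+ 2) :* S :+ con 1ℤ) :+ con 1ℤ) refl (+ S) (+ R)))

  -- Each power of (2 R + 1)(2 S + 1) separates into a function of R times a function of S, so the
  -- two differences act independently and produce U r k · U s k.
  differences-Z : ∀ n p q → + scale n * Δ (n ∸ q) (λ S → Δ (n ∸ p) (total n S) 0) 0 ≡ Z (suc n) (coeff n) p q
  differences-Z n p q = trans (sym (Δ-scale s (+ scale n) _ 0))
    (trans (Δ-cong s (λ S → trans (sym (Δ-scale r (+ scale n) (total n S) 0))
        (trans (Δ-cong r (λ R → trans (scaled-total n S R) (sumBelow-cong (suc n) (λ k _ → cong (+ coeff n k *_) (trans (^-distrib (odd R) (odd S) k) (ℤ.*-comm (odd R ^ k) (odd S ^ k)))))) 0)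
          (trans (Δ-sumBelow r (suc n) (λ k R → + coeff n k * (odd S ^ k * odd R ^ k)) 0)
            (sumBelow-cong (suc n) (λ k _ → trans (Δ-scale r (+ coeff n k) (λ R → odd S ^ k * odd R ^ k) 0)
               (cong (+ coeff n k *_) (trans (Δ-scale r (odd S ^ k) (λ R → odd R ^ k) 0) (ℤ.*-comm (odd S ^ k) (U r k))))))))) 0)
      (trans (Δ-sumBelow s (suc n) (λ k S → + coeff n k * (U r k * odd S ^ k)) 0)
        (sumBelow-cong (suc n) (λ k _ → trans (Δ-scale s (+ coeff n k) (λ S → U r k * odd S ^ k) 0)
          (cong (+ coeff n k *_) (Δ-scale s (U r k) (λ S → odd S ^ k) 0))))))
    where
    r = n ∸ p
    s = n ∸ q

-- Sorted words and inclusion-exclusion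

module SortedTuples where

  open import Defs hiding (B)
  open FiniteDifferences
  open Multichoose
  open Metamatrices using (sum-cong; sum-zero; sum-filter)
  open import Data.Nat using (ℕ; zero; suc; z≤n; s≤s; _≡ᵇ_; _<ᵇ_; _∸_; _≤ᵇ_) renaming (_+_ to _+ℕ_; _*_ to _*ℕ_; _<_ to _<ℕ_; _≤_ to _≤ℕ_)
  import Data.Nat.Properties as ℕ
  open import Data.Integer using (+≤+; -≤+; -≤-; ℤ; +_; -[1+_]; -_; _+_; _-_; ∣_∣; 0ℤ; 1ℤ) renaming (_≤ᵇ_ to _≤ℤᵇ_; _≤_ to _≤ℤ_)
  import Data.Integer.Properties as ℤ
  open import Data.Integer.Solver using (module +-*-Solver)
  open import Data.Bool using (Bool; true; false; _∧_; _∨_; not; if_then_else_; T)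
  import Data.Bool.Properties as Bool
  open import Data.Fin.Subset using (Subset)
  open import Data.List using (List; []; _∷_; _++_; map; concatMap; upTo; filterᵇ; applyUpTo; _∷ʳ_)
  import Data.List.Properties as List
  open import Data.Nat.ListAction using (sum)
  open import Data.Nat.ListAction.Properties using (sum-++)
  open import Data.Vec using (Vec) renaming ([] to []ᵛ; _∷_ to _∷ᵛ_)
  import Data.Vec as Vec
  open import Data.Unit using (tt)
  open import Data.Sum using (inj₁; inj₂)
  open import Relation.Nullary using (yes; no)
  open import Function.Bundles using (Equivalence)
  open import Data.Empty using (⊥-elim)
  open import Relation.Binary.PropositionalEquality
  open import Function using (_∘_; id)

  open +-*-Solver

  ∑ : {A : Set} → List A → (A → ℕ) → ℕ
  ∑ xs f = sum (map f xs)

  ∑-++ : {A : Set} (xs ys : List A) (f : A → ℕ) → ∑ (xs ++ ys) f ≡ ∑ xs f +ℕ ∑ ys f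
  ∑-++ xs ys f = trans (cong sum (List.map-++ f xs ys)) (sum-++ (map f xs) (map f ys))

  ∑-map : {A B : Set} (g : A → B) (f : B → ℕ) (xs : List A) → ∑ (map g xs) f ≡ ∑ xs (f ∘ g)
  ∑-map g f xs = cong sum (sym (List.map-∘ xs))

  ∑-concatMap : {A B : Set} (g : A → List B) (f : B → ℕ) (xs : List A) → ∑ (concatMap g xs) f ≡ ∑ xs (λ x → ∑ (g x) f)
  ∑-concatMap g f []       = refl
  ∑-concatMap g f (x ∷ xs) = trans (∑-++ (g x) (concatMap g xs) f) (cong (∑ (g x) f +ℕ_) (∑-concatMap g f xs))

  ∑-+ : {A : Set} (f g : A → ℕ) (xs : List A) → ∑ xs (λ x → f x +ℕ g x) ≡ ∑ xs f +ℕ ∑ xs g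
  ∑-+ f g []       = refl
  ∑-+ f g (x ∷ xs) = trans (cong (f x +ℕ g x +ℕ_) (∑-+ f g xs))
    (trans (ℕ.+-assoc (f x) (g x) _) (trans (cong (f x +ℕ_) (trans (sym (ℕ.+-assoc (g x) _ _)) (trans (cong (_+ℕ ∑ xs g) (ℕ.+-comm (g x) (∑ xs f))) (ℕ.+-assoc (∑ xs f) (g x) _))))
      (sym (ℕ.+-assoc (f x) (∑ xs f) _))))

  ∑-swap : {A B : Set} (f : A → B → ℕ) (xs : List A) (ys : List B) → ∑ xs (λ x → ∑ ys (f x)) ≡ ∑ ys (λ y → ∑ xs (λ x → f x y))
  ∑-swap f []       ys = sym (sum-zero ys)
  ∑-swap f (x ∷ xs) ys = trans (cong (∑ ys (f x) +ℕ_) (∑-swap f xs ys)) (sym (∑-+ (f x) (λ y → ∑ xs (λ x → f x y)) ys))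

  ∑-if : {A : Set} (b : Bool) (f : A → ℕ) (xs : List A) → (if b then ∑ xs f else 0) ≡ ∑ xs (λ x → if b then f x else 0)
  ∑-if true  f xs = refl
  ∑-if false f xs = sym (sum-zero xs)

  ∑-upTo : ∀ n (g : ℕ → ℕ) (f : ℕ → ℕ) → + ∑ (applyUpTo g n) f ≡ sumBelow n (λ k → + f (g k))
  ∑-upTo zero    g f = refl
  ∑-upTo (suc n) g f = cong (λ z → + f (g 0) + z) (∑-upTo n (g ∘ suc) f)

  ind : Bool → ℕ
  ind b = if b then 1 else 0

  tuples : {A : Set} → ∀ n → List A → List (Vec A n)
  tuples zero    as = []ᵛ ∷ []
  tuples (suc n) as = concatMap (λ a → map (a ∷ᵛ_) (tuples n as)) as

  cnt : {A : Set} → ∀ n → List A → (Vec A n → Bool) → ℕ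
  cnt n as P = ∑ (tuples n as) (ind ∘ P)

  cnt-suc : {A : Set} → ∀ n (as : List A) P → cnt (suc n) as P ≡ ∑ as (λ a → cnt n as (P ∘ (a ∷ᵛ_)))
  cnt-suc n as P = trans (∑-concatMap (λ a → map (a ∷ᵛ_) (tuples n as)) (ind ∘ P) as)
    (sum-cong (λ a → ∑-map (a ∷ᵛ_) (ind ∘ P) (tuples n as)) as)

  cnt-cong : {A : Set} → ∀ n (as : List A) {P Q : Vec A n → Bool} → (∀ x → P x ≡ Q x) → cnt n as P ≡ cnt n as Q
  cnt-cong n as e = sum-cong (λ x → cong ind (e x)) (tuples n as)

  cnt-∧ : {A : Set} → ∀ n (as : List A) b P → cnt n as (λ x → b ∧ P x) ≡ (if b then cnt n as P else 0)
  cnt-∧ n as true  P = refl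
  cnt-∧ n as false P = sum-zero (tuples n as)

  cnt-map : {A B : Set} → ∀ n (g : A → B) (as : List A) P → cnt n (map g as) P ≡ cnt n as (P ∘ Vec.map g)
  cnt-map zero    g as P = refl
  cnt-map (suc n) g as P = trans (cnt-suc n (map g as) P) (trans (∑-map g _ as)
    (trans (sum-cong (λ a → cnt-map n g as (P ∘ (g a ∷ᵛ_))) as) (sym (cnt-suc n as (P ∘ Vec.map g)))))

  falses : ∀ {n} → Subset n → ℕ
  falses []ᵛ          = 0
  falses (true  ∷ᵛ I) = falses I
  falses (false ∷ᵛ I) = suc (falses I)

  -- A position outside the subset is free of its predecessor, so the word breaks into weakly
  -- decreasing runs; `t` plays the predecessor of the first letter.
  descending : ∀ {n} → ℕ → Subset n → Vec ℕ n → Bool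
  descending t []ᵛ      []ᵛ       = true
  descending t (i ∷ᵛ I) (u ∷ᵛ us) = (if i then u ≤ᵇ t else true) ∧ descending u I us

  K : ℕ → ℕ → ℕ → ℕ → ℕ
  K n w r t = ∑ (allSubsets n) (λ I → if falses I ≡ᵇ r then cnt n (upTo w) (descending t I) else 0)

  previous : (ℕ → ℕ) → ℕ → ℕ
  previous f zero    = 0
  previous f (suc r) = f r

  private
    pull : ∀ n w r (b : ℕ → Bool) →
      ∑ (allSubsets n) (λ I → if falses I ≡ᵇ r then ∑ (upTo w) (λ u → if b u then cnt n (upTo w) (descending u I) else 0) else 0) ≡
      ∑ (upTo w) (λ u → if b u then K n w r u else 0)
    pull n w r b = trans (sum-cong (λ I → ∑-if (falses I ≡ᵇ r) _ (upTo w)) (allSubsets n))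
      (trans (∑-swap _ (allSubsets n) (upTo w)) (sum-cong (λ u → collect (b u) u) (upTo w)))
      where
      collect : ∀ c u → ∑ (allSubsets n) (λ I → if falses I ≡ᵇ r then (if c then cnt n (upTo w) (descending u I) else 0) else 0) ≡
                        (if c then K n w r u else 0)
      collect true  u = refl
      collect false u = trans (sum-cong (λ I → Bool.if-eta (falses I ≡ᵇ r)) (allSubsets n)) (sum-zero (allSubsets n))

    K-suc : ∀ n w r t → K (suc n) w r t ≡ ∑ (upTo w) (λ u → if u ≤ᵇ t then K n w r u else 0) +ℕ previous (λ r → ∑ (upTo w) (K n w r)) r
    K-suc n w r t = trans (∑-++ (map (true ∷ᵛ_) (allSubsets n)) (map (false ∷ᵛ_) (allSubsets n)) _)
      (cong₂ _+ℕ_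
        (trans (∑-map (true ∷ᵛ_) _ (allSubsets n))
          (trans (sum-cong (λ I → cong (λ x → if falses I ≡ᵇ r then x else 0)
              (trans (cnt-suc n (upTo w) (descending t (true ∷ᵛ I))) (sum-cong (λ u → cnt-∧ n (upTo w) (u ≤ᵇ t) (descending u I)) (upTo w)))) (allSubsets n))
            (pull n w r (_≤ᵇ t))))
        (trans (∑-map (false ∷ᵛ_) _ (allSubsets n)) (drop r)))
      where
      drop : ∀ r → ∑ (allSubsets n) (λ I → if suc (falses I) ≡ᵇ r then cnt (suc n) (upTo w) (descending t (false ∷ᵛ I)) else 0) ≡ previous (λ r → ∑ (upTo w) (K n w r)) r
      drop zero    = sum-zero (allSubsets n)
      drop (suc r) = trans (sum-cong (λ I → cong (λ x → if falses I ≡ᵇ r then x else 0) (cnt-suc n (upTo w) (descending t (false ∷ᵛ I)))) (allSubsets n))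
        (pull n w r (λ _ → true))

    sumBelow-+ : ∀ a b f → sumBelow (a +ℕ b) f ≡ sumBelow a f + sumBelow b (λ k → f (a +ℕ k))
    sumBelow-+ zero    b f = sym (ℤ.+-identityˡ _)
    sumBelow-+ (suc a) b f = trans (cong (λ z → f 0 + z) (sumBelow-+ a b (f ∘ suc))) (sym (ℤ.+-assoc (f 0) _ _))

    multichoose-sum : ∀ N n → + multichoose N (suc n) ≡ sumBelow N (λ i → + multichoose (suc i) n)
    multichoose-sum zero    n = refl
    multichoose-sum (suc N) n = trans (cong (_+ + multichoose (suc N) n) (multichoose-sum N n)) (sym (sumBelow-last N (λ i → + multichoose (suc i) n)))

    sumBelow-prefix : ∀ R w f → sumBelow (R *ℕ w) f ≡ prefix (λ R' → sumBelow w (λ k → f (R' *ℕ w +ℕ k))) R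
    sumBelow-prefix zero    w f = refl
    sumBelow-prefix (suc R) w f = trans (cong (λ N → sumBelow N f) (ℕ.+-comm w (R *ℕ w)))
      (trans (sumBelow-+ (R *ℕ w) w f) (cong (_+ sumBelow w (λ k → f (R *ℕ w +ℕ k))) (sumBelow-prefix R w f)))

    ≤ᵇ-true : ∀ {m n} → m ≤ℕ n → (m ≤ᵇ n) ≡ true
    ≤ᵇ-true p = Equivalence.to Bool.T-≡ (ℕ.≤⇒≤ᵇ p)

    ≤ᵇ-false : ∀ m n → n <ℕ m → (m ≤ᵇ n) ≡ false
    ≤ᵇ-false m n p with m ≤ᵇ n in e
    ... | false = refl
    ... | true  = ⊥-elim (ℕ.<⇒≱ p (ℕ.≤ᵇ⇒≤ m n (subst T (sym e) tt)))

    truncate : ∀ w t f → t <ℕ w → sumBelow w (λ u → if u ≤ᵇ t then f u else 0ℤ) ≡ sumBelow (suc t) f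
    truncate w t f t<w = trans (cong (λ w → sumBelow w g) (sym (ℕ.m+[n∸m]≡n t<w)))
      (trans (sumBelow-+ (suc t) (w ∸ suc t) g)
        (trans (cong₂ _+_ (sumBelow-cong (suc t) (λ u u≤t → cong (λ b → if b then f u else 0ℤ) (≤ᵇ-true (ℕ.≤-pred u≤t))))
            (sumBelow-zero (w ∸ suc t) (λ k → g (suc t +ℕ k)) (λ k → cong (λ b → if b then f (suc t +ℕ k) else 0ℤ) (≤ᵇ-false (suc t +ℕ k) t (s≤s (ℕ.m≤m+n t k))))))
          (ℤ.+-identityʳ _)))
      where
      g : ℕ → ℤ
      g u = if u ≤ᵇ t then f u else 0ℤ

    if-+ : ∀ b x → + (if b then x else 0) ≡ (if b then + x else 0ℤ)
    if-+ true  x = refl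
    if-+ false x = refl

  -- Put R further copies of the alphabet of size w below the letters 0, ..., t. In a weakly
  -- decreasing word over this chain each drop to a lower copy frees the letter, and r drops can
  -- choose their copies in binomial(R, r) ways. So the number of multisets is Σ_r binomial(R, r)
  -- K_r, and K_r is its r-th difference at 0. The proof splits off the first letter: `low` stays in
  -- the present copy, `high` drops.
  K-total : ∀ n w r t → t <ℕ w → + K n w r t ≡ Δ r (λ R → + multichoose (suc t +ℕ R *ℕ w) n) 0
  K-total zero w zero    t t<w = refl
  K-total zero w (suc r) t t<w = sym (Δ-const r 1ℤ 0)
  K-total (suc n) w r t t<w = trans (cong +_ (K-suc n w r t))
    (trans (ℤ.pos-+ (∑ (upTo w) (λ u → if u ≤ᵇ t then K n w r u else 0)) _)
      (trans (cong₂ _+_ low (high r))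
        (trans (ℤ.+-comm (Δ r lowF 0) (Δ r highF 0)) (trans (sym (Δ-+ r highF lowF 0)) (Δ-cong r (λ R → sym (split R)) 0)))))
    where
    lowF highF : ℕ → ℤ
    lowF R = sumBelow (suc t) (λ u → + multichoose (suc u +ℕ R *ℕ w) n)
    highF = prefix (λ R → sumBelow w (λ u → + multichoose (suc u +ℕ R *ℕ w) n))
    low : + ∑ (upTo w) (λ u → if u ≤ᵇ t then K n w r u else 0) ≡ Δ r lowF 0
    low = trans (∑-upTo w id (λ u → if u ≤ᵇ t then K n w r u else 0))
      (trans (sumBelow-cong w (λ u _ → if-+ (u ≤ᵇ t) (K n w r u)))
        (trans (truncate w t (λ u → + K n w r u) t<w)
          (trans (sumBelow-cong (suc t) (λ u u≤t → K-total n w r u (ℕ.≤-trans u≤t t<w)))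
            (sym (Δ-sumBelow r (suc t) (λ u R → + multichoose (suc u +ℕ R *ℕ w) n) 0)))))
    high : ∀ r → + previous (λ r → ∑ (upTo w) (K n w r)) r ≡ Δ r highF 0
    high zero    = refl
    high (suc r) = trans (∑-upTo w id (K n w r)) (trans (sumBelow-cong w (λ u u<w → K-total n w r u u<w))
      (trans (sym (Δ-sumBelow r w (λ u R → + multichoose (suc u +ℕ R *ℕ w) n) 0)) (sym (Δ-prefix r _ 0))))
    split : ∀ R → + multichoose (suc t +ℕ R *ℕ w) (suc n) ≡ highF R + lowF R
    split R = trans (cong (λ N → + multichoose N (suc n)) (ℕ.+-comm (suc t) (R *ℕ w)))
      (trans (multichoose-sum (R *ℕ w +ℕ suc t) n)
        (trans (sumBelow-+ (R *ℕ w) (suc t) (λ i → + multichoose (suc i) n))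
          (cong₂ _+_ (trans (sumBelow-prefix R w (λ i → + multichoose (suc i) n)) (prefix-cong R))
                     (sumBelow-cong (suc t) (λ k _ → cong (λ N → + multichoose (suc N) n) (ℕ.+-comm (R *ℕ w) k))))))
      where
      prefix-cong : ∀ R → prefix (λ R' → sumBelow w (λ k → + multichoose (suc (R' *ℕ w +ℕ k)) n)) R ≡ highF R
      prefix-cong zero    = refl
      prefix-cong (suc R) = cong₂ _+_ (prefix-cong R) (sumBelow-cong w (λ k _ → cong (λ N → + multichoose (suc N) n) (ℕ.+-comm (R *ℕ w) k)))

  -- The first generator compares a coordinate with 0, the others with the preceding coordinate, so
  -- starting from 0 this is I-dominance for signed permutations.
  sortedFrom : ∀ {n} → ℤ → Subset n → Vec ℤ n → Bool
  sortedFrom p []ᵛ      []ᵛ       = true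
  sortedFrom p (i ∷ᵛ I) (x ∷ᵛ xs) = (if i then p ≤ℤᵇ x else true) ∧ sortedFrom x I xs

  -- Listed in decreasing order, so that position t carries s - t and sorted words become descending
  -- words of positions; 0 sits at position s.
  letters : ℕ → List ℤ
  letters zero    = 0ℤ ∷ []
  letters (suc s) = + suc s ∷ (letters s ∷ʳ -[1+ s ])

  hasAbs : ∀ {n} → ℕ → Vec ℤ n → Bool
  hasAbs k []ᵛ       = false
  hasAbs k (x ∷ᵛ xs) = (∣ x ∣ ≡ᵇ k) ∨ hasAbs k xs

  usesBelow : ∀ {n} → ℕ → Vec ℤ n → Bool
  usesBelow zero    x = true
  usesBelow (suc j) x = usesBelow j x ∧ hasAbs (suc j) x

  letters-applyUpTo : ∀ s → letters s ≡ applyUpTo (λ t → + s - + t) (suc (2 *ℕ s))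
  letters-applyUpTo zero    = refl
  letters-applyUpTo (suc s) = cong₂ _∷_ (sym (ℤ.+-identityʳ (+ suc s)))
    (trans (cong₂ _∷ʳ_ (letters-applyUpTo s) (solve′ s))
      (trans (List.applyUpTo-∷ʳ (λ t → + s - + t) (suc (2 *ℕ s)))
        (trans (cong (applyUpTo (λ t → + s - + t)) (cong suc (sym (ℕ.+-suc s (s +ℕ 0)))))
          (applyUpTo-cong (suc (s +ℕ suc (s +ℕ 0))) (λ t → solve 2 (λ s t → s :- t := (con 1ℤ :+ s) :- (con 1ℤ :+ t)) refl (+ s) (+ t))))))
    where
    applyUpTo-cong : ∀ n {f g : ℕ → ℤ} → (∀ t → f t ≡ g t) → applyUpTo f n ≡ applyUpTo g n
    applyUpTo-cong zero    e = refl
    applyUpTo-cong (suc n) e = cong₂ _∷_ (e 0) (applyUpTo-cong n (e ∘ suc))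
    solve′ : ∀ s → -[1+ s ] ≡ + s - + suc (2 *ℕ s)
    solve′ s = trans (solve 1 (λ s → :- (con 1ℤ :+ s) := s :- (con 1ℤ :+ con (+ 2) :* s)) refl (+ s))
      (cong (λ x → + s - (1ℤ + x)) (sym (ℤ.pos-* 2 s)))

  private
    bool-ext : ∀ {a b} → (a ≡ true → b ≡ true) → (b ≡ true → a ≡ true) → a ≡ b
    bool-ext {true}  {b}     f g = sym (f refl)
    bool-ext {false} {false} f g = refl
    bool-ext {false} {true}  f g = g refl

    from-true : ∀ {b} → b ≡ true → T b
    from-true e = subst T (sym e) tt

    to-true : ∀ {b} → T b → b ≡ true
    to-true {true} _ = refl

    reversed : ∀ s t u → (+ s - + t ≤ℤᵇ + s - + u) ≡ (u ≤ᵇ t)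
    reversed s t u = bool-ext
      (λ e → to-true (ℕ.≤⇒≤ᵇ (ℤ.drop‿+≤+ (ℤ.neg-cancel-≤ (subst₂ _≤ℤ_ (drop t) (drop u) (ℤ.+-monoʳ-≤ (- + s) (ℤ.≤ᵇ⇒≤ {+ s - + t} (from-true e))))))))
      (λ e → to-true (ℤ.≤⇒≤ᵇ (ℤ.+-monoʳ-≤ (+ s) (ℤ.neg-mono-≤ (+≤+ (ℕ.≤ᵇ⇒≤ u t (from-true e)))))))
      where
      drop : ∀ t → - + s + (+ s - + t) ≡ - + t
      drop t = solve 2 (λ s t → :- s :+ (s :- t) := :- t) refl (+ s) (+ t)

    sorted-descending : ∀ {n} s t (I : Subset n) us → sortedFrom (+ s - + t) I (Vec.map (λ u → + s - + u) us) ≡ descending t I us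
    sorted-descending s t []ᵛ      []ᵛ       = refl
    sorted-descending s t (i ∷ᵛ I) (u ∷ᵛ us) = cong₂ (λ a b → (if i then a else true) ∧ b) (reversed s t u) (sorted-descending s u I us)

  sorted-count : ∀ {n} S (I : Subset n) → cnt n (letters S) (sortedFrom 0ℤ I) ≡ cnt n (upTo (suc (2 *ℕ S))) (descending S I)
  sorted-count {n} S I = trans (cong (λ as → cnt n as (sortedFrom 0ℤ I)) (trans (letters-applyUpTo S) (sym (List.map-applyUpTo id (λ t → + S - + t) (suc (2 *ℕ S))))))
    (trans (cnt-map n (λ t → + S - + t) (upTo (suc (2 *ℕ S))) (sortedFrom 0ℤ I))
      (cnt-cong n (upTo (suc (2 *ℕ S))) (λ us → trans (cong (λ p → sortedFrom p I (Vec.map (λ t → + S - + t) us)) (sym (ℤ.+-inverseʳ (+ S)))) (sorted-descending S S I us))))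

  -- relabelling that skips the absolute value j + 1
  bump : ℕ → ℕ → ℕ
  bump j k = if k <ᵇ j then k else suc k

  relabel : ℕ → ℤ → ℤ
  relabel j (+ zero)  = 0ℤ
  relabel j (+ suc k) = + suc (bump j k)
  relabel j -[1+ k ]  = -[1+ bump j k ]

  private
    <ᵇ-true : ∀ {m n} → m <ℕ n → (m <ᵇ n) ≡ true
    <ᵇ-true p = to-true (ℕ.<⇒<ᵇ p)

    <ᵇ-false : ∀ m n → n ≤ℕ m → (m <ᵇ n) ≡ false
    <ᵇ-false m n p with m <ᵇ n in e
    ... | false = refl
    ... | true  = ⊥-elim (ℕ.<⇒≱ (ℕ.<ᵇ⇒< m n (from-true e)) p)

    ≡ᵇ-false : ∀ m n → m ≢ n → (m ≡ᵇ n) ≡ false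
    ≡ᵇ-false m n p with m ≡ᵇ n in e
    ... | false = refl
    ... | true  = ⊥-elim (p (ℕ.≡ᵇ⇒≡ m n (from-true e)))

    ≡ᵇ-refl : ∀ m → (m ≡ᵇ m) ≡ true
    ≡ᵇ-refl m = to-true (ℕ.≡⇒≡ᵇ m m refl)

    data Bump (j k : ℕ) : Set where
      below : k <ℕ j → bump j k ≡ k → Bump j k
      above : j ≤ℕ k → bump j k ≡ suc k → Bump j k

    bump-view : ∀ j k → Bump j k
    bump-view j k with k ℕ.<? j
    ... | yes p = below p (cong (λ b → if b then k else suc k) (<ᵇ-true p))
    ... | no p = above (ℕ.≮⇒≥ p) (cong (λ b → if b then k else suc k) (<ᵇ-false k j (ℕ.≮⇒≥ p)))

    bump-mono : ∀ j {k l} → k ≤ℕ l → bump j k ≤ℕ bump j l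
    bump-mono j {k} {l} p with bump-view j k | bump-view j l
    ... | below _ e | below _ f = subst₂ _≤ℕ_ (sym e) (sym f) p
    ... | above _ e | above _ f = subst₂ _≤ℕ_ (sym e) (sym f) (s≤s p)
    ... | below _ e | above _ f = subst₂ _≤ℕ_ (sym e) (sym f) (ℕ.≤-trans p (ℕ.n≤1+n l))
    ... | above q e | below r f = ⊥-elim (ℕ.<⇒≱ r (ℕ.≤-trans q p))

    bump-cancel : ∀ j {k l} → bump j k ≤ℕ bump j l → k ≤ℕ l
    bump-cancel j {k} {l} p with bump-view j k | bump-view j l
    ... | below _ e | below _ f = subst₂ _≤ℕ_ e f p
    ... | above _ e | above _ f = ℕ.≤-pred (subst₂ _≤ℕ_ e f p)
    ... | below r e | above q f = ℕ.≤-trans (ℕ.<⇒≤ r) q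
    ... | above q e | below r f = ⊥-elim (ℕ.<⇒≱ r (ℕ.≤-trans q (ℕ.≤-trans (ℕ.n≤1+n k) (subst₂ _≤ℕ_ e f p))))

    relabel-≤ᵇ : ∀ j x y → (relabel j x ≤ℤᵇ relabel j y) ≡ (x ≤ℤᵇ y)
    relabel-≤ᵇ j x y = bool-ext (λ e → to-true (ℤ.≤⇒≤ᵇ (back x y (ℤ.≤ᵇ⇒≤ {relabel j x} (from-true e))))) (λ e → to-true (ℤ.≤⇒≤ᵇ (forth (ℤ.≤ᵇ⇒≤ {x} {y} (from-true e)))))
      where
      forth : ∀ {x y} → x ≤ℤ y → relabel j x ≤ℤ relabel j y
      forth {+ zero}  {+ zero}  _ = ℤ.≤-refl
      forth {+ zero}  {+ suc l} _ = +≤+ z≤n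
      forth {+ suc k} {+ suc l} (+≤+ (s≤s p)) = +≤+ (s≤s (bump-mono j p))
      forth { -[1+ k ]} {+ zero}  -≤+ = -≤+
      forth { -[1+ k ]} {+ suc l} -≤+ = -≤+
      forth { -[1+ k ]} { -[1+ l ]} (-≤- p) = -≤- (bump-mono j p)
      back : ∀ x y → relabel j x ≤ℤ relabel j y → x ≤ℤ y
      back (+ zero)  (+ l)     _ = +≤+ z≤n
      back (+ suc k) (+ zero) (+≤+ ())
      back (+ suc k) (+ suc l) (+≤+ (s≤s p)) = +≤+ (s≤s (bump-cancel j p))
      back -[1+ k ]  (+ l)     _ = -≤+
      back -[1+ k ]  -[1+ l ]  (-≤- p) = -≤- (bump-cancel j p)

    relabel-sorted : ∀ {n} j p (I : Subset n) x → sortedFrom (relabel j p) I (Vec.map (relabel j) x) ≡ sortedFrom p I x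
    relabel-sorted j p []ᵛ      []ᵛ       = refl
    relabel-sorted j p (i ∷ᵛ I) (x ∷ᵛ xs) = cong₂ (λ a b → (if i then a else true) ∧ b) (relabel-≤ᵇ j p x) (relabel-sorted j x I xs)

    relabel-abs : ∀ j k → k <ℕ j → ∀ x → (∣ relabel j x ∣ ≡ᵇ suc k) ≡ (∣ x ∣ ≡ᵇ suc k)
    relabel-abs j k k<j (+ zero)  = refl
    relabel-abs j k k<j (+ suc l) = bump-abs j k k<j l
      where
      bump-abs : ∀ j k → k <ℕ j → ∀ l → (bump j l ≡ᵇ k) ≡ (l ≡ᵇ k)
      bump-abs j k k<j l with bump-view j l
      ... | below _ e = cong (_≡ᵇ k) e
      ... | above q e = trans (cong (_≡ᵇ k) e) (trans (≡ᵇ-false (suc l) k (λ p → ℕ.<⇒≱ k<j (ℕ.≤-trans q (ℕ.≤-trans (ℕ.n≤1+n l) (ℕ.≤-reflexive p)))))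
                          (sym (≡ᵇ-false l k (λ p → ℕ.<⇒≱ k<j (ℕ.≤-trans q (ℕ.≤-reflexive p))))))
    relabel-abs j k k<j -[1+ l ] = relabel-abs j k k<j (+ suc l)

    relabel-has : ∀ {n} j k → k <ℕ j → ∀ (x : Vec ℤ n) → hasAbs (suc k) (Vec.map (relabel j) x) ≡ hasAbs (suc k) x
    relabel-has j k k<j []ᵛ       = refl
    relabel-has j k k<j (x ∷ᵛ xs) = cong₂ _∨_ (relabel-abs j k k<j x) (relabel-has j k k<j xs)

    relabel-uses : ∀ {n} i j → i ≤ℕ j → ∀ (x : Vec ℤ n) → usesBelow i (Vec.map (relabel j) x) ≡ usesBelow i x
    relabel-uses zero    j i≤j x = refl
    relabel-uses (suc i) j i≤j x = cong₂ _∧_ (relabel-uses i j (ℕ.≤-trans (ℕ.n≤1+n i) i≤j) x) (relabel-has j i i≤j x)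

    avoids : ℕ → ℤ → Bool
    avoids k x = not (∣ x ∣ ≡ᵇ k)

    filter-++ : {A : Set} (p : A → Bool) (xs ys : List A) → filterᵇ p (xs ++ ys) ≡ filterᵇ p xs ++ filterᵇ p ys
    filter-++ p [] ys = refl
    filter-++ p (x ∷ xs) ys with p x
    ... | true  = cong (x ∷_) (filter-++ p xs ys)
    ... | false = filter-++ p xs ys

    filter-keep : ∀ k s → s <ℕ k → filterᵇ (avoids k) (letters s) ≡ letters s
    filter-keep (suc k) zero p = refl
    filter-keep k (suc s) p with suc s ≡ᵇ k in e
    ... | true  = ⊥-elim (ℕ.<⇒≢ p (ℕ.≡ᵇ⇒≡ (suc s) k (from-true e)))
    ... | false = cong (+ suc s ∷_) (trans (filter-++ (avoids k) (letters s) (-[1+ s ] ∷ []))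
            (cong₂ _++_ (filter-keep k s (ℕ.<-trans ℕ.≤-refl p)) (keep-last e)))
      where
      keep-last : (suc s ≡ᵇ k) ≡ false → filterᵇ (avoids k) (-[1+ s ] ∷ []) ≡ -[1+ s ] ∷ []
      keep-last e rewrite e = refl

    relabel-id : ∀ j s → s ≤ℕ j → map (relabel j) (letters s) ≡ letters s
    relabel-id j zero    p = refl
    relabel-id j (suc s) p with bump-view j s
    ... | above q _ = ⊥-elim (ℕ.<⇒≱ p q)
    ... | below _ e = cong₂ _∷_ (cong (λ k → + suc k) e)
            (trans (List.map-++ (relabel j) (letters s) (-[1+ s ] ∷ [])) (cong₂ _++_ (relabel-id j s (ℕ.<⇒≤ p)) (cong (λ k → -[1+ k ] ∷ []) e)))

    -- Removing the two letters of absolute value j + 1 leaves an ordered alphabet isomorphic,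
    -- through `relabel j`, to the one with bound s.
    filter-letters : ∀ j s → j ≤ℕ s → filterᵇ (avoids (suc j)) (letters (suc s)) ≡ map (relabel j) (letters s)
    filter-letters j s j≤s with ℕ.m≤n⇒m<n∨m≡n j≤s
    ... | inj₂ refl rewrite ≡ᵇ-refl s = trans (filter-++ (avoids (suc s)) (letters s) (-[1+ s ] ∷ []))
          (trans (cong₂ _++_ (filter-keep (suc s) s ℕ.≤-refl) drop-last) (trans (List.++-identityʳ (letters s)) (sym (relabel-id s s ℕ.≤-refl))))
      where
      drop-last : filterᵇ (avoids (suc s)) (-[1+ s ] ∷ []) ≡ []
      drop-last rewrite ≡ᵇ-refl s = refl
    filter-letters j (suc s) j≤s | inj₁ (s≤s j≤s') rewrite ≡ᵇ-false (suc s) j (λ { refl → ℕ.<⇒≱ j≤s' ℕ.≤-refl }) =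
      cong₂ _∷_ (cong (λ k → + suc k) (sym bumped))
        (trans (filter-++ (avoids (suc j)) (letters (suc s)) (-[1+ suc s ] ∷ []))
          (trans (cong₂ _++_ (filter-letters j s j≤s') keep-last) (sym (List.map-++ (relabel j) (letters s) (-[1+ s ] ∷ [])))))
      where
      bumped : bump j s ≡ suc s
      bumped = cong (λ b → if b then s else suc s) (<ᵇ-false s j j≤s')
      keep-last : filterᵇ (avoids (suc j)) (-[1+ suc s ] ∷ []) ≡ -[1+ bump j s ] ∷ []
      keep-last rewrite ≡ᵇ-false (suc s) j (λ { refl → ℕ.<⇒≱ j≤s' ℕ.≤-refl }) = cong (λ k → -[1+ k ] ∷ []) (sym bumped)

    cnt-avoid : ∀ n as k (P : Vec ℤ n → Bool) → cnt n as (λ x → P x ∧ not (hasAbs k x)) ≡ cnt n (filterᵇ (avoids k) as) P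
    cnt-avoid zero    as k P = cnt-cong 0 as {λ x → P x ∧ not (hasAbs k x)} {P} (λ { []ᵛ → Bool.∧-identityʳ (P []ᵛ) })
    cnt-avoid (suc n) as k P = trans (cnt-suc n as (λ x → P x ∧ not (hasAbs k x)))
      (trans (sum-cong (λ a → trans (cnt-cong n as {λ x → P (a ∷ᵛ x) ∧ not (hasAbs k (a ∷ᵛ x))} {λ x → avoids k a ∧ (P (a ∷ᵛ x) ∧ not (hasAbs k x))} (λ x → head (∣ a ∣ ≡ᵇ k) (P (a ∷ᵛ x)) (hasAbs k x)))
          (trans (cnt-∧ n as (avoids k a) (λ x → P (a ∷ᵛ x) ∧ not (hasAbs k x)))
            (cong (λ c → if avoids k a then c else 0) (cnt-avoid n as k (P ∘ (a ∷ᵛ_)))))) as)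
        (trans (sum-filter (avoids k) (λ a → cnt n (filterᵇ (avoids k) as) (P ∘ (a ∷ᵛ_))) as) (sym (cnt-suc n (filterᵇ (avoids k) as) P))))
      where
      head : ∀ b p h → p ∧ not (b ∨ h) ≡ not b ∧ (p ∧ not h)
      head true  true  h = refl
      head true  false h = refl
      head false p     h = refl

  module Surjective {n} (I : Subset n) where

    E : ℕ → ℕ → ℕ
    E s j = cnt n (letters s) (λ x → sortedFrom 0ℤ I x ∧ usesBelow j x)

    -- Among the words using 1, ..., j, those missing j + 1 correspond under `relabel j` to words
    -- over the smaller alphabet, because relabelling preserves the order and the values up to j.
    -- Iterated, this turns surjectivity into finite differences in s.
    E-suc : ∀ s j → j ≤ℕ s → E (suc s) (suc j) +ℕ E s j ≡ E (suc s) j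
    E-suc s j j≤s = trans (cong (E (suc s) (suc j) +ℕ_) (sym skipped))
      (trans (sym (∑-+ (λ x → ind (sortedFrom 0ℤ I x ∧ usesBelow (suc j) x)) (λ x → ind ((sortedFrom 0ℤ I x ∧ usesBelow j x) ∧ not (hasAbs (suc j) x))) (tuples n (letters (suc s)))))
        (sum-cong (λ x → split (sortedFrom 0ℤ I x) (usesBelow j x) (hasAbs (suc j) x)) (tuples n (letters (suc s)))))
      where
      split : ∀ p u h → ind (p ∧ (u ∧ h)) +ℕ ind ((p ∧ u) ∧ not h) ≡ ind (p ∧ u)
      split true true true = refl
      split true true false = refl
      split true false h = refl
      split false u h = refl
      skipped : cnt n (letters (suc s)) (λ x → (sortedFrom 0ℤ I x ∧ usesBelow j x) ∧ not (hasAbs (suc j) x)) ≡ E s j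
      skipped = trans (cnt-avoid n (letters (suc s)) (suc j) (λ x → sortedFrom 0ℤ I x ∧ usesBelow j x))
        (trans (cong (λ as → cnt n as (λ x → sortedFrom 0ℤ I x ∧ usesBelow j x)) (filter-letters j s j≤s))
          (trans (cnt-map n (relabel j) (letters s) _)
            (cnt-cong n (letters s) (λ x → cong₂ _∧_ (relabel-sorted j 0ℤ I x) (relabel-uses j j ℕ.≤-refl x)))))

    E-difference : ∀ j S → + E (j +ℕ S) j ≡ Δ j (λ S → + E S 0) S
    E-difference zero    S = refl
    E-difference (suc j) S = trans (solve 2 (λ a b → a := (a :+ b) :- b) refl (+ E (suc (j +ℕ S)) (suc j)) (+ E (j +ℕ S) j))
      (cong₂ _-_ (trans (cong +_ (trans (E-suc (j +ℕ S) j (ℕ.m≤m+n j S)) (cong (λ s → E s j) (sym (ℕ.+-suc j S))))) (E-difference j (suc S)))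
                 (E-difference j S))

    E-sorted : ∀ S → E S 0 ≡ cnt n (upTo (suc (2 *ℕ S))) (descending S I)
    E-sorted S = trans (cnt-cong n (letters S) (λ x → Bool.∧-identityʳ (sortedFrom 0ℤ I x))) (sorted-count S I)

  -- Inclusion-exclusion over the absolute values acts in S and the free positions act in R; both
  -- are differences of the one function `total`.
  surjective-total : ∀ n r s → + ∑ (allSubsets n) (λ I → if falses I ≡ᵇ r then Surjective.E I s s else 0) ≡ Δ s (λ S → Δ r (total n S) 0) 0
  surjective-total n r s = trans (sumOver (allSubsets n))
    (Δ-cong s (λ S → trans (cong +_ (sum-cong (λ I → cong (λ x → if falses I ≡ᵇ r then x else 0) (Surjective.E-sorted I S)) (allSubsets n)))
      (K-total n (suc (2 *ℕ S)) r S (s≤s (ℕ.m≤m+n S (S +ℕ 0))))) 0)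
    where
    sumOver : ∀ (Is : List (Subset n)) → + ∑ Is (λ I → if falses I ≡ᵇ r then Surjective.E I s s else 0) ≡
              Δ s (λ S → + ∑ Is (λ I → if falses I ≡ᵇ r then Surjective.E I S 0 else 0)) 0
    sumOver [] = sym (Δ-zero s 0)
    sumOver (I ∷ Is) = trans (ℤ.pos-+ (if falses I ≡ᵇ r then Surjective.E I s s else 0) _)
      (trans (cong₂ _+_ (single (falses I ≡ᵇ r)) (sumOver Is))
        (sym (Δ-+ s (λ S → + (if falses I ≡ᵇ r then Surjective.E I S 0 else 0)) (λ S → + ∑ Is (λ I → if falses I ≡ᵇ r then Surjective.E I S 0 else 0)) 0)))
      where
      single : ∀ b → + (if b then Surjective.E I s s else 0) ≡ Δ s (λ S → + (if b then Surjective.E I S 0 else 0)) 0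
      single true  = trans (cong (λ t → + Surjective.E I t s) (sym (ℕ.+-identityʳ s))) (Surjective.E-difference I s 0)
      single false = sym (Δ-zero s 0)

-- Signed permutations as the group of type B

module SignedPermutations where

  open import Defs hiding (B)
  open Tits
  open Cosets
  open Weights
  open DominantPoints
  open SortedTuples
  open import Data.Nat using (ℕ; zero; suc; _≡ᵇ_; _⊓_; _⊔_)
  open import Data.Integer using (ℤ; +_; -_; _+_; _-_; _*_; 0ℤ)
  import Data.Integer.Properties as ℤ
  open import Algebra.Properties.AbelianGroup ℤ.+-0-abelianGroup using (∙-cancelʳ)
  open import Data.Integer.Solver using (module +-*-Solver)
  open import Data.Bool using (true; if_then_else_)
  open import Data.Fin using (Fin; toℕ) renaming (zero to fz; suc to fs)
  import Data.Fin.Properties as Fin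
  open import Data.Vec using (Vec; lookup; tabulate) renaming ([] to []ᵛ; _∷_ to _∷ᵛ_)
  import Data.Vec.Properties as Vec
  open import Data.Product using (_,_; proj₁)
  open import Data.Empty using (⊥-elim)
  open import Relation.Binary.PropositionalEquality hiding ([_])
  open import Function using (_∘_)

  open +-*-Solver

  neighbour : Coef → ℕ → Coef
  neighbour c zero    = c
  neighbour c (suc _) = nil

  -- Structural recursion instead of comparisons, so that shifting both indices leaves the entries
  -- of type A unchanged by computation.
  coefA coefB : ℕ → ℕ → Coef
  coefA zero    zero    = -two
  coefA zero    (suc j) = neighbour one j
  coefA (suc i) zero    = neighbour one i
  coefA (suc i) (suc j) = coefA i j
  coefB zero    j       = coefA zero j
  coefB (suc i) zero    = neighbour two i
  coefB (suc i) (suc j) = coefA i j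

  cartanB : ∀ n → Cartan n
  cartanB n = tabulate λ i → tabulate λ j → coefB (toℕ i) (toℕ j)

  entry-cartanB : ∀ {n} (i j : Fin n) → entry (cartanB n) i j ≡ coefB (toℕ i) (toℕ j)
  entry-cartanB i j = trans (cong (λ r → lookup r j) (Vec.lookup∘tabulate _ i)) (Vec.lookup∘tabulate (λ j → coefB (toℕ i) (toℕ j)) j)

  private
    coefA-diagonal : ∀ i → coefA i i ≡ -two
    coefA-diagonal zero          = refl
    coefA-diagonal (suc i)       = coefA-diagonal i

    coefB-diagonal : ∀ i → coefB i i ≡ -two
    coefB-diagonal zero          = refl
    coefB-diagonal (suc i)       = coefA-diagonal i

    bondsA : ∀ i j → i ≢ j → Bond (coefA i j) (coefA j i) (if i ≡ᵇ j then 1 else (if i ⊔ j ≡ᵇ suc (i ⊓ j) then 3 else 2))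
    bondsA zero          zero          p = ⊥-elim (p refl)
    bondsA zero          (suc zero)    p = bond3
    bondsA zero          (suc (suc j)) p = bond2
    bondsA (suc zero)    zero          p = bond3
    bondsA (suc (suc i)) zero          p = bond2
    bondsA (suc i)       (suc j)       p = bondsA i j (p ∘ cong suc)

    bondsB : ∀ i j → i ≢ j → Bond (coefB i j) (coefB j i) (if i ≡ᵇ j then 1 else bondB (i ⊓ j) (i ⊔ j))
    bondsB zero          zero          p = ⊥-elim (p refl)
    bondsB zero          (suc zero)    p = bond4
    bondsB zero          (suc (suc j)) p = bond2
    bondsB (suc zero)    zero          p = bond4'
    bondsB (suc (suc i)) zero          p = bond2
    bondsB (suc i)       (suc j)       p = bondsA i j (p ∘ cong suc)

    ≡ᵇ-refl : ∀ i → (i ≡ᵇ i) ≡ true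
    ≡ᵇ-refl zero    = refl
    ≡ᵇ-refl (suc i) = ≡ᵇ-refl i

  presentsB : ∀ n → Presents (cartanB n) (coxMatrix bondB)
  presentsB n = record
    { diagonal = λ s → trans (entry-cartanB s s) (coefB-diagonal (toℕ s)) , cong (λ b → if b then 1 else bondB (toℕ s ⊓ toℕ s) (toℕ s ⊔ toℕ s)) (≡ᵇ-refl (toℕ s))
    ; bonds    = λ s t s≢t → subst₂ (λ c d → Bond c d (coxMatrix bondB s t)) (sym (entry-cartanB s t)) (sym (entry-cartanB t s))
                   (bondsB (toℕ s) (toℕ t) (s≢t ∘ Fin.toℕ-injective))
    }

  swap : ∀ {n} → Fin n → Vec ℤ (suc n) → Vec ℤ (suc n)
  swap fz     (x ∷ᵛ y ∷ᵛ z) = y ∷ᵛ x ∷ᵛ z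
  swap (fs i) (x ∷ᵛ y)      = x ∷ᵛ swap i y

  signed : ∀ {n} → Fin n → Vec ℤ n → Vec ℤ n
  signed fz     (x ∷ᵛ y) = - x ∷ᵛ y
  signed (fs i) x        = swap i x

  differences : ∀ {n} → ℤ → Vec ℤ n → Weight n
  differences p []ᵛ      = []ᵛ
  differences p (x ∷ᵛ y) = (x - p , 0ℤ) ∷ᵛ differences x y

  -- the values of the simple roots 2 x₀, x₁ - x₀, x₂ - x₁, …
  simple : ∀ {n} → Vec ℤ n → Weight n
  simple []ᵛ      = []ᵛ
  simple (x ∷ᵛ y) = differences (- x) (x ∷ᵛ y)

  private
    pair : ∀ {a b : ℤ} → a ≡ b → (a , 0ℤ) ≡ (b , 0ℤ)
    pair = cong (_, 0ℤ)

    -- Exchanging two neighbours changes at most three consecutive differences, as the Cartan row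
    -- prescribes. The coordinate `p` in front shifts the index by one, hence `suc (toℕ i)`.
    swap-differences : ∀ {n} p (i : Fin n) x r → lookup (differences p (swap i x)) r ≡
      step (coefA (suc (toℕ i)) (toℕ r)) (lookup (differences p x) (fs i)) (lookup (differences p x) r)
    swap-differences p fz (x ∷ᵛ y ∷ᵛ z) fz = pair (solve 3 (λ p x y → y :- p := (y :- x) :+ (x :- p)) refl p x y)
    swap-differences p fz (x ∷ᵛ y ∷ᵛ z) (fs fz) = pair (solve 2 (λ x y → x :- y := (y :- x) :+ :- ((y :- x) :+ (y :- x))) refl x y)
    swap-differences p fz (x ∷ᵛ y ∷ᵛ z ∷ᵛ u) (fs (fs fz)) = pair (solve 3 (λ x y z → z :- x := (y :- x) :+ (z :- y)) refl x y z)
    swap-differences p fz (x ∷ᵛ y ∷ᵛ z ∷ᵛ u) (fs (fs (fs r))) = refl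
    swap-differences p (fs i) (x ∷ᵛ y ∷ᵛ z) fz     = refl
    swap-differences p (fs i) (x ∷ᵛ y ∷ᵛ z) (fs r) = swap-differences x i (y ∷ᵛ z) r

    signed-simple : ∀ {n} (s : Fin n) x r → lookup (simple (signed s x)) r ≡
      step (coefB (toℕ s) (toℕ r)) (lookup (simple x) s) (lookup (simple x) r)
    signed-simple fz (x ∷ᵛ y) fz = pair (solve 1 (λ x → :- x :- :- :- x := (x :- :- x) :+ :- ((x :- :- x) :+ (x :- :- x))) refl x)
    signed-simple fz (x ∷ᵛ y ∷ᵛ z) (fs fz) = pair (solve 2 (λ x y → y :- :- x := (x :- :- x) :+ (y :- x)) refl x y)
    signed-simple fz (x ∷ᵛ y ∷ᵛ z) (fs (fs r)) = refl
    signed-simple (fs fz) (x ∷ᵛ y ∷ᵛ z) fz = pair (solve 2 (λ x y → y :- :- y := ((y :- x) :+ (y :- x)) :+ (x :- :- x)) refl x y)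
    signed-simple (fs (fs i)) (x ∷ᵛ y ∷ᵛ z) fz = refl
    signed-simple (fs i) (x ∷ᵛ y) (fs r) = trans (shift i (x ∷ᵛ y) r) (swap-differences (- x) i (x ∷ᵛ y) (fs r))
      where
      shift : ∀ {n} (i : Fin n) (x : Vec ℤ (suc n)) r → lookup (simple (swap i x)) (fs r) ≡ lookup (differences (- Data.Vec.head x) (swap i x)) (fs r)
      shift fz     (x ∷ᵛ y ∷ᵛ z) r = refl
      shift (fs i) (x ∷ᵛ y)      r = refl

    ext : ∀ {A : Set} {n} (u v : Vec A n) → (∀ r → lookup u r ≡ lookup v r) → u ≡ v
    ext u v e = trans (sym (Vec.tabulate∘lookup u)) (trans (Vec.tabulate-cong e) (Vec.tabulate∘lookup v))

    differences-injective : ∀ {n} p {x y : Vec ℤ n} → differences p x ≡ differences p y → x ≡ y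
    differences-injective p {[]ᵛ}     {[]ᵛ}     e = refl
    differences-injective p {x ∷ᵛ xs} {y ∷ᵛ ys} e with ∙-cancelʳ (- p) x y (cong proj₁ (Vec.∷-injectiveˡ e))
    ... | refl = cong (x ∷ᵛ_) (differences-injective x (Vec.∷-injectiveʳ e))

    double-injective : ∀ x y → x - - x ≡ y - - y → x ≡ y
    double-injective x y e = ℤ.*-cancelˡ-≡ (+ 2) x y (trans (double x) (trans e (sym (double y))))
      where
      double : ∀ x → + 2 * x ≡ x - - x
      double = solve 1 (λ x → con (+ 2) :* x := x :- :- x) refl

    simple-injective : ∀ {n} {x y : Vec ℤ n} → simple x ≡ simple y → x ≡ y
    simple-injective {x = []ᵛ}     {[]ᵛ}     e = refl
    simple-injective {x = x ∷ᵛ xs} {y ∷ᵛ ys} e with double-injective x y (cong proj₁ (Vec.∷-injectiveˡ e))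
    ... | refl = cong (x ∷ᵛ_) (differences-injective x (Vec.∷-injectiveʳ e))

  -- Not every integral weight has the form `simple x`, whose first coordinate is even; an injective
  -- equivariant map is all that `pullback` asks for.
  halfSpacesB : ∀ n → HalfSpaces (coxMatrix bondB) (Vec ℤ n)
  halfSpacesB n = pullback (weights (presentsB n)) simple simple-injective signed λ s x → ext _ _ λ r →
    trans (signed-simple s x r) (sym (trans (lookup-reflect (cartanB n) s (simple x) r)
      (cong (λ c → step c (lookup (simple x) s) (lookup (simple x) r)) (entry-cartanB s r))))

-- Orbits of signed permutations

module SignedOrbits where

  open import Defs hiding (B)
  open Tits
  open Cosets
  open Weights
  open DominantPoints
  open SortedTuples
  open SignedPermutations
  open Tries using (∧-true)
  open Metamatrices using (sum-cong; sum-zero; ∈-filterᵇ)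
  open import Data.Nat using (ℕ; zero; suc; z≤n; s≤s; _≡ᵇ_) renaming (_+_ to _+ℕ_; _*_ to _*ℕ_; _<_ to _<ℕ_; _≤_ to _≤ℕ_)
  import Data.Nat.Properties as ℕ
  open import Data.Integer using (ℤ; +_; -[1+_]; -_; _+_; _-_; _*_; ∣_∣; 0ℤ; 1ℤ; _<_; _≤_; +≤+; -≤+; +<+) renaming (_≤ᵇ_ to _≤ℤᵇ_)
  import Data.Integer.Properties as ℤ
  open import Algebra.Properties.AbelianGroup ℤ.+-0-abelianGroup using (∙-cancelˡ)
  open import Data.Integer.Solver using (module +-*-Solver)
  open import Data.Bool using (Bool; true; false; _∧_; _∨_; if_then_else_; T)
  import Data.Bool.Properties as Bool
  open import Data.Fin using (Fin) renaming (zero to fz; suc to fs)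
  open import Data.Fin.Subset using (Subset; _∈_; ⊤)
  open import Data.Fin.Subset.Properties using (∈⊤)
  open import Data.List using (List; []; _∷_; _++_; [_]; map; concatMap; filterᵇ; length; reverse; cartesianProductWith)
  open import Data.List.Membership.Propositional using () renaming (_∈_ to _∈ˡ_)
  import Data.List.Membership.Propositional.Properties as List
  open import Data.List.Relation.Unary.Any using () renaming (here to hereˡ; there to thereˡ)
  open import Data.List.Relation.Unary.All using (All; []; _∷_)
  import Data.List.Relation.Unary.All as All
  import Data.List.Relation.Unary.All.Properties as All
  open import Data.List.Relation.Unary.Unique.Propositional using (Unique)
  open import Data.List.Relation.Unary.AllPairs using ([]; _∷_)
  import Data.List.Relation.Unary.Unique.Propositional.Properties as Unique
  open import Data.Vec using (Vec; lookup; here; there) renaming ([] to []ᵛ; _∷_ to _∷ᵛ_)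
  import Data.Vec.Properties as Vec
  import Data.Vec.Relation.Unary.All as VecAll
  open VecAll using () renaming ([] to []ᵃ; _∷_ to _∷ᵃ_)
  open import Data.Product using (Σ; ∃; _×_; _,_; proj₁; proj₂)
  open import Data.Sum using (_⊎_; inj₁; inj₂)
  open import Data.Empty using (⊥-elim)
  open import Data.Unit using (tt) renaming (⊤ to Unit)
  open import Relation.Nullary using (yes; no)
  open import Relation.Binary.PropositionalEquality hiding ([_])
  import Function
  open import Function using (_∘_)

  open +-*-Solver

  private
    ≤ᵇ⇒≤ : ∀ {x y} → (x ≤ℤᵇ y) ≡ true → x ≤ y
    ≤ᵇ⇒≤ e = ℤ.≤ᵇ⇒≤ (subst T (sym e) tt)

    ≤⇒≤ᵇ : ∀ {x y} → x ≤ y → (x ≤ℤᵇ y) ≡ true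
    ≤⇒≤ᵇ {x} {y} p with x ≤ℤᵇ y | ℤ.≤⇒≤ᵇ p
    ... | true | _ = refl

    double-nonneg : ∀ x → 0ℤ ≤ x → 0ℤ ≤ x - - x
    double-nonneg x p = subst (0ℤ ≤_) (cong (λ z → x + z) (sym (ℤ.neg-involutive x))) (ℤ.+-mono-≤ p p)

    sorted⇒nonneg : ∀ {n} p (I : Subset n) x → sortedFrom p I x ≡ true → ∀ s → s ∈ I → Nonneg (lookup (differences p x) s)
    sorted⇒nonneg p (true ∷ᵛ I) (x ∷ᵛ xs) e fz here = ℤ.i≤j⇒0≤j-i {p} {x} (≤ᵇ⇒≤ (proj₁ (∧-true {p ≤ℤᵇ x} e))) , +≤+ z≤n
    sorted⇒nonneg p (i ∷ᵛ I) (x ∷ᵛ xs) e (fs s) (there s∈I) = sorted⇒nonneg x I xs (proj₂ (∧-true {if i then p ≤ℤᵇ x else true} e)) s s∈I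

  sorted⇒dominant : ∀ {n} (I : Subset n) x → sortedFrom 0ℤ I x ≡ true → ∀ s → s ∈ I → Nonneg (lookup (simple x) s)
  sorted⇒dominant (true ∷ᵛ I) (x ∷ᵛ xs) e fz here = double-nonneg x (≤ᵇ⇒≤ (proj₁ (∧-true {0ℤ ≤ℤᵇ x} e))) , +≤+ z≤n
  sorted⇒dominant (i ∷ᵛ I) (x ∷ᵛ xs) e (fs s) (there s∈I) = sorted⇒nonneg x I xs (proj₂ (∧-true {if i then 0ℤ ≤ℤᵇ x else true} e)) s s∈I

  Within : ∀ {n} → ℕ → Vec ℤ n → Set
  Within S = VecAll.All (λ x → ∣ x ∣ ≤ℕ S)

  private
    swap-within : ∀ {n S} (i : Fin n) {x} → Within S x → Within S (swap i x)
    swap-within fz     (p ∷ᵃ q ∷ᵃ r) = q ∷ᵃ p ∷ᵃ r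
    swap-within (fs i) (p ∷ᵃ q)      = p ∷ᵃ swap-within i q

  signed-within : ∀ {n S} (s : Fin n) {x} → Within S x → Within S (signed s x)
  signed-within fz     {x ∷ᵛ _} (p ∷ᵃ q) = subst (_≤ℕ _) (sym (ℤ.∣-i∣≡∣i∣ x)) p ∷ᵃ q
  signed-within (fs i) p = swap-within i p

  private
    swap-hasAbs : ∀ {n} k (i : Fin n) x → hasAbs k (swap i x) ≡ hasAbs k x
    swap-hasAbs k fz (x ∷ᵛ y ∷ᵛ z) = trans (sym (Bool.∨-assoc (∣ y ∣ ≡ᵇ k) (∣ x ∣ ≡ᵇ k) (hasAbs k z)))
      (trans (cong (_∨ hasAbs k z) (Bool.∨-comm (∣ y ∣ ≡ᵇ k) (∣ x ∣ ≡ᵇ k))) (Bool.∨-assoc (∣ x ∣ ≡ᵇ k) (∣ y ∣ ≡ᵇ k) (hasAbs k z)))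
    swap-hasAbs k (fs i) (x ∷ᵛ y) = cong ((∣ x ∣ ≡ᵇ k) ∨_) (swap-hasAbs k i y)

  signed-hasAbs : ∀ {n} k (s : Fin n) x → hasAbs k (signed s x) ≡ hasAbs k x
  signed-hasAbs k fz     (x ∷ᵛ y) = cong (λ a → (a ≡ᵇ k) ∨ hasAbs k y) (ℤ.∣-i∣≡∣i∣ x)
  signed-hasAbs k (fs i) x        = swap-hasAbs k i x

  signed-usesBelow : ∀ {n} j (s : Fin n) x → usesBelow j (signed s x) ≡ usesBelow j x
  signed-usesBelow zero    s x = refl
  signed-usesBelow (suc j) s x = cong₂ _∧_ (signed-usesBelow j s x) (signed-hasAbs (suc j) s x)

  run-within : ∀ {n S} (w : Word n) {x} → Within S x → Within S (run signed w x)
  run-within []      p = p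
  run-within (s ∷ w) p = signed-within s (run-within w p)

  run-usesBelow : ∀ {n} j (w : Word n) x → usesBelow j (run signed w x) ≡ usesBelow j x
  run-usesBelow j []      x = refl
  run-usesBelow j (s ∷ w) x = trans (signed-usesBelow j s (run signed w x)) (run-usesBelow j w x)

  -- Σ (k + i) x i, which every reflection towards the dominant chamber increases
  moment : ∀ {n} → ℕ → Vec ℤ n → ℤ
  moment k []ᵛ      = 0ℤ
  moment k (x ∷ᵛ y) = + k * x + moment (suc k) y

  private
    increase : ∀ {a b c} → a + c ≡ b → 0ℤ < c → a < b
    increase {a} e p = subst₂ _<_ (ℤ.+-identityʳ a) e (ℤ.+-monoʳ-< a p)

    swap-violation : ∀ {n} k x (I : Subset n) y → sortedFrom x I y ≡ true ⊎ ∃ λ i → i ∈ I × moment k (x ∷ᵛ y) < moment k (swap i (x ∷ᵛ y))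
    swap-violation k x []ᵛ []ᵛ = inj₁ refl
    swap-violation k x (i ∷ᵛ I) (y ∷ᵛ z) with swap-violation (suc k) y I z
    ... | inj₂ (j , j∈I , p) = inj₂ (fs j , there j∈I , ℤ.+-monoʳ-< (+ k * x) p)
    swap-violation k x (false ∷ᵛ I) (y ∷ᵛ z) | inj₁ e = inj₁ e
    swap-violation k x (true ∷ᵛ I)  (y ∷ᵛ z) | inj₁ e with x ℤ.≤? y
    ... | yes p = inj₁ (cong₂ _∧_ (≤⇒≤ᵇ p) e)
    ... | no ¬p = inj₂ (fz , here , increase
            (solve 4 (λ k x y m → k :* x :+ ((con 1ℤ :+ k) :* y :+ m) :+ (x :- y) := k :* y :+ ((con 1ℤ :+ k) :* x :+ m)) refl (+ k) x y (moment (suc (suc k)) z))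
            (ℤ.+-monoˡ-< (- y) (ℤ.≰⇒> ¬p) ▹ ℤ.+-inverseʳ y))
      where
      _▹_ : ∀ {a b c} → a < b → a ≡ c → c < b
      p ▹ refl = p

  -- Swapping neighbours x > y with weights k and k + 1 raises the moment by x - y; changing the
  -- sign of a first coordinate -a with a > 0 raises it by 2 a.
  violation : ∀ {n} (I : Subset n) x → sortedFrom 0ℤ I x ≡ true ⊎ ∃ λ s → s ∈ I × moment 1 x < moment 1 (signed s x)
  violation []ᵛ []ᵛ = inj₁ refl
  violation (i ∷ᵛ I) (x ∷ᵛ y) with swap-violation 1 x I y
  ... | inj₂ (j , j∈I , p) = inj₂ (fs j , there j∈I , p)
  violation (false ∷ᵛ I) (x ∷ᵛ y)        | inj₁ e = inj₁ e
  violation (true ∷ᵛ I)  (+ x ∷ᵛ y)      | inj₁ e = inj₁ e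
  violation (true ∷ᵛ I)  (-[1+ x ] ∷ᵛ y) | inj₁ e = inj₂ (fz , here , increase
    (solve 2 (λ a m → con 1ℤ :* :- a :+ m :+ (a :+ a) := con 1ℤ :* a :+ m) refl (+ suc x) (moment 2 y)) (+<+ (s≤s z≤n)))

  private
    ceiling : ℕ → ℕ → ℕ → ℤ
    ceiling k zero    S = 0ℤ
    ceiling k (suc n) S = + k * + S + ceiling (suc k) n S

    ≤-abs : ∀ x → x ≤ + ∣ x ∣
    ≤-abs (+ n)    = ℤ.≤-refl
    ≤-abs -[1+ n ] = -≤+

    moment-bound : ∀ {n S} k {x : Vec ℤ n} → Within S x → moment k x ≤ ceiling k n S
    moment-bound k []ᵃ = ℤ.≤-refl
    moment-bound k {x ∷ᵛ _} (p ∷ᵃ q) = ℤ.+-mono-≤ (ℤ.*-monoˡ-≤-nonNeg (+ k) (ℤ.≤-trans (≤-abs x) (+≤+ p))) (moment-bound (suc k) q)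

    -- The moment increases strictly and is bounded on vectors with coordinates of absolute value at
    -- most S, a condition that every step preserves; the fuel measures the gap.
    sort : ∀ f {n S} (I : Subset n) x → Within S x → ceiling 1 n S ≤ moment 1 x + + f →
           ∃ λ u → All (_∈ I) u × sortedFrom 0ℤ I (run signed u x) ≡ true
    sort f I x r b with violation I x
    ... | inj₁ e = [] , [] , e
    sort zero I x r b | inj₂ (s , s∈I , p) = ⊥-elim (ℤ.<⇒≱ p (ℤ.≤-trans (moment-bound 1 (signed-within s r)) (subst (_ ≤_) (ℤ.+-identityʳ (moment 1 x)) b)))
    sort (suc f) I x r b | inj₂ (s , s∈I , p) with sort f I (signed s x) (signed-within s r)
          (ℤ.≤-trans b (subst (_≤ moment 1 (signed s x) + + f) (solve 2 (λ m f → con 1ℤ :+ m :+ f := m :+ (con 1ℤ :+ f)) refl (moment 1 x) (+ f)) (ℤ.+-monoˡ-≤ (+ f) (ℤ.i<j⇒suc[i]≤j p))))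
    ... | u , uI , e = u ++ [ s ] , All.++⁺ uI (s∈I ∷ []) , trans (cong (sortedFrom 0ℤ I) (append u)) e
      where
      append : ∀ u → run signed (u ++ [ s ]) x ≡ run signed u (signed s x)
      append []      = refl
      append (t ∷ u) = cong (signed t) (append u)

    size : ∀ {n} → Vec ℤ n → ℕ
    size []ᵛ      = 0
    size (x ∷ᵛ y) = ∣ x ∣ +ℕ size y

    within-size : ∀ {n} (x : Vec ℤ n) → Within (size x) x
    within-size []ᵛ      = []ᵃ
    within-size (x ∷ᵛ y) = ℕ.m≤m+n ∣ x ∣ (size y) ∷ᵃ VecAll.map (λ p → ℕ.≤-trans p (ℕ.m≤n+m (size y) ∣ x ∣)) (within-size y)

  straighten : ∀ {n} (I : Subset n) x → ∃ λ u → All (_∈ I) u × sortedFrom 0ℤ I (run signed u x) ≡ true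
  straighten {n} I x = sort ∣ gap ∣ I x (within-size x) (subst (_≤ moment 1 x + + ∣ gap ∣)
    (solve 2 (λ c m → m :+ (c :- m) := c) refl (ceiling 1 n (size x)) (moment 1 x)) (ℤ.+-monoʳ-≤ (moment 1 x) (≤-abs gap)))
    where
    gap : ℤ
    gap = ceiling 1 n (size x) - moment 1 x

  private
    ∈-letters : ∀ {s} a → ∣ a ∣ ≤ℕ s → a ∈ˡ letters s
    ∈-letters {zero}  (+ zero) p = hereˡ refl
    ∈-letters {suc s} a p with ∣ a ∣ ℕ.≤? s
    ... | yes q = thereˡ (List.∈-++⁺ˡ (∈-letters a q))
    ∈-letters {suc s} (+ zero)  p | no q = ⊥-elim (q z≤n)
    ∈-letters {suc s} (+ suc k) p | no q = hereˡ (cong +_ (ℕ.≤-antisym p (ℕ.≰⇒> q)))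
    ∈-letters {suc s} -[1+ k ]  p | no q = thereˡ (List.∈-++⁺ʳ (letters s) (hereˡ (cong -[1+_] (ℕ.suc-injective (ℕ.≤-antisym p (ℕ.≰⇒> q))))))

    ∈-letters⁻ : ∀ {s a} → a ∈ˡ letters s → ∣ a ∣ ≤ℕ s
    ∈-letters⁻ {zero}  (hereˡ refl) = z≤n
    ∈-letters⁻ {suc s} (hereˡ refl) = ℕ.≤-refl
    ∈-letters⁻ {suc s} (thereˡ i) with List.∈-++⁻ (letters s) i
    ... | inj₁ j            = ℕ.≤-trans (∈-letters⁻ j) (ℕ.n≤1+n s)
    ... | inj₂ (hereˡ refl) = ℕ.≤-refl

    letters-unique : ∀ s → Unique (letters s)
    letters-unique s = subst Unique (sym (letters-applyUpTo s)) (Unique.applyUpTo⁺₁ (λ t → + s - + t) (suc (2 *ℕ s)) λ {i} {j} i<j _ e →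
      ℕ.<⇒≢ i<j (ℤ.+-injective (ℤ.neg-injective (∙-cancelˡ (+ s) (- + i) (- + j) e))))

    tuples-product : {A : Set} → ∀ n (as : List A) → tuples (suc n) as ≡ cartesianProductWith _∷ᵛ_ as (tuples n as)
    tuples-product n as = product as
      where
      product : ∀ bs → concatMap (λ a → map (a ∷ᵛ_) (tuples n as)) bs ≡ cartesianProductWith _∷ᵛ_ bs (tuples n as)
      product []       = refl
      product (b ∷ bs) = cong (map (b ∷ᵛ_) (tuples n as) ++_) (product bs)

    tuples-unique : {A : Set} → ∀ n {as : List A} → Unique as → Unique (tuples n as)
    tuples-unique zero    u = [] ∷ []
    tuples-unique (suc n) {as} u = subst Unique (sym (tuples-product n as)) (Unique.cartesianProductWith⁺ _∷ᵛ_ Vec.∷-injective u (tuples-unique n u))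

    ∈-tuples : ∀ {n s} {x : Vec ℤ n} → Within s x → x ∈ˡ tuples n (letters s)
    ∈-tuples []ᵃ = hereˡ refl
    ∈-tuples {suc n} {s} {x ∷ᵛ _} (p ∷ᵃ q) = subst (_ ∈ˡ_) (sym (tuples-product n (letters s))) (List.∈-cartesianProductWith⁺ _∷ᵛ_ (∈-letters x p) (∈-tuples q))

    ∈-tuples⁻ : ∀ {n s} {x : Vec ℤ n} → x ∈ˡ tuples n (letters s) → Within s x
    ∈-tuples⁻ {x = []ᵛ} _ = []ᵃ
    ∈-tuples⁻ {suc n} {s} {x ∷ᵛ y} i with List.∈-cartesianProductWith⁻ _∷ᵛ_ (letters s) (tuples n (letters s)) (subst (_ ∈ˡ_) (tuples-product n (letters s)) i)
    ... | a , b , p , q , refl = ∈-letters⁻ p ∷ᵃ ∈-tuples⁻ q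

  -- the point of the dominant chamber with stabiliser W_J and smallest possible coordinates
  vertex : ∀ {n} → ℕ → Subset n → Vec ℤ n
  vertex p []ᵛ          = []ᵛ
  vertex p (true ∷ᵛ J)  = + p ∷ᵛ vertex p J
  vertex p (false ∷ᵛ J) = + suc p ∷ᵛ vertex (suc p) J

  ties : ∀ {n} → ℕ → Vec ℤ n → Subset n
  ties p []ᵛ      = []ᵛ
  ties p (x ∷ᵛ y) with x ℤ.≟ + p
  ... | yes _ = true ∷ᵛ ties p y
  ... | no  _ = false ∷ᵛ ties (suc p) y

  private
    ties-vertex : ∀ {n} p (J : Subset n) → ties p (vertex p J) ≡ J
    ties-vertex p []ᵛ = refl
    ties-vertex p (true ∷ᵛ J) with + p ℤ.≟ + p
    ... | yes _ = cong (true ∷ᵛ_) (ties-vertex p J)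
    ... | no ¬e = ⊥-elim (¬e refl)
    ties-vertex p (false ∷ᵛ J) with + suc p ℤ.≟ + p
    ... | yes e = ⊥-elim (ℕ.1+n≢n (ℤ.+-injective e))
    ... | no _  = cong (false ∷ᵛ_) (ties-vertex (suc p) J)

    vertex-sorted : ∀ {n} p (I J : Subset n) → sortedFrom (+ p) I (vertex p J) ≡ true
    vertex-sorted p []ᵛ      []ᵛ          = refl
    vertex-sorted p (i ∷ᵛ I) (true ∷ᵛ J)  = cong₂ _∧_ (weaken i (≤⇒≤ᵇ {+ p} ℤ.≤-refl)) (vertex-sorted p I J)
      where
      weaken : ∀ i {b} → b ≡ true → (if i then b else true) ≡ true
      weaken true  e = e
      weaken false e = refl
    vertex-sorted p (i ∷ᵛ I) (false ∷ᵛ J) = cong₂ _∧_ (weaken i (≤⇒≤ᵇ {+ p} {+ suc p} (+≤+ (ℕ.n≤1+n p)))) (vertex-sorted (suc p) I J)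
      where
      weaken : ∀ i {b} → b ≡ true → (if i then b else true) ≡ true
      weaken true  e = e
      weaken false e = refl

    swap-vertex : ∀ {n} q (J : Subset n) i → i ∈ J → swap i (+ q ∷ᵛ vertex q J) ≡ + q ∷ᵛ vertex q J
    swap-vertex q (true ∷ᵛ J)  fz     here        = refl
    swap-vertex q (true ∷ᵛ J)  (fs i) (there i∈J) = cong (+ q ∷ᵛ_) (swap-vertex q J i i∈J)
    swap-vertex q (false ∷ᵛ J) (fs i) (there i∈J) = cong (+ q ∷ᵛ_) (swap-vertex (suc q) J i i∈J)

    swap-vertex⁻ : ∀ {n} q (J : Subset n) i → swap i (+ q ∷ᵛ vertex q J) ≡ + q ∷ᵛ vertex q J → i ∈ J
    swap-vertex⁻ q (true ∷ᵛ J)  fz     e = here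
    swap-vertex⁻ q (false ∷ᵛ J) fz     e = ⊥-elim (ℕ.1+n≢n (ℤ.+-injective (Vec.∷-injectiveˡ e)))
    swap-vertex⁻ q (true ∷ᵛ J)  (fs i) e = there (swap-vertex⁻ q J i (Vec.∷-injectiveʳ e))
    swap-vertex⁻ q (false ∷ᵛ J) (fs i) e = there (swap-vertex⁻ (suc q) J i (Vec.∷-injectiveʳ e))

    signed-vertex : ∀ {n} (J : Subset n) s → s ∈ J → signed s (vertex 0 J) ≡ vertex 0 J
    signed-vertex (true ∷ᵛ J)  fz     here        = refl
    signed-vertex (true ∷ᵛ J)  (fs i) (there i∈J) = swap-vertex 0 J i i∈J
    signed-vertex (false ∷ᵛ J) (fs i) (there i∈J) = swap-vertex 1 J i i∈J

    signed-vertex⁻ : ∀ {n} (J : Subset n) s → signed s (vertex 0 J) ≡ vertex 0 J → s ∈ J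
    signed-vertex⁻ (true ∷ᵛ J)  fz     e = here
    signed-vertex⁻ (false ∷ᵛ J) fz     ()
    signed-vertex⁻ (true ∷ᵛ J)  (fs i) e = there (swap-vertex⁻ 0 J i e)
    signed-vertex⁻ (false ∷ᵛ J) (fs i) e = there (swap-vertex⁻ 1 J i e)

    vertex-within : ∀ {n} p (J : Subset n) → Within (p +ℕ falses J) (vertex p J)
    vertex-within p []ᵛ          = []ᵃ
    vertex-within p (true ∷ᵛ J)  = ℕ.m≤m+n p (falses J) ∷ᵃ vertex-within p J
    vertex-within p (false ∷ᵛ J) = subst (λ S → Within S (+ suc p ∷ᵛ vertex (suc p) J)) (sym (ℕ.+-suc p (falses J)))
      (ℕ.m≤m+n (suc p) (falses J) ∷ᵃ vertex-within (suc p) J)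

    vertex-hasAbs : ∀ {n} p (J : Subset n) k → p <ℕ k → k ≤ℕ p +ℕ falses J → hasAbs k (vertex p J) ≡ true
    vertex-hasAbs p []ᵛ         k p<k k≤ = ⊥-elim (ℕ.<⇒≱ p<k (subst (k ≤ℕ_) (ℕ.+-identityʳ p) k≤))
    vertex-hasAbs p (true ∷ᵛ J) k p<k k≤ = trans (cong ((p ≡ᵇ k) ∨_) (vertex-hasAbs p J k p<k k≤)) (Bool.∨-zeroʳ (p ≡ᵇ k))
    vertex-hasAbs p (false ∷ᵛ J) k p<k k≤ with ℕ.m≤n⇒m<n∨m≡n p<k
    ... | inj₂ refl = cong (_∨ hasAbs (suc p) (vertex (suc p) J)) (Bool.T-≡ .Function.Equivalence.to (ℕ.≡⇒≡ᵇ p p refl))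
    ... | inj₁ q = trans (cong ((suc p ≡ᵇ k) ∨_) (vertex-hasAbs (suc p) J k q (subst (k ≤ℕ_) (ℕ.+-suc p (falses J)) k≤))) (Bool.∨-zeroʳ (suc p ≡ᵇ k))

    usesBelow⁺ : ∀ {n} j {x : Vec ℤ n} → (∀ k → 0 <ℕ k → k ≤ℕ j → hasAbs k x ≡ true) → usesBelow j x ≡ true
    usesBelow⁺ zero    h = refl
    usesBelow⁺ (suc j) h = cong₂ _∧_ (usesBelow⁺ j (λ k p q → h k p (ℕ.≤-trans q (ℕ.n≤1+n j)))) (h (suc j) (s≤s z≤n) ℕ.≤-refl)

    usesBelow⁻ : ∀ {n} j {x : Vec ℤ n} → usesBelow j x ≡ true → ∀ k → 0 <ℕ k → k ≤ℕ j → hasAbs k x ≡ true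
    usesBelow⁻ zero    e k p q = ⊥-elim (ℕ.<⇒≱ p q)
    usesBelow⁻ (suc j) {x} e k p q with ℕ.m≤n⇒m<n∨m≡n q
    ... | inj₁ (s≤s r) = usesBelow⁻ j (proj₁ (∧-true e)) k p r
    ... | inj₂ refl    = proj₂ (∧-true {usesBelow j x} e)

    sorted-head : ∀ {n} k q (y : Vec ℤ n) → sortedFrom (+ q) ⊤ y ≡ true → hasAbs k y ≡ true → q ≤ℕ k
    sorted-head k q (+ z ∷ᵛ y) e h with z ℕ.≟ k | ∧-true {+ q ≤ℤᵇ + z} e
    ... | yes refl | f , _ = ℤ.drop‿+≤+ (≤ᵇ⇒≤ {+ q} {+ z} f)
    ... | no ¬p    | f , g = ℕ.≤-trans (ℤ.drop‿+≤+ (≤ᵇ⇒≤ {+ q} {+ z} f)) (sorted-head k z y g (subst (λ b → b ∨ hasAbs k y ≡ true) (≡ᵇ-false z k ¬p) h))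
      where
      ≡ᵇ-false : ∀ m n → m ≢ n → (m ≡ᵇ n) ≡ false
      ≡ᵇ-false m n p with m ≡ᵇ n in e
      ... | false = refl
      ... | true  = ⊥-elim (p (ℕ.≡ᵇ⇒≡ m n (subst T (sym e) tt)))
    sorted-head k q (-[1+ z ] ∷ᵛ y) () h

    -- In a sorted vector the next coordinate either repeats p or must be p + 1, since a skipped
    -- value could not occur later. `ties` records which of the two happens.
    is-vertex : ∀ {n} p s (y : Vec ℤ n) → p ≤ℕ s → sortedFrom (+ p) ⊤ y ≡ true → Within s y →
                (∀ k → p <ℕ k → k ≤ℕ s → hasAbs k y ≡ true) → y ≡ vertex p (ties p y) × p +ℕ falses (ties p y) ≡ s
    is-vertex p s []ᵛ p≤s e r h with ℕ.m≤n⇒m<n∨m≡n p≤s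
    ... | inj₂ refl = refl , ℕ.+-identityʳ p
    ... | inj₁ p<s with h s p<s ℕ.≤-refl
    ...   | ()
    is-vertex p s (x ∷ᵛ y) p≤s e r h with ∧-true {+ p ≤ℤᵇ x} e | x ℤ.≟ + p
    is-vertex p s (x ∷ᵛ y) p≤s e (_ ∷ᵃ r) h | _ , g | yes refl =
      let q , q' = is-vertex p s y p≤s g r (λ k p<k k≤s → trans (cong (_∨ hasAbs k y) (sym (other k p<k))) (h k p<k k≤s)) in cong (+ p ∷ᵛ_) q , q'
      where
      other : ∀ k → p <ℕ k → (p ≡ᵇ k) ≡ false
      other k p<k with p ≡ᵇ k in e
      ... | false = refl
      ... | true  = ⊥-elim (ℕ.<⇒≢ p<k (ℕ.≡ᵇ⇒≡ p k (subst T (sym e) tt)))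
    is-vertex p s (-[1+ z ] ∷ᵛ y) p≤s e r h | f , g | no ¬p with ≤ᵇ⇒≤ {+ p} { -[1+ z ]} f
    ... | ()
    is-vertex p s (+ z ∷ᵛ y) p≤s e (z≤s ∷ᵃ r) h | f , g | no ¬p = next (ℕ.≤-antisym least p<z) g
      where
      p<z : p <ℕ z
      p<z = ℕ.≤∧≢⇒< (ℤ.drop‿+≤+ (≤ᵇ⇒≤ {+ p} {+ z} f)) (λ q → ¬p (cong +_ (sym q)))
      p<s : p <ℕ s
      p<s = ℕ.≤-trans p<z z≤s
      least : z ≤ℕ suc p
      least = sorted-head (suc p) z (+ z ∷ᵛ y) (cong₂ _∧_ (≤⇒≤ᵇ {+ z} ℤ.≤-refl) g) (h (suc p) ℕ.≤-refl p<s)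
      next : z ≡ suc p → sortedFrom (+ z) ⊤ y ≡ true → + z ∷ᵛ y ≡ + suc p ∷ᵛ vertex (suc p) (ties (suc p) y) × p +ℕ suc (falses (ties (suc p) y)) ≡ s
      next refl g = let q , q' = is-vertex (suc p) s y p<s g r (λ k p<k k≤s → trans (cong (_∨ hasAbs k y) (sym (other k p<k))) (h k (ℕ.<-trans ℕ.≤-refl p<k) k≤s))
                    in cong (+ suc p ∷ᵛ_) q , trans (ℕ.+-suc p _) q'
        where
        other : ∀ k → suc p <ℕ k → (suc p ≡ᵇ k) ≡ false
        other k p<k with suc p ≡ᵇ k in e
        ... | false = refl
        ... | true  = ⊥-elim (ℕ.<⇒≢ p<k (ℕ.≡ᵇ⇒≡ (suc p) k (subst T (sym e) tt)))

  same : ∀ {n} → Subset n → Subset n → Bool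
  same []ᵛ          []ᵛ          = true
  same (true ∷ᵛ I)  (true ∷ᵛ J)  = same I J
  same (false ∷ᵛ I) (false ∷ᵛ J) = same I J
  same (true ∷ᵛ I)  (false ∷ᵛ J) = false
  same (false ∷ᵛ I) (true ∷ᵛ J)  = false

  private
    same-sound : ∀ {n} (I J : Subset n) → same I J ≡ true → I ≡ J
    same-sound []ᵛ          []ᵛ          e = refl
    same-sound (true ∷ᵛ I)  (true ∷ᵛ J)  e = cong (true ∷ᵛ_) (same-sound I J e)
    same-sound (false ∷ᵛ I) (false ∷ᵛ J) e = cong (false ∷ᵛ_) (same-sound I J e)

    same-refl : ∀ {n} (I : Subset n) → same I I ≡ true
    same-refl []ᵛ          = refl
    same-refl (true ∷ᵛ I)  = same-refl I
    same-refl (false ∷ᵛ I) = same-refl I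

    ∑-same : ∀ {n} (I : Subset n) (f : Subset n → ℕ) → ∑ (allSubsets n) (λ J → if same I J then f J else 0) ≡ f I
    ∑-same []ᵛ f = ℕ.+-identityʳ (f []ᵛ)
    ∑-same {suc n} (true ∷ᵛ I) f = trans (∑-++ (map (true ∷ᵛ_) (allSubsets n)) (map (false ∷ᵛ_) (allSubsets n)) _)
      (trans (cong₂ _+ℕ_ (trans (∑-map (true ∷ᵛ_) _ (allSubsets n)) (∑-same I (f ∘ (true ∷ᵛ_)))) (trans (∑-map (false ∷ᵛ_) _ (allSubsets n)) (sum-zero (allSubsets n))))
        (ℕ.+-identityʳ _))
    ∑-same {suc n} (false ∷ᵛ I) f = trans (∑-++ (map (true ∷ᵛ_) (allSubsets n)) (map (false ∷ᵛ_) (allSubsets n)) _)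
      (cong₂ _+ℕ_ (trans (∑-map (true ∷ᵛ_) _ (allSubsets n)) (sum-zero (allSubsets n))) (trans (∑-map (false ∷ᵛ_) _ (allSubsets n)) (∑-same I (f ∘ (false ∷ᵛ_)))))

  dominantForm : ∀ {n} → Vec ℤ n → Vec ℤ n
  dominantForm x = run signed (proj₁ (straighten ⊤ x)) x

  -- x lies in the orbit of vertex 0 (type x) when its coordinates use all of 1, …, s, the largest being s in absolute value
  type : ∀ {n} → Vec ℤ n → Subset n
  type x = ties 0 (dominantForm x)

  private
    type-sound : ∀ {n} s {x : Vec ℤ n} → Within s x → usesBelow s x ≡ true → dominantForm x ≡ vertex 0 (type x) × falses (type x) ≡ s
    type-sound s {x} r e = let u , _ , f = straighten ⊤ x in
      is-vertex 0 s (dominantForm x) z≤n f (run-within u r) (λ k p q → usesBelow⁻ s (trans (run-usesBelow s u x) e) k p q)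

  inOrbit : ∀ {n} → Subset n → Subset n → Vec ℤ n → Bool
  inOrbit I J x = (sortedFrom 0ℤ I x ∧ usesBelow (falses J) x) ∧ same (type x) J

  representatives : ∀ {n} → Subset n → Subset n → List (Vec ℤ n)
  representatives {n} I J = filterᵇ (inOrbit I J) (tuples n (letters (falses J)))

  private
    filterᵇ-all : {A : Set} (p : A → Bool) (xs : List A) → All (λ x → p x ≡ true × x ∈ˡ xs) (filterᵇ p xs)
    filterᵇ-all p [] = []
    filterᵇ-all p (x ∷ xs) with p x in e
    ... | true  = (e , hereˡ refl) ∷ All.map (λ (f , i) → f , thereˡ i) (filterᵇ-all p xs)
    ... | false = All.map (λ (f , i) → f , thereˡ i) (filterᵇ-all p xs)

    length-filterᵇ : {A : Set} (p : A → Bool) (xs : List A) → length (filterᵇ p xs) ≡ ∑ xs (ind ∘ p)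
    length-filterᵇ p [] = refl
    length-filterᵇ p (x ∷ xs) with p x
    ... | true  = cong suc (length-filterᵇ p xs)
    ... | false = length-filterᵇ p xs

  -- The type is constant on orbits because the dominant point is unique, so `inOrbit` selects
  -- exactly the I-dominant points of the orbit of `vertex 0 J`.
  doubleCosetsB : ∀ {n} (I J : Subset n) → DoubleCosets (coxMatrix bondB) I J (length (representatives I J))
  doubleCosetsB {n} I J = dominant-count I J (vertex 0 J) (λ s → sorted⇒dominant ⊤ (vertex 0 J) (vertex-sorted 0 ⊤ J) s ∈⊤)
    (signed-vertex J) (signed-vertex⁻ J) (representatives I J)
    (Unique.filter⁺ (λ x → Bool.T? (inOrbit I J x)) (tuples-unique n (letters-unique (falses J))))
    (All.map inside (filterᵇ-all (inOrbit I J) (tuples n (letters (falses J))))) complete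
    where
    open Action (halfSpacesB n)
    open DominantCount (halfSpacesB n)
    inside : ∀ {x} → inOrbit I J x ≡ true × x ∈ˡ tuples n (letters (falses J)) →
             Dominant (_∈ I) x × ∃ λ w → run signed w (vertex 0 J) ≡ x
    inside {x} (e , i) with ∧-true {sortedFrom 0ℤ I x ∧ usesBelow (falses J) x} e
    ... | f , g with ∧-true {sortedFrom 0ℤ I x} f
    ...   | d , u = sorted⇒dominant I x d , reverse (proj₁ (straighten ⊤ x)) , run-reverse (proj₁ (straighten ⊤ x))
            (trans (proj₁ (type-sound (falses J) (∈-tuples⁻ i) u)) (cong (vertex 0) (same-sound (type x) J g)))
    orbit-type : ∀ w → type (run signed w (vertex 0 J)) ≡ J
    orbit-type w with straighten ⊤ (run signed w (vertex 0 J))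
    ... | u , _ , e = trans (cong (ties 0) (trans (sym (run-++ u w (vertex 0 J)))
          (proj₁ (dominant-unique (λ _ → Unit) (length (u ++ w)) (u ++ w) ℕ.≤-refl (everything (u ++ w)) (vertex 0 J)
            (λ s _ → sorted⇒dominant ⊤ (vertex 0 J) (vertex-sorted 0 ⊤ J) s ∈⊤)
            (λ s _ → subst (λ y → Nonneg (lookup (simple y) s)) (sym (run-++ u w (vertex 0 J))) (sorted⇒dominant ⊤ _ e s ∈⊤))))))
          (ties-vertex 0 J)
    complete : ∀ w → ∃ λ u → All (_∈ I) u × run signed u (run signed w (vertex 0 J)) ∈ˡ representatives I J
    complete w with straighten I (run signed w (vertex 0 J))
    ... | u , uI , e = u , uI , subst (_∈ˡ representatives I J) (run-++ u w (vertex 0 J))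
          (∈-filterᵇ (inOrbit I J) (∈-tuples (run-within (u ++ w) (vertex-within 0 J)))
            (cong₂ _∧_ (cong₂ _∧_ (trans (cong (sortedFrom 0ℤ I) (run-++ u w (vertex 0 J))) e)
                (trans (run-usesBelow (falses J) (u ++ w) (vertex 0 J)) (usesBelow⁺ (falses J) (vertex-hasAbs 0 J))))
              (trans (cong (λ K → same K J) (orbit-type (u ++ w))) (same-refl J))))

  private
    ∑-cong-∈ : {A : Set} {f g : A → ℕ} (xs : List A) → (∀ {x} → x ∈ˡ xs → f x ≡ g x) → ∑ xs f ≡ ∑ xs g
    ∑-cong-∈ []       e = refl
    ∑-cong-∈ (x ∷ xs) e = cong₂ _+ℕ_ (e (hereˡ refl)) (∑-cong-∈ xs (e ∘ thereˡ))

  -- Summing over J removes the condition on the type: a word bounded by s that uses all of 1, ...,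
  -- s has one type, and exactly s generators lie outside it.
  ∑-representatives : ∀ {n} (I : Subset n) s → ∑ (allSubsets n) (λ J → if falses J ≡ᵇ s then length (representatives I J) else 0) ≡ Surjective.E I s s
  ∑-representatives {n} I s = trans (sum-cong expand (allSubsets n))
    (trans (∑-swap _ (allSubsets n) (tuples n (letters s))) (∑-cong-∈ (tuples n (letters s)) collect))
    where
    good : Vec ℤ n → Bool
    good x = sortedFrom 0ℤ I x ∧ usesBelow s x
    expand : ∀ J → (if falses J ≡ᵇ s then length (representatives I J) else 0) ≡
                   ∑ (tuples n (letters s)) (λ x → if same (type x) J then (if falses J ≡ᵇ s then ind (good x) else 0) else 0)
    expand J = by (falses J ≡ᵇ s) refl
      where
      both : ∀ a b → ind (a ∧ b) ≡ (if b then ind a else 0)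
      both true  b     = refl
      both false true  = refl
      both false false = refl
      by : ∀ b → (falses J ≡ᵇ s) ≡ b → (if b then length (representatives I J) else 0) ≡
           ∑ (tuples n (letters s)) (λ x → if same (type x) J then (if b then ind (good x) else 0) else 0)
      by false _ = sym (trans (sum-cong (λ x → Bool.if-eta (same (type x) J)) (tuples n (letters s))) (sum-zero (tuples n (letters s))))
      by true  e = trans (length-filterᵇ (inOrbit I J) (tuples n (letters (falses J))))
        (trans (cong (λ k → ∑ (tuples n (letters k)) (λ x → ind ((sortedFrom 0ℤ I x ∧ usesBelow k x) ∧ same (type x) J)))
            (ℕ.≡ᵇ⇒≡ (falses J) s (subst T (sym e) tt)))
          (sum-cong (λ x → both (good x) (same (type x) J)) (tuples n (letters s))))
    collect : ∀ {x} → x ∈ˡ tuples n (letters s) →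
              ∑ (allSubsets n) (λ J → if same (type x) J then (if falses J ≡ᵇ s then ind (good x) else 0) else 0) ≡ ind (good x)
    collect {x} i = trans (∑-same (type x) (λ J → if falses J ≡ᵇ s then ind (good x) else 0)) exact
      where
      exact : (if falses (type x) ≡ᵇ s then ind (good x) else 0) ≡ ind (good x)
      exact with good x in e
      ... | false = Bool.if-eta (falses (type x) ≡ᵇ s)
      ... | true  rewrite proj₂ (type-sound s (∈-tuples⁻ i) (proj₂ (∧-true {sortedFrom 0ℤ I x} e))) = cong ind (Bool.T-≡ .Function.Equivalence.to (ℕ.≡⇒≡ᵇ s s refl))

-- Total positivity in type B

module TypeB where

  open import Defs hiding (B)
  open Cosets
  open TotalPositivity
  open Factorisations
  open FiniteDifferences
  open Multichoose
  open SortedTuples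
  open SignedPermutations
  open SignedOrbits
  open Weights using (module Presents)
  open Metamatrices
  open import Data.Nat using (ℕ; suc; s≤s; _≡ᵇ_; _∸_) renaming (_+_ to _+ℕ_; _≤_ to _≤ℕ_)
  import Data.Nat.Properties as ℕ
  open import Data.Integer using (+_; _*_)
  open import Data.Bool using (true; false; _∧_; if_then_else_; T)
  open import Data.Fin using (Fin; toℕ)
  import Data.Fin.Properties as Fin
  open import Data.Fin.Subset using (Subset; ∣_∣)
  open import Data.List using (length)
  open import Data.Vec using () renaming ([] to []ᵛ; _∷_ to _∷ᵛ_)
  open import Data.Product using (_,_; proj₂)
  open import Data.Unit using (tt)
  open import Relation.Binary.PropositionalEquality

  private
    size+falses : ∀ {n} (I : Subset n) → ∣ I ∣ +ℕ falses I ≡ n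
    size+falses []ᵛ          = refl
    size+falses (true ∷ᵛ I)  = cong suc (size+falses I)
    size+falses (false ∷ᵛ I) = trans (ℕ.+-suc ∣ I ∣ (falses I)) (cong suc (size+falses I))

    bool-ext : ∀ {a b} → (a ≡ true → b ≡ true) → (b ≡ true → a ≡ true) → a ≡ b
    bool-ext {true}  {b}     f g = sym (f refl)
    bool-ext {false} {false} f g = refl
    bool-ext {false} {true}  f g = g refl

    size≡ᵇ : ∀ {n} (I : Subset n) p → p ≤ℕ n → (∣ I ∣ ≡ᵇ p) ≡ (falses I ≡ᵇ n ∸ p)
    size≡ᵇ {n} I p p≤n = bool-ext
      (λ e → true⁺ (trans (sym (ℕ.m+n∸m≡n ∣ I ∣ (falses I))) (cong₂ _∸_ (size+falses I) (true⁻ {∣ I ∣} e))))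
      (λ e → true⁺ (ℕ.+-cancelʳ-≡ (falses I) ∣ I ∣ p (trans (size+falses I) (sym (trans (cong (p +ℕ_) (true⁻ {falses I} e)) (ℕ.m+[n∸m]≡n p≤n))))))
      where
      true⁻ : ∀ {a b} → (a ≡ᵇ b) ≡ true → a ≡ b
      true⁻ {a} {b} e = ℕ.≡ᵇ⇒≡ a b (subst T (sym e) tt)
      true⁺ : ∀ {a b} → a ≡ b → (a ≡ᵇ b) ≡ true
      true⁺ {a} refl with a ≡ᵇ a | ℕ.≡⇒≡ᵇ a a refl
      ... | true | _ = refl

  countB : ∀ {n} → Subset n → Subset n → ℕ
  countB I J = length (representatives I J)

  metamatrixB : ∀ n → IsMetamatrix (coxMatrix bondB) (λ p q → metamatrixEntry n countB (toℕ p) (toℕ q))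
  metamatrixB n = countB , (λ I J → hasNumClasses (doubleCoset-sym (λ s → proj₂ (Presents.diagonal (presentsB n) s))) (doubleCosetsB I J)) , λ p q → refl

  entryB : ∀ n p q → p ≤ℕ n → q ≤ℕ n → + scale n * + metamatrixEntry n countB p q ≡ Z (suc n) (coeff n) p q
  entryB n p q p≤n q≤n = trans (cong (λ x → + scale n * x) (trans (cong +_ (sum-cong row (allSubsets n))) (surjective-total n (n ∸ p) (n ∸ q)))) (differences-Z n p q)
    where
    row : ∀ I → ∑ (allSubsets n) (λ J → if (∣ I ∣ ≡ᵇ p) ∧ (∣ J ∣ ≡ᵇ q) then countB I J else 0) ≡
                (if falses I ≡ᵇ n ∸ p then Surjective.E I (n ∸ q) (n ∸ q) else 0)
    row I = trans (sum-cong (λ J → cong₂ (λ a b → if a ∧ b then countB I J else 0) (size≡ᵇ I p p≤n) (size≡ᵇ J q q≤n)) (allSubsets n)) (outer (falses I ≡ᵇ n ∸ p))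
      where
      outer : ∀ b → ∑ (allSubsets n) (λ J → if b ∧ (falses J ≡ᵇ n ∸ q) then countB I J else 0) ≡ (if b then Surjective.E I (n ∸ q) (n ∸ q) else 0)
      outer true  = ∑-representatives I (n ∸ q)
      outer false = sum-zero (allSubsets n)

  totallyPositiveB : ∀ n → TotallyPositive {suc n} (λ p q → metamatrixEntry n countB (toℕ p) (toℕ q))
  totallyPositiveB n = tp⇒totallyPositive _ (scale n) (scale>0 n) (Z (suc n) (coeff n))
    (Z-tp (suc n) (coeff n) (λ { k (s≤s k≤n) → coeff>0 n k k≤n }))
    λ p q → entryB n (toℕ p) (toℕ q) (ℕ.≤-pred (Fin.toℕ<n p)) (ℕ.≤-pred (Fin.toℕ<n q))

-- Dihedral groups acting on a path

module Dihedral where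

  open import Defs hiding (B)
  open Tits
  open Cosets
  open DominantPoints
  open Metamatrices
  open TotalPositivity
  open Factorisations
  open import Data.Nat using (ℕ; zero; suc; pred; z≤n; s≤s; _≤_; _<_; _≤?_; _<?_) renaming (_+_ to _+ℕ_; _*_ to _*ℕ_)
  import Data.Nat.Properties as ℕ
  open import Data.Bool using (Bool; true; false; not; _xor_)
  import Data.Bool.Properties as Bool
  open import Data.Nat.ListAction using (sum)
  open import Data.List.Relation.Unary.AllPairs using (AllPairs; []; _∷_)
  open import Data.List.Relation.Unary.Any using (Any; here; there)
  open import Data.Fin using (Fin; _≟_) renaming (zero to fz; suc to fs)
  open import Data.Fin.Subset using (Subset; _∈_)
  open import Data.List using (List; []; _∷_; _++_; [_]; length; reverse; map; upTo; filter; applyUpTo)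
  import Data.List.Properties as List
  open import Data.List.Membership.Propositional using () renaming (_∈_ to _∈ˡ_)
  import Data.List.Membership.Propositional.Properties as List
  open import Data.List.Relation.Unary.All using (All; []; _∷_)
  import Data.List.Relation.Unary.All as All
  import Data.List.Relation.Unary.All.Properties as All
  open import Data.List.Relation.Unary.Unique.Propositional using (Unique)
  import Data.List.Relation.Unary.Unique.Propositional.Properties as Unique
  open import Data.Vec using (here; there) renaming ([] to []ᵛ; _∷_ to _∷ᵛ_)
  open import Data.Product using (Σ; ∃; _×_; _,_; proj₁)
  open import Data.Sum using (_⊎_; inj₁; inj₂)
  open import Data.Empty using (⊥-elim)
  open import Relation.Nullary using (¬_; Dec; yes; no)
  open import Relation.Binary.PropositionalEquality hiding ([_])
  open import Function using (_∘_)

  other : Fin 2 → Fin 2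
  other fz      = fs fz
  other (fs fz) = fz

  other-involutive : ∀ a → other (other a) ≡ a
  other-involutive fz      = refl
  other-involutive (fs fz) = refl

  other≢ : ∀ a → a ≢ other a
  other≢ fz      ()
  other≢ (fs fz) ()

  ≢⇒other : ∀ {a b} → a ≢ b → b ≡ other a
  ≢⇒other {fz}    {fz}    p = ⊥-elim (p refl)
  ≢⇒other {fz}    {fs fz} p = refl
  ≢⇒other {fs fz} {fz}    p = refl
  ≢⇒other {fs fz} {fs fz} p = ⊥-elim (p refl)

  dihedralMatrix : ℕ → Fin 2 → Fin 2 → ℕ
  dihedralMatrix m = coxMatrix (bondI m)

  -- The cosets of ⟨c⟩ in the dihedral group form a path 0, …, m - 1 whose edges are labelled alternately other c, c, …
  -- and whose ends carry a loop; the numbers ≥ m are fixed points.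
  module Path (c : Fin 2) (m' : ℕ) where

    m : ℕ
    m = suc (suc m')

    up : ℕ → Fin 2
    up zero    = other c
    up (suc x) = other (up x)

    -- A relational description of `walk`, closed under reversal, so that its values and its
    -- involutivity follow from `unique` and `reverseMove` without repeating the case distinctions.
    data Move (a : Fin 2) (x : ℕ) : ℕ → Set where
      outside : m ≤ x → Move a x x
      ascend  : a ≡ up x → suc x < m → Move a x (suc x)
      stop    : a ≡ up x → suc x ≡ m → Move a x x
      descend : a ≡ other (up x) → x < m → Move a x (pred x)

    walk : Fin 2 → ℕ → ℕ
    walk a x with x <? m
    ... | no _  = x
    ... | yes _ with a ≟ up x
    ...   | no _ = pred x
    ...   | yes _ with suc x <? m
    ...     | yes _ = suc x
    ...     | no _  = x

    moved : ∀ a x → Move a x (walk a x)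
    moved a x with x <? m
    ... | no p  = outside (ℕ.≮⇒≥ p)
    ... | yes p with a ≟ up x
    ...   | no q  = descend (≢⇒other (q ∘ sym)) p
    ...   | yes q with suc x <? m
    ...     | yes r = ascend q r
    ...     | no r  = stop q (ℕ.≤-antisym p (ℕ.≮⇒≥ r))

    unique : ∀ {a x y z} → Move a x y → Move a x z → y ≡ z
    unique (outside p)   (outside _)   = refl
    unique (outside p)   (ascend _ q)  = ⊥-elim (ℕ.<⇒≱ (ℕ.<-trans ℕ.≤-refl q) p)
    unique (outside p)   (stop _ _)    = refl
    unique (outside p)   (descend _ q) = ⊥-elim (ℕ.<⇒≱ q p)
    unique (ascend _ q)  (outside p)   = ⊥-elim (ℕ.<⇒≱ (ℕ.<-trans ℕ.≤-refl q) p)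
    unique (ascend _ _)  (ascend _ _)  = refl
    unique (ascend _ q)  (stop _ e)    = ⊥-elim (ℕ.<⇒≢ q e)
    unique (ascend e _)  (descend f _) = ⊥-elim (other≢ _ (trans (sym e) f))
    unique (stop _ _)    (outside _)   = refl
    unique (stop _ e)    (ascend _ q)  = ⊥-elim (ℕ.<⇒≢ q e)
    unique (stop _ _)    (stop _ _)    = refl
    unique (stop e _)    (descend f _) = ⊥-elim (other≢ _ (trans (sym e) f))
    unique (descend _ q) (outside p)   = ⊥-elim (ℕ.<⇒≱ q p)
    unique (descend f _) (ascend e _)  = ⊥-elim (other≢ _ (trans (sym e) f))
    unique (descend f _) (stop e _)    = ⊥-elim (other≢ _ (trans (sym e) f))
    unique (descend _ _) (descend _ _) = refl

    walk≡ : ∀ {a x y} → Move a x y → walk a x ≡ y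
    walk≡ p = unique (moved _ _) p

    reverseMove : ∀ {a x y} → Move a x y → Move a y x
    reverseMove (outside p)  = outside p
    reverseMove {x = x} (ascend e q) = descend (trans e (sym (other-involutive (up x)))) q
    reverseMove (stop e q)   = stop e q
    reverseMove {x = zero}  (descend e q) = descend e q
    reverseMove {x = suc x} (descend e q) = ascend (trans e (other-involutive (up x))) q

    involutive : ∀ a x → walk a (walk a x) ≡ x
    involutive a x = walk≡ (reverseMove (moved a x))

    walk-bound : ∀ a {x} → x < m → walk a x < m
    walk-bound a {x} p with walk a x | moved a x
    ... | _ | outside _   = p
    ... | _ | ascend _ q  = q
    ... | _ | stop _ _    = p
    ... | _ | descend _ q = ℕ.≤-trans (s≤s ℕ.pred[n]≤n) q

    run-outside : ∀ w {x} → m ≤ x → run walk w x ≡ x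
    run-outside []      p = refl
    run-outside (s ∷ w) p = trans (cong (walk s) (run-outside w p)) (walk≡ (outside p))

    -- The two words differ in the letter that acts first: `other c` leaves 0 at once, while `c`
    -- spends one step on the loop at 0, so its word lags by one.
    climb : ∀ k → k < m → run walk (alt (other (up k)) (up k) k) 0 ≡ k × run walk (alt (up k) (other (up k)) k) 0 ≡ pred k
    climb zero    p = refl , refl
    climb (suc k) p with climb k (ℕ.<-trans ℕ.≤-refl p)
    ... | e , f rewrite other-involutive (up k) = trans (cong (walk (up k)) e) (walk≡ (ascend refl p)) ,
                                                  trans (cong (walk (other (up k))) f) (walk≡ (down k p))
      where
      down : ∀ k → suc k < m → Move (other (up k)) (pred k) k
      down zero    p = descend refl (s≤s z≤n)
      down (suc k) p = ascend (other-involutive (up k)) (ℕ.<-trans ℕ.≤-refl p)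

    private
      -- Of the two alternating words of length m, one loses a step on the loop at 0 and the other
      -- on the loop at the far end; both finish at the far end.
      top : ∀ a b → a ≢ b → run walk (alt a b m) 0 ≡ suc m'
      top a b a≢b with a ≟ up (suc m') | climb (suc m') ℕ.≤-refl
      ... | yes refl | e , _ = subst (λ b → run walk (alt (up (suc m')) b m) 0 ≡ suc m') (sym (≢⇒other a≢b))
            (trans (cong (walk (up (suc m'))) e) (walk≡ (stop refl refl)))
      ... | no p | _ , f with ≢⇒other (p ∘ sym)
      ...   | refl = subst (λ b → run walk (alt (other (up (suc m'))) b m) 0 ≡ suc m') (trans (sym (other-involutive (up (suc m')))) (sym (≢⇒other a≢b)))
              (trans (cong (walk (other (up (suc m')))) f) (walk≡ (ascend (other-involutive (up m')) ℕ.≤-refl)))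

      run-++ : ∀ u v x → run walk (u ++ v) x ≡ run walk u (run walk v x)
      run-++ []      v x = refl
      run-++ (s ∷ u) v x = cong (walk s) (run-++ u v x)

      run-reverse : ∀ w x → run walk w (run walk (reverse w) x) ≡ x
      run-reverse []      x = refl
      run-reverse (s ∷ w) x = trans (cong (λ v → walk s (run walk w (run walk v x))) (List.unfold-reverse s w))
        (trans (cong (walk s ∘ run walk w) (run-++ (reverse w) [ s ] x)) (trans (cong (walk s) (run-reverse w (walk s x))) (involutive s x)))

      alt-snoc : ∀ (s t : Fin 2) j → alt s t (j +ℕ j) ++ [ s ] ≡ alt s t (suc (j +ℕ j))
      alt-snoc s t zero    = refl
      alt-snoc s t (suc j) rewrite ℕ.+-suc j j = cong (λ w → s ∷ t ∷ w) (alt-snoc s t j)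

      alt-double : ∀ (s t : Fin 2) j → alt s t j ++ reverse (alt t s j) ≡ alt s t (j +ℕ j)
      alt-double s t zero    = refl
      alt-double s t (suc j) = trans (cong (λ v → s ∷ alt t s j ++ v) (List.unfold-reverse t (alt s t j)))
        (trans (cong (s ∷_) (trans (sym (List.++-assoc (alt t s j) (reverse (alt s t j)) [ t ])) (trans (cong (_++ [ t ]) (alt-double t s j)) (alt-snoc t s j))))
          (cong (alt s t) (cong suc (sym (ℕ.+-suc j j)))))

      -- `(s t)^m` is one alternating word of length m times the inverse of the other, and both lead
      -- from 0 to the far end.
      rotation-end : ∀ s t → s ≢ t → run walk (alt s t (m +ℕ m)) (suc m') ≡ suc m'
      rotation-end s t s≢t = trans (cong (λ w → run walk w (suc m')) (sym (alt-double s t m)))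
        (trans (run-++ (alt s t m) (reverse (alt t s m)) (suc m'))
          (trans (cong (run walk (alt s t m)) back) (top s t s≢t)))
        where
        back : run walk (reverse (alt t s m)) (suc m') ≡ 0
        back = subst (λ x → run walk (reverse (alt t s m)) x ≡ 0) (top t s (s≢t ∘ sym))
          (trans (cong (λ w → run walk (reverse (alt t s m)) (run walk w 0)) (sym (List.reverse-involutive (alt t s m)))) (run-reverse (reverse (alt t s m)) 0))

      rotation-inverse : ∀ s t j x → run walk (alt s t (j +ℕ j)) x ≡ x → run walk (alt t s (j +ℕ j)) x ≡ x
      rotation-inverse s t j x e = trans (cong (run walk (alt t s (j +ℕ j))) (sym e))
        (trans (cong₂ (λ u v → run walk u (run walk v x)) (sym (alt-double t s j))
            (trans (sym (alt-double s t j)) (trans (cong (_++ reverse (alt t s j)) (sym (List.reverse-involutive (alt s t j))))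
              (sym (List.reverse-++ (alt t s j) (reverse (alt s t j)))))))
          (run-reverse (alt t s j ++ reverse (alt s t j)) x))

      -- s (s t)^m s is the inverse of (s t)^m, hence the set of fixed points of (s t)^m is stable
      rotation-move : ∀ s t j x → run walk (alt s t (j +ℕ j)) x ≡ x → run walk (alt s t (j +ℕ j)) (walk s x) ≡ walk s x
      rotation-move s t j x e = trans (sym (run-++ (alt s t (j +ℕ j)) [ s ] x))
        (trans (cong (λ w → run walk w x) (alt-snoc s t j)) (cong (walk s) (rotation-inverse s t j x e)))

      -- Downward induction from the far end: `up x` leads from x + 1 to x and preserves the set of
      -- fixed points, whichever of `s` and `t` it is.
      rotation-fixed : ∀ s t → s ≢ t → ∀ k x → x +ℕ k ≡ suc m' → run walk (alt s t (m +ℕ m)) x ≡ x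
      rotation-fixed s t s≢t zero x e with trans (sym (ℕ.+-identityʳ x)) e
      ... | refl = rotation-end s t s≢t
      rotation-fixed s t s≢t (suc k) x e = subst (λ y → run walk (alt s t (m +ℕ m)) y ≡ y) back (stable (up x) (rotation-fixed s t s≢t k (suc x) (trans (sym (ℕ.+-suc x k)) e)))
        where
        back : walk (up x) (suc x) ≡ x
        back = walk≡ (descend (sym (other-involutive (up x))) (s≤s (ℕ.≤-trans (s≤s (ℕ.m≤m+n x k)) (ℕ.≤-reflexive (trans (sym (ℕ.+-suc x k)) e)))))
        stable : ∀ a {y} → run walk (alt s t (m +ℕ m)) y ≡ y → run walk (alt s t (m +ℕ m)) (walk a y) ≡ walk a y
        stable a {y} p with s ≟ a
        ... | yes refl = rotation-move s t m y p
        ... | no s≢a with trans (≢⇒other s≢a) (sym (≢⇒other s≢t))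
        ...   | refl = rotation-inverse t s m (walk t y) (rotation-move t s m y (rotation-inverse s t m y p))

      rotation : ∀ s t → s ≢ t → ∀ x → run walk (alt s t (m +ℕ m)) x ≡ x
      rotation s t s≢t x with x <? m
      ... | yes p = rotation-fixed s t s≢t (suc m' Data.Nat.∸ x) x (ℕ.m+[n∸m]≡n (ℕ.≤-pred p))
      ... | no p  = run-outside (alt s t (m +ℕ m)) (ℕ.≮⇒≥ p)

      diagonal : ∀ s → dihedralMatrix m s s ≡ 1
      diagonal fz      = refl
      diagonal (fs fz) = refl

      off-diagonal : ∀ s t → s ≢ t → dihedralMatrix m s t ≡ m
      off-diagonal fz      fz      p = ⊥-elim (p refl)
      off-diagonal fz      (fs fz) p = refl
      off-diagonal (fs fz) fz      p = refl
      off-diagonal (fs fz) (fs fz) p = ⊥-elim (p refl)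

      Up : Fin 2 → ℕ → Set
      Up s x = x ≤ walk s x

      -- At every node of the path other than 0 one of the two generators descends.
      chamber : ∀ s t → s ≢ t → ∀ x → x < m → Up s x → Up t x → x ≡ 0
      chamber s t s≢t zero    x<m p q = refl
      chamber s t s≢t (suc x) x<m p q with s ≟ other (up (suc x))
      ... | yes refl = ⊥-elim (ℕ.<⇒≱ ℕ.≤-refl (subst (suc x ≤_) (walk≡ (descend refl x<m)) p))
      ... | no r with trans (≢⇒other s≢t) (sym (≢⇒other r))
      ...   | refl = ⊥-elim (ℕ.<⇒≱ ℕ.≤-refl (subst (suc x ≤_) (walk≡ (descend (trans (≢⇒other s≢t) (sym (≢⇒other r))) x<m)) q))

      up-move : ∀ x → Up (up x) x
      up-move x with walk (up x) x | moved (up x) x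
      ... | _ | outside _   = ℕ.≤-refl
      ... | _ | ascend _ _  = ℕ.n≤1+n x
      ... | _ | stop _ _    = ℕ.≤-refl
      ... | _ | descend e _ = ⊥-elim (other≢ (up x) e)

      -- By `climb` the image of 0 is k or k - 1, and in either case `s` is a letter that leads
      -- upwards from there or stays.
      climbing : ∀ s t → s ≢ t → ∀ k → k < m → Up s (run walk (alt t s k) 0)
      climbing s t s≢t k p with s ≟ up k | climb k p
      ... | yes refl | e , _ = subst (λ t → Up (up k) (run walk (alt t (up k) k) 0)) (sym (≢⇒other s≢t)) (subst (Up (up k)) (sym e) (up-move k))
      ... | no r | _ , f with ≢⇒other (r ∘ sym)
      ...   | refl = subst (λ t → Up (other (up k)) (run walk (alt t (other (up k)) k) 0)) (trans (sym (other-involutive (up k))) (sym (≢⇒other s≢t)))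
              (subst (Up (other (up k))) (sym f) (below k))
        where
        below : ∀ k → Up (other (up k)) (pred k)
        below zero    = z≤n
        below (suc k) = subst (λ a → Up a k) (sym (other-involutive (up k))) (up-move k)

    path : HalfSpaces (dihedralMatrix m) ℕ
    path = record
      { m-diag   = diagonal
      ; m-pos    = positive
      ; act      = walk
      ; Pos      = Up
      ; relation = relation
      ; dihedral = λ s t s≢t k k<m x p q → dihedral s t s≢t k (subst (k <_) (off-diagonal s t s≢t) k<m) x p q
      ; wall     = λ s x p q → ℕ.≤-antisym (subst (walk s x ≤_) (involutive s x) q) p
      }
      where
      positive : ∀ s t → 0 < dihedralMatrix m s t
      positive fz      fz      = s≤s z≤n
      positive fz      (fs fz) = s≤s z≤n
      positive (fs fz) fz      = s≤s z≤n
      positive (fs fz) (fs fz) = s≤s z≤n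
      relation : ∀ s t x → run walk (alt s t (2 *ℕ dihedralMatrix m s t)) x ≡ x
      relation s t x with s ≟ t
      ... | yes refl rewrite diagonal s = involutive s x
      ... | no s≢t rewrite off-diagonal s t s≢t = trans (cong (λ k → run walk (alt s t (m +ℕ k)) x) (ℕ.+-identityʳ m)) (rotation s t s≢t x)
      dihedral : ∀ s t → s ≢ t → ∀ k → k < m → ∀ x → Up s x → Up t x → Up s (run walk (alt t s k) x)
      dihedral s t s≢t k k<m x p q with ℕ.<-≤-connex x m
      ... | inj₂ r = subst (Up s) (sym (run-outside (alt t s k) r)) p
      ... | inj₁ r with chamber s t s≢t x r p q
      ...   | refl = climbing s t s≢t k k<m

    private
      open Action path using (run-≈; ++-congˡ; ++-congʳ; ≡⇒≈; cancel; reverse-inverseʳ; stabiliser)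
      open DominantCount path using (dominant-count)

      start-fixed : walk c 0 ≡ 0
      start-fixed = walk≡ (descend (sym (other-involutive c)) (s≤s z≤n))

      start-fixing : ∀ s → walk s 0 ≡ 0 → s ≡ c
      start-fixing s e = decide (s ≟ up 0)
        where
        rises : s ≡ up 0 → walk s 0 ≡ 1
        rises p = walk≡ (ascend p (s≤s (s≤s z≤n)))
        decide : Dec (s ≡ up 0) → s ≡ c
        decide (no p)  = trans (≢⇒other (p ∘ sym)) (other-involutive c)
        decide (yes p) with trans (sym (rises p)) e
        ... | ()

      start-dominant : ∀ s → Up s 0
      start-dominant s = z≤n

      run-bound : ∀ w → run walk w 0 < m
      run-bound []      = s≤s z≤n
      run-bound (s ∷ w) = walk-bound s (run-bound w)

      ascent : ℕ → Word 2
      ascent k = alt (other (up k)) (up k) k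

    minimal : Fin 2 → List ℕ
    minimal a = filter (λ x → x ≤? walk a x) (upTo m)

    none : Subset 2
    none = false ∷ᵛ false ∷ᵛ []ᵛ

    single : Fin 2 → Subset 2
    single fz      = true ∷ᵛ false ∷ᵛ []ᵛ
    single (fs fz) = false ∷ᵛ true ∷ᵛ []ᵛ

    private
      ∈-single : ∀ {s a} → s ≡ a → s ∈ single a
      ∈-single {fz}    refl = here
      ∈-single {fs fz} refl = there here

      ∈-single⁻ : ∀ {s a} → s ∈ single a → s ≡ a
      ∈-single⁻ {fz}    {fz}    _                 = refl
      ∈-single⁻ {fs fz} {fs fz} _                 = refl
      ∈-single⁻ {fz}    {fs fz} ()
      ∈-single⁻ {fs fz} {fz}    (there ())

      ∉-none : ∀ {s} → ¬ (s ∈ none)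
      ∉-none {fz}    ()
      ∉-none {fs fz} (there ())

      orbit : ∀ {x} → x < m → ∃ λ w → run walk w 0 ≡ x
      orbit {x} p = ascent x , proj₁ (climb x p)

    cosets-none : DoubleCosets (dihedralMatrix m) none (single c) m
    cosets-none = subst (DoubleCosets (dihedralMatrix m) none (single c)) (List.length-upTo m)
      (dominant-count none (single c) 0 start-dominant (λ s p → subst (λ s → walk s 0 ≡ 0) (sym (∈-single⁻ p)) start-fixed) (λ s e → ∈-single (start-fixing s e))
        (upTo m) (Unique.upTo⁺ m) (All.tabulate (λ i → (λ s p → ⊥-elim (∉-none p)) , orbit (List.∈-upTo⁻ i)))
        (λ w → [] , [] , List.∈-upTo⁺ (run-bound w)))

    -- An orbit of ⟨a⟩ on the path is a pair of neighbours or a node with a loop; its dominant point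
    -- is the smaller member, so `minimal a` contains one point of each orbit.
    cosets-single : ∀ a → DoubleCosets (dihedralMatrix m) (single a) (single c) (length (minimal a))
    cosets-single a = dominant-count (single a) (single c) 0 start-dominant (λ s p → subst (λ s → walk s 0 ≡ 0) (sym (∈-single⁻ p)) start-fixed) (λ s e → ∈-single (start-fixing s e))
      (minimal a) (Unique.filter⁺ (λ x → x ≤? walk a x) (Unique.upTo⁺ m))
      (All.tabulate (λ {x} i → let j , p = List.∈-filter⁻ (λ x → x ≤? walk a x) {xs = upTo m} i in
        (λ s q → subst (λ s → Up s x) (sym (∈-single⁻ q)) p) , orbit (List.∈-upTo⁻ j)))
      complete
      where
      keep : ∀ {x} → x < m → Up a x → x ∈ˡ minimal a
      keep p q = List.∈-filter⁺ (λ x → x ≤? walk a x) (List.∈-upTo⁺ p) q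
      complete : ∀ w → ∃ λ u → All (_∈ single a) u × run walk u (run walk w 0) ∈ˡ minimal a
      complete w with ℕ.≤-total (run walk w 0) (walk a (run walk w 0))
      ... | inj₁ p = [] , [] , keep (run-bound w) p
      ... | inj₂ p = [ a ] , ∈-single refl ∷ [] , keep (walk-bound a (run-bound w)) (subst (walk a (run walk w 0) ≤_) (sym (involutive a (run walk w 0))) p)

    private
      up-exactly : ∀ x → x < m → ∀ a → a ≡ up (suc x) → suc x < m → Up a (suc x) × ¬ Up (other a) (suc x)
      up-exactly x p a refl q = up-move (suc x) , λ r → ℕ.<⇒≱ ℕ.≤-refl (subst (suc x ≤_) (walk≡ (descend refl q)) r)

      count-filter : ∀ a n (f : ℕ → ℕ) → (∀ k → k < n → (Up a (f k) × ¬ Up (other a) (f k)) ⊎ (¬ Up a (f k) × Up (other a) (f k))) →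
        length (filter (λ x → x ≤? walk a x) (applyUpTo f n)) +ℕ length (filter (λ x → x ≤? walk (other a) x) (applyUpTo f n)) ≡ n
      count-filter a zero    f e = refl
      count-filter a (suc n) f e with count-filter a n (f ∘ suc) (λ k p → e (suc k) (s≤s p)) | e 0 (s≤s z≤n)
      ... | i | inj₁ (p , q) = trans (cong₂ (λ xs ys → length xs +ℕ length ys)
              (List.filter-accept (λ x → x ≤? walk a x) p) (List.filter-reject (λ x → x ≤? walk (other a) x) q)) (cong suc i)
      ... | i | inj₂ (p , q) = trans (cong₂ (λ xs ys → length xs +ℕ length ys)
              (List.filter-reject (λ x → x ≤? walk a x) p) (List.filter-accept (λ x → x ≤? walk (other a) x) q)) (trans (ℕ.+-suc _ _) (cong suc i))

    -- each node other than 0 is minimal for exactly one of the two generators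
    minimal-total : ∀ a → length (minimal a) +ℕ length (minimal (other a)) ≡ suc m
    minimal-total a = trans (cong₂ (λ xs ys → length xs +ℕ length ys)
        (List.filter-accept (λ x → x ≤? walk a x) {0} {tail} z≤n) (List.filter-accept (λ x → x ≤? walk (other a) x) {0} {tail} z≤n))
      (cong suc (trans (ℕ.+-suc (length (filter (λ x → x ≤? walk a x) tail)) (length (filter (λ x → x ≤? walk (other a) x) tail))) (cong suc (count-filter a (suc m') suc split))))
      where
      tail : List ℕ
      tail = applyUpTo suc (suc m')
      split : ∀ k → k < suc m' → (Up a (suc k) × ¬ Up (other a) (suc k)) ⊎ (¬ Up a (suc k) × Up (other a) (suc k))
      split k p with a ≟ up (suc k)
      ... | yes e = inj₁ (up-exactly k (ℕ.<-trans p ℕ.≤-refl) a e (s≤s p))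
      ... | no e with up-exactly k (ℕ.<-trans p ℕ.≤-refl) (other a) (sym (≢⇒other e)) (s≤s p)
      ...   | u , v = inj₂ ((λ w → v (subst (λ b → Up b (suc k)) (sym (other-involutive a)) w)) , u)

    private
      parity : Word 2 → Bool
      parity []      = false
      parity (s ∷ w) = not (parity w)

      parity-++ : ∀ u v → parity (u ++ v) ≡ parity u xor parity v
      parity-++ []      v = refl
      parity-++ (s ∷ u) v = trans (cong not (parity-++ u v)) (Bool.not-distribˡ-xor (parity u) (parity v))

      parity-alt : ∀ (s t : Fin 2) j → parity (alt s t (j +ℕ j)) ≡ false
      parity-alt s t zero    = refl
      parity-alt s t (suc j) rewrite ℕ.+-suc j j = trans (Bool.not-involutive _) (parity-alt s t j)

      parity-≈ : ∀ {u v} → CoxEq (dihedralMatrix m) u v → parity u ≡ parity v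
      parity-≈ ceRefl        = refl
      parity-≈ (ceSym p)     = sym (parity-≈ p)
      parity-≈ (ceTrans p q) = trans (parity-≈ p) (parity-≈ q)
      parity-≈ (ceRel s t)   = trans (cong (λ k → parity (alt s t (dihedralMatrix m s t +ℕ k))) (ℕ.+-identityʳ _)) (parity-alt s t (dihedralMatrix m s t))
      parity-≈ (ceCong x {u} {v} y p) = trans (parity-++ x (u ++ y)) (trans (cong (parity x xor_)
        (trans (parity-++ u y) (trans (cong (_xor parity y) (parity-≈ p)) (sym (parity-++ v y))))) (sym (parity-++ x (v ++ y))))

      trivial-coset : ∀ {w w'} → SameDoubleCoset (dihedralMatrix m) none none w w' → CoxEq (dihedralMatrix m) w' w
      trivial-coset ([] , [] , _ , _ , p) = ceTrans p (≡⇒≈ (List.++-identityʳ _))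
      trivial-coset (_ ∷ _ , _ , q ∷ _ , _) = ⊥-elim (∉-none q)
      trivial-coset ([] , _ ∷ _ , _ , q ∷ _ , _) = ⊥-elim (∉-none q)

      coset-trivial : ∀ {w w'} → CoxEq (dihedralMatrix m) w w' → SameDoubleCoset (dihedralMatrix m) none none w w'
      coset-trivial p = [] , [] , [] , [] , ceTrans (ceSym p) (≡⇒≈ (sym (List.++-identityʳ _)))

      reduce : ∀ v → All (λ s → walk s 0 ≡ 0) v → CoxEq (dihedralMatrix m) v [] ⊎ CoxEq (dihedralMatrix m) v [ c ]
      reduce [] _ = inj₁ ceRefl
      reduce (s ∷ v) (e ∷ es) with start-fixing s e | reduce v es
      ... | refl | inj₁ p = inj₂ (++-congˡ [ s ] p)
      ... | refl | inj₂ p = inj₁ (ceTrans (++-congˡ [ s ] p) (cancel s []))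

    -- Over each node lie two elements, `ascent κ` times 1 and times c, since ⟨c⟩ is the stabiliser
    -- of 0. The node does not separate them, but the parity of the length does, all relators being
    -- of even length.
    cosets-trivial : DoubleCosets (dihedralMatrix m) none none (m +ℕ m)
    cosets-trivial = subst (DoubleCosets (dihedralMatrix m) none none) (twice (upTo m) (List.length-upTo m))
      (classes-partition (SameDoubleCoset (dihedralMatrix m) none none) (λ w → run walk w 0) (λ p → sym (run-≈ (trivial-coset p) 0))
        (upTo m) (Unique.upTo⁺ m) (λ w → List.∈-upTo⁺ (run-bound w)) (λ _ → 2) (λ i → fibre (List.∈-upTo⁻ i)))
      where
      twice : ∀ (xs : List ℕ) {k} → length xs ≡ k → sum (map (λ _ → 2) xs) ≡ k +ℕ k
      twice []       refl = refl
      twice (x ∷ xs) refl = cong suc (trans (cong suc (twice xs refl)) (sym (ℕ.+-suc (length xs) (length xs))))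
      fibre : ∀ {κ} → κ < m → Σ (List (Word 2)) λ ws → length ws ≡ 2 × AllPairs (λ w w' → ¬ SameDoubleCoset (dihedralMatrix m) none none w w') ws ×
        All (λ w → run walk w 0 ≡ κ) ws × (∀ w → run walk w 0 ≡ κ → Any (SameDoubleCoset (dihedralMatrix m) none none w) ws)
      fibre {κ} p = ascent κ ∷ (ascent κ ++ [ c ]) ∷ [] , refl , (((λ r → odd (parity-≈ (trivial-coset r))) ∷ []) ∷ [] ∷ []) ,
        (reach ∷ trans (run-++ (ascent κ) [ c ] 0) (trans (cong (run walk (ascent κ)) start-fixed) reach) ∷ []) , cover
        where
        reach : run walk (ascent κ) 0 ≡ κ
        reach = proj₁ (climb κ p)
        odd : parity (ascent κ ++ [ c ]) ≢ parity (ascent κ)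
        odd e = Bool.not-¬ {parity (ascent κ)} refl (trans (sym e) (trans (parity-++ (ascent κ) [ c ]) (trans (Bool.xor-comm (parity (ascent κ)) true) refl)))
        from : ∀ w {v} → CoxEq (dihedralMatrix m) (reverse (ascent κ) ++ w) v → CoxEq (dihedralMatrix m) w (ascent κ ++ v)
        from w s = ceTrans (ceSym (++-congʳ w (reverse-inverseʳ (ascent κ)))) (ceTrans (≡⇒≈ (List.++-assoc (ascent κ) (reverse (ascent κ)) w)) (++-congˡ (ascent κ) s))
        cover : ∀ w → run walk w 0 ≡ κ → Any (SameDoubleCoset (dihedralMatrix m) none none w) (ascent κ ∷ (ascent κ ++ [ c ]) ∷ [])
        cover w e with stabiliser 0 start-dominant (reverse (ascent κ) ++ w)
              (trans (run-++ (reverse (ascent κ)) w 0) (trans (cong (run walk (reverse (ascent κ))) e) (DominantCount.run-reverse path (ascent κ) reach)))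
        ... | v , fv , q with reduce v fv
        ...   | inj₁ r = here (coset-trivial (ceTrans (from w (ceTrans q r)) (≡⇒≈ (List.++-identityʳ (ascent κ)))))
        ...   | inj₂ r = there (here (coset-trivial (from w (ceTrans q r))))

-- Total positivity for dihedral groups

module TypeI where

  open import Defs hiding (B)
  open Tits
  open Cosets
  open Metamatrices
  open TotalPositivity
  open Factorisations
  open Dihedral
  open import Data.Nat using (ℕ; zero; suc; pred; z≤n; s≤s) renaming (_+_ to _+ℕ_)
  import Data.Nat.Solver as ℕ-Solver
  open import Data.Integer using (+_)
  import Data.Integer.Solver as ℤ-Solver
  open import Data.Bool using (true; false)
  open import Data.Fin using (Fin; toℕ) renaming (zero to fz; suc to fs)
  open import Data.Fin.Subset using (Subset; ⊤)
  open import Data.Fin.Subset.Properties using (∈⊤)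
  open import Data.List using (List; []; _∷_; [_]; length; reverse)
  open import Data.List.Relation.Unary.All using (All; []; _∷_)
  import Data.List.Relation.Unary.All as All
  open import Data.List.Relation.Unary.AllPairs using ([]; _∷_)
  open import Data.List.Relation.Unary.Any using (here)
  open import Data.Vec using (lookup) renaming ([] to []ᵛ; _∷_ to _∷ᵛ_)
  open import Data.Product using (_,_)
  open import Relation.Binary.PropositionalEquality hiding ([_])

  doubleCosets-full : ∀ {n} {m : Fin n → Fin n → ℕ} → (∀ s → m s s ≡ 1) → ∀ I → DoubleCosets m I ⊤ 1
  doubleCosets-full {m = m} m-diag I = [ [] ] , refl , [] ∷ [] , λ w →
    here ([] , reverse w , [] , All.tabulate (λ _ → ∈⊤) , ceSym (Words.reverse-inverseʳ m m-diag w))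

  module _ (m' : ℕ) where

    private
      m : ℕ
      m = suc (suc m')

      least : Fin 2 → Fin 2 → ℕ
      least a c = length (Path.minimal c m' a)

      diagonal : ∀ s → dihedralMatrix m s s ≡ 1
      diagonal fz      = refl
      diagonal (fs fz) = refl

    countI : Subset 2 → Subset 2 → ℕ
    countI I                          (true ∷ᵛ true ∷ᵛ []ᵛ)   = 1
    countI (true ∷ᵛ true ∷ᵛ []ᵛ)      J                       = 1
    countI (false ∷ᵛ false ∷ᵛ []ᵛ)    (false ∷ᵛ false ∷ᵛ []ᵛ) = m +ℕ m
    countI (false ∷ᵛ false ∷ᵛ []ᵛ)    J                       = m
    countI I                          (false ∷ᵛ false ∷ᵛ []ᵛ) = m
    countI (true ∷ᵛ false ∷ᵛ []ᵛ)     (true ∷ᵛ false ∷ᵛ []ᵛ)  = least fz fz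
    countI (true ∷ᵛ false ∷ᵛ []ᵛ)     (false ∷ᵛ true ∷ᵛ []ᵛ)  = least fz (fs fz)
    countI (false ∷ᵛ true ∷ᵛ []ᵛ)     (true ∷ᵛ false ∷ᵛ []ᵛ)  = least (fs fz) fz
    countI (false ∷ᵛ true ∷ᵛ []ᵛ)     (false ∷ᵛ true ∷ᵛ []ᵛ)  = least (fs fz) (fs fz)

    doubleCosetsI : ∀ I J → DoubleCosets (dihedralMatrix m) I J (countI I J)
    doubleCosetsI (true ∷ᵛ true ∷ᵛ []ᵛ)   (true ∷ᵛ true ∷ᵛ []ᵛ)   = doubleCosets-full diagonal _
    doubleCosetsI (true ∷ᵛ false ∷ᵛ []ᵛ)  (true ∷ᵛ true ∷ᵛ []ᵛ)   = doubleCosets-full diagonal _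
    doubleCosetsI (false ∷ᵛ true ∷ᵛ []ᵛ)  (true ∷ᵛ true ∷ᵛ []ᵛ)   = doubleCosets-full diagonal _
    doubleCosetsI (false ∷ᵛ false ∷ᵛ []ᵛ) (true ∷ᵛ true ∷ᵛ []ᵛ)   = doubleCosets-full diagonal _
    doubleCosetsI (true ∷ᵛ true ∷ᵛ []ᵛ)   (true ∷ᵛ false ∷ᵛ []ᵛ)  = doubleCosets-sym diagonal (doubleCosets-full diagonal _)
    doubleCosetsI (true ∷ᵛ true ∷ᵛ []ᵛ)   (false ∷ᵛ true ∷ᵛ []ᵛ)  = doubleCosets-sym diagonal (doubleCosets-full diagonal _)
    doubleCosetsI (true ∷ᵛ true ∷ᵛ []ᵛ)   (false ∷ᵛ false ∷ᵛ []ᵛ) = doubleCosets-sym diagonal (doubleCosets-full diagonal _)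
    doubleCosetsI (false ∷ᵛ false ∷ᵛ []ᵛ) (false ∷ᵛ false ∷ᵛ []ᵛ) = Path.cosets-trivial fz m'
    doubleCosetsI (false ∷ᵛ false ∷ᵛ []ᵛ) (true ∷ᵛ false ∷ᵛ []ᵛ)  = Path.cosets-none fz m'
    doubleCosetsI (false ∷ᵛ false ∷ᵛ []ᵛ) (false ∷ᵛ true ∷ᵛ []ᵛ)  = Path.cosets-none (fs fz) m'
    doubleCosetsI (true ∷ᵛ false ∷ᵛ []ᵛ)  (false ∷ᵛ false ∷ᵛ []ᵛ) = doubleCosets-sym diagonal (Path.cosets-none fz m')
    doubleCosetsI (false ∷ᵛ true ∷ᵛ []ᵛ)  (false ∷ᵛ false ∷ᵛ []ᵛ) = doubleCosets-sym diagonal (Path.cosets-none (fs fz) m')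
    doubleCosetsI (true ∷ᵛ false ∷ᵛ []ᵛ)  (true ∷ᵛ false ∷ᵛ []ᵛ)  = Path.cosets-single fz m' fz
    doubleCosetsI (true ∷ᵛ false ∷ᵛ []ᵛ)  (false ∷ᵛ true ∷ᵛ []ᵛ)  = Path.cosets-single (fs fz) m' fz
    doubleCosetsI (false ∷ᵛ true ∷ᵛ []ᵛ)  (true ∷ᵛ false ∷ᵛ []ᵛ)  = Path.cosets-single fz m' (fs fz)
    doubleCosetsI (false ∷ᵛ true ∷ᵛ []ᵛ)  (false ∷ᵛ true ∷ᵛ []ᵛ)  = Path.cosets-single (fs fz) m' (fs fz)

    -- The middle entry is twice m + 1, the sum that `minimal-total` gives for each choice of the
    -- generator on the right.
    metamatrixI : Fin 3 → Fin 3 → ℕ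
    metamatrixI p q = lookup (lookup
      (((m +ℕ m) ∷ᵛ (m +ℕ m)     ∷ᵛ 1 ∷ᵛ []ᵛ) ∷ᵛ
       ((m +ℕ m) ∷ᵛ m +ℕ m +ℕ 2 ∷ᵛ 2 ∷ᵛ []ᵛ) ∷ᵛ
       (1        ∷ᵛ 2            ∷ᵛ 1 ∷ᵛ []ᵛ) ∷ᵛ []ᵛ) p) q

    private
      singles : ∀ w x y z → w +ℕ y ≡ suc m → x +ℕ z ≡ suc m → (w +ℕ (x +ℕ 0)) +ℕ ((y +ℕ (z +ℕ 0)) +ℕ 0) ≡ m +ℕ m +ℕ 2
      singles w x y z e f = trans
        (solve 4 (λ w x y z → (w :+ (x :+ con 0)) :+ ((y :+ (z :+ con 0)) :+ con 0) := (w :+ y) :+ (x :+ z)) refl w x y z)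
        (trans (cong₂ _+ℕ_ e f) (solve 1 (λ m → (con 1 :+ m) :+ (con 1 :+ m) := m :+ m :+ con 2) refl m))
        where open ℕ-Solver.+-*-Solver

      entry : ∀ p q → metamatrixI p q ≡ metamatrixEntry 2 countI (toℕ p) (toℕ q)
      entry fz           fz           = solve 1 (λ m → m :+ m := m :+ m :+ con 0 :+ con 0) refl m
        where open ℕ-Solver.+-*-Solver
      entry fz           (fs fz)      = solve 1 (λ m → m :+ m := m :+ (m :+ con 0) :+ con 0) refl m
        where open ℕ-Solver.+-*-Solver
      entry fz           (fs (fs fz)) = refl
      entry (fs fz)      fz           = solve 1 (λ m → m :+ m := m :+ con 0 :+ (m :+ con 0 :+ con 0)) refl m
        where open ℕ-Solver.+-*-Solver
      entry (fs fz)      (fs fz)      = sym (singles (least fz fz) (least fz (fs fz)) (least (fs fz) fz) (least (fs fz) (fs fz))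
        (Path.minimal-total fz m' fz) (Path.minimal-total (fs fz) m' fz))
      entry (fs fz)      (fs (fs fz)) = refl
      entry (fs (fs fz)) fz           = refl
      entry (fs (fs fz)) (fs fz)      = refl
      entry (fs (fs fz)) (fs (fs fz)) = refl

    isMetamatrixI : IsMetamatrix (dihedralMatrix m) metamatrixI
    isMetamatrixI = countI , (λ I J → hasNumClasses (doubleCoset-sym diagonal) (doubleCosetsI I J)) , entry

    private
      levels : List Level
      -- Obtained by eliminating the symbolic matrix scaled by the group order 2 m; the diagonal and
      -- subdiagonal entries are positive for all m = m' + 2.
      levels = (suc m' , m ∷ 2 ∷ 1 ∷ [] , 0 ∷ suc m' ∷ 1 ∷ []) ∷ (m , 2 ∷ 1 ∷ [] , 0 ∷ 1 ∷ []) ∷ (1 , 1 ∷ [] , 0 ∷ []) ∷ []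

      open ℤ-Solver.+-*-Solver

      Table : Set
      Table = ℕ → ℕ → Polynomial 1

      row : List (Polynomial 1) → ℕ → Polynomial 1
      row = nth (con (+ 0))

      border : (Polynomial 1) → List (Polynomial 1) → List (Polynomial 1) → Table → Table
      border d y z B p q = row y q :* (row y p :* B p q :+ row z p :* B (pred p) q) :+ row z q :* (row y p :* B p (pred q) :+ row z p :* B (pred p) (pred q))

      -- The table of `levels` rebuilt from polynomials, so that agreement of the entries becomes
      -- nine ring identities in m'.
      factorised : Polynomial 1 → Table
      factorised x = border (con (+ 1) :+ x) (con (+ 2) :+ x ∷ con (+ 2) ∷ con (+ 1) ∷ []) (con (+ 0) ∷ con (+ 1) :+ x ∷ con (+ 1) ∷ []) outer
        where
        O : Polynomial 1
        O = con (+ 0)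
        inner middle outer : Table
        inner zero       zero       = con (+ 1)
        inner (suc zero) (suc zero) = con (+ 2) :+ x
        inner _          _          = O
        middle = border (con (+ 2) :+ x) (con (+ 2) ∷ con (+ 1) ∷ []) (O ∷ con (+ 1) ∷ []) inner
        outer (suc (suc zero)) (suc (suc zero)) = con (+ 1) :+ x
        outer (suc (suc _))    _                = O
        outer _                (suc (suc _))    = O
        outer p                q                = middle p q

    totallyPositiveI : TotallyPositive metamatrixI
    totallyPositiveI = tp⇒totallyPositive metamatrixI (m +ℕ m) (s≤s z≤n) (entries (table levels)) (table-tp levels refl) agree
      where
      two : Polynomial 1 → Polynomial 1
      two x = (con (+ 2) :+ x) :+ (con (+ 2) :+ x)
      agree : ∀ i j → Data.Integer._*_ (+ (m +ℕ m)) (+ metamatrixI i j) ≡ entries (table levels) (toℕ i) (toℕ j)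
      agree fz           fz           = solve 1 (λ x → two x :* two x := factorised x 0 0) refl (+ m')
      agree fz           (fs fz)      = solve 1 (λ x → two x :* two x := factorised x 0 1) refl (+ m')
      agree fz           (fs (fs fz)) = solve 1 (λ x → two x :* con (+ 1) := factorised x 0 2) refl (+ m')
      agree (fs fz)      fz           = solve 1 (λ x → two x :* two x := factorised x 1 0) refl (+ m')
      agree (fs fz)      (fs fz)      = solve 1 (λ x → two x :* (two x :+ con (+ 2)) := factorised x 1 1) refl (+ m')
      agree (fs fz)      (fs (fs fz)) = solve 1 (λ x → two x :* con (+ 2) := factorised x 1 2) refl (+ m')
      agree (fs (fs fz)) fz           = solve 1 (λ x → two x :* con (+ 1) := factorised x 2 0) refl (+ m')
      agree (fs (fs fz)) (fs fz)      = solve 1 (λ x → two x :* con (+ 2) := factorised x 2 1) refl (+ m')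
      agree (fs (fs fz)) (fs (fs fz)) = solve 1 (λ x → two x :* con (+ 1) := factorised x 2 2) refl (+ m')

open import Defs
open import Data.Nat using (ℕ; suc; s≤s; _≡ᵇ_; _⊓_; _⊔_)
open import Data.Bool using (true; _∧_; if_then_else_)
open import Data.Fin using (Fin; toℕ)
open import Data.Fin.Subset using (∣_∣)
open import Data.Integer using (+_; _<_)
open import Data.Product using (Σ; _×_; _,_)
open import Relation.Binary.PropositionalEquality
open Cosets
open Determinants
open Metamatrices
open TypeB
open Dihedral
open TypeI
open Exceptional

-- Uniqueness of the metamatrix, and the union of the cases

coxMatrix-diagonal : ∀ {n} bond (s : Fin n) → coxMatrix bond s s ≡ 1
coxMatrix-diagonal bond s = cong (λ b → if b then 1 else bond (toℕ s ⊓ toℕ s) (toℕ s ⊔ toℕ s)) (≡ᵇ-refl (toℕ s))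
  where
  ≡ᵇ-refl : ∀ k → (k ≡ᵇ k) ≡ true
  ≡ᵇ-refl 0       = refl
  ≡ᵇ-refl (suc k) = ≡ᵇ-refl k

-- The number of classes is determined by the relation, whatever representatives are chosen; this
-- carries total positivity from the constructed metamatrix to an arbitrary one.
metamatrix-unique : ∀ {n} {m : Fin n → Fin n → ℕ} → (∀ s → m s s ≡ 1) → ∀ {M N} → IsMetamatrix m M → IsMetamatrix m N → ∀ p q → M p q ≡ N p q
metamatrix-unique {n} m-diag (c , classes , e) (d , classes' , f) p q = trans (e p q) (trans
  (sum-cong (λ I → sum-cong (λ J → cong (λ k → if (∣ I ∣ ≡ᵇ toℕ p) ∧ (∣ J ∣ ≡ᵇ toℕ q) then k else 0)
    (hasNumClasses-unique (doubleCoset-sym m-diag) (doubleCoset-trans m-diag) (classes I J) (classes' I J))) (allSubsets n)) (allSubsets n))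
  (sym (f p q)))

totallyPositive-cong : ∀ {N} {M M' : Fin N → Fin N → ℕ} → (∀ p q → M p q ≡ M' p q) → TotallyPositive M → TotallyPositive M'
totallyPositive-cong e tp k r c ir ic = subst (+ 0 <_) (det-cong (suc k) (λ a b → cong +_ (e (r a) (c b)))) (tp k r c ir ic)

theorem1p0p2 : ∀ {n} (X : CoxType n) →
  Σ (Fin (suc n) → Fin (suc n) → ℕ) (IsMetamatrix (coxMat X)) ×
  (∀ M → IsMetamatrix (coxMat X) M → TotallyPositive M)
theorem1p0p2 X = conclude (metamatrix X)
  where
  metamatrix : ∀ {n} (X : CoxType n) → (∀ s → coxMat X s s ≡ 1) × Σ (Fin (suc n) → Fin (suc n) → ℕ) λ M → IsMetamatrix (coxMat X) M × TotallyPositive M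
  metamatrix (B n _)              = coxMatrix-diagonal bondB , _ , metamatrixB n , totallyPositiveB n
  metamatrix E6                   = coxMatrix-diagonal bondE , _ , metamatrixE6 , totallyPositiveE6
  metamatrix E7                   = coxMatrix-diagonal bondE , _ , metamatrixE7 , totallyPositiveE7
  metamatrix E8                   = coxMatrix-diagonal bondE , _ , metamatrixE8 , totallyPositiveE8
  metamatrix F4                   = coxMatrix-diagonal bondF , _ , metamatrixF4 , totallyPositiveF4
  metamatrix H3                   = coxMatrix-diagonal bondH , _ , metamatrixH3 , totallyPositiveH3
  metamatrix H4                   = coxMatrix-diagonal bondH , _ , metamatrixH4 , totallyPositiveH4
  metamatrix (I2 m (s≤s (s≤s {n = m'} _))) = coxMatrix-diagonal (bondI m) , _ , isMetamatrixI m' , totallyPositiveI m'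
  conclude : ∀ {n} {m : Fin n → Fin n → ℕ} → (∀ s → m s s ≡ 1) × (Σ (Fin (suc n) → Fin (suc n) → ℕ) λ M → IsMetamatrix m M × TotallyPositive M) →
             Σ (Fin (suc n) → Fin (suc n) → ℕ) (IsMetamatrix m) × (∀ M → IsMetamatrix m M → TotallyPositive M)
  conclude (m-diag , M , is , tp) = (M , is) , λ N is' → totallyPositive-cong (metamatrix-unique m-diag is is') tp
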